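{- There exists a set $T$ of $14$ generalized Wang tiles such that the problem of tiling finite simply connected regions with the fixed set $T$ is $\mathsf{NP}$-complete.
   Context: A polyomino is a simply connected shape obtained by gluing finitely many unit squares of the square grid together edge-to-edge. A generalized Wang tile is a polyomino with a color assigned to each unit segment of its boundary. Tiles are used only by translation (no rotation or reflection), and each tile of a set may be used an unlimited number of times (including zero). A finite simply connected region (for generalized Wang tiles) is a finite simply connected polyomino region $D$ (i.e. without holes) together with a color assigned to each unit segment of its boundary. A set $T$ of generalized Wang tiles tiles $D$ if $D$ is the union of translated copies of members of $T$, placed on the unit grid with pairwise disjoint interiors, such that whenever two copies share a unit boundary segment they have the same color on it, and every unit boundary segment of a copy lying on the boundary of $D$ has the color assigned to that segment of the boundary of $D$. For a fixed set $T$ of generalized Wang tiles, the problem of tiling finite simply connected regions with $T$ is the decision problem: given an arbitrary finite simply connected region $D$ (with its boundary colors), can $D$ be tiled with translated copies of tiles from $T$? The set $T$ is not part of the input; the region $D$ is given explicitly, as a list of its unit squares together with the colors of its boundary segments. -}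

module Defs where

open import Data.Bool.Base using (Bool; true; false)
open import Data.Fin.Base using (Fin; zero; suc)
open import Data.Integer.Base as ℤ using (ℤ; +_; -[1+_]; 0ℤ; 1ℤ)
open import Data.List.Base as List using (List; []; _∷_; _++_; concatMap; foldr; length)
open import Data.List.Membership.Propositional using (_∈_; _∉_)
open import Data.List.Relation.Binary.Permutation.Propositional using (_↭_)
open import Data.List.Relation.Unary.AllPairs using (AllPairs)
open import Data.List.Relation.Unary.Unique.Propositional using (Unique)
open import Data.Maybe.Base using (Maybe; just; nothing)
open import Data.Nat.Base using (ℕ; zero; suc; _+_; _*_; _≤_)
open import Data.Nat.Binary.Base as ℕᵇ using (ℕᵇ; 2[1+_]; 1+[2_])
open import Data.Product.Base using (Σ-syntax; ∃; ∃-syntax; _×_; _,_; proj₁)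
open import Data.Vec.Base as Vec using (Vec; []; _∷_)
open import Function.Bundles using (_⇔_)
open import Relation.Binary.Construct.Closure.ReflexiveTransitive using (Star)
open import Relation.Binary.PropositionalEquality.Core using (_≡_; _≢_)
open import Relation.Nullary.Negation.Core using (¬_)

------------------------------------------------------------------------
-- The square grid

-- The same type serves for lattice points and for unit squares: the
-- cell (x , y) is the unit square [x , x+1] × [y , y+1].
Point Cell : Set
Point = ℤ × ℤ
Cell  = Point

infixl 6 _⊕_
_⊕_ : Point → Point → Point
(a , b) ⊕ (c , d) = (a ℤ.+ c , b ℤ.+ d)

data Axis : Set where
  horizontal vertical : Axis

-- (horizontal , x , y) is the unit segment from (x , y) to (x+1 , y);
-- (vertical   , x , y) is the unit segment from (x , y) to (x , y+1).
-- Segments are undirected, so a segment between two cells has a single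
-- name, whichever of the two cells it is viewed from.
Segment : Set
Segment = Axis × Point

sides : Cell → List Segment
sides c = (horizontal , c)
        ∷ (horizontal , c ⊕ (0ℤ , 1ℤ))
        ∷ (vertical   , c)
        ∷ (vertical   , c ⊕ (1ℤ , 0ℤ))
        ∷ []

Adjacent : Cell → Cell → Set
Adjacent c d = c ≢ d × ∃[ s ] (s ∈ sides c × s ∈ sides d)

EdgeConnected : (Cell → Set) → Set
EdgeConnected P = ∀ {c d} → P c → P d →
  Star (λ u v → P u × P v × Adjacent u v) c d

BoundarySegment : List Cell → Segment → Set
BoundarySegment cs s =
    (∃[ c ] (c ∈ cs × s ∈ sides c))
  × (∃[ c ] (c ∉ cs × s ∈ sides c))

------------------------------------------------------------------------
-- Coloured polyominoes

Colour : Set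
Colour = ℕ

-- A finite simply connected polyomino, each unit segment of whose
-- boundary carries exactly one colour.  Having no holes means that the
-- complement in the plane is connected.  Both connectedness conditions
-- are through edges: a cell outside the polyomino that meets the rest
-- of the complement only at a corner is a hole, since the closed
-- squares of the polyomino surround it.
record ColouredPolyomino : Set where
  field
    cells     : List Cell
    boundary  : List (Segment × Colour)
    nonempty  : cells ≢ []
    distinct  : Unique cells
    connected : EdgeConnected (_∈ cells)
    no-holes  : EdgeConnected (_∉ cells)
    coloured  : ∀ s → s ∈ List.map proj₁ boundary ⇔ BoundarySegment cells s
    one-colour : Unique (List.map proj₁ boundary)

open ColouredPolyomino public

GeneralizedWangTile Region : Set
GeneralizedWangTile = ColouredPolyomino
Region              = ColouredPolyomino

translateCells : Point → List Cell → List Cell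
translateCells v = List.map (v ⊕_)

translateBoundary : Point → List (Segment × Colour) → List (Segment × Colour)
translateBoundary v = List.map λ ((a , p) , k) → ((a , v ⊕ p) , k)

-- The lists are duplicate-free, so ↭ is equality of the sets listed.
SameTile : GeneralizedWangTile → GeneralizedWangTile → Set
SameTile t u = ∃[ v ]
    ( translateCells v (cells t) ↭ cells u
    × translateBoundary v (boundary t) ↭ boundary u )

record TileSet (n : ℕ) : Set where
  field
    tile     : Fin n → GeneralizedWangTile
    pairwise-different : ∀ i j → i ≢ j → ¬ SameTile (tile i) (tile j)

open TileSet public

------------------------------------------------------------------------
-- Tilings

module _ {n : ℕ} (T : TileSet n) where

  Placement : Set
  Placement = Fin n × Point

  copyCells : Placement → List Cell
  copyCells (i , v) = translateCells v (cells (tile T i))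

  copyBoundary : Placement → List (Segment × Colour)
  copyBoundary (i , v) = translateBoundary v (boundary (tile T i))

  record IsTiling (D : Region) (ps : List Placement) : Set where
    field
      union    : ∀ c → c ∈ cells D ⇔ (∃[ p ] (p ∈ ps × c ∈ copyCells p))
      disjoint : AllPairs (λ p q → ∀ c → ¬ (c ∈ copyCells p × c ∈ copyCells q)) ps
      matching : ∀ p q → p ∈ ps → q ∈ ps → ∀ s a b →
        (s , a) ∈ copyBoundary p → (s , b) ∈ copyBoundary q → a ≡ b
      border   : ∀ p → p ∈ ps → ∀ s a b →
        (s , a) ∈ copyBoundary p → (s , b) ∈ boundary D → a ≡ b

  Tiles : Region → Set
  Tiles D = ∃ (IsTiling D)

------------------------------------------------------------------------
-- Regions as bit strings

Word : Set
Word = List Bool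

-- Every encoder below is prefix-free, so concatenations can be parsed.

-- Bijective base 2, least significant digit first; each digit is
-- preceded by true, and false marks the end.
encodeℕᵇ : ℕᵇ → Word
encodeℕᵇ ℕᵇ.zero  = false ∷ []
encodeℕᵇ 2[1+ x ] = true ∷ false ∷ encodeℕᵇ x
encodeℕᵇ 1+[2 x ] = true ∷ true ∷ encodeℕᵇ x

encodeℕ : ℕ → Word
encodeℕ m = encodeℕᵇ (ℕᵇ.fromℕ m)

encodeℤ : ℤ → Word
encodeℤ (+ m)    = false ∷ encodeℕ m
encodeℤ -[1+ m ] = true ∷ encodeℕ m

encodePoint : Point → Word
encodePoint (x , y) = encodeℤ x ++ encodeℤ y

encodeAxis : Axis → Word
encodeAxis horizontal = false ∷ []
encodeAxis vertical   = true ∷ []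

encodeColouredSegment : Segment × Colour → Word
encodeColouredSegment ((a , p) , k) = encodeAxis a ++ encodePoint p ++ encodeℕ k

encodeList : {A : Set} → (A → Word) → List A → Word
encodeList enc []       = false ∷ []
encodeList enc (x ∷ xs) = true ∷ enc x ++ encodeList enc xs

encodeRegion : Region → Word
encodeRegion D = encodeList encodePoint (cells D)
              ++ encodeList encodeColouredSegment (boundary D)

Language : Set₁
Language = Word → Set

-- Words that do not encode a region are no-instances.
TilingProblem : {n : ℕ} → TileSet n → Language
TilingProblem T w = ∃[ D ] (encodeRegion D ≡ w × Tiles T D)

------------------------------------------------------------------------
-- Deterministic multi-tape Turing machines

data Symbol (g : ℕ) : Set where
  blank : Symbol g
  bit   : Bool → Symbol g
  extra : Fin g → Symbol g

data Move : Set where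
  left stay right : Move

-- A two-way infinite tape.  The part to the left of the head is listed
-- from the head outwards, and beyond both lists everything is blank.
record Tape (g : ℕ) : Set where
  constructor tape
  field
    before : List (Symbol g)
    here   : Symbol g
    after  : List (Symbol g)

open Tape public

module _ {g : ℕ} where

  -- The tape containing the given symbols, with the head on the first.
  fromSymbols : List (Symbol g) → Tape g
  fromSymbols []       = tape [] blank []
  fromSymbols (x ∷ xs) = tape [] x xs

  move : Move → Tape g → Tape g
  move left  (tape []       x rs) = tape [] blank (x ∷ rs)
  move left  (tape (l ∷ ls) x rs) = tape ls l (x ∷ rs)
  move stay  t                    = t
  move right (tape ls x [])       = tape (x ∷ ls) blank []
  move right (tape ls x (r ∷ rs)) = tape (x ∷ ls) r rs

  write : Symbol g × Move → Tape g → Tape g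
  write (x , m) (tape ls _ rs) = move m (tape ls x rs)

  leadingBits : List (Symbol g) → Word
  leadingBits (bit b ∷ xs) = b ∷ leadingBits xs
  leadingBits _            = []

-- The tapes are numbered from 0, and there is at least one.  The machine
-- halts when δ is nothing.
record Machine : Set where
  field
    workTapes states extras : ℕ
    start  : Fin states
    accept : Fin states → Bool
    δ      : Fin states → Vec (Symbol extras) (suc workTapes) →
             Maybe (Fin states × Vec (Symbol extras × Move) (suc workTapes))

module _ (M : Machine) where
  open Machine M

  record Config : Set where
    constructor config
    field
      state : Fin states
      tapes : Vec (Tape extras) (suc workTapes)

  open Config

  initial : Word → Config
  initial w = config start
    (fromSymbols (List.map bit w) ∷ Vec.replicate workTapes (fromSymbols []))

  step : Config → Maybe Config
  step (config q ts) with δ q (Vec.map here ts)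
  ... | nothing       = nothing
  ... | just (q′ , as) = just (config q′ (Vec.zipWith write as ts))

  -- HaltsAfter t c c′: started in c, the machine halts in c′ after
  -- exactly t steps.
  data HaltsAfter : ℕ → Config → Config → Set where
    halted : ∀ {c} → step c ≡ nothing → HaltsAfter 0 c c
    next   : ∀ {t c c′ c″} → step c ≡ just c′ → HaltsAfter t c′ c″ →
             HaltsAfter (suc t) c c″

  Accepts : Word → Set
  Accepts w = ∃[ t ] ∃[ c ] (HaltsAfter t (initial w) c × accept (state c) ≡ true)

  -- The output is the block of bits on tape 0 that starts at the head.
  output : Config → Word
  output c = leadingBits (here t ∷ after t) where t = Vec.head (tapes c)

  Outputs : Word → Word → Set
  Outputs w v = ∃[ t ] ∃[ c ] (HaltsAfter t (initial w) c × output c ≡ v)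

------------------------------------------------------------------------
-- NP-completeness

-- A list of coefficients, constant term first.
Polynomial : Set
Polynomial = List ℕ

eval : Polynomial → ℕ → ℕ
eval p m = foldr (λ a r → a + m * r) 0 p

RunsInTime : Machine → Polynomial → Set
RunsInTime M p = ∀ w → ∃[ t ] ∃[ c ]
  (HaltsAfter M t (initial M w) c × t ≤ eval p (length w))

pair : Word → Word → Word
pair x y = concatMap (λ b → true ∷ b ∷ []) x ++ false ∷ y

-- V is a verifier running in polynomial time, and q bounds the length
-- of the certificates.
NP : Language → Set
NP L = Σ[ V ∈ Machine ] Σ[ p ∈ Polynomial ] Σ[ q ∈ Polynomial ]
  ( RunsInTime V p
  × (∀ x → L x ⇔ (∃[ y ] (length y ≤ eval q (length x) × Accepts V (pair x y)))) )

PolynomialTimeComputable : (Word → Word) → Set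
PolynomialTimeComputable f = Σ[ M ∈ Machine ] Σ[ p ∈ Polynomial ]
  (RunsInTime M p × (∀ w → Outputs M w (f w)))

infix 4 _≤ₚ_
_≤ₚ_ : Language → Language → Set
L ≤ₚ K = ∃[ f ] (PolynomialTimeComputable f × (∀ w → L w ⇔ K (f w)))

NPHard : Language → Set₁
NPHard K = ∀ L → NP L → L ≤ₚ K

NPComplete : Language → Set₁
NPComplete K = NP K × NPHard K

module Submission where

-- Wires carrying bits form a queue that enters the region from below. Four crossing tiles, two that make a
-- wire go right and two that make it go up again let a row of the region take off the first wire of the queue
-- and put it back at the end; two more tiles swap two wires on the way, and four apply to three of them a gate
-- that may exchange a pair of ones for a single one. So the region of a list of operations is tiled just when
-- they lead from the queue at the bottom to the one at the top. Since swaps permute the wires at will, the gate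
-- makes a nondeterministic finite device sweep over a tape of cells, each a block of wires of which one pair is
-- on, and such sweeps simulate a Turing machine that verifies a guessed certificate. Conversely, a tiling is
-- certified by its placements, together with orderings of the cells and of a ring around them that show both
-- to be connected.

open import Defs renaming (here to head; before to left-of; after to right-of; move to moveTape; step to stepM)
open import Data.Bool.Base using (Bool; true; false; if_then_else_; _∧_; _∨_; not; _xor_)
open import Data.Bool.Properties using () renaming (_≟_ to _≟B_)
open import Data.Empty using (⊥; ⊥-elim)
open import Data.Fin.Base using (Fin; zero; suc; toℕ; fromℕ<; combine; remQuot; join; splitAt)
open import Data.Fin.Patterns
open import Data.Fin.Properties as Finₚ using (remQuot-combine; splitAt-join) renaming (_≟_ to _≟F_)
open import Data.Integer.Base as ℤ using (ℤ; +_; -[1+_]; 0ℤ; 1ℤ; +≤+; +<+; -≤+; -<+)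
import Data.Integer.Properties as Z
open import Algebra.Properties.AbelianGroup Z.+-0-abelianGroup using (∙-cancelˡ)
open import Data.List.Base as List using (List; []; _∷_; _++_; _ʳ++_; allFin; cartesianProduct; concat; concatMap; drop; filter; foldl; length; map; replicate; reverse; take)
open import Data.List.Membership.Propositional using (_∈_; _∉_; find; lose)
open import Data.List.Membership.Propositional.Properties
open import Data.List.Properties hiding (≡-dec; lookup-replicate; tabulate-cong; map-replicate)
open import Data.List.Relation.Binary.Permutation.Propositional using (_↭_; refl; prep; swap; ↭-refl; ↭-sym; ↭-trans; ↭⇒↭ₛ) renaming (trans to ↭trans)
open import Data.List.Relation.Binary.Permutation.Propositional.Properties using (↭-length; shift; ∈-resp-↭)
import Data.List.Relation.Binary.Permutation.Propositional.Properties as ↭ₚ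
import Data.List.Relation.Binary.Permutation.Setoid.Properties as ↭ₛ
open import Data.List.Relation.Unary.All as All using (All; []; _∷_)
import Data.List.Relation.Unary.All.Properties as Allₚ
open import Data.List.Relation.Unary.AllPairs as AllPairs using (AllPairs; []; _∷_)
open import Data.List.Relation.Unary.Any using (here; there)
open import Data.List.Relation.Unary.Unique.Propositional using (Unique)
import Data.List.Relation.Unary.Unique.Propositional.Properties as Uniqueₚ
open import Data.Maybe.Base using (Maybe; just; nothing)
open import Data.Maybe.Properties using (just-injective)
open import Data.Nat.Base
open import Data.Nat.Binary.Base as ℕᵇ using (ℕᵇ; 2[1+_]; 1+[2_])
open import Data.Nat.Binary.Properties using (toℕ-fromℕ; fromℕ-toℕ; toℕ-suc; toℕ-pred)
open import Data.Nat.ListAction using (sum)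
open import Data.Nat.ListAction.Properties using (sum-↭)
open import Data.Nat.Properties
open import Data.Nat.Tactic.RingSolver using (solve-∀)
open import Data.Product.Base using (Σ-syntax; ∃; ∃-syntax; _×_; _,_) renaming (proj₁ to fst; proj₂ to snd)
open import Data.Product.Properties using (≡-dec)
open import Data.Sum.Base as Sum using (_⊎_) renaming (inj₁ to inl; inj₂ to inr)
import Data.Sum.Properties as Sumₚ
open import Data.Unit.Base using (⊤; tt)
open import Data.Vec.Base as Vec using (Vec; []; _∷_; lookup; _[_]≔_)
open import Data.Vec.Properties as Vecₚ using (lookup-map; lookup-zipWith; lookup-replicate; tabulate∘lookup; tabulate-cong)
open import Data.Vec.Relation.Binary.Pointwise.Inductive as Pw using (Pointwise; []; _∷_)
open import Data.Vec.Relation.Unary.All as VecAll using ([]; _∷_)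
open import Function.Base using (_∘_; _∋_; flip)
open import Function.Bundles using (_⇔_; mk⇔; Equivalence)
open import Relation.Binary.Construct.Closure.ReflexiveTransitive as Star using (Star; ε; _◅_; _◅◅_)
open import Relation.Binary.Definitions using (DecidableEquality)
open import Relation.Binary.PropositionalEquality
open import Relation.Nullary using (¬_; ¬?; Dec; yes; no; does; contradiction; Reflects; ofʸ; ofⁿ; invert)
open import Relation.Nullary.Decidable using (toWitness; dec-true; _×-dec_; _→-dec_)
open import Relation.Nullary.Reflects using (_×-reflects_; _⊎-reflects_; ¬-reflects; _→-reflects_)
open import Data.List.Membership.DecPropositional (≡-dec _≟_ _≟_) using () renaming (_∈?_ to _∈ℕ?_)
open import Data.List.Relation.Unary.Unique.DecPropositional (≡-dec _≟_ _≟_) using (unique?)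

-- Only the lower left cell of a tile has both its left and its lower side on the boundary, and the
-- colours there leave one tile or two gates. So a tiling is forced from the bottom up, and the only
-- free choice is between keeping a pair of ones and exchanging it. A gate with such a choice can
-- never be made to act. What it can do is block: its first two wires must be equal, and a pair of
-- ones must not meet a third one. With other wires known to be zero, the same gate thus tests a
-- wire for zero, or two wires for equality. Hence a place of the device is a pair of wires, scratch
-- wires of known value accompany the blocks, and each rule may be skipped, a test at the end making
-- sure that one was applied. The upper boundary is part of the input, so the outcome has to be
-- known beforehand: after acceptance the tape is wiped. Polynomial time refers to actual multi-tape
-- machines; verifier and reduction are therefore functions on binary trees, kept on a stack in
-- prefix notation, built from combinators that carry their time bounds.

pattern 1st = here refl
pattern 2nd = there 1st
pattern 3rd = there 2nd
pattern 4th = there 3rd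
pattern 5th = there 4th
pattern 6th = there 5th
pattern 7th = there 6th
pattern 8th = there 7th
pattern 9th = there 8th
pattern 10th = there 9th
pattern 11th = there 10th
pattern 12th = there 11th

infixr 6 _∙_ _»_

_∙_ : ∀ {a} {A : Set a} {x y z : A} → x ≡ y → y ≡ z → x ≡ z
_∙_ = trans

_»_ : ∀ {i j k} → i ≤ j → j ≤ k → i ≤ k
_»_ = ≤-trans

slack : ∀ {a b c} → a + c ≡ b → a ≤ b
slack refl = m≤m+n _ _

-- Polynomial bounds

data Pol : Set where
  con : ℕ → Pol
  X : Pol
  _⊞_ _⊠_ : Pol → Pol → Pol

infixl 6 _⊞_
infixl 7 _⊠_

⟦_⟧ : Pol → ℕ → ℕ
⟦ con k ⟧ n = k
⟦ X ⟧ n = n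
⟦ p ⊞ q ⟧ n = ⟦ p ⟧ n + ⟦ q ⟧ n
⟦ p ⊠ q ⟧ n = ⟦ p ⟧ n * ⟦ q ⟧ n

-- There is no subtraction, so a bound may be evaluated at any upper estimate of a size.
⟦⟧-mono : ∀ p {m n} → m ≤ n → ⟦ p ⟧ m ≤ ⟦ p ⟧ n
⟦⟧-mono (con k) le = ≤-refl
⟦⟧-mono X le = le
⟦⟧-mono (p ⊞ q) le = +-mono-≤ (⟦⟧-mono p le) (⟦⟧-mono q le)
⟦⟧-mono (p ⊠ q) le = *-mono-≤ (⟦⟧-mono p le) (⟦⟧-mono q le)

infixr 8 _⊚_
-- Running times of composed programs are composed polynomials. Bounds therefore stay expressions,
-- and become lists of coefficients only in `toPolynomial`.
_⊚_ : Pol → Pol → Pol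
con k ⊚ q = con k
X ⊚ q = q
(p ⊞ p') ⊚ q = p ⊚ q ⊞ p' ⊚ q
(p ⊠ p') ⊚ q = p ⊚ q ⊠ p' ⊚ q

⟦⊚⟧ : ∀ p q n → ⟦ p ⊚ q ⟧ n ≡ ⟦ p ⟧ (⟦ q ⟧ n)
⟦⊚⟧ (con k) q n = refl
⟦⊚⟧ X q n = refl
⟦⊚⟧ (p ⊞ p') q n = cong₂ _+_ (⟦⊚⟧ p q n) (⟦⊚⟧ p' q n)
⟦⊚⟧ (p ⊠ p') q n = cong₂ _*_ (⟦⊚⟧ p q n) (⟦⊚⟧ p' q n)

plus : Polynomial → Polynomial → Polynomial
plus [] q = q
plus (a ∷ p) [] = a ∷ p
plus (a ∷ p) (b ∷ q) = (a + b) ∷ plus p q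

scale : ℕ → Polynomial → Polynomial
scale a [] = []
scale a (b ∷ q) = a * b ∷ scale a q

times : Polynomial → Polynomial → Polynomial
times [] q = []
times (a ∷ p) q = plus (scale a q) (0 ∷ times p q)

eval-plus : ∀ p q m → eval (plus p q) m ≡ eval p m + eval q m
eval-plus [] q m = refl
eval-plus (a ∷ p) [] m = sym (+-identityʳ _)
eval-plus (a ∷ p) (b ∷ q) m rewrite eval-plus p q m = lemma a b m (eval p m) (eval q m)
  where
  lemma : ∀ a b m x y → a + b + m * (x + y) ≡ a + m * x + (b + m * y)
  lemma = solve-∀

eval-scale : ∀ a q m → eval (scale a q) m ≡ a * eval q m
eval-scale a [] m = sym (*-zeroʳ a)
eval-scale a (b ∷ q) m rewrite eval-scale a q m = lemma a b m (eval q m)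
  where
  lemma : ∀ a b m y → a * b + m * (a * y) ≡ a * (b + m * y)
  lemma = solve-∀

eval-times : ∀ p q m → eval (times p q) m ≡ eval p m * eval q m
eval-times [] q m = refl
eval-times (a ∷ p) q m
  rewrite eval-plus (scale a q) (0 ∷ times p q) m | eval-scale a q m | eval-times p q m
  = lemma a m (eval p m) (eval q m)
  where
  lemma : ∀ a m x y → a * y + m * (x * y) ≡ (a + m * x) * y
  lemma = solve-∀

toPolynomial : Pol → Polynomial
toPolynomial (con k) = k ∷ []
toPolynomial X = 0 ∷ 1 ∷ []
toPolynomial (p ⊞ q) = plus (toPolynomial p) (toPolynomial q)
toPolynomial (p ⊠ q) = times (toPolynomial p) (toPolynomial q)

eval-toPolynomial : ∀ p m → eval (toPolynomial p) m ≡ ⟦ p ⟧ m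
eval-toPolynomial (con k) m rewrite *-zeroʳ m = +-identityʳ k
eval-toPolynomial X m rewrite *-zeroʳ m = *-identityʳ m
eval-toPolynomial (p ⊞ q) m rewrite eval-plus (toPolynomial p) (toPolynomial q) m
  = cong₂ _+_ (eval-toPolynomial p m) (eval-toPolynomial q m)
eval-toPolynomial (p ⊠ q) m rewrite eval-times (toPolynomial p) (toPolynomial q) m
  = cong₂ _*_ (eval-toPolynomial p m) (eval-toPolynomial q m)

fromPolynomial : Polynomial → Pol
fromPolynomial [] = con 0
fromPolynomial (a ∷ p) = con a ⊞ X ⊠ fromPolynomial p

-- Finite types

record Finite (A : Set) : Set where
  field
    card : ℕ
    rank : A → Fin card
    unrank : Fin card → A
    unrank-rank : ∀ a → unrank (rank a) ≡ a

  rank-injective : ∀ {a b} → rank a ≡ rank b → a ≡ b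
  rank-injective {a} {b} e = sym (unrank-rank a) ∙ cong unrank e ∙ unrank-rank b

  all : List A
  all = map unrank (allFin card)

  ∈all : ∀ a → a ∈ all
  ∈all a = subst (_∈ all) (unrank-rank a) (∈-map⁺ unrank (∈-allFin (rank a)))

open Finite public

finite-Fin : ∀ n → Finite (Fin n)
finite-Fin n = record { card = n ; rank = λ i → i ; unrank = λ i → i ; unrank-rank = λ _ → refl }

-- Finiteness asks only for an injective numbering, with `unrank` as a left inverse; so a map with a
-- left inverse is enough, and numbers without a meaning do no harm.
retract : ∀ {A B} (f : A → B) (g : B → A) → (∀ a → g (f a) ≡ a) → Finite B → Finite A
retract f g e F = record { card = card F ; rank = λ a → rank F (f a) ; unrank = λ i → g (unrank F i)
    ; unrank-rank = λ a → cong g (unrank-rank F (f a)) ∙ e a }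

finite-⊤ : Finite ⊤
finite-⊤ = retract (λ _ → zero) (λ _ → tt) (λ _ → refl) (finite-Fin 1)

infixr 2 _×-finite_
infixr 1 _⊎-finite_

_×-finite_ : ∀ {A B} → Finite A → Finite B → Finite (A × B)
F ×-finite G = record
  { card = card F * card G
  ; rank = λ (a , b) → combine (rank F a) (rank G b)
  ; unrank = λ i → unrank F (fst (remQuot (card G) i)) , unrank G (snd (remQuot {card F} (card G) i))
  ; unrank-rank = λ (a , b) → cong₂ _,_
      (cong (λ x → unrank F (fst x)) (remQuot-combine (rank F a) (rank G b)) ∙ unrank-rank F a)
      (cong (λ x → unrank G (snd x)) (remQuot-combine (rank F a) (rank G b)) ∙ unrank-rank G b) }

_⊎-finite_ : ∀ {A B} → Finite A → Finite B → Finite (A ⊎ B)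
F ⊎-finite G = record
  { card = card F + card G
  ; rank = λ x → join (card F) (card G) (Sum.map (rank F) (rank G) x)
  ; unrank = λ i → Sum.map (unrank F) (unrank G) (splitAt (card F) i)
  ; unrank-rank = λ x → cong (Sum.map (unrank F) (unrank G)) (splitAt-join (card F) (card G) (Sum.map (rank F) (rank G) x)) ∙ back x }
  where
  back : ∀ x → Sum.map (unrank F) (unrank G) (Sum.map (rank F) (rank G) x) ≡ x
  back (inl a) = cong inl (unrank-rank F a)
  back (inr b) = cong inr (unrank-rank G b)

finite-Vec : ∀ {A} → Finite A → ∀ n → Finite (Vec A n)
finite-Vec F zero = retract (λ _ → tt) (λ _ → []) (λ { [] → refl }) finite-⊤
finite-Vec F (suc n) = retract (λ { (x ∷ xs) → x , xs }) (λ (x , xs) → x ∷ xs) (λ { (_ ∷ _) → refl }) (F ×-finite finite-Vec F n)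

finite-Bool : Finite Bool
finite-Bool = retract to from (λ { false → refl ; true → refl }) (finite-Fin 2)
  where
  to : Bool → Fin 2
  to false = zero
  to true = suc zero
  from : Fin 2 → Bool
  from zero = false
  from (suc _) = true

-- A while language on four stacks and its compilation to a Turing machine

Store : Set
Store = Vec Word 4

infixr 5 _⨾_

-- Popping an empty stack is possible and observable in case, and ends a while.
data Cmd : Set where
  skip : Cmd
  push : Fin 4 → Bool → Cmd
  _⨾_ : Cmd → Cmd → Cmd
  case : Fin 4 → (onEmpty onFalse onTrue : Cmd) → Cmd
  while : Fin 4 → Cmd → Cmd

-- The index counts machine steps exactly: two for a pop, which moves onto the top and then erases
-- it, and none for sequencing or for returning to the test of a loop.
data Exec : Cmd → Store → ℕ → Store → Set where
  skip : ∀ {σ} → Exec skip σ 1 σ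
  push : ∀ {i b σ} → Exec (push i b) σ 1 (σ [ i ]≔ (b ∷ lookup σ i))
  _⨾_ : ∀ {c d σ τ υ m n} → Exec c σ m τ → Exec d τ n υ → Exec (c ⨾ d) σ (m + n) υ
  caseE : ∀ {i a b c σ τ n} → lookup σ i ≡ [] → Exec a σ n τ →
      Exec (case i a b c) σ (2 + n) τ
  caseF : ∀ {i a b c σ τ n w} → lookup σ i ≡ false ∷ w → Exec b (σ [ i ]≔ w) n τ →
      Exec (case i a b c) σ (2 + n) τ
  caseT : ∀ {i a b c σ τ n w} → lookup σ i ≡ true ∷ w → Exec c (σ [ i ]≔ w) n τ →
      Exec (case i a b c) σ (2 + n) τ
  whileE : ∀ {i c σ} → lookup σ i ≡ [] → Exec (while i c) σ 2 σ
  whileF : ∀ {i c σ w} → lookup σ i ≡ false ∷ w → Exec (while i c) σ 2 (σ [ i ]≔ w)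
  whileT : ∀ {i c σ τ υ w m n} → lookup σ i ≡ true ∷ w → Exec c (σ [ i ]≔ w) m τ →
      Exec (while i c) τ n υ → Exec (while i c) σ (2 + m + n) υ

-- Control points. The Boolean in `case` and `while` distinguishes the two steps of a pop.
PC : Cmd → Set
PC skip = ⊤
PC (push _ _) = ⊤
PC (c ⨾ d) = PC c ⊎ PC d
PC (case _ a b c) = Bool ⊎ (PC a ⊎ (PC b ⊎ PC c))
PC (while _ c) = Bool ⊎ PC c

first : ∀ c → PC c
first skip = tt
first (push _ _) = tt
first (c ⨾ d) = inl (first c)
first (case _ _ _ _) = inl false
first (while _ _) = inl false

PC-finite : ∀ c → Finite (PC c)
PC-finite skip = finite-⊤
PC-finite (push _ _) = finite-⊤
PC-finite (c ⨾ d) = PC-finite c ⊎-finite PC-finite d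
PC-finite (case _ a b c) = finite-Bool ⊎-finite PC-finite a ⊎-finite PC-finite b ⊎-finite PC-finite c
PC-finite (while _ c) = finite-Bool ⊎-finite PC-finite c

Sym = Symbol 0
Heads = Vec Sym 4
Actions = Vec (Sym × Move) 4

idle : ∀ {n} → Vec Sym n → Vec (Sym × Move) n
idle = Vec.map (λ x → x , stay)

act : Fin 4 → Sym → Move → Heads → Actions
act i x m h = idle h [ i ]≔ (x , m)

branch : {S : Set} → Sym → S → S → S → S
branch blank a b c = a
branch (bit false) a b c = b
branch (bit true) a b c = c
branch (extra ())

-- Compilation with a continuation: `emb` places the control points of the command among those of
-- the whole program, and `k` is the state to which its last step leads.
transition : ∀ c {S : Set} → (PC c → S) → S → PC c → Heads → S × Actions
transition skip emb k _ h = k , idle h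
transition (push i b) emb k _ h = k , act i (bit b) left h
transition (c ⨾ d) emb k (inl p) = transition c (emb ∘ inl) (emb (inr (first d))) p
transition (c ⨾ d) emb k (inr p) = transition d (emb ∘ inr) k p
transition (case i a b c) emb k (inl false) h = emb (inl true) , act i blank right h
transition (case i a b c) emb k (inl true) h =
  branch (lookup h i) (emb (inr (inl (first a)))) (emb (inr (inr (inl (first b)))))
      (emb (inr (inr (inr (first c))))) ,
  act i blank stay h
transition (case i a b c) emb k (inr (inl p)) = transition a (emb ∘ inr ∘ inl) k p
transition (case i a b c) emb k (inr (inr (inl p))) = transition b (emb ∘ inr ∘ inr ∘ inl) k p
transition (case i a b c) emb k (inr (inr (inr p))) = transition c (emb ∘ inr ∘ inr ∘ inr) k p
transition (while i c) emb k (inl false) h = emb (inl true) , act i blank right h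
transition (while i c) emb k (inl true) h =
  branch (lookup h i) k k (emb (inr (first c))) , act i blank stay h
transition (while i c) emb k (inr p) = transition c (emb ∘ inr) (emb (inl false)) p

-- Stacks as tapes: the head is just left of the top, and what is left of the head is blank.

Rep : Tape 0 → Word → Set
Rep t w = ∃[ m ] ∃[ n ] t ≡ tape (replicate m blank) blank (map bit w ++ replicate n blank)

rep-push : ∀ {t w} b → Rep t w → Rep (write (bit b , left) t) (b ∷ w)
rep-push b (zero , n , refl) = 0 , n , refl
rep-push b (suc m , n , refl) = m , n , refl

popped : Tape 0 → Tape 0
popped t = write (blank , right) t

rep-here-[] : ∀ {t} → Rep t [] → head (popped t) ≡ blank
rep-here-[] (m , zero , refl) = refl
rep-here-[] (m , suc n , refl) = refl

rep-[] : ∀ {t} → Rep t [] → Rep (write (blank , stay) (popped t)) []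
rep-[] (m , zero , refl) = suc m , 0 , refl
rep-[] (m , suc n , refl) = suc m , n , refl

rep-here-∷ : ∀ {t b w} → Rep t (b ∷ w) → head (popped t) ≡ bit b
rep-here-∷ (m , n , refl) = refl

rep-∷ : ∀ {t b w} → Rep t (b ∷ w) → Rep (write (blank , stay) (popped t)) w
rep-∷ (m , n , refl) = suc m , n , refl

Reps : Vec (Tape 0) 4 → Store → Set
Reps = Pointwise Rep

update-Pw : ∀ {n} {ts : Vec (Tape 0) n} {σ : Vec Word n} {t w} (i : Fin n) →
  Pointwise Rep ts σ → Rep t w → Pointwise Rep (ts [ i ]≔ t) (σ [ i ]≔ w)
update-Pw zero (_ ∷ rs) r = r ∷ rs
update-Pw (suc i) (x ∷ rs) r = x ∷ update-Pw i rs r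

idle-write : ∀ {n} (ts : Vec (Tape 0) n) →
  Vec.zipWith write (idle (Vec.map head ts)) ts ≡ ts
idle-write [] = refl
idle-write (t ∷ ts) = cong (t ∷_) (idle-write ts)

act-write : ∀ {n} (ts : Vec (Tape 0) n) i a →
  Vec.zipWith write (idle (Vec.map head ts) [ i ]≔ a) ts ≡ ts [ i ]≔ write a (lookup ts i)
act-write (t ∷ ts) zero a = cong (write a t ∷_) (idle-write ts)
act-write (t ∷ ts) (suc i) a = cong (t ∷_) (act-write ts i a)

-- The machine running a command with its input on stack 0, which finally puts the head of
-- tape 0 on the top of stack 0 and accepts when it finds true there.

pattern beginning = 0F
pattern rewind = 1F
pattern testing = 2F
pattern succeeded = 3F
pattern refused = 4F

module _ (prog : Cmd) where

  St : Set
  St = Fin 5 ⊎ PC prog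

  St-finite : Finite St
  St-finite = finite-Fin 5 ⊎-finite PC-finite prog

  δS : St → Heads → Maybe (St × Actions)
  -- The symbol is written back and the head moves left, because a stack is represented with the
  -- head just left of its top.
  δS (inl beginning) h@(x ∷ _) = just (inr (first prog) , act zero x left h)
  δS (inl rewind) h = just (inl testing , act zero blank right h)
  δS (inl testing) h@(x ∷ _) = just (branch x (inl refused) (inl refused) (inl succeeded) , idle h)
  δS (inl succeeded) h = nothing
  δS (inl refused) h = nothing
  δS (inr p) h = just (transition prog inr (inl rewind) p h)

  accepting : St → Bool
  accepting (inl succeeded) = true
  accepting _ = false

  encode-step : Maybe (St × Actions) → Maybe (Fin (card St-finite) × Actions)
  encode-step nothing = nothing
  encode-step (just (s , as)) = just (rank St-finite s , as)

  machine : Machine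
  machine = record
    { workTapes = 3
    ; states = card St-finite
    ; extras = 0
    ; start = rank St-finite (inl beginning)
    ; accept = accepting ∘ unrank St-finite
    ; δ = λ q h → encode-step (δS (unrank St-finite q) h) }

  cfg : St → Vec (Tape 0) 4 → Config machine
  cfg s ts = config (rank St-finite s) ts

  step-just : ∀ s {s' as} ts → δS s (Vec.map head ts) ≡ just (s' , as) →
    stepM machine (cfg s ts) ≡ just (cfg s' (Vec.zipWith write as ts))
  step-just s ts eq rewrite unrank-rank St-finite s | eq = refl

  step-nothing : ∀ s ts → δS s (Vec.map head ts) ≡ nothing → stepM machine (cfg s ts) ≡ nothing
  step-nothing s ts eq rewrite unrank-rank St-finite s | eq = refl

  data Steps : ℕ → Config machine → Config machine → Set where
    [] : ∀ {c} → Steps 0 c c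
    _∷_ : ∀ {n c c' c″} → stepM machine c ≡ just c' → Steps n c' c″ → Steps (suc n) c c″

  _++ˢ_ : ∀ {m n a b c} → Steps m a b → Steps n b c → Steps (m + n) a c
  [] ++ˢ t = t
  (e ∷ s) ++ˢ t = e ∷ (s ++ˢ t)

  Steps-halt : ∀ {m n a b c} → Steps m a b → HaltsAfter machine n b c → HaltsAfter machine (m + n) a c
  Steps-halt [] h = h
  Steps-halt (e ∷ s) h = next e (Steps-halt s h)

  one : ∀ {a b ts ts'} → δS a (Vec.map head ts) ≡ just b → Vec.zipWith write (snd b) ts ≡ ts' →
    Steps 1 (cfg a ts) (cfg (fst b) ts')
  one {a} {b} {ts} e refl = step-just a ts e ∷ []

  -- The two steps of a pop: move onto the top symbol, then erase it and branch.
  pop-steps : ∀ {s₀ s₁ A B C : St} (i : Fin 4) {x ts} →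
    (∀ h → δS s₀ h ≡ just (s₁ , act i blank right h)) →
    (∀ h → δS s₁ h ≡ just (branch (lookup h i) A B C , act i blank stay h)) →
    head (popped (lookup ts i)) ≡ x →
    Steps 2 (cfg s₀ ts) (cfg (branch x A B C) (ts [ i ]≔ write (blank , stay) (popped (lookup ts i))))
  pop-steps {s₀} {s₁} {A} {B} {C} i {x} {ts} e₀ e₁ ex =
    step-just s₀ ts (e₀ _) ∷
    subst₂ (λ q us → stepM machine (cfg s₁ ts₁) ≡ just (cfg q us)) qeq teq
        (step-just s₁ ts₁ (e₁ _)) ∷ []
    where
    ts₁ = Vec.zipWith write (act i blank right (Vec.map head ts)) ts
    eq₁ : ts₁ ≡ ts [ i ]≔ popped (lookup ts i)
    eq₁ = act-write ts i _
    look : lookup ts₁ i ≡ popped (lookup ts i)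
    look = cong (λ us → lookup us i) eq₁ ∙ Vecₚ.lookup∘update i ts _
    qeq : branch (lookup (Vec.map head ts₁) i) A B C ≡ branch x A B C
    qeq = cong (λ y → branch y A B C) (lookup-map i head ts₁ ∙ cong head look ∙ ex)
    teq : Vec.zipWith write (act i blank stay (Vec.map head ts₁)) ts₁
        ≡ ts [ i ]≔ write (blank , stay) (popped (lookup ts i))
    teq = act-write ts₁ i _ ∙
        cong (λ u → ts₁ [ i ]≔ write (blank , stay) u) look ∙
        cong (_[ i ]≔ write (blank , stay) (popped (lookup ts i))) eq₁ ∙ Vecₚ.[]≔-idempotent ts i

  Emb : ∀ c → (PC c → St) → St → Set
  Emb c emb k = ∀ p h → δS (emb p) h ≡ just (transition c emb k p h)

  Sim : ∀ c → (PC c → St) → St → ℕ → Vec (Tape 0) 4 → Store → Set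
  Sim c emb k n ts τ = ∃[ us ] Steps n (cfg (emb (first c)) ts) (cfg k us) × Reps us τ

  rep-at : ∀ {ts σ} i → Reps ts σ → ∀ {w} → lookup σ i ≡ w → Rep (lookup ts i) w
  rep-at i rs refl = Pw.lookup rs i

  -- Induction on the execution. `Emb` says that the machine behaves at the embedded control points
  -- as the compiled command prescribes, and subcommands inherit this; the step counts then agree
  -- without any rounding.
  simulate : ∀ c emb k → Emb c emb k → ∀ {σ n τ ts} → Exec c σ n τ → Reps ts σ → Sim c emb k n ts τ
  popE : ∀ i {ts σ} → Reps ts σ → lookup σ i ≡ [] →
    Reps (ts [ i ]≔ write (blank , stay) (popped (lookup ts i))) σ
  popE i rs e = subst (Reps _) (cong (_ [ i ]≔_) (sym e) ∙ Vecₚ.[]≔-lookup _ i) (update-Pw i rs (rep-[] (rep-at i rs e)))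
  pop∷ : ∀ i {ts σ b w} → Reps ts σ → lookup σ i ≡ b ∷ w →
    Reps (ts [ i ]≔ write (blank , stay) (popped (lookup ts i))) (σ [ i ]≔ w)
  pop∷ i rs e = update-Pw i rs (rep-∷ (rep-at i rs e))

  simulate skip emb k H {ts = ts} skip rs = ts , one (H tt _) (idle-write ts) , rs
  simulate (push i b) emb k H {ts = ts} push rs =
    _ , one (H tt _) (act-write ts i _) , update-Pw i rs (rep-push b (Pw.lookup rs i))
  simulate (c ⨾ d) emb k H (x ⨾ y) rs
    with us , s , rs' ← simulate c (emb ∘ inl) _ (λ p → H (inl p)) x rs
    with vs , t , rs″ ← simulate d (emb ∘ inr) k (λ p → H (inr p)) y rs'
    = vs , (s ++ˢ t) , rs″
  simulate (case i a b c) emb k H (caseE e x) rs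
    with us , s , rs' ← simulate a (emb ∘ inr ∘ inl) k (λ p → H (inr (inl p))) x (popE i rs e)
    = us , (pop-steps i (H (inl false)) (H (inl true)) (rep-here-[] (rep-at i rs e)) ++ˢ s) , rs'
  simulate (case i a b c) emb k H (caseF e x) rs
    with us , s , rs' ← simulate b (emb ∘ inr ∘ inr ∘ inl) k (λ p → H (inr (inr (inl p)))) x
        (pop∷ i rs e)
    = us , (pop-steps i (H (inl false)) (H (inl true)) (rep-here-∷ (rep-at i rs e)) ++ˢ s) , rs'
  simulate (case i a b c) emb k H (caseT e x) rs
    with us , s , rs' ← simulate c (emb ∘ inr ∘ inr ∘ inr) k (λ p → H (inr (inr (inr p)))) x
        (pop∷ i rs e)
    = us , (pop-steps i (H (inl false)) (H (inl true)) (rep-here-∷ (rep-at i rs e)) ++ˢ s) , rs'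
  simulate (while i c) emb k H (whileE e) rs =
    _ , pop-steps i (H (inl false)) (H (inl true)) (rep-here-[] (rep-at i rs e)) , popE i rs e
  simulate (while i c) emb k H (whileF e) rs =
    _ , pop-steps i (H (inl false)) (H (inl true)) (rep-here-∷ (rep-at i rs e)) , pop∷ i rs e
  simulate (while i c) emb k H (whileT e x y) rs
    with us , s , rs' ← simulate c (emb ∘ inr) _ (λ p → H (inr p)) x (pop∷ i rs e)
    with vs , t , rs″ ← simulate (while i c) emb k H y rs'
    = vs , ((pop-steps i (H (inl false)) (H (inl true)) (rep-here-∷ (rep-at i rs e)) ++ˢ s) ++ˢ t) , rs″

  start-reps : ∀ w → Reps (Vec.zipWith write (act zero (head (fromSymbols (map bit w))) left
      (Vec.map head (fromSymbols (map bit w) ∷ Vec.replicate 3 (fromSymbols []))))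
      (fromSymbols (map bit w) ∷ Vec.replicate 3 (fromSymbols [])))
          (w ∷ [] ∷ [] ∷ [] ∷ [])
  start-reps [] = (0 , 1 , refl) ∷ (0 , 0 , refl) ∷ (0 , 0 , refl) ∷ (0 , 0 , refl) ∷ []
  start-reps (b ∷ w) = (0 , 0 , cong (λ x → tape [] blank (bit b ∷ x)) (sym (++-identityʳ _)))
    ∷ (0 , 0 , refl) ∷ (0 , 0 , refl) ∷ (0 , 0 , refl) ∷ []

  result : Word → Fin 5
  result (true ∷ _) = succeeded
  result _ = refused

  leadingBits-rep : ∀ w n → leadingBits {0} (map bit w ++ replicate n blank) ≡ w
  leadingBits-rep [] zero = refl
  leadingBits-rep [] (suc n) = refl
  leadingBits-rep (b ∷ w) n = cong (b ∷_) (leadingBits-rep w n)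

  output-popped : ∀ {t} w → Rep t w → leadingBits (head (popped t) ∷ right-of (popped t)) ≡ w
  output-popped [] (m , zero , refl) = refl
  output-popped [] (m , suc n , refl) = refl
  output-popped (b ∷ w) (m , n , refl) = cong (b ∷_) (leadingBits-rep w n)

  branch-result : ∀ {t} w → Rep t w →
    branch {St} (head (popped t)) (inl refused) (inl refused) (inl succeeded) ≡ inl (result w)
  branch-result [] (m , zero , refl) = refl
  branch-result [] (m , suc n , refl) = refl
  branch-result (false ∷ w) (m , n , refl) = refl
  branch-result (true ∷ w) (m , n , refl) = refl

  result-halts : ∀ w ts → stepM machine (cfg (inl (result w)) ts) ≡ nothing
  result-halts [] ts = step-nothing (inl refused) ts refl
  result-halts (false ∷ w) ts = step-nothing (inl refused) ts refl
  result-halts (true ∷ w) ts = step-nothing (inl succeeded) ts refl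

  -- The three additional steps go to the cell left of the input, return to the top of the output,
  -- and test the symbol found there.
  machine-run : ∀ {w n v r₁ r₂ r₃} → Exec prog (w ∷ [] ∷ [] ∷ [] ∷ []) n (v ∷ r₁ ∷ r₂ ∷ r₃ ∷ []) →
    ∃[ c ] HaltsAfter machine (3 + n) (initial machine w) c
        × output machine c ≡ v × Config.state c ≡ rank St-finite (inl (result v))
  machine-run {w} {n} {v} x
    with us@(u ∷ us') , s , rs@(r ∷ _) ← simulate prog inr (inl rewind) (λ _ _ → refl) x (start-reps w)
    = cfg (inl (result v)) vs
    , subst (λ k → HaltsAfter machine k (initial machine w) (cfg (inl (result v)) vs))
        (+-comm (suc n) 2)
        (Steps-halt (step-just (inl beginning) (fromSymbols (map bit w) ∷ Vec.replicate 3 (fromSymbols [])) refl ∷ s)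
          (next (step-just (inl rewind) us refl)
          (next {c′ = cfg (inl (result v)) vs} last (halted (result-halts v vs)))))
    , output-popped v r
    , refl
    where
    vs = popped u ∷ us'
    last : stepM machine (cfg (inl testing)
        (Vec.zipWith write (act zero blank right (Vec.map head us)) us)) ≡ just (cfg (inl (result v)) vs)
    last = step-just (inl testing) _ refl ∙
      (cong₂ (λ q ts → just (cfg q ts)) (branch-result v r)
        (idle-write _ ∙ cong (popped u ∷_) (idle-write us')))

  accepts-result : ∀ w → accepting (unrank St-finite (rank St-finite (inl (result w)))) ≡ accepting (inl (result w))
  accepts-result w = cong accepting (unrank-rank St-finite (inl (result w)))

-- Polynomial-time functions on binary trees

data Tree : Set where
  leaf : Tree
  node : Tree → Tree → Tree

-- Prefix notation: a code shows where it ends, so that trees can be stacked by concatenating their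
-- codes.
enc : Tree → Word
enc leaf = false ∷ []
enc (node a b) = true ∷ enc a ++ enc b

size : Tree → ℕ
size leaf = 1
size (node a b) = suc (size a + size b)

pattern s0 = zero
pattern s1 = suc zero
pattern s2 = suc (suc zero)
pattern s3 = suc (suc (suc zero))

Do : Cmd → Store → Store → ℕ → Set
Do c σ τ n = ∃[ m ] m ≤ n × Exec c σ m τ

infixr 5 _⨾ᵈ_
_⨾ᵈ_ : ∀ {c d σ τ υ m n} → Do c σ τ m → Do d τ υ n → Do (c ⨾ d) σ υ (m + n)
(_ , le , x) ⨾ᵈ (_ , le' , y) = _ , +-mono-≤ le le' , x ⨾ y

within : ∀ {c σ τ m n} → m ≤ n → Do c σ τ m → Do c σ τ n
within le (m , le' , x) = m , le' » le , x

exec : ∀ {c σ τ n} → Exec c σ n τ → Do c σ τ n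
exec x = _ , ≤-refl , x

input : ∀ {c v w σ n τ} → v ≡ w → Exec c (v ∷ σ) n τ → Exec c (w ∷ σ) n τ
input refl e = e

costing : ∀ {c σ m n τ} → m ≡ n → Exec c σ m τ → Exec c σ n τ
costing refl e = e

-- Words are moved to another stack bit by bit, which reverses them; every bit is covered by
-- a true, so that a false below the word stops the way back.

stash : Word → Word → Word
stash [] s = s
stash (b ∷ w) s = stash w (true ∷ b ∷ s)

stash-++ : ∀ v w s → stash (v ++ w) s ≡ stash w (stash v s)
stash-++ [] w s = refl
stash-++ (b ∷ v) w s = stash-++ v w _

stash? : Bool → Word → Word → Word
stash? false w s = s
stash? true w s = stash w s

stash?-node : ∀ u a b s →
  stash? u (enc (node a b)) s ≡ stash? u (enc b) (stash? u (enc a) (stash? u (true ∷ []) s))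
stash?-node false a b s = refl
stash?-node true a b s = stash-++ (enc a) (enc b) _

push? : Bool → Fin 4 → Bool → Cmd
push? false i b = skip
push? true i b = push i b

emit : Bool → Bool → Bool → Cmd
emit u v b = (push? u s1 b ⨾ push? u s1 true) ⨾ (push? v s2 b ⨾ push? v s2 true)

emit-run : ∀ u v b {r x y k} →
  Exec (emit u v b) (r ∷ x ∷ y ∷ k ∷ []) 4 (r ∷ stash? u (b ∷ []) x ∷ stash? v (b ∷ []) y ∷ k ∷ [])
emit-run false false b = (skip ⨾ skip) ⨾ (skip ⨾ skip)
emit-run false true b = (skip ⨾ skip) ⨾ (push ⨾ push)
emit-run true false b = (push ⨾ push) ⨾ (skip ⨾ skip)
emit-run true true b = (push ⨾ push) ⨾ (push ⨾ push)

-- Stack 3 holds one true for every subtree that is still to be read.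
scanLoop : Bool → Bool → Cmd
scanLoop u v = while s3 (case s0 skip (emit u v false ⨾ skip ⨾ skip)
    (emit u v true ⨾ push s3 true ⨾ push s3 true))

cost-node : ∀ a b n → 10 + (10 * a + (10 * b + n)) ≡ 10 * suc (a + b) + n
cost-node = solve-∀

-- Ten steps per symbol, since the two `skip`s at a leaf match the two pushes at a node. The lemma
-- is stated in front of any continuation of the loop, so that the two subtrees of a node can be
-- read one after the other.
scan-step : ∀ u v t {r x y k n τ} →
  Exec (scanLoop u v) (r ∷ stash? u (enc t) x ∷ stash? v (enc t) y ∷ k ∷ []) n τ →
  Exec (scanLoop u v) ((enc t ++ r) ∷ x ∷ y ∷ (true ∷ k) ∷ []) (10 * size t + n) τ
scan-step u v leaf e = whileT refl (caseF refl (emit-run u v false ⨾ skip ⨾ skip)) e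
scan-step u v (node a b) {r} {x} {y} {k} {n} {τ} e =
  subst₂ (λ w m → Exec (scanLoop u v) ((true ∷ w) ∷ x ∷ y ∷ (true ∷ k) ∷ []) m τ)
    (sym (++-assoc (enc a) (enc b) r)) (cost-node (size a) (size b) n)
    (whileT refl (caseT refl (emit-run u v true ⨾ push ⨾ push))
      (scan-step u v a (scan-step u v b
        (subst₂ (λ x' y' → Exec (scanLoop u v) (r ∷ x' ∷ y' ∷ k ∷ []) n τ)
          (stash?-node u a b x) (stash?-node v a b y) e))))

-- The flags choose the stacks that receive a copy, which makes dropping, duplicating and moving a
-- tree instances of one program. The `false` laid down below a copy stops `unstash₁` and
-- `unstash₂`, the one on stack 3 stops the loop.
scan : Bool → Bool → Cmd
scan u v = push? u s1 false ⨾ push? v s2 false ⨾ push s3 false ⨾ push s3 true ⨾ scanLoop u v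

base? : Bool → Word → Word
base? false s = s
base? true s = false ∷ s

scan-run : ∀ u v t {r x y k} →
  Do (scan u v) ((enc t ++ r) ∷ x ∷ y ∷ k ∷ [])
     (r ∷ stash? u (enc t) (base? u x) ∷ stash? v (enc t) (base? v y) ∷ k ∷ []) (6 + 10 * size t)
scan-run u v t = within (≤-reflexive (lemma (size t)))
  (exec (pushed u v (push ⨾ push ⨾ scan-step u v t (whileF refl))))
  where
  lemma : ∀ s → 1 + (1 + (1 + (1 + (10 * s + 2)))) ≡ 6 + 10 * s
  lemma = solve-∀
  pushed : ∀ u v {c r x y k n τ} → Exec c (r ∷ base? u x ∷ base? v y ∷ k ∷ []) n τ →
    Exec (push? u s1 false ⨾ push? v s2 false ⨾ c) (r ∷ x ∷ y ∷ k ∷ []) (2 + n) τ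
  pushed false false e = skip ⨾ skip ⨾ e
  pushed false true e = skip ⨾ push ⨾ e
  pushed true false e = push ⨾ skip ⨾ e
  pushed true true e = push ⨾ push ⨾ e

unstash₁ unstash₂ : Cmd
unstash₁ = while s1 (case s1 skip (push s0 false) (push s0 true))
unstash₂ = while s2 (case s2 skip (push s0 false) (push s0 true))

cost-unstash : ∀ l n → 5 * l + (5 + n) ≡ 5 * suc l + n
cost-unstash = solve-∀

unstash₁-step : ∀ w {r x y k n τ} → Exec unstash₁ ((w ++ r) ∷ x ∷ y ∷ k ∷ []) n τ →
  Exec unstash₁ (r ∷ stash w x ∷ y ∷ k ∷ []) (5 * length w + n) τ
unstash₁-step [] e = e
unstash₁-step (b ∷ w) {n = n} e =
  costing (cost-unstash (length w) n) (unstash₁-step w (bit₁ b e))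
  where
  bit₁ : ∀ b {r x y k n τ} → Exec unstash₁ ((b ∷ r) ∷ x ∷ y ∷ k ∷ []) n τ →
    Exec unstash₁ (r ∷ (true ∷ b ∷ x) ∷ y ∷ k ∷ []) (5 + n) τ
  bit₁ false e = whileT refl (caseF refl push) e
  bit₁ true e = whileT refl (caseT refl push) e

unstash₂-step : ∀ w {r x y k n τ} → Exec unstash₂ ((w ++ r) ∷ x ∷ y ∷ k ∷ []) n τ →
  Exec unstash₂ (r ∷ x ∷ stash w y ∷ k ∷ []) (5 * length w + n) τ
unstash₂-step [] e = e
unstash₂-step (b ∷ w) {n = n} e =
  costing (cost-unstash (length w) n) (unstash₂-step w (bit₂ b e))
  where
  bit₂ : ∀ b {r x y k n τ} → Exec unstash₂ ((b ∷ r) ∷ x ∷ y ∷ k ∷ []) n τ →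
    Exec unstash₂ (r ∷ x ∷ (true ∷ b ∷ y) ∷ k ∷ []) (5 + n) τ
  bit₂ false e = whileT refl (caseF refl push) e
  bit₂ true e = whileT refl (caseT refl push) e

length-enc : ∀ t → length (enc t) ≡ size t
length-enc leaf = refl
length-enc (node a b) = cong suc (length-++ (enc a) ∙ cong₂ _+_ (length-enc a) (length-enc b))

unstash-cost : ∀ t → 5 * length (enc t) + 2 ≤ 2 + 5 * size t
unstash-cost t = ≤-reflexive (+-comm _ 2 ∙ cong (λ l → 2 + 5 * l) (length-enc t))

unstash₁-run : ∀ t {r x y k} →
  Do unstash₁ (r ∷ stash (enc t) (false ∷ x) ∷ y ∷ k ∷ []) ((enc t ++ r) ∷ x ∷ y ∷ k ∷ []) (2 + 5 * size t)
unstash₁-run t = within (unstash-cost t) (exec (unstash₁-step (enc t) (whileF refl)))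

unstash₂-run : ∀ t {r x y k} →
  Do unstash₂ (r ∷ x ∷ stash (enc t) (false ∷ y) ∷ k ∷ []) ((enc t ++ r) ∷ x ∷ y ∷ k ∷ []) (2 + 5 * size t)
unstash₂-run t = within (unstash-cost t) (exec (unstash₂-step (enc t) (whileF refl)))

dropTree dupTree swapTrees : Cmd
dropTree = scan false false
dupTree = scan true true ⨾ unstash₁ ⨾ unstash₂
swapTrees = scan true false ⨾ scan false true ⨾ unstash₁ ⨾ unstash₂

drop-run : ∀ t {r x y k} →
  Do dropTree ((enc t ++ r) ∷ x ∷ y ∷ k ∷ []) (r ∷ x ∷ y ∷ k ∷ []) (6 + 10 * size t)
drop-run t = scan-run false false t

dup-run : ∀ t {r x y k} →
  Do dupTree ((enc t ++ r) ∷ x ∷ y ∷ k ∷ []) ((enc t ++ enc t ++ r) ∷ x ∷ y ∷ k ∷ []) (10 + 20 * size t)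
dup-run t = within (≤-reflexive (lemma (size t))) (scan-run true true t ⨾ᵈ unstash₁-run t ⨾ᵈ unstash₂-run t)
  where
  lemma : ∀ s → 6 + 10 * s + ((2 + 5 * s) + (2 + 5 * s)) ≡ 10 + 20 * s
  lemma = solve-∀

swap-run : ∀ a b {r x y k} →
  Do swapTrees ((enc a ++ enc b ++ r) ∷ x ∷ y ∷ k ∷ []) ((enc b ++ enc a ++ r) ∷ x ∷ y ∷ k ∷ [])
     (16 + 15 * (size a + size b))
swap-run a b = within (≤-reflexive (lemma (size a) (size b)))
  (scan-run true false a ⨾ᵈ scan-run false true b ⨾ᵈ unstash₁-run a ⨾ᵈ unstash₂-run b)
  where
  lemma : ∀ s t → 6 + 10 * s + (6 + 10 * t + ((2 + 5 * s) + (2 + 5 * t))) ≡ 16 + 15 * (s + t)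
  lemma = solve-∀

-- What lies below the argument and on the other stacks is arbitrary and restored, so codes can be
-- combined without saving anything. A single polynomial bounds both the time and the size of the
-- result; composition needs both.
record PT (f : Tree → Tree) : Set where
  field
    code : Cmd
    bound : Pol
    run : ∀ t {r x y k} →
      Do code ((enc t ++ r) ∷ x ∷ y ∷ k ∷ []) ((enc (f t) ++ r) ∷ x ∷ y ∷ k ∷ []) (⟦ bound ⟧ (size t))
    grow : ∀ t → size (f t) ≤ ⟦ bound ⟧ (size t)
open PT public

fore rear : Tree → Tree
fore leaf = leaf
fore (node a b) = a
rear leaf = leaf
rear (node a b) = b

ifNode : {A : Set} → Tree → A → A → A
ifNode (node _ _) x y = x
ifNode leaf x y = y

PT-ext : ∀ {f g} → (∀ t → f t ≡ g t) → PT f → PT g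
PT-ext eq p = record
  { code = code p
  ; bound = bound p
  ; run = λ t {r} {x} {y} {k} →
      subst (λ u → Do (code p) _ ((enc u ++ r) ∷ x ∷ y ∷ k ∷ []) _) (eq t) (run p t)
  ; grow = λ t → subst (λ u → size u ≤ ⟦ bound p ⟧ (size t)) (eq t) (grow p t) }

PT-id : PT (λ t → t)
PT-id = record { code = skip ; bound = X ⊞ con 1 ; run = λ t → within (m≤n+m 1 (size t)) (exec skip)
    ; grow = λ t → m≤m+n (size t) 1 }

PT-comp : ∀ {f g} → PT g → PT f → PT (λ t → g (f t))
PT-comp {f} {g} q p = record
  { code = code p ⨾ code q
  ; bound = bound p ⊞ bound q ⊚ bound p
  ; run = λ t → within (+-monoʳ-≤ _ (le t)) (run p t ⨾ᵈ run q (f t))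
  ; grow = λ t → grow q (f t) » le t » m≤n+m _ (⟦ bound p ⟧ (size t)) }
  where
  le : ∀ t → ⟦ bound q ⟧ (size (f t)) ≤ ⟦ bound q ⊚ bound p ⟧ (size t)
  le t rewrite ⟦⊚⟧ (bound q) (bound p) (size t) = ⟦⟧-mono (bound q) (grow p t)

PT-leaf : PT (λ _ → leaf)
PT-leaf = record
  { code = dropTree ⨾ push s0 false
  ; bound = con 7 ⊞ con 10 ⊠ X
  ; run = λ t → within (≤-reflexive (+-comm (6 + 10 * size t) 1)) (drop-run t ⨾ᵈ exec push)
  ; grow = λ t → s≤s z≤n }

module _ {f g : Tree → Tree} (p : PT f) (q : PT g) where
  pair-run : ∀ t {r x y k} → Do
    (dupTree ⨾ code p ⨾ swapTrees ⨾ code q ⨾ swapTrees ⨾ push s0 true)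
    ((enc t ++ r) ∷ x ∷ y ∷ k ∷ []) ((true ∷ enc (f t) ++ enc (g t) ++ r) ∷ x ∷ y ∷ k ∷ [])
    (10 + 20 * size t + (⟦ bound p ⟧ (size t) + (16 + 15 * (size (f t) + size t) +
      (⟦ bound q ⟧ (size t) + (16 + 15 * (size (g t) + size (f t)) + 1)))))
  pair-run t = dup-run t ⨾ᵈ run p t ⨾ᵈ swap-run (f t) t ⨾ᵈ run q t ⨾ᵈ swap-run (g t) (f t) ⨾ᵈ exec push

  PT-node : PT (λ t → node (f t) (g t))
  PT-node = record
    { code = dupTree ⨾ code p ⨾ swapTrees ⨾ code q ⨾ swapTrees ⨾ push s0 true
    ; bound = con 10 ⊞ con 20 ⊠ X ⊞ (bound p ⊞ (con 16 ⊞ con 15 ⊠ (bound p ⊞ X) ⊞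
        (bound q ⊞ (con 16 ⊞ con 15 ⊠ (bound q ⊞ bound p) ⊞ con 1))))
    ; run = λ t {r} {x} {y} {k} →
        subst (λ w → Do _ _ ((true ∷ w) ∷ x ∷ y ∷ k ∷ []) _) (sym (++-assoc (enc (f t)) (enc (g t)) r))
        (within (+-monoʳ-≤ (10 + 20 * size t) (+-monoʳ-≤ (⟦ bound p ⟧ (size t))
          (+-mono-≤ (+-monoʳ-≤ 16 (*-monoʳ-≤ 15 (+-monoˡ-≤ (size t) (grow p t))))
            (+-monoʳ-≤ (⟦ bound q ⟧ (size t)) (+-monoˡ-≤ 1 (+-monoʳ-≤ 16
              (*-monoʳ-≤ 15 (+-mono-≤ (grow q t) (grow p t))))))))) (pair-run t))
    ; grow = λ t → s≤s (+-mono-≤ (grow p t) (grow q t)) »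
        slack (lemma (size t) (⟦ bound p ⟧ (size t)) (⟦ bound q ⟧ (size t))) }
    where
    lemma : ∀ s a b → suc (a + b) + (42 + 35 * s + 30 * a + 15 * b)
        ≡ 10 + 20 * s + (a + (16 + 15 * (a + s) + (b + (16 + 15 * (b + a) + 1))))
    lemma = solve-∀

PT-left : PT fore
PT-left = record
  { code = case s0 skip (push s0 false) (swapTrees ⨾ dropTree)
  ; bound = con 25 ⊠ X ⊞ con 25
  ; run = λ { leaf → within (m≤m+n 3 47) (exec (caseF refl push))
      ; (node a b) {r} {x} {y} {k} →
          let m , le , e = swap-run a b ⨾ᵈ drop-run b in
          2 + m , +-monoʳ-≤ 2 le » slack (lemma (size a) (size b)) ,
          input (cong (true ∷_) (sym (++-assoc (enc a) (enc b) r)))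
              (caseT refl e) }
  ; grow = λ { leaf → s≤s z≤n ; (node a b) → slack (lemma' (size a) (size b)) } }
  where
  lemma : ∀ a b → 2 + (16 + 15 * (a + b) + (6 + 10 * b)) + (26 + 10 * a) ≡ 25 * suc (a + b) + 25
  lemma = solve-∀
  lemma' : ∀ a b → a + (24 * a + 25 * b + 50) ≡ 25 * suc (a + b) + 25
  lemma' = solve-∀

PT-right : PT rear
PT-right = record
  { code = case s0 skip (push s0 false) dropTree
  ; bound = con 10 ⊠ X ⊞ con 10
  ; run = λ { leaf → within (m≤m+n 3 17) (exec (caseF refl push))
      ; (node a b) {r} {x} {y} {k} →
          let m , le , e = drop-run a in
          2 + m , +-monoʳ-≤ 2 le » slack (lemma (size a) (size b)) ,
          input (cong (true ∷_) (sym (++-assoc (enc a) (enc b) r)))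
              (caseT refl e) }
  ; grow = λ { leaf → s≤s z≤n ; (node a b) → slack (lemma' (size a) (size b)) } }
  where
  lemma : ∀ a b → 2 + (6 + 10 * a) + (10 * b + 12) ≡ 10 * suc (a + b) + 10
  lemma = solve-∀
  lemma' : ∀ a b → b + (10 * a + 9 * b + 20) ≡ 10 * suc (a + b) + 10
  lemma' = solve-∀

module _ {f g h : Tree → Tree} (p : PT f) (q : PT g) (r : PT h) where
  -- The test has popped the bit of the root: a leaf is then gone, while a node leaves two subtrees
  -- to be dropped.
  after-test : ∀ t u {w x y k} → u ≡ f t →
    Do (case s0 skip (code r) (dropTree ⨾ dropTree ⨾ code q)) ((enc u ++ enc t ++ w) ∷ x ∷ y ∷ k ∷ [])
       ((enc (ifNode u (g t) (h t)) ++ w) ∷ x ∷ y ∷ k ∷ [])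
       (2 + (12 + 20 * size u + (⟦ bound q ⟧ (size t) + ⟦ bound r ⟧ (size t))))
  after-test t leaf _ =
    let m , le , e = run r t in
    2 + m , +-monoʳ-≤ 2 (le » m≤n+m _ (⟦ bound q ⟧ (size t)) » m≤n+m _ 32) , caseF refl e
  after-test t (node a b) {w} {x} {y} {k} _ =
    let m , le , e = drop-run a ⨾ᵈ drop-run b ⨾ᵈ run q t in
    2 + m , +-monoʳ-≤ 2 (le » slack (lemma (size a) (size b) _ (⟦ bound r ⟧ (size t)))) ,
    input (cong (true ∷_) (sym (++-assoc (enc a) (enc b) (enc t ++ w))))
      (caseT refl e)
    where
    lemma : ∀ a b G H → 6 + 10 * a + (6 + 10 * b + G) + (20 + 10 * a + 10 * b + H) ≡ 12 + 20 * suc (a + b) + (G + H)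
    lemma = solve-∀

  PT-if : PT (λ t → ifNode (f t) (g t) (h t))
  PT-if = record
    { code = dupTree ⨾ code p ⨾ case s0 skip (code r) (dropTree ⨾ dropTree ⨾ code q)
    ; bound = con 10 ⊞ con 20 ⊠ X ⊞ (bound p ⊞ (con 2 ⊞ (con 12 ⊞ con 20 ⊠ bound p ⊞ (bound q ⊞ bound r))))
    ; run = λ t → within
        (+-monoʳ-≤ (10 + 20 * size t) (+-monoʳ-≤ (⟦ bound p ⟧ (size t)) (+-monoʳ-≤ 2
          (+-monoˡ-≤ (⟦ bound q ⟧ (size t) + ⟦ bound r ⟧ (size t)) (+-monoʳ-≤ 12 (*-monoʳ-≤ 20 (grow p t)))))))
        (dup-run t ⨾ᵈ run p t ⨾ᵈ after-test t (f t) refl)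
    ; grow = λ t → small t (f t) » m≤n+m _ (12 + 20 * ⟦ bound p ⟧ (size t)) »
        m≤n+m _ 2 » m≤n+m _ (⟦ bound p ⟧ (size t)) » m≤n+m _ (10 + 20 * size t) }
    where
    small : ∀ t u → size (ifNode u (g t) (h t)) ≤ ⟦ bound q ⟧ (size t) + ⟦ bound r ⟧ (size t)
    small t leaf = grow r t » m≤n+m _ _
    small t (node _ _) = grow q t » m≤m+n _ _

foldTree : (Tree → Tree) → Tree → Tree → Tree
foldTree f leaf acc = acc
foldTree f (node x xs) acc = foldTree f xs (f (node x acc))

Bounded : (Tree → Tree) → Tree → Tree → ℕ → Set
Bounded f leaf acc n = size acc ≤ n
Bounded f (node x xs) acc n = size acc ≤ n × Bounded f xs (f (node x acc)) n

Bounded-last : ∀ f xs acc {n} → Bounded f xs acc n → size (foldTree f xs acc) ≤ n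
Bounded-last f leaf acc b = b
Bounded-last f (node x xs) acc (_ , b) = Bounded-last f xs _ b

module _ {f : Tree → Tree} (p : PT f) (B : Pol)
  (bd : ∀ t → Bounded f (fore t) (rear t) (⟦ B ⟧ (size t))) where
  -- The code of the list drives the loop: `while` pops the bit of its root, and stops by consuming
  -- the final leaf, which uncovers the accumulator. In the body the remaining list waits on stack
  -- 1, and a pushed `true` joins the element and the accumulator, by then adjacent, to a node.
  body : Cmd
  body = swapTrees ⨾ scan true false ⨾ push s0 true ⨾ code p ⨾ unstash₁

  K : ℕ → ℕ → ℕ
  K S M = 2 + (29 + 45 * S + ⟦ bound p ⟧ (suc (S + M)))

  body-run : ∀ x xs acc S M {r a b k} → size x + size xs ≤ S → size acc ≤ M →
    Do body ((enc x ++ enc xs ++ enc acc ++ r) ∷ a ∷ b ∷ k ∷ [])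
        ((enc xs ++ enc (f (node x acc)) ++ r) ∷ a ∷ b ∷ k ∷ [])
        (29 + 45 * S + ⟦ bound p ⟧ (suc (S + M)))
  body-run x xs acc S M {r} le le' =
    within (+-monoʳ-≤ (16 + 15 * (size x + size xs)) (+-monoʳ-≤ (6 + 10 * size xs)
        (+-monoʳ-≤ 1 (+-monoˡ-≤ (2 + 5 * size xs) (⟦⟧-mono (bound p) {n = suc (S + M)}
            (s≤s (+-mono-≤ (m≤m+n _ _ » le) le')))))) »
            ≤-reflexive (regroup (size x) (size xs) (⟦ bound p ⟧ (suc (S + M)))) »
              +-monoˡ-≤ _ ((+-monoˡ-≤ _ (+-monoʳ-≤ 25 (*-monoʳ-≤ 15 le)) »
                 +-monoʳ-≤ (25 + 15 * S) (*-monoʳ-≤ 15 (m≤n+m _ (size x) » le))) »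
                 slack (final S)))
    (swap-run x xs ⨾ᵈ scan-run true false xs ⨾ᵈ exec push ⨾ᵈ
     (_ , fst (snd (run p (node x acc))) ,
      input (cong (true ∷_) (++-assoc (enc x) (enc acc) r)) (snd (snd (run p (node x acc))))) ⨾ᵈ
     unstash₁-run xs)
    where
    regroup : ∀ x xs b → 16 + 15 * (x + xs) + (6 + 10 * xs + (1 + (b + (2 + 5 * xs))))
      ≡ 25 + 15 * (x + xs) + 15 * xs + b
    regroup = solve-∀
    final : ∀ S → 25 + 15 * S + 15 * S + (4 + 15 * S) ≡ 29 + 45 * S
    final = solve-∀

  loop-run : ∀ xs acc S M {r a b k} → size xs ≤ S → Bounded f xs acc M →
    Do (while s0 body) ((enc xs ++ enc acc ++ r) ∷ a ∷ b ∷ k ∷ [])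
       ((enc (foldTree f xs acc) ++ r) ∷ a ∷ b ∷ k ∷ []) (2 + size xs * K S M)
  loop-run leaf acc S M le bd = within (m≤m+n 2 _) (exec (whileF refl))
  loop-run (node x xs) acc S M {r} {a} {b} {k} le (le' , bd') =
    let m , ml , e = body-run x xs acc S M (n≤1+n _ » le) le'
        n , nl , e' = loop-run xs (f (node x acc)) S M (m≤n+m _ (suc (size x)) » le) bd'
    in 2 + m + n , +-mono-≤ (+-monoʳ-≤ 2 ml) nl » slack (lemma (size x) (size xs) (K S M)) ,
       input (cong (true ∷_) (sym (++-assoc (enc x) (enc xs) _))) (whileT refl e e')
    where
    lemma : ∀ x xs K → K + (2 + xs * K) + x * K ≡ 2 + suc (x + xs) * K
    lemma = solve-∀

  PT-fold : PT (λ t → foldTree f (fore t) (rear t))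
  PT-fold = record
    { code = case s0 skip (push s0 false) (while s0 body)
    ; bound = con 4 ⊞ X ⊠ (con 2 ⊞ (con 29 ⊞ con 45 ⊠ X ⊞ bound p ⊚ (con 1 ⊞ (X ⊞ B)))) ⊞ B
    ; run = run'
    ; grow = λ t → Bounded-last f (fore t) (rear t) (bd t) » m≤n+m _ _ }
    where
    total : ∀ t → 4 + size t * K (size t) (⟦ B ⟧ (size t))
      ≤ ⟦ con 4 ⊞ X ⊠ (con 2 ⊞ (con 29 ⊞ con 45 ⊠ X ⊞ bound p ⊚ (con 1 ⊞ (X ⊞ B)))) ⊞ B ⟧ (size t)
    total t rewrite ⟦⊚⟧ (bound p) (con 1 ⊞ (X ⊞ B)) (size t) = m≤m+n _ _
    run' : ∀ t {r x y k} → Do (case s0 skip (push s0 false) (while s0 body)) ((enc t ++ r) ∷ x ∷ y ∷ k ∷ [])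
      ((enc (foldTree f (fore t) (rear t)) ++ r) ∷ x ∷ y ∷ k ∷ []) _
    run' leaf = within (m≤m+n 3 _ » total leaf) (exec (caseF refl push))
    run' (node a b) {r} {x} {y} {k} =
      let m , le , e = loop-run a b (size (node a b)) _ (m≤m+n _ _ » n≤1+n _) (bd (node a b)) in
      2 + m , +-monoʳ-≤ 2 le » +-monoʳ-≤ 4 (*-monoˡ-≤ (K (size (node a b)) (⟦ B ⟧ (size (node a b)))) {x = size a} {y = size (node a b)} (m≤m+n _ _ » n≤1+n _)) » total (node a b) ,
      input (cong (true ∷_) (sym (++-assoc (enc a) (enc b) r))) (caseT refl e)

-- Words as trees, and machines for functions and decisions on words

bitTree : Bool → Tree
bitTree false = leaf
bitTree true = node leaf leaf

wordTree : Word → Tree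
wordTree [] = leaf
wordTree (b ∷ w) = node (bitTree b) (wordTree w)

isNode : Tree → Bool
isNode leaf = false
isNode (node _ _) = true

treeWord : Tree → Word
treeWord leaf = []
treeWord (node b t) = isNode b ∷ treeWord t

-- The input has no terminator. `load` reads until `case` finds stack 0 empty and does not renew the
-- `true` on stack 3. This reverses the word, and the list is then built from its last bit onwards.
loadLoop listLoop load unloadLoop unload : Cmd
loadLoop = while s3 (case s0 skip (push s1 false ⨾ push s1 true ⨾ push s3 true)
    (push s1 true ⨾ push s1 true ⨾ push s3 true))
listLoop = while s1 (case s1 skip (push s0 false ⨾ push s0 true)
    (push s0 false ⨾ push s0 false ⨾ push s0 true ⨾ push s0 true))
load = push s1 false ⨾ push s3 true ⨾ loadLoop ⨾ push s0 false ⨾ listLoop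
unloadLoop = while s0 (case s0 skip (push s1 false ⨾ push s1 true)
    (dropTree ⨾ dropTree ⨾ push s1 true ⨾ push s1 true))
unload = push s1 false ⨾ unloadLoop ⨾ unstash₁

load-run : ∀ w {x y} →
  Do loadLoop (w ∷ x ∷ y ∷ (true ∷ []) ∷ []) ([] ∷ stash w x ∷ y ∷ [] ∷ []) (7 + 7 * length w)
load-run [] = exec (whileT refl (caseE refl skip) (whileE refl))
load-run (b ∷ w) =
  let m , le , e = load-run w in _ , +-monoʳ-≤ 7 le » ≤-reflexive (lemma (length w)) , onebit b e
  where
  lemma : ∀ l → 7 + (7 + 7 * l) ≡ 7 + 7 * suc l
  lemma = solve-∀
  onebit : ∀ b {w x y k n τ} → Exec loadLoop (w ∷ (true ∷ b ∷ x) ∷ y ∷ (true ∷ k) ∷ []) n τ →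
    Exec loadLoop ((b ∷ w) ∷ x ∷ y ∷ (true ∷ k) ∷ []) (7 + n) τ
  onebit false e = whileT refl (caseF refl (push ⨾ push ⨾ push)) e
  onebit true e = whileT refl (caseT refl (push ⨾ push ⨾ push)) e

prepend : Word → Tree → Tree
prepend [] t = t
prepend (b ∷ w) t = node (bitTree b) (prepend w t)

list-run : ∀ w {t x y k n τ} → Exec listLoop (enc (prepend w t) ∷ x ∷ y ∷ k ∷ []) n τ →
  Do listLoop (enc t ∷ stash w x ∷ y ∷ k ∷ []) τ (8 * length w + n)
list-run [] e = exec e
list-run (b ∷ w) {n = n} e =
  let m , le , e' = onebit b e
      m' , le' , e″ = list-run w e' in
  m' , le' » +-monoʳ-≤ (8 * length w) le » ≤-reflexive (lemma (length w) n) , e″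
  where
  lemma : ∀ l n → 8 * l + (8 + n) ≡ 8 * suc l + n
  lemma = solve-∀
  onebit : ∀ b {t x y k n τ} → Exec listLoop (enc (node (bitTree b) t) ∷ x ∷ y ∷ k ∷ []) n τ →
    Do listLoop (enc t ∷ (true ∷ b ∷ x) ∷ y ∷ k ∷ []) τ (8 + n)
  onebit false e = _ , +-monoˡ-≤ _ (m≤m+n 6 2) , whileT refl (caseF refl (push ⨾ push)) e
  onebit true e = _ , ≤-refl , whileT refl (caseT refl (push ⨾ push ⨾ push ⨾ push)) e

size-wordTree : ∀ w → size (wordTree w) ≤ 1 + 4 * length w
size-wordTree [] = ≤-refl
size-wordTree (b ∷ w) = s≤s (+-mono-≤ (size-bit b) (size-wordTree w)) » ≤-reflexive (lemma (length w))
  where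
  size-bit : ∀ b → size (bitTree b) ≤ 3
  size-bit false = s≤s z≤n
  size-bit true = ≤-refl
  lemma : ∀ l → 1 + (3 + (1 + 4 * l)) ≡ 1 + 4 * suc l
  lemma = solve-∀

loaded : ∀ w → Do load (w ∷ [] ∷ [] ∷ [] ∷ []) (enc (wordTree w) ∷ [] ∷ [] ∷ [] ∷ []) (12 + 15 * length w)
loaded w = within (≤-reflexive (lemma (length w)))
  (exec push ⨾ᵈ exec push ⨾ᵈ load-run w ⨾ᵈ exec push ⨾ᵈ
    subst (λ t → Do listLoop ((false ∷ []) ∷ stash w (false ∷ []) ∷ [] ∷ [] ∷ [])
        (enc t ∷ [] ∷ [] ∷ [] ∷ []) (8 * length w + 2)) (same w) (list-run w (whileF refl)))
  where
  lemma : ∀ l → 1 + (1 + (7 + 7 * l + (1 + (8 * l + 2)))) ≡ 12 + 15 * l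
  lemma = solve-∀
  same : ∀ w → prepend w leaf ≡ wordTree w
  same [] = refl
  same (b ∷ w) = cong (node (bitTree b)) (same w)

unload-run : ∀ t {x y k} →
  Do unloadLoop (enc t ∷ x ∷ y ∷ k ∷ []) ([] ∷ stash (treeWord t) x ∷ y ∷ k ∷ []) (2 + 18 * size t)
unload-run leaf = within (m≤m+n 2 _) (exec (whileF refl))
unload-run (node leaf t) =
  let m , le , e = unload-run t in
  6 + m , +-monoʳ-≤ 6 le » slack (lemma (size t)) ,
  whileT refl (caseF refl (push ⨾ push)) e
  where
  lemma : ∀ s → 6 + (2 + 18 * s) + 30 ≡ 2 + 18 * suc (1 + s)
  lemma = solve-∀
unload-run (node (node a b) t) {x} =
  let m , le , e = unload-run t {true ∷ true ∷ x}
      n , le' , e' = drop-run a ⨾ᵈ drop-run b ⨾ᵈ exec push ⨾ᵈ exec push in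
  2 + (2 + n) + m , +-mono-≤ (+-monoʳ-≤ 4 le') le »
     subst (4 + (6 + 10 * size a + (6 + 10 * size b + (1 + 1))) + (2 + 18 * size t) ≤_)
       (lemma (size a) (size b) (size t)) (m≤m+n _ _) ,
  whileT refl (caseT refl (reassoc e')) e
  where
  lemma : ∀ a b s → 4 + (6 + 10 * a + (6 + 10 * b + (1 + 1))) + (2 + 18 * s) + (18 + 8 * a + 8 * b)
      ≡ 2 + 18 * suc (suc (a + b) + s)
  lemma = solve-∀
  reassoc : ∀ {c r y k n τ} → Exec c ((enc a ++ enc b ++ r) ∷ x ∷ y ∷ k ∷ []) n τ →
    Exec c (((enc a ++ enc b) ++ r) ∷ x ∷ y ∷ k ∷ []) n τ
  reassoc {r = r} = input (sym (++-assoc (enc a) (enc b) r))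

loadBound : Pol
loadBound = con 1 ⊞ con 4 ⊠ X

module _ {g : Tree → Tree} (p : PT g) where

  wordFun : Word → Word
  wordFun w = treeWord (g (wordTree w))

  wordCmd : Cmd
  wordCmd = load ⨾ code p ⨾ unload

  outBound wordBound : Pol
  outBound = bound p ⊚ loadBound
  wordBound = con 3 ⊞ (con 12 ⊞ con 15 ⊠ X ⊞ (outBound ⊞ (con 1 ⊞ (con 2 ⊞ con 18 ⊠ outBound ⊞ (con 2 ⊞ con 5 ⊠ outBound)))))

  length-treeWord : ∀ t → length (treeWord t) ≤ size t
  length-treeWord leaf = z≤n
  length-treeWord (node b t) = s≤s (length-treeWord t » m≤n+m _ (size b))

  size-loaded : ∀ w → ⟦ bound p ⟧ (size (wordTree w)) ≤ ⟦ outBound ⟧ (length w)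
  size-loaded w rewrite ⟦⊚⟧ (bound p) loadBound (length w) = ⟦⟧-mono (bound p) (size-wordTree w)

  word-run : ∀ w → ∃[ n ] 3 + n ≤ ⟦ wordBound ⟧ (length w) ×
    Exec wordCmd (w ∷ [] ∷ [] ∷ [] ∷ []) n (wordFun w ∷ [] ∷ [] ∷ [] ∷ [])
  word-run w =
    let n , le , e = loaded w ⨾ᵈ p-run ⨾ᵈ exec push ⨾ᵈ unload-run (g (wordTree w)) ⨾ᵈ within (≤-reflexive (+-comm (5 * length (wordFun w)) 2)) (exec (unstash₁-step (wordFun w) (whileF refl))) in
    n , +-monoʳ-≤ 3 (le » +-monoʳ-≤ (12 + 15 * length w) (+-mono-≤ (size-loaded w) (+-monoʳ-≤ 1
      (+-mono-≤ (+-monoʳ-≤ 2 (*-monoʳ-≤ 18 out)) (+-monoʳ-≤ 2 (*-monoʳ-≤ 5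
        (length-treeWord (g (wordTree w)) » out))))))) ,
    subst (λ v → Exec wordCmd (w ∷ [] ∷ [] ∷ [] ∷ []) n (v ∷ [] ∷ [] ∷ [] ∷ [])) (++-identityʳ (wordFun w)) e
    where
    out : size (g (wordTree w)) ≤ ⟦ outBound ⟧ (length w)
    out = grow p (wordTree w) » size-loaded w
    p-run : Do (code p) (enc (wordTree w) ∷ [] ∷ [] ∷ [] ∷ []) (enc (g (wordTree w)) ∷ [] ∷ [] ∷ [] ∷ [])
      (⟦ bound p ⟧ (size (wordTree w)))
    p-run = subst₂ (λ u v → Do (code p) (u ∷ [] ∷ [] ∷ [] ∷ []) (v ∷ [] ∷ [] ∷ [] ∷ []) (⟦ bound p ⟧ (size (wordTree w))))
      (++-identityʳ _) (++-identityʳ _)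
      (run p (wordTree w) {[]} {[]} {[]} {[]})

  halts : ∀ w → ∃[ t ] ∃[ c ] HaltsAfter (machine wordCmd) t (initial (machine wordCmd) w) c
    × t ≤ eval (toPolynomial wordBound) (length w)
    × output (machine wordCmd) c ≡ wordFun w
    × Config.state c ≡ rank (St-finite wordCmd) (inl (result wordCmd (wordFun w)))
  halts w =
    let n , le , e = word-run w
        c , h , o , s = machine-run wordCmd e in
    3 + n , c , h , subst (3 + n ≤_) (sym (eval-toPolynomial wordBound (length w))) le , o , s

  wordFun-computable : PolynomialTimeComputable wordFun
  wordFun-computable = machine wordCmd , toPolynomial wordBound ,
    (λ w → let t , c , h , le , _ = halts w in t , c , h , le) ,
    (λ w → let t , c , h , _ , o , _ = halts w in t , c , h , o)

HaltsAfter-deterministic : ∀ M {m n a b c} → HaltsAfter M m a b → HaltsAfter M n a c → b ≡ c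
HaltsAfter-deterministic M (halted _) (halted _) = refl
HaltsAfter-deterministic M (halted e) (next e' _) with () ← trans (sym e) e'
HaltsAfter-deterministic M (next e _) (halted e') with () ← trans (sym e) e'
HaltsAfter-deterministic M (next e h) (next e' h')
  with refl ← just-injective (sym e ∙ e') = HaltsAfter-deterministic M h h'

-- As a list with one entry the verdict becomes the first bit of the output, the bit that the
-- machine tests.
asBool : (Tree → Bool) → Tree → Tree
asBool g t = node (bitTree (g t)) leaf

module _ {g : Tree → Bool} (p : PT (asBool g)) where

  cmd : Cmd
  cmd = wordCmd p

  decider : Machine
  decider = machine cmd

  decider-time : RunsInTime decider (toPolynomial (wordBound p))
  decider-time w = let t , c , h , le , _ = halts p w in t , c , h , le

  verdict : Bool → Bool
  verdict b = accepting cmd (inl (result cmd (isNode (bitTree b) ∷ [])))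

  accept-at : ∀ w {c : Config decider} →
    Config.state c ≡ rank (St-finite cmd) (inl (result cmd (wordFun p w))) →
    Machine.accept decider (Config.state c) ≡ verdict (g (wordTree w))
  accept-at w s = cong (Machine.accept decider) s ∙ accepts-result cmd (wordFun p w)

  only-true : ∀ b → verdict b ≡ true → b ≡ true
  only-true true _ = refl

  decider-accepts : ∀ w → Accepts decider w ⇔ (g (wordTree w) ≡ true)
  decider-accepts w = mk⇔ (to' (halts p w)) (from' (halts p w))
    where
    Halts : Set
    Halts = ∃[ t ] ∃[ c ] HaltsAfter decider t (initial decider w) c
      × t ≤ eval (toPolynomial (wordBound p)) (length w)
      × output decider c ≡ wordFun p w
      × Config.state c ≡ rank (St-finite cmd) (inl (result cmd (wordFun p w)))
    to' : Halts → Accepts decider w → g (wordTree w) ≡ true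
    to' (t , c , h , _ , _ , s) (t' , c' , h' , a) = only-true (g (wordTree w))
      (sym (accept-at w {c} s) ∙ cong (λ d → Machine.accept decider (Config.state d))
        (HaltsAfter-deterministic decider h h') ∙ a)
    from' : Halts → g (wordTree w) ≡ true → Accepts decider w
    from' (t , c , h , _ , _ , s) e = t , c , h , accept-at w {c} s ∙ cong verdict e

-- Typed polynomial-time functions

infixr 2 _⊗_

data U : Set where
  tree bool nat int axis : U
  fin : ℕ → U
  _⊗_ : U → U → U
  list : U → U

-- Bijective base 2, least significant digit first: `true` is the digit 1 and `false` the digit 2.
-- Every word is the numeral of exactly one number.
fromDigits : Word → ℕᵇ
fromDigits [] = ℕᵇ.zero
fromDigits (false ∷ ds) = 2[1+ fromDigits ds ]
fromDigits (true ∷ ds) = 1+[2 fromDigits ds ]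

toNat : Word → ℕ
toNat ds = ℕᵇ.toℕ (fromDigits ds)

toInt : Bool × Word → ℤ
toInt (false , ds) = + toNat ds
toInt (true , ds) = -[1+ toNat ds ]

El : U → Set
El tree = Tree
El bool = Bool
El nat = ℕ
El int = ℤ
El axis = Axis
El (fin n) = Fin (suc n)
El (A ⊗ B) = El A × El B
El (list A) = List (El A)

toAxis : Bool → Axis
toAxis false = horizontal
toAxis true = vertical

decFin : ∀ n → Tree → Fin (suc n)
decFin n leaf = zero
decFin zero (node _ _) = zero
decFin (suc n) (node _ t) = suc (decFin n t)

codeFin : ∀ n → Fin (suc n) → Tree
codeFin n zero = leaf
codeFin (suc n) (suc i) = node leaf (codeFin n i)

decFin-codeFin : ∀ n i → decFin n (codeFin n i) ≡ i
decFin-codeFin n zero = refl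
decFin-codeFin (suc n) (suc i) = cong suc (decFin-codeFin n i)

-- Every tree is a value of every type, usually in many ways.
dec : ∀ A → Tree → El A
dec tree t = t
dec bool t = isNode t
dec nat t = toNat (treeWord t)
dec int t = toInt (isNode (fore t) , treeWord (rear t))
dec axis t = toAxis (isNode t)
dec (fin n) t = decFin n t
dec (A ⊗ B) t = dec A (fore t) , dec B (rear t)
dec (list A) leaf = []
dec (list A) (node x t) = dec A x ∷ dec (list A) t

-- `raw` only has to respect decoding. A value may be represented by many trees, and no normal form
-- has to be maintained.
record PF {A B : U} (f : El A → El B) : Set where
  constructor pf
  field
    raw : Tree → Tree
    pt : PT raw
    sound : ∀ t → dec B (raw t) ≡ f (dec A t)
open PF public

extF : ∀ {A B} {f g : El A → El B} → (∀ x → f x ≡ g x) → PF {A} {B} f → PF {A} {B} g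
extF {A} eq p = pf (raw p) (pt p) (λ t → sound p t ∙ eq (dec A t))

idF : ∀ {A} → PF {A} {A} (λ x → x)
idF = pf (λ t → t) PT-id (λ _ → refl)

infixr 9 _∘F_
_∘F_ : ∀ {A B C} {f : El A → El B} {g : El B → El C} → PF {B} {C} g → PF {A} {B} f → PF {A} {C} (λ x → g (f x))
_∘F_ {g = g} q p = pf (λ t → raw q (raw p t)) (PT-comp (pt q) (pt p))
  (λ t → sound q (raw p t) ∙ cong g (sound p t))

infixr 4 _,F_
_,F_ : ∀ {Γ A B} {f : El Γ → El A} {g : El Γ → El B} → PF {Γ} {A} f → PF {Γ} {B} g → PF {Γ} {A ⊗ B} (λ x → f x , g x)
p ,F q = pf (λ t → node (raw p t) (raw q t)) (PT-node (pt p) (pt q)) (λ t → cong₂ _,_ (sound p t) (sound q t))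

fstF : ∀ {A B} → PF {A ⊗ B} {A} fst
fstF = pf fore PT-left (λ _ → refl)

sndF : ∀ {A B} → PF {A ⊗ B} {B} snd
sndF = pf rear PT-right (λ _ → refl)

PT-const : ∀ u → PT (λ _ → u)
PT-const leaf = PT-leaf
PT-const (node a b) = PT-node (PT-const a) (PT-const b)

digits : ℕᵇ → Word
digits ℕᵇ.zero = []
digits 2[1+ x ] = false ∷ digits x
digits 1+[2 x ] = true ∷ digits x

fromDigits-digits : ∀ x → fromDigits (digits x) ≡ x
fromDigits-digits ℕᵇ.zero = refl
fromDigits-digits 2[1+ x ] = cong 2[1+_] (fromDigits-digits x)
fromDigits-digits 1+[2 x ] = cong 1+[2_] (fromDigits-digits x)

digits-fromDigits : ∀ w → digits (fromDigits w) ≡ w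
digits-fromDigits [] = refl
digits-fromDigits (false ∷ w) = cong (false ∷_) (digits-fromDigits w)
digits-fromDigits (true ∷ w) = cong (true ∷_) (digits-fromDigits w)

natDigits : ℕ → Word
natDigits n = digits (ℕᵇ.fromℕ n)

intDigits : ℤ → Bool × Word
intDigits (+ n) = false , natDigits n
intDigits -[1+ n ] = true , natDigits n

toNat-natDigits : ∀ n → toNat (natDigits n) ≡ n
toNat-natDigits n = cong ℕᵇ.toℕ (fromDigits-digits (ℕᵇ.fromℕ n)) ∙ toℕ-fromℕ n

natDigits-toNat : ∀ w → natDigits (toNat w) ≡ w
natDigits-toNat w = cong digits (fromℕ-toℕ (fromDigits w)) ∙ digits-fromDigits w

toInt-intDigits : ∀ z → toInt (intDigits z) ≡ z
toInt-intDigits (+ n) = cong +_ (toNat-natDigits n)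
toInt-intDigits -[1+ n ] = cong -[1+_] (toNat-natDigits n)

intDigits-toInt : ∀ x → intDigits (toInt x) ≡ x
intDigits-toInt (false , w) = cong (false ,_) (natDigits-toNat w)
intDigits-toInt (true , w) = cong (true ,_) (natDigits-toNat w)

codeTree : ∀ A → El A → Tree
codeTree tree t = t
codeTree bool b = bitTree b
codeTree nat n = wordTree (natDigits n)
codeTree int z = node (bitTree (fst (intDigits z))) (wordTree (snd (intDigits z)))
codeTree axis horizontal = leaf
codeTree axis vertical = node leaf leaf
codeTree (fin n) i = codeFin n i
codeTree (A ⊗ B) (a , b) = node (codeTree A a) (codeTree B b)
codeTree (list A) [] = leaf
codeTree (list A) (x ∷ xs) = node (codeTree A x) (codeTree (list A) xs)

isNode-bitTree : ∀ b → isNode (bitTree b) ≡ b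
isNode-bitTree false = refl
isNode-bitTree true = refl

dec-bits : ∀ t → dec (list bool) t ≡ treeWord t
dec-bits leaf = refl
dec-bits (node b t) = cong (isNode b ∷_) (dec-bits t)

dec-wordTree : ∀ w → treeWord (wordTree w) ≡ w
dec-wordTree [] = refl
dec-wordTree (b ∷ w) = cong₂ _∷_ (isNode-bitTree b) (dec-wordTree w)

dec-code : ∀ A x → dec A (codeTree A x) ≡ x
dec-code tree x = refl
dec-code bool x = isNode-bitTree x
dec-code nat x = cong toNat (dec-wordTree (natDigits x)) ∙ toNat-natDigits x
dec-code int x = cong toInt (cong₂ _,_ (isNode-bitTree _) (dec-wordTree _)) ∙ toInt-intDigits x
dec-code axis horizontal = refl
dec-code axis vertical = refl
dec-code (fin n) i = decFin-codeFin n i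
dec-code (A ⊗ B) (x , y) = cong₂ _,_ (dec-code A x) (dec-code B y)
dec-code (list A) [] = refl
dec-code (list A) (x ∷ xs) = cong₂ _∷_ (dec-code A x) (dec-code (list A) xs)

constF : ∀ {Γ A} (a : El A) → PF {Γ} {A} (λ _ → a)
constF {A = A} a = pf (λ _ → codeTree A a) (PT-const _) (λ _ → dec-code A a)

nilF : ∀ {Γ A} → PF {Γ} {list A} (λ _ → [])
nilF = constF []

infixr 5 _∷F_
_∷F_ : ∀ {Γ A} {f : El Γ → El A} {g : El Γ → List (El A)} → PF {Γ} {A} f → PF {Γ} {list A} g → PF {Γ} {list A} (λ x → f x ∷ g x)
p ∷F q = pf (λ t → node (raw p t) (raw q t)) (PT-node (pt p) (pt q)) (λ t → cong₂ _∷_ (sound p t) (sound q t))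

ifF : ∀ {Γ A} {b : El Γ → Bool} {f g : El Γ → El A} → PF {Γ} {bool} b → PF {Γ} {A} f → PF {Γ} {A} g →
  PF {Γ} {A} (λ x → if b x then f x else g x)
ifF {Γ} {A} {b} {f} {g} p q r = pf (λ t → ifNode (raw p t) (raw q t) (raw r t)) (PT-if (pt p) (pt q) (pt r))
  (λ t → lemma t (raw p t) (sound p t))
  where
  lemma : ∀ t u → isNode u ≡ b (dec Γ t) →
    dec A (ifNode u (raw q t) (raw r t)) ≡ (if b (dec Γ t) then f (dec Γ t) else g (dec Γ t))
  lemma t leaf e rewrite sym e = sound r t
  lemma t (node _ _) e rewrite sym e = sound q t

caseList : {A B : Set} → List A → B → (A × List A → B) → B
caseList [] n c = n
caseList (x ∷ xs) n c = c (x , xs)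

-- A nonempty list and the pair of its head and tail are decoded from the same node, so nothing has
-- to be taken apart.
caseListF : ∀ {Γ A B} {xs : El Γ → List (El A)} {n : El Γ → El B} {c : El Γ × El A × List (El A) → El B} →
  PF {Γ} {list A} xs → PF {Γ} {B} n → PF {Γ ⊗ A ⊗ list A} {B} c →
  PF {Γ} {B} (λ γ → caseList (xs γ) (n γ) (λ y → c (γ , y)))
caseListF {Γ} {A} {B} {xs} {n} {c} p q r = pf
  (λ t → ifNode (raw p t) (raw r (node t (raw p t))) (raw q t))
  (PT-if (pt p) (PT-comp (pt r) (PT-node PT-id (pt p))) (pt q))
  (λ t → lemma t (raw p t) (sound p t))
  where
  lemma : ∀ t u → dec (list A) u ≡ xs (dec Γ t) →
    dec B (ifNode u (raw r (node t u)) (raw q t)) ≡ caseList (xs (dec Γ t)) (n (dec Γ t)) (λ y → c (dec Γ t , y))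
  lemma t leaf e rewrite sym e = sound q t
  lemma t (node x y) e rewrite sym e = sound r (node t (node x y))

notF : PF {bool} {bool} not
notF = extF (λ { false → refl ; true → refl }) (ifF idF (constF false) (constF true))

andF : ∀ {Γ} {b c : El Γ → Bool} → PF {Γ} {bool} b → PF {Γ} {bool} c → PF {Γ} {bool} (λ x → b x ∧ c x)
andF {Γ} {b} {c} p q = extF (λ x → lemma (b x) (c x)) (ifF p q (constF false))
  where
  lemma : ∀ b c → (if b then c else false) ≡ b ∧ c
  lemma false c = refl
  lemma true c = refl

caseAxisF : ∀ {Γ B} {a : El Γ → Axis} {h : Axis → El Γ → El B} →
  PF {Γ} {axis} a → PF {Γ} {B} (h horizontal) → PF {Γ} {B} (h vertical) → PF {Γ} {B} (λ γ → h (a γ) γ)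
caseAxisF {Γ} {B} {a} {h} p q r = pf (λ t → ifNode (raw p t) (raw r t) (raw q t)) (PT-if (pt p) (pt r) (pt q))
  (λ t → lemma t (raw p t) (sound p t))
  where
  lemma : ∀ t u → toAxis (isNode u) ≡ a (dec Γ t) → dec B (ifNode u (raw r t) (raw q t)) ≡ h (a (dec Γ t)) (dec Γ t)
  lemma t leaf e rewrite sym e = sound q t
  lemma t (node _ _) e rewrite sym e = sound r t

caseFinF : ∀ {Γ B} n {h : Fin (suc n) → El Γ → El B} → (∀ i → PF {Γ} {B} (h i)) →
  PF {fin n ⊗ Γ} {B} (λ y → h (fst y) (snd y))
caseFinF {Γ} {B} zero {h} p = pf (raw (p zero) ∘ rear) (PT-comp (pt (p zero)) PT-right)
  (λ t → sound (p zero) (rear t) ∙ cong (λ i → h i (dec Γ (rear t))) (sym (only (fore t))))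
  where
  only : ∀ t → decFin zero t ≡ zero
  only leaf = refl
  only (node _ _) = refl
caseFinF {Γ} {B} (suc n) {h} p = pf
  (λ t → ifNode (fore t) (raw rest (node (rear (fore t)) (rear t))) (raw (p zero) (rear t)))
  (PT-if PT-left (PT-comp (pt rest) (PT-node (PT-comp PT-right PT-left) PT-right)) (PT-comp (pt (p zero)) PT-right))
  (λ t → lemma (fore t) (rear t))
  where
  rest : PF {fin n ⊗ Γ} {B} (λ y → h (suc (fst y)) (snd y))
  rest = caseFinF n (p ∘ suc)
  lemma : ∀ i t → dec B (ifNode i (raw rest (node (rear i) t)) (raw (p zero) t)) ≡ h (decFin (suc n) i) (dec Γ t)
  lemma leaf t = sound (p zero) t
  lemma (node _ i) t = sound rest (node i t)

-- A fold whose accumulator grows by an amount that depends only on the element and on a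
-- measure of the accumulator that itself grows by at most a constant.
record Growing (f : Tree → Tree) : Set where
  constructor growing
  field
    measure : Tree → ℕ
    rate : ℕ
    growth : Pol
    measure≤ : ∀ a → measure a ≤ size a
    measureStep : ∀ x a → measure (f (node x a)) ≤ measure a + rate
    sizeStep : ∀ x a → size (f (node x a)) ≤ size a + ⟦ growth ⟧ (size x + measure a)
open Growing public

Bounded-mono : ∀ f xs acc {m n} → m ≤ n → Bounded f xs acc m → Bounded f xs acc n
Bounded-mono f leaf acc le b = b » le
Bounded-mono f (node _ _) acc le (b , bs) = b » le , Bounded-mono f _ _ le bs

left≤ : ∀ t → size (fore t) ≤ size t
left≤ leaf = ≤-refl
left≤ (node a b) = m≤m+n _ _ » n≤1+n _

right≤ : ∀ t → size (rear t) ≤ size t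
right≤ leaf = ≤-refl
right≤ (node a b) = m≤n+m _ _ » n≤1+n _

-- Over a list of size s the measure rises from e to at most e + rate * s. Hence each step adds at
-- most `grown s e`, and there are at most s steps.
PT-fold-growing : ∀ {f} → PT f → Growing f → PT (λ t → foldTree f (fore t) (rear t))
PT-fold-growing {f} p G = PT-fold p (X ⊞ X ⊠ growth G ⊚ (X ⊞ (X ⊞ con (rate G) ⊠ X))) (λ t →
  Bounded-mono f _ _ (le t) (bounded (fore t) (rear t)))
  where
  grown : ℕ → ℕ → ℕ
  grown s e = ⟦ growth G ⟧ (s + (e + rate G * s))
  grown-mono : ∀ {s s' e e'} → s ≤ s' → e ≤ e' → grown s e ≤ grown s' e'
  grown-mono le le' = ⟦⟧-mono (growth G) (+-mono-≤ le (+-mono-≤ le' (*-monoʳ-≤ (rate G) le)))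
  bounded : ∀ xs acc → Bounded f xs acc (size acc + size xs * grown (size xs) (measure G acc))
  bounded leaf acc = m≤m+n _ _
  bounded (node x xs) acc = m≤m+n _ _ ,
    Bounded-mono f xs _ (+-mono-≤ (sizeStep G x acc) (*-monoʳ-≤ (size xs) inner) »
      ≤-reflexive (+-assoc (size acc) _ _) » +-monoʳ-≤ (size acc) total) (bounded xs _)
    where
    S = suc (size x + size xs)
    e = measure G acc
    inner : grown (size xs) (measure G (f (node x acc))) ≤ grown S e
    inner = ⟦⟧-mono (growth G) (+-monoʳ-≤ (size xs) (+-monoˡ-≤ (rate G * size xs) (measureStep G x acc)) »
      slack (eq₂ (size x) (size xs) e (rate G)))
      where
      eq₂ : ∀ x xs e c → xs + (e + c + c * xs) + (1 + x + c * x) ≡ suc (x + xs) + (e + c * suc (x + xs))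
      eq₂ = solve-∀
    outer : ⟦ growth G ⟧ (size x + e) ≤ grown S e
    outer = ⟦⟧-mono (growth G) (+-mono-≤ (m≤m+n _ (size xs) » n≤1+n _) (m≤m+n e _))
    total : ⟦ growth G ⟧ (size x + e) + size xs * grown S e ≤ S * grown S e
    total = +-mono-≤ outer (*-monoˡ-≤ (grown S e) (m≤n+m (size xs) (size x)))
  le : ∀ t → size (rear t) + size (fore t) * grown (size (fore t)) (measure G (rear t))
    ≤ ⟦ X ⊞ X ⊠ growth G ⊚ (X ⊞ (X ⊞ con (rate G) ⊠ X)) ⟧ (size t)
  le t rewrite ⟦⊚⟧ (growth G) (X ⊞ (X ⊞ con (rate G) ⊠ X)) (size t) =
    +-mono-≤ (right≤ t) (*-mono-≤ (left≤ t) (grown-mono (left≤ t) (measure≤ G _ » right≤ t)))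

foldlF : ∀ {A S} {step : El A × El S → El S} (p : PF {A ⊗ S} {S} step) → Growing (raw p) →
  PF {list A ⊗ S} {S} (λ y → foldl (λ s x → step (x , s)) (snd y) (fst y))
foldlF {A} {S} {step} p G = pf (λ t → foldTree (raw p) (fore t) (rear t)) (PT-fold-growing (pt p) G)
  (λ t → lemma (fore t) (rear t))
  where
  lemma : ∀ xs acc → dec S (foldTree (raw p) xs acc) ≡ foldl (λ s x → step (x , s)) (dec S acc) (dec (list A) xs)
  lemma leaf acc = refl
  lemma (node x xs) acc = lemma xs (raw p (node x acc)) ∙
    cong (λ s → foldl (λ s x → step (x , s)) s (dec (list A) xs)) (sound p (node x acc))

left-right : ∀ t → size (fore t) + size (rear t) ≤ suc (size t)
left-right leaf = ≤-refl
left-right (node a b) = n≤1+n _ » n≤1+n _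

additive : ∀ {f} (G : Pol) → (∀ x a → size (f (node x a)) ≤ size a + ⟦ G ⟧ (size x)) → Growing f
additive {f} G h = growing (λ _ → 0) 0 G (λ _ → z≤n) (λ _ _ → z≤n)
  (λ x a → subst (λ s → size (f (node x a)) ≤ size a + ⟦ G ⟧ s) (sym (+-identityʳ (size x))) (h x a))

revOntoF : ∀ {A} → PF {list A ⊗ list A} {list A} (λ y → fst y ʳ++ snd y)
revOntoF {A} = foldlF {A} {list A} (fstF {A} {list A} ∷F sndF) (additive (X ⊞ con 1) (λ x a → ≤-reflexive (lemma (size x) (size a))))
  where
  lemma : ∀ x a → suc (x + a) ≡ a + (x + 1)
  lemma = solve-∀

reverseF : ∀ {A} → PF {list A} {list A} reverse
reverseF = revOntoF ∘F (idF ,F nilF)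

appendF : ∀ {Γ A} {f g : El Γ → List (El A)} → PF {Γ} {list A} f → PF {Γ} {list A} g → PF {Γ} {list A} (λ x → f x ++ g x)
appendF {f = f} {g} p q = extF (λ x → ʳ++-defn (reverse (f x)) ∙ cong (_++ g x) (reverse-involutive (f x)))
  (revOntoF ∘F ((reverseF ∘F p) ,F q))

infixr 5 _++ʷ_
_++ʷ_ : ∀ {Γ} {f g : El Γ → Word} → PF {Γ} {list bool} f → PF {Γ} {list bool} g → PF {Γ} {list bool} (λ x → f x ++ g x)
_++ʷ_ = appendF {A = bool}

WordF : (Word → Word) → Set
WordF = PF {list bool} {list bool}

size-revOnto : ∀ xs ys → size (foldTree (λ t → node (fore t) (rear t)) xs ys) ≤ size xs + size ys
size-revOnto leaf ys = n≤1+n _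
size-revOnto (node x xs) ys = size-revOnto xs (node x ys) » ≤-reflexive (lemma (size x) (size xs) (size ys))
  where
  lemma : ∀ x xs ys → xs + suc (x + ys) ≡ suc (x + xs) + ys
  lemma = solve-∀

-- A step of a fold sees only the element and the accumulator, so the environment travels inside the
-- accumulator. Its size is the measure, which stays constant. The output is collected in reverse.
concatMapF : ∀ {Γ A B} {xs : El Γ → List (El A)} {f : El Γ × El A → List (El B)} →
  PF {Γ} {list A} xs → PF {Γ ⊗ A} {list B} f → PF {Γ} {list B} (λ γ → concatMap (λ a → f (γ , a)) (xs γ))
concatMapF {Γ} {A} {B} {xs} {f} p q = extF lemma
  (reverseF ∘F sndF {Γ} {list B} ∘F foldlF {A} {Γ ⊗ list B} stepF gr ∘F (p ,F (idF ,F nilF)))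
  where
  stepFun : El A × (El Γ × List (El B)) → El Γ × List (El B)
  stepFun (a , γ , out) = γ , (f (γ , a) ʳ++ out)
  envF : PF {A ⊗ Γ ⊗ list B} {Γ} (λ y → fst (snd y))
  envF = fstF {Γ} {list B} ∘F sndF
  stepF : PF {A ⊗ Γ ⊗ list B} {Γ ⊗ list B} stepFun
  stepF = envF ,F revOntoF ∘F ((q ∘F (envF ,F fstF)) ,F (sndF {Γ} {list B} ∘F sndF))
  gr : Growing (raw stepF)
  gr = growing (λ a → size (fore a)) 0 (con 2 ⊞ bound (pt q) ⊚ (con 1 ⊞ X)) left≤
    (λ x a → m≤m+n _ 0)
    (λ x a → s≤s (+-monoʳ-≤ (size (fore a)) (size-revOnto (raw q (node (fore a) x)) (rear a) »
        +-monoˡ-≤ (size (rear a)) (grow (pt q) (node (fore a) x)))) »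
      subst₂ _≤_ (eq₁ (size (fore a)) (size (rear a)) _) (eq₂ a x)
        (+-monoˡ-≤ (1 + ⟦ bound (pt q) ⟧ (size (node (fore a) x))) (left-right a)))
    where
    eq₁ : ∀ l r b → l + r + (1 + b) ≡ suc (l + (b + r))
    eq₁ = solve-∀
    eq₃ : ∀ a b → suc a + (1 + b) ≡ a + (2 + b)
    eq₃ = solve-∀
    eq₂ : ∀ a x → suc (size a) + (1 + ⟦ bound (pt q) ⟧ (size (node (fore a) x)))
      ≡ size a + ⟦ con 2 ⊞ bound (pt q) ⊚ (con 1 ⊞ X) ⟧ (size x + size (fore a))
    eq₂ a x rewrite ⟦⊚⟧ (bound (pt q)) (con 1 ⊞ X) (size x + size (fore a)) | +-comm (size x) (size (fore a))
      = eq₃ (size a) _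
  loop : ∀ ys γ out → foldl (λ s x → stepFun (x , s)) (γ , out) ys ≡ (γ , concatMap (λ a → f (γ , a)) ys ʳ++ out)
  loop [] γ out = refl
  loop (y ∷ ys) γ out = loop ys γ _ ∙ cong (γ ,_) (sym (++-ʳ++ (f (γ , y))))
  lemma : ∀ γ → reverse (snd (foldl (λ s x → stepFun (x , s)) (γ , []) (xs γ))) ≡ concatMap (λ a → f (γ , a)) (xs γ)
  lemma γ = cong (reverse ∘ snd) (loop (xs γ) γ []) ∙ reverse-involutive _

mapF : ∀ {Γ A B} {xs : El Γ → List (El A)} {f : El Γ × El A → El B} →
  PF {Γ} {list A} xs → PF {Γ ⊗ A} {B} f → PF {Γ} {list B} (λ γ → map (λ a → f (γ , a)) (xs γ))
mapF {xs = xs} {f} p q = extF (λ γ → lemma γ (xs γ)) (concatMapF p (q ∷F nilF))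
  where
  lemma : ∀ γ ys → concatMap (λ a → f (γ , a) ∷ []) ys ≡ map (λ a → f (γ , a)) ys
  lemma γ [] = refl
  lemma γ (y ∷ ys) = cong (f (γ , y) ∷_) (lemma γ ys)

allB : {A : Set} → (A → Bool) → List A → Bool
allB p [] = true
allB p (x ∷ xs) = p x ∧ allB p xs

-- Every node counts as `true`, so a Boolean may come as a large tree; recoding it keeps
-- accumulators small.
boolify : ∀ {Γ} {b : El Γ → Bool} → PF {Γ} {bool} b → PF {Γ} {bool} b
boolify {b = b} p = extF (λ x → lemma (b x)) (ifF p (constF true) (constF false))
  where
  lemma : ∀ b → (if b then true else false) ≡ b
  lemma false = refl
  lemma true = refl

size-boolify : ∀ t → size (ifNode t (node leaf leaf) leaf) ≤ 3
size-boolify leaf = s≤s z≤n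
size-boolify (node _ _) = ≤-refl

scanB : {A : Set} → (A × List A → Bool) → List A → List A → Bool
scanB q seen [] = true
scanB q seen (x ∷ xs) = q (x , seen) ∧ scanB q (x ∷ seen) xs

scanF : ∀ {Γ A} {xs : El Γ → List (El A)} {q : El Γ × El A × List (El A) → Bool} →
  PF {Γ} {list A} xs → PF {Γ ⊗ A ⊗ list A} {bool} q → PF {Γ} {bool} (λ γ → scanB (λ y → q (γ , y)) [] (xs γ))
scanF {Γ} {A} {xs} {q} p r = extF lemma
  (sndF {list A} {bool} ∘F sndF {Γ} {list A ⊗ bool} ∘F foldlF {A} {Γ ⊗ list A ⊗ bool} stepF gr ∘F
    (p ,F (idF ,F (nilF {A = A} ,F constF {A = bool} true))))
  where
  S = Γ ⊗ list A ⊗ bool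
  stepFun : El A × El S → El S
  stepFun (a , γ , seen , b) = γ , a ∷ seen , b ∧ q (γ , a , seen)
  envF : PF {A ⊗ S} {Γ} (λ y → fst (snd y))
  envF = fstF {Γ} ∘F sndF
  seenF : PF {A ⊗ S} {list A} (λ y → fst (snd (snd y)))
  seenF = fstF {list A} ∘F sndF {Γ} ∘F sndF
  okF : PF {A ⊗ S} {bool} (λ y → snd (snd (snd y)))
  okF = sndF {list A} ∘F sndF {Γ} ∘F sndF
  stepF : PF {A ⊗ S} {S} stepFun
  stepF = envF ,F (fstF {A} {S} ∷F seenF) ,F boolify (andF okF (r ∘F (envF ,F fstF {A} {S} ,F seenF)))
  gr : Growing (raw stepF)
  gr = additive (X ⊞ con 8) (λ x a → let r₁ = rear a in
    s≤s (+-monoʳ-≤ (size (fore a)) (s≤s (+-monoʳ-≤ (suc (size x + size (fore r₁)))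
        (size-boolify (ifNode (rear r₁) (raw r (node (fore a) (node x (fore r₁)))) leaf))))) »
    +-monoʳ-≤ 1 (+-monoʳ-≤ (size (fore a)) (s≤s (+-monoˡ-≤ 3 (s≤s (+-monoʳ-≤ (size x)
        (left≤ r₁)))))) »
    subst₂ _≤_ (eq₁ (size (fore a)) (size r₁) (size x)) (eq₂ (size a) (size x))
      (+-monoˡ-≤ (size x + 6) (left-right a) » n≤1+n _))
    where
    eq₁ : ∀ l r x → l + r + (x + 6) ≡ 1 + (l + suc (suc (x + r) + 3))
    eq₁ = solve-∀
    eq₂ : ∀ a x → suc (suc a + (x + 6)) ≡ a + (x + 8)
    eq₂ = solve-∀
  loop : ∀ ys γ seen b → snd (snd (foldl (λ s x → stepFun (x , s)) (γ , seen , b) ys)) ≡ b ∧ scanB (λ y → q (γ , y)) seen ys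
  loop [] γ seen false = refl
  loop [] γ seen true = refl
  loop (y ∷ ys) γ seen false = loop ys γ (y ∷ seen) false
  loop (y ∷ ys) γ seen true = loop ys γ (y ∷ seen) (q (γ , y , seen))
  lemma : ∀ γ → snd (snd (foldl (λ s x → stepFun (x , s)) (γ , [] , true) (xs γ))) ≡ scanB (λ y → q (γ , y)) [] (xs γ)
  lemma γ = loop (xs γ) γ [] true

allF : ∀ {Γ A} {xs : El Γ → List (El A)} {q : El Γ × El A → Bool} →
  PF {Γ} {list A} xs → PF {Γ ⊗ A} {bool} q → PF {Γ} {bool} (λ γ → allB (λ a → q (γ , a)) (xs γ))
allF {Γ} {A} {xs} {q} p r = extF (λ γ → lemma γ [] (xs γ)) (scanF p (r ∘F (fstF ,F fstF {A} {list A} ∘F sndF)))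
  where
  lemma : ∀ γ seen ys → scanB (λ y → q (γ , fst y)) seen ys ≡ allB (λ a → q (γ , a)) ys
  lemma γ seen [] = refl
  lemma γ seen (y ∷ ys) = cong (q (γ , y) ∧_) (lemma γ (y ∷ seen) ys)

-- Counting with binary numerals

SD : U
SD = bool ⊗ list bool

-- Ripple: the carry is passed on by the digits satisfying pass, and flips the digits it reaches.

module Ripple (pass : Bool → Bool) (passF : PF {bool} {bool} pass) where

  stepFun : Bool × (Bool × Word) → Bool × Word
  stepFun (d , c , out) = (c ∧ pass d) , (c xor d) ∷ out

  rippleStep : PF {bool ⊗ SD} {SD} stepFun
  rippleStep = boolify (andF carry (passF ∘F fstF {bool} {SD})) ,F (extF lemma (boolify (ifF carry (notF ∘F fstF {bool} {SD}) (fstF {bool} {SD}))) ∷F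
      (sndF {bool} {list bool} ∘F sndF))
    where
    carry : PF {bool ⊗ SD} {bool} (λ y → fst (snd y))
    carry = fstF {bool} {list bool} ∘F sndF
    lemma : ∀ (y : Bool × Bool × Word) → (if fst (snd y) then not (fst y) else fst y) ≡ fst (snd y) xor fst y
    lemma (d , false , _) = refl
    lemma (d , true , _) = refl

  rippleF : PF {list bool} {SD} (λ ds → foldl (λ s d → stepFun (d , s)) (true , []) ds)
  rippleF = foldlF {bool} {SD} rippleStep gr ∘F (idF ,F constF {A = SD} (true , []))
    where
    gr : Growing (raw rippleStep)
    gr = additive (con 8) (λ x a → s≤s (+-mono-≤ (size-boolify _) (s≤s (+-mono-≤ (size-boolify _) (right≤ a)))) »
      ≤-reflexive (+-comm 8 (size a)))

open Ripple using (rippleF) renaming (stepFun to ripple)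

-- Adding one turns a digit 1 into 2, and a digit 2 into 1 with a carry. Subtracting does the
-- reverse; a borrow that leaves the most significant digit deletes it.
increment decrement : Word → Word
increment [] = true ∷ []
increment (true ∷ ds) = false ∷ ds
increment (false ∷ ds) = true ∷ increment ds
decrement [] = []
decrement (false ∷ ds) = true ∷ ds
decrement (true ∷ []) = []
decrement (true ∷ d ∷ ds) = false ∷ decrement (d ∷ ds)

idle-ripple : ∀ pass passF ds out → foldl (λ s d → ripple pass passF (d , s)) (false , out) ds ≡ (false , ds ʳ++ out)
idle-ripple pass passF [] out = refl
idle-ripple pass passF (d ∷ ds) out = idle-ripple pass passF ds (d ∷ out)

reverse-ʳ++ : ∀ (ds : Word) {ys} → reverse (ds ʳ++ ys) ≡ ys ʳ++ ds
reverse-ʳ++ ds {ys} = ʳ++-ʳ++ ds ∙ cong (ys ʳ++_) (++-identityʳ ds)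

incrementF : WordF increment
incrementF = extF (λ ds → loop ds [])
  (reverseF ∘F ifF (fstF {bool} {list bool}) (constF {A = bool} true ∷F sndF) sndF ∘F rippleF not notF)
  where
  go : Word → Word → Bool × Word
  go ds out = foldl (λ s d → ripple not notF (d , s)) (true , out) ds
  finish : Bool × Word → Word
  finish (c , out) = if c then true ∷ out else out
  loop : ∀ ds out → reverse (finish (go ds out)) ≡ out ʳ++ increment ds
  loop [] out = unfold-reverse true out ∙ sym (ʳ++-defn out)
  loop (true ∷ ds) out = cong (reverse ∘ finish) (idle-ripple not notF ds (false ∷ out)) ∙ reverse-ʳ++ ds
  loop (false ∷ ds) out = loop ds (true ∷ out)

drop1 : Word → Word
drop1 [] = []
drop1 (_ ∷ xs) = xs

tailF : WordF drop1
tailF = pf rear PT-right (λ { leaf → refl ; (node a b) → refl })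

decrementF : WordF decrement
decrementF = extF (λ { [] → refl ; (d ∷ ds) → loop d ds [] })
  (reverseF ∘F ifF (fstF {bool} {list bool}) (tailF ∘F sndF) sndF ∘F rippleF (λ d → d) idF)
  where
  go : Word → Word → Bool × Word
  go ds out = foldl (λ s d → ripple (λ d → d) idF (d , s)) (true , out) ds
  finish : Bool × Word → Word
  finish (c , out) = if c then drop1 out else out
  loop : ∀ d ds out → reverse (finish (go (d ∷ ds) out)) ≡ out ʳ++ decrement (d ∷ ds)
  loop false ds out = cong (reverse ∘ finish) (idle-ripple (λ d → d) idF ds (true ∷ out)) ∙ reverse-ʳ++ ds
  loop true [] out = refl
  loop true (d ∷ ds) out = loop d ds (false ∷ out)

fromDigits-increment : ∀ ds → fromDigits (increment ds) ≡ ℕᵇ.suc (fromDigits ds)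
fromDigits-increment [] = refl
fromDigits-increment (true ∷ ds) = refl
fromDigits-increment (false ∷ ds) = cong 1+[2_] (fromDigits-increment ds)

toNat-increment : ∀ ds → toNat (increment ds) ≡ suc (toNat ds)
toNat-increment ds = cong ℕᵇ.toℕ (fromDigits-increment ds) ∙ toℕ-suc (fromDigits ds)

increment-decrement : ∀ d ds → increment (decrement (d ∷ ds)) ≡ d ∷ ds
increment-decrement false ds = refl
increment-decrement true [] = refl
increment-decrement true (d ∷ ds) = cong (true ∷_) (increment-decrement d ds)

toNat-decrement : ∀ d ds → toNat (d ∷ ds) ≡ suc (toNat (decrement (d ∷ ds)))
toNat-decrement d ds = cong toNat (sym (increment-decrement d ds)) ∙ toNat-increment (decrement (d ∷ ds))

length-increment : ∀ ds → length (increment ds) ≤ suc (length ds)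
length-increment [] = ≤-refl
length-increment (true ∷ ds) = n≤1+n _
length-increment (false ∷ ds) = s≤s (length-increment ds)

length-decrement : ∀ ds → length (decrement ds) ≤ suc (length ds)
length-decrement [] = z≤n
length-decrement (false ∷ ds) = n≤1+n _
length-decrement (true ∷ []) = z≤n
length-decrement (true ∷ d ∷ ds) = s≤s (length-decrement (d ∷ ds))

-- The sign `true` stands for `-[1+ n ]`, so between 0 and -1 only the sign changes.
up down : Bool × Word → Bool × Word
up (false , ds) = false , increment ds
up (true , []) = false , []
up (true , d ∷ ds) = true , decrement (d ∷ ds)
down (true , ds) = true , increment ds
down (false , []) = true , []
down (false , d ∷ ds) = false , decrement (d ∷ ds)

toInt-up : ∀ x → toInt (up x) ≡ ℤ.suc (toInt x)
toInt-up (false , ds) = cong +_ (toNat-increment ds)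
toInt-up (true , []) = refl
toInt-up (true , d ∷ ds) rewrite toNat-decrement d ds = refl

toInt-down : ∀ x → toInt (down x) ≡ ℤ.pred (toInt x)
toInt-down (true , ds) = cong -[1+_] (toNat-increment ds)
toInt-down (false , []) = refl
toInt-down (false , d ∷ ds) rewrite toNat-decrement d ds = refl

length-up : ∀ x → length (snd (up x)) ≤ suc (length (snd x))
length-up (false , ds) = length-increment ds
length-up (true , []) = z≤n
length-up (true , d ∷ ds) = length-decrement (d ∷ ds)

nullF : ∀ {Γ A B} {xs : El Γ → List (El A)} {f g : El Γ → El B} →
  PF {Γ} {list A} xs → PF {Γ} {B} f → PF {Γ} {B} g → PF {Γ} {B} (λ γ → caseList (xs γ) (f γ) (λ _ → g γ))
nullF p q r = caseListF p q (r ∘F fstF)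

upF : PF {SD} {SD} up
upF = extF (λ { (false , ds) → refl ; (true , []) → refl ; (true , _ ∷ _) → refl })
  (ifF (fstF {bool} {list bool})
    (nullF {A = bool} sndF (constF {A = SD} (false , [])) (constF {A = bool} true ,F (decrementF ∘F sndF)))
    (constF {A = bool} false ,F (incrementF ∘F sndF)))

downF : PF {SD} {SD} down
downF = extF (λ { (true , ds) → refl ; (false , []) → refl ; (false , _ ∷ _) → refl })
  (ifF (fstF {bool} {list bool})
    (constF {A = bool} true ,F (incrementF ∘F sndF))
    (nullF {A = bool} sndF (constF {A = SD} (true , [])) (constF {A = bool} false ,F (decrementF ∘F sndF))))

decSD : Tree → Bool × Word
decSD t = isNode (fore t) , treeWord (rear t)

codeSD : Bool × Word → Tree
codeSD (s , w) = node (bitTree s) (wordTree w)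

-- The identity on values, but with the standard tree as result. Its size depends on the number of
-- digits alone, which is what makes a counter inside a fold bounded.
canonF : PF {SD} {SD} (λ x → x)
canonF = pf (λ t → codeSD (decSD t))
  (PT-ext (λ t → cong₂ node (bit-eq (fore t)) (word-eq (rear t))) (pt composite))
  (λ t → cong₂ _,_ (isNode-bitTree (isNode (fore t)))
    (dec-bits (wordTree (treeWord (rear t))) ∙ dec-wordTree _ ∙ sym (dec-bits (rear t))))
  where
  pushF : PF {bool ⊗ list bool} {list bool} (λ y → fst y ∷ snd y)
  pushF = boolify fstF ∷F sndF
  gr : Growing (raw pushF)
  gr = additive (con 4) (λ x a → s≤s (+-monoˡ-≤ (size a) (size-boolify x)) » ≤-reflexive (+-comm 4 (size a)))
  composite : PF {SD} {SD} (λ x → fst x , (foldl (λ s d → d ∷ s) [] (snd x) ʳ++ []))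
  composite = boolify (fstF {bool} {list bool}) ,F reverseF {bool} ∘F foldlF {bool} {list bool} pushF gr ∘F (sndF ,F nilF)
  bit-eq : ∀ t → ifNode t (node leaf leaf) leaf ≡ bitTree (isNode t)
  bit-eq leaf = refl
  bit-eq (node _ _) = refl
  word₁ : ∀ t w → foldTree (raw pushF) t (wordTree w) ≡ wordTree (treeWord t ʳ++ w)
  word₁ leaf w = refl
  word₁ (node b t) w = cong (λ u → foldTree (raw pushF) t (node u (wordTree w))) (bit-eq b) ∙ word₁ t (isNode b ∷ w)
  word₂ : ∀ v w → foldTree (λ t → node (fore t) (rear t)) (wordTree v) (wordTree w) ≡ wordTree (v ʳ++ w)
  word₂ [] w = refl
  word₂ (b ∷ v) w = word₂ v (b ∷ w)
  word-eq : ∀ t → foldTree (λ t → node (fore t) (rear t)) (foldTree (raw pushF) t leaf) leaf ≡ wordTree (treeWord t)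
  word-eq t = cong (λ u → foldTree (λ t → node (fore t) (rear t)) u leaf) (word₁ t []) ∙
    (word₂ (treeWord t ʳ++ []) []) ∙ cong wordTree (reverse-involutive (treeWord t))

viaSD : ∀ {f g} → (∀ x → toInt (f x) ≡ g (toInt x)) → PF {SD} {SD} f → PF {int} {int} g
viaSD {f} {g} h p = pf (λ t → codeSD (f (decSD t)))
  (PT-ext (λ t → cong codeSD (decSD-dec (raw p t) ∙ sound p t ∙ cong f (sym (decSD-dec t))))
    (pt (canonF ∘F p)))
  (λ t → cong toInt (cong₂ _,_ (isNode-bitTree _) (dec-wordTree _)) ∙ h (decSD t))
  where
  decSD-dec : ∀ t → decSD t ≡ dec SD t
  decSD-dec t = cong (isNode (fore t) ,_) (sym (dec-bits (rear t)))

sucF : PF {int} {int} ℤ.suc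
sucF = viaSD toInt-up upF

predF : PF {int} {int} ℤ.pred
predF = viaSD toInt-down downF

canonInt : PF {int} {int} (λ z → z)
canonInt = viaSD (λ _ → refl) idF

size-codeSD : ∀ x n → length (snd x) ≤ n → size (codeSD x) ≤ 5 + 4 * n
size-codeSD (s , w) n le = s≤s (+-mono-≤ (size-bit s)
    (size-wordTree w » s≤s (*-monoʳ-≤ 4 le)) » ≤-refl)
  where
  size-bit : ∀ b → size (bitTree b) ≤ 3
  size-bit false = s≤s z≤n
  size-bit true = ≤-refl

length-treeWord≤ : ∀ t → length (treeWord t) ≤ size t
length-treeWord≤ leaf = z≤n
length-treeWord≤ (node b t) = s≤s (length-treeWord≤ t » m≤n+m _ (size b))

number : {A : Set} → ℤ → List A → List (ℤ × A)
number z [] = []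
number z (x ∷ xs) = (z , x) ∷ number (ℤ.suc z) xs

-- The counter gains at most one digit per element: the number of digits is a measure of rate 1.
numberF : ∀ {A} → PF {int ⊗ list A} {list (int ⊗ A)} (λ y → number (fst y) (snd y))
numberF {A} = extF lemma (reverseF ∘F sndF {int} {list (int ⊗ A)} ∘F foldlF {A} {int ⊗ list (int ⊗ A)} stepF gr ∘F
    (sndF {int} {list A} ,F fstF {int} {list A} ,F nilF))
  where
  stepFun : El A × (ℤ × List (ℤ × El A)) → ℤ × List (ℤ × El A)
  stepFun (x , z , out) = ℤ.suc z , (z , x) ∷ out
  zF : PF {A ⊗ int ⊗ list (int ⊗ A)} {int} (λ y → fst (snd y))
  zF = fstF {int} {list (int ⊗ A)} ∘F sndF
  stepF : PF {A ⊗ int ⊗ list (int ⊗ A)} {int ⊗ list (int ⊗ A)} stepFun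
  stepF = (sucF ∘F zF) ,F (canonInt ∘F zF ,F fstF {A} {int ⊗ list (int ⊗ A)}) ∷F sndF {int} {list (int ⊗ A)} ∘F sndF
  ndigits : Tree → ℕ
  ndigits a = length (treeWord (rear (fore a)))
  gr : Growing (raw stepF)
  gr = growing ndigits 1 (con 17 ⊞ con 9 ⊠ X)
    (λ a → length-treeWord≤ (rear (fore a)) » right≤ (fore a) » left≤ a)
    (λ x a → subst₂ _≤_ (cong length (sym (dec-wordTree (snd (up (decSD (fore a))))))) (+-comm 1 _)
       (length-up (decSD (fore a))))
    (λ x a → s≤s (+-mono-≤ (size-codeSD (up (decSD (fore a))) _ (length-up (decSD (fore a))))
        (s≤s (+-mono-≤ (s≤s (+-monoˡ-≤ (size x) (size-codeSD (decSD (fore a)) _ ≤-refl))) (right≤ a)))) »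
      subst (_≤ size a + (17 + 9 * (size x + ndigits a))) (eq (ndigits a) (size x) (size a))
        (+-monoʳ-≤ (size a) (+-monoʳ-≤ 17 (+-mono-≤ (m≤m+n (size x) (8 * size x)) (*-monoˡ-≤ (ndigits a) {8} {9} (n≤1+n 8)) »
          ≤-reflexive (eq' (size x) (ndigits a))))))
    where
    eq : ∀ e x a → a + (17 + (x + 8 * e)) ≡ 1 + (5 + 4 * suc e + (1 + (1 + (5 + 4 * e + x) + a)))
    eq = solve-∀
    eq' : ∀ x e → x + 8 * x + 9 * e ≡ 9 * (x + e)
    eq' = solve-∀
  loop : ∀ ys z out → snd (foldl (λ s x → stepFun (x , s)) (z , out) ys) ≡ number z ys ʳ++ out
  loop [] z out = refl
  loop (y ∷ ys) z out = loop ys (ℤ.suc z) ((z , y) ∷ out)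
  lemma : ∀ y → reverse (snd (foldl (λ s x → stepFun (x , s)) (fst y , []) (snd y))) ≡ number (fst y) (snd y)
  lemma (z , ys) = cong reverse (loop ys z []) ∙ reverse-involutive (number z ys)

lengthF : ∀ {A} → PF {list A} {int} (λ xs → + length xs)
lengthF {A} = extF (λ xs → loop xs 0 ∙ (cong +_ (+-identityʳ (length xs))))
  (foldlF {A} {int} stepF gr ∘F (idF ,F constF {A = int} (+ 0)))
  where
  stepF : PF {A ⊗ int} {int} (λ y → ℤ.suc (snd y))
  stepF = sucF ∘F sndF {A} {int}
  gr : Growing (raw stepF)
  gr = growing (λ a → length (treeWord (rear a))) 1 (con 9 ⊞ con 4 ⊠ X)
    (λ a → length-treeWord≤ (rear a) » right≤ a)
    (λ x a → subst₂ _≤_ (cong length (sym (dec-wordTree (snd (up (decSD a)))))) (+-comm 1 _) (length-up (decSD a)))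
    (λ x a → size-codeSD (up (decSD a)) _ (length-up (decSD a)) »
      ≤-reflexive (eq (length (treeWord (rear a)))) » +-monoʳ-≤ 9 (*-monoʳ-≤ 4 (m≤n+m _ (size x))) »
        m≤n+m _ (size a))
    where
    eq : ∀ e → 5 + 4 * suc e ≡ 9 + 4 * e
    eq = solve-∀
  loop : ∀ (xs : List (El A)) n → foldl (λ z x → ℤ.suc z) (+ n) xs ≡ + (length xs + n)
  loop [] n = refl
  loop (x ∷ xs) n = loop xs (suc n) ∙ (cong +_ (+-suc (length xs) n))

-- The encodings of numbers and lists as programs

encodeNatW : Word → Word
encodeNatW ds = concatMap (λ d → true ∷ d ∷ []) ds ++ (false ∷ [])

encodeℕᵇ-digits : ∀ ds → encodeℕᵇ (fromDigits ds) ≡ encodeNatW ds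
encodeℕᵇ-digits [] = refl
encodeℕᵇ-digits (false ∷ ds) = cong (λ w → true ∷ false ∷ w) (encodeℕᵇ-digits ds)
encodeℕᵇ-digits (true ∷ ds) = cong (λ w → true ∷ true ∷ w) (encodeℕᵇ-digits ds)

encodeℕ-toNat : ∀ ds → encodeℕ (toNat ds) ≡ encodeNatW ds
encodeℕ-toNat ds = cong encodeℕᵇ (fromℕ-toℕ (fromDigits ds)) ∙ encodeℕᵇ-digits ds

encodeWF : WordF encodeNatW
encodeWF = appendF (concatMapF idF (constF {A = bool} true ∷F sndF ∷F nilF)) (constF {A = list bool} (false ∷ []))

-- A number and its word of digits are decoded from the same tree, so a program on digits is already
-- a program on numbers.
digitsOfNat : ∀ {B f} → PF {list bool} {B} f → (g : ℕ → El B) → (∀ w → f w ≡ g (toNat w)) → PF {nat} {B} g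
digitsOfNat p g h = pf (raw p) (pt p) (λ t → sound p t ∙ h _ ∙ cong (g ∘ toNat) (dec-bits t))

digitsOfInt : ∀ {B f} → PF {SD} {B} f → (g : ℤ → El B) → (∀ w → f w ≡ g (toInt w)) → PF {int} {B} g
digitsOfInt p g h = pf (raw p) (pt p) (λ t → sound p t ∙ h _ ∙ cong (λ w → g (toInt (isNode (fore t) , w))) (dec-bits (rear t)))

encodeℕF : PF {nat} {list bool} encodeℕ
encodeℕF = digitsOfNat encodeWF encodeℕ (λ w → sym (encodeℕ-toNat w))

encodeℤF : PF {int} {list bool} encodeℤ
encodeℤF = digitsOfInt (fstF {bool} {list bool} ∷F (encodeWF ∘F sndF)) encodeℤ
  (λ { (false , w) → cong (false ∷_) (sym (encodeℕ-toNat w)) ; (true , w) → cong (true ∷_) (sym (encodeℕ-toNat w)) })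

encodeListF : ∀ {A} {f : El A → Word} → PF {A} {list bool} f → PF {list A} {list bool} (encodeList f)
encodeListF {A} {f} p = extF loop (appendF (concatMapF idF (constF {A = bool} true ∷F (p ∘F sndF))) (constF {A = list bool} (false ∷ [])))
  where
  loop : ∀ xs → concatMap (λ a → true ∷ f a) xs ++ (false ∷ []) ≡ encodeList f xs
  loop [] = refl
  loop (x ∷ xs) = cong (true ∷_) (++-assoc (f x) _ _ ∙ cong (f x ++_) (loop xs))

-- Predicates decided in polynomial time

record Prd (Γ : U) (P : El Γ → Set) : Set where
  constructor prd
  field
    test : El Γ → Bool
    program : PF {Γ} {bool} test
    reflects : ∀ γ → Reflects (P γ) (test γ)
open Prd public

reflects-⇔ : ∀ {P Q : Set} {b} → (P → Q) → (Q → P) → Reflects P b → Reflects Q b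
reflects-⇔ f g (ofʸ p) = ofʸ (f p)
reflects-⇔ f g (ofⁿ ¬p) = ofⁿ (¬p ∘ g)

mapP : ∀ {Γ} {P Q : El Γ → Set} → (∀ {γ} → P γ → Q γ) → (∀ {γ} → Q γ → P γ) → Prd Γ P → Prd Γ Q
mapP f g p = prd (test p) (program p) (λ γ → reflects-⇔ f g (reflects p γ))

substP : ∀ {Γ Δ} {P : El Δ → Set} {f : El Γ → El Δ} → Prd Δ P → PF {Γ} {Δ} f → Prd Γ (λ γ → P (f γ))
substP {f = f} p q = prd (λ γ → test p (f γ)) (program p ∘F q) (λ γ → reflects p (f γ))

infixr 2 _×P_
infixr 1 _⊎P_ _→P_

_×P_ : ∀ {Γ} {P Q : El Γ → Set} → Prd Γ P → Prd Γ Q → Prd Γ (λ γ → P γ × Q γ)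
p ×P q = prd _ (andF (program p) (program q)) (λ γ → reflects p γ ×-reflects reflects q γ)

¬P : ∀ {Γ} {P : El Γ → Set} → Prd Γ P → Prd Γ (λ γ → ¬ P γ)
¬P p = prd _ (notF ∘F program p) (λ γ → ¬-reflects (reflects p γ))

_⊎P_ : ∀ {Γ} {P Q : El Γ → Set} → Prd Γ P → Prd Γ Q → Prd Γ (λ γ → P γ ⊎ Q γ)
p ⊎P q = prd _ (extF (λ γ → lemma (test p γ) (test q γ)) (ifF (program p) (constF {A = bool} true) (program q)))
  (λ γ → reflects p γ ⊎-reflects reflects q γ)
  where
  lemma : ∀ b c → (if b then true else c) ≡ b ∨ c
  lemma false c = refl
  lemma true c = refl

_→P_ : ∀ {Γ} {P Q : El Γ → Set} → Prd Γ P → Prd Γ Q → Prd Γ (λ γ → P γ → Q γ)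
p →P q = prd _ (extF (λ γ → lemma (test p γ) (test q γ)) (ifF (program p) (program q) (constF {A = bool} true)))
  (λ γ → reflects p γ →-reflects reflects q γ)
  where
  lemma : ∀ b c → (if b then c else true) ≡ not b ∨ c
  lemma false c = refl
  lemma true c = refl

-- Each element is judged against the ones before it, latest first, which is the information that a
-- fold has at hand.
data Scan {A : Set} (P : A → List A → Set) (seen : List A) : List A → Set where
  [] : Scan P seen []
  _∷_ : ∀ {x xs} → P x seen → Scan P (x ∷ seen) xs → Scan P seen (x ∷ xs)

scanP : ∀ {Γ A} {xs : El Γ → List (El A)} {P : El Γ × El A × List (El A) → Set} →
  PF {Γ} {list A} xs → Prd (Γ ⊗ A ⊗ list A) P → Prd Γ (λ γ → Scan (λ x seen → P (γ , x , seen)) [] (xs γ))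
scanP {A = A} {xs} {P} p q = prd _ (scanF {A = A} p (program q)) (λ γ → loop γ [] (xs γ))
  where
  loop : ∀ γ seen ys → Reflects (Scan (λ x seen → P (γ , x , seen)) seen ys) (scanB (λ y → test q (γ , y)) seen ys)
  loop γ seen [] = ofʸ []
  loop γ seen (y ∷ ys) = reflects-⇔ (λ { (p , ps) → p ∷ ps }) (λ { (p ∷ ps) → p , ps })
    (reflects q (γ , y , seen) ×-reflects loop γ (y ∷ seen) ys)

allP : ∀ {Γ A} {xs : El Γ → List (El A)} {P : El Γ × El A → Set} →
  PF {Γ} {list A} xs → Prd (Γ ⊗ A) P → Prd Γ (λ γ → ∀ a → a ∈ xs γ → P (γ , a))
allP {A = A} {xs} {P} p q = prd _ (allF {A = A} p (program q)) (λ γ → loop γ (xs γ))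
  where
  loop : ∀ γ ys → Reflects (∀ a → a ∈ ys → P (γ , a)) (allB (λ y → test q (γ , y)) ys)
  loop γ [] = ofʸ (λ _ ())
  loop γ (y ∷ ys) = reflects-⇔ (λ { (p , ps) a 1st → p ; (p , ps) a (there i) → ps a i })
    (λ h → h y 1st , λ a i → h a (there i)) (reflects q (γ , y) ×-reflects loop γ ys)

anyP : ∀ {Γ A} {xs : El Γ → List (El A)} {P : El Γ × El A → Set} →
  PF {Γ} {list A} xs → Prd (Γ ⊗ A) P → Prd Γ (λ γ → ∃[ a ] (a ∈ xs γ × P (γ , a)))
anyP {A = A} {xs} {P} p q = prd _ (extF (λ γ → refl) (notF ∘F allF {A = A} p (notF ∘F program q))) (λ γ → loop γ (xs γ))
  where
  loop : ∀ γ ys → Reflects (∃[ a ] (a ∈ ys × P (γ , a))) (not (allB (λ y → not (test q (γ , y))) ys))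
  loop γ [] = ofⁿ (λ { (_ , () , _) })
  loop γ (y ∷ ys) with test q (γ , y) | reflects q (γ , y)
  ... | true | ofʸ p = ofʸ (y , 1st , p)
  ... | false | ofⁿ ¬p = reflects-⇔ (λ { (a , i , pa) → a , there i , pa })
    (λ { (a , 1st , pa) → ⊥-elim (¬p pa) ; (a , there i , pa) → a , i , pa }) (loop γ ys)

-- A fold knows the earlier elements, whereas `AllPairs` looks ahead; symmetry of `R` reconciles the
-- two.
allPairsP : ∀ {Γ A} {xs : El Γ → List (El A)} {R : El Γ → El A → El A → Set} →
  (∀ {γ a b} → R γ a b → R γ b a) →
  PF {Γ} {list A} xs → Prd ((Γ ⊗ A) ⊗ A) (λ y → R (fst (fst y)) (snd (fst y)) (snd y)) →
  Prd Γ (λ γ → AllPairs (R γ) (xs γ))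
allPairsP {Γ} {A} {xs} {R} sym-R p q = mapP (λ {γ} s → fst (to-pairs γ s)) (λ {γ} ps → from-pairs γ (λ _ _ ()) ps)
  (scanP {A = A} p (allP {A = A} (sndF {A} {list A} ∘F sndF) (substP q ((fstF ∘F fstF ,F (fstF {A} ∘F sndF ∘F fstF)) ,F sndF))))
  where
  S : El Γ → El A → List (El A) → Set
  S γ x seen = ∀ a → a ∈ seen → R γ x a
  to-pairs : ∀ γ {seen ys} → Scan (S γ) seen ys → AllPairs (R γ) ys × (∀ a b → a ∈ seen → b ∈ ys → R γ a b)
  to-pairs γ [] = [] , λ _ _ _ ()
  to-pairs γ {seen} {x ∷ ys} (h ∷ s) with ps , hs ← to-pairs γ s =
    (All.tabulate (λ {b} i → hs x b 1st i) ∷ ps) ,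
    λ { a b i 1st → sym-R (h a i) ; a b i (there j) → hs a b (there i) j }
  from-pairs : ∀ γ {seen ys} → (∀ a b → a ∈ seen → b ∈ ys → R γ a b) → AllPairs (R γ) ys → Scan (S γ) seen ys
  from-pairs γ hs [] = []
  from-pairs γ hs (h ∷ ps) = (λ a i → sym-R (hs a _ i 1st)) ∷
    from-pairs γ (λ { a b 1st j → All.lookup h j ; a b (there i) j → hs a b i (there j) }) ps

Eq : U → Set
Eq A = Prd (A ⊗ A) (λ y → fst y ≡ snd y)

eqP : ∀ {Γ A} {f g : El Γ → El A} → Eq A → PF {Γ} {A} f → PF {Γ} {A} g → Prd Γ (λ γ → f γ ≡ g γ)
eqP e p q = substP e (p ,F q)

trueP : ∀ {Γ} {b : El Γ → Bool} → PF {Γ} {bool} b → Prd Γ (λ γ → b γ ≡ true)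
trueP {b = b} p = prd b p (λ γ → lemma (b γ))
  where
  lemma : ∀ b → Reflects (b ≡ true) b
  lemma false = ofⁿ (λ ())
  lemma true = ofʸ refl

eqBool : Eq bool
eqBool = mapP (λ { {a , b} → to' a b }) (λ { {a , b} → from' a b })
  (trueP (ifF (fstF {bool} {bool}) sndF (notF ∘F sndF)))
  where
  to' : ∀ a b → (if a then b else not b) ≡ true → a ≡ b
  to' false false _ = refl
  to' true true _ = refl
  from' : ∀ a b → a ≡ b → (if a then b else not b) ≡ true
  from' false .false refl = refl
  from' true .true refl = refl

eqPair : ∀ {A B} → Eq A → Eq B → Eq (A ⊗ B)
eqPair {A} {B} e f = mapP (λ { (p , q) → cong₂ _,_ p q }) (λ p → cong fst p , cong snd p)
  (eqP e (fstF {A} {B} ∘F fstF) (fstF {A} {B} ∘F sndF) ×P eqP f (sndF {A} {B} ∘F fstF) (sndF {A} {B} ∘F sndF))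

sameBool : Bool → Bool → Bool
sameBool a b = if a then b else not b

isCons : Word → Bool
isCons [] = false
isCons (_ ∷ _) = true

head1 : Word → Bool
head1 [] = false
head1 (b ∷ _) = b

isConsF : PF {list bool} {bool} isCons
isConsF = pf (λ t → t) PT-id (λ { leaf → refl ; (node _ _) → refl })

headF : PF {list bool} {bool} head1
headF = pf fore PT-left (λ { leaf → refl ; (node _ _) → refl })

-- While the first word is folded the second one is consumed, and both have to be exhausted
-- together.
eqWord : Eq (list bool)
eqWord = mapP (λ { {v , w} e → to' v w true e .snd }) (λ { {v , w} e → from' v w e })
  (trueP (andF (sndF {list bool} {bool}) (notF ∘F isConsF ∘F fstF {list bool} {bool})
      ∘F foldlF {bool} {list bool ⊗ bool} compareF gr ∘F (fstF {list bool} {list bool} ,F sndF ,F constF {A = bool} true)))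
  where
  compare' : Bool × (Word × Bool) → Word × Bool
  compare' (x , ys , b) = drop1 ys , b ∧ (isCons ys ∧ sameBool x (head1 ys))
  ysF : PF {bool ⊗ list bool ⊗ bool} {list bool} (λ y → fst (snd y))
  ysF = fstF {list bool} {bool} ∘F sndF
  compareF : PF {bool ⊗ list bool ⊗ bool} {list bool ⊗ bool} compare'
  compareF = tailF ∘F ysF ,F boolify (andF (sndF {list bool} {bool} ∘F sndF)
    (andF (isConsF ∘F ysF) (ifF fstF (headF ∘F ysF) (notF ∘F headF ∘F ysF))))
  gr : Growing (raw compareF)
  gr = additive (con 4) (λ x a → s≤s (+-mono-≤ (right≤ (fore a) » left≤ a) (size-boolify _)) »
    ≤-reflexive (eq (size a)))
    where
    eq : ∀ a → suc (a + 3) ≡ a + 4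
    eq = solve-∀
  finish : Word × Bool → Bool
  finish (ys , b) = b ∧ not (isCons ys)
  go : Word → Word → Bool → Word × Bool
  go v w b = foldl (λ s x → compare' (x , s)) (w , b) v
  failed : ∀ v w → finish (go v w false) ≡ true → ⊥
  failed [] w = λ ()
  failed (x ∷ v) w = failed v (drop1 w)
  to' : ∀ v w b → finish (go v w b) ≡ true → b ≡ true × v ≡ w
  to' v w false e = ⊥-elim (failed v w e)
  to' [] [] true e = refl , refl
  to' (x ∷ v) [] true e = ⊥-elim (failed v [] e)
  to' (x ∷ v) (y ∷ w) true e with sameBool x y in s
  ... | false = ⊥-elim (failed v w e)
  ... | true = refl , cong₂ _∷_ (same x y s) (snd (to' v w true e))
    where
    same : ∀ x y → sameBool x y ≡ true → x ≡ y
    same false false _ = refl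
    same true true _ = refl
  from' : ∀ v w → v ≡ w → finish (go v w true) ≡ true
  from' [] .[] refl = refl
  from' (false ∷ v) .(false ∷ v) refl = from' v v refl
  from' (true ∷ v) .(true ∷ v) refl = from' v v refl

viaDigits : ∀ {A B} {f : El A → El B} → (∀ {x y} → f x ≡ f y → x ≡ y) → Eq B → PF {A} {B} f → Eq A
viaDigits {A} {B} {f} inj e p = mapP inj (cong f) (eqP e (p ∘F fstF) (p ∘F sndF))

natDigitsF : PF {nat} {list bool} natDigits
natDigitsF = digitsOfNat idF natDigits (λ w → sym (natDigits-toNat w))

intDigitsF : PF {int} {SD} intDigits
intDigitsF = digitsOfInt idF intDigits (λ w → sym (intDigits-toInt w))

eqNat : Eq nat
eqNat = viaDigits (λ {x} {y} e → sym (toNat-natDigits x) ∙ cong toNat e ∙ toNat-natDigits y) eqWord natDigitsF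

eqInt : Eq int
eqInt = viaDigits (λ {x} {y} e → sym (toInt-intDigits x) ∙ cong toInt e ∙ toInt-intDigits y) (eqPair eqBool eqWord) intDigitsF

-- Decoding certificates, and the resulting criterion for NP

-- Parsing: a tree is read off its code from right to left.

parseStep : Bool × Tree → Tree
parseStep (true , s) = node (node (fore s) (fore (rear s))) (rear (rear s))
parseStep (false , s) = node leaf s

parse : Word → Tree → Tree
parse w s = foldl (λ s b → parseStep (b , s)) s (reverse w)

-- Read backwards, both subtrees come before their root, so a stack of finished trees suffices; that
-- stack is itself a tree.
parse-enc : ∀ t s → parse (enc t) s ≡ node t s
parse-enc leaf s = refl
parse-enc (node a b) s = (cong (foldl _ s) (unfold-reverse true (enc a ++ enc b) ∙ cong (List._∷ʳ true) (reverse-++ (enc a) (enc b))) ∙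
  foldl-++ _ s (reverse (enc b) ++ reverse (enc a)) (true ∷ []) ∙
    cong (λ u → parseStep (true , u)) (foldl-++ _ s (reverse (enc b)) (reverse (enc a)))) ∙
  cong (λ u → parseStep (true , u)) (cong (parse (enc a)) (parse-enc b s) ∙ parse-enc a (node b s))

parseStepF : PF {bool ⊗ tree} {tree} parseStep
parseStepF = pf (λ t → ifNode (fore t) (node (node (ls t) (lrs t)) (rrs t)) (node leaf (rear t)))
  (PT-if PT-left (PT-node (PT-node pls plrs) prrs) (PT-node PT-leaf PT-right))
  (λ t → lemma (fore t) (rear t))
  where
  ls lrs rrs : Tree → Tree
  ls t = fore (rear t)
  lrs t = fore (rear (rear t))
  rrs t = rear (rear (rear t))
  pls : PT ls
  pls = PT-comp PT-left PT-right
  plrs : PT lrs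
  plrs = PT-comp PT-left (PT-comp PT-right PT-right)
  prrs : PT rrs
  prrs = PT-comp PT-right (PT-comp PT-right PT-right)
  lemma : ∀ b s → ifNode b (node (node (fore s) (fore (rear s))) (rear (rear s))) (node leaf s)
      ≡ parseStep (isNode b , s)
  lemma leaf s = refl
  lemma (node _ _) s = refl

size-ifNode : ∀ {n} u {x y} → size x ≤ n → size y ≤ n → size (ifNode u x y) ≤ n
size-ifNode leaf p q = q
size-ifNode (node _ _) p q = p

parseRevF : PF {list bool} {tree} (λ w → foldl (λ s b → parseStep (b , s)) leaf w)
parseRevF = foldlF {bool} {tree} parseStepF gr ∘F (idF ,F constF {A = tree} leaf)
  where
  gr : Growing (raw parseStepF)
  gr = additive (con 4) (λ x a → size-ifNode x
    (≤-reflexive (eq (size (fore a)) (size (fore (rear a))) (size (rear (rear a)))) »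
      +-monoʳ-≤ 2 (+-monoʳ-≤ (size (fore a)) (left-right (rear a))) »
        ≤-reflexive (eq₂ (size (fore a)) (size (rear a))) » +-monoʳ-≤ 3 (left-right a) » ≤-reflexive (+-comm 4 (size a)))
    (≤-reflexive (+-comm 2 (size a)) » +-monoʳ-≤ (size a) (s≤s (s≤s z≤n))))
    where
    eq : ∀ x y z → suc (suc (x + y) + z) ≡ 2 + (x + (y + z))
    eq = solve-∀
    eq₂ : ∀ x y → 2 + (x + suc y) ≡ 3 + (x + y)
    eq₂ = solve-∀

-- The state while splitting a pair: is the second component reached, is the next bit one of
-- the first component, and both components reversed.
Split : U
Split = bool ⊗ bool ⊗ list bool ⊗ list bool

splitStep : Bool × El Split → El Split
splitStep (b , r , e , x , y) =
  if r then (r , e , x , b ∷ y) else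
  if e then (r , false , b ∷ x , y) else
  if b then (r , true , x , y) else (true , e , x , y)

splitStepF : PF {bool ⊗ Split} {Split} splitStep
splitStepF = ifF rF (rF ,F eF ,F xF ,F bF ∷F yF)
  (ifF eF (rF ,F constF {A = bool} false ,F bF ∷F xF ,F yF)
    (ifF bF (rF ,F constF {A = bool} true ,F xF ,F yF) (constF {A = bool} true ,F eF ,F xF ,F yF)))
  where
  bF : PF {bool ⊗ Split} {bool} fst
  bF = fstF {bool} {Split}
  rF : PF {bool ⊗ Split} {bool} (λ s → fst (snd s))
  rF = fstF {bool} {bool ⊗ list bool ⊗ list bool} ∘F sndF
  eF : PF {bool ⊗ Split} {bool} (λ s → fst (snd (snd s)))
  eF = fstF {bool} {list bool ⊗ list bool} ∘F sndF {bool} {bool ⊗ list bool ⊗ list bool} ∘F sndF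
  xF : PF {bool ⊗ Split} {list bool} (λ s → fst (snd (snd (snd s))))
  xF = fstF {list bool} {list bool} ∘F sndF {bool} {list bool ⊗ list bool} ∘F sndF {bool} {bool ⊗ list bool ⊗ list bool} ∘F sndF
  yF : PF {bool ⊗ Split} {list bool} (λ s → snd (snd (snd (snd s))))
  yF = sndF {list bool} {list bool} ∘F sndF {bool} {list bool ⊗ list bool} ∘F sndF {bool} {bool ⊗ list bool ⊗ list bool} ∘F sndF

splitBits : Word → El Split
splitBits w = foldl (λ s b → splitStep (b , s)) (false , false , [] , []) w

splitF : PF {list bool} {Split} splitBits
splitF = foldlF {bool} {Split} splitStepF gr ∘F (idF ,F constF {A = Split} (false , false , [] , []))
  where
  parts : ∀ a → size (fore a) + (size (fore (rear a)) +
    (size (fore (rear (rear a))) + size (rear (rear (rear a))))) ≤ 3 + size a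
  parts a = +-monoʳ-≤ (size (fore a)) (+-monoʳ-≤ (size (fore (rear a))) (left-right (rear (rear a))) »
      ≤-reflexive (+-suc _ _) » s≤s (left-right (rear a))) »
    ≤-reflexive (eq (size (fore a)) (size (rear a))) » +-monoʳ-≤ 2 (left-right a)
    where
    eq : ∀ l r → l + suc (suc r) ≡ 2 + (l + r)
    eq = solve-∀
  gr : Growing (raw splitStepF)
  gr = additive (X ⊞ con 10) λ x a →
    let r = fore a
        e = fore (rear a)
        u = fore (rear (rear a))
        v = rear (rear (rear a))
        fit : ∀ {m} k → m + k ≡ (size r + (size e + (size u + size v))) + (size x + 7) → m ≤ size a + (size x + 10)
        fit {m} k eq = m≤m+n m k » ≤-reflexive eq » +-monoˡ-≤ (size x + 7) (parts a) » ≤-reflexive (eq₀ (size a) (size x))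
    in size-ifNode r (fit 3 (eq₁ (size r) (size e) (size u) (size v) (size x)))
      (size-ifNode e (m≤n+m _ (size e) » fit 2 (eq₂ (size r) (size e) (size u) (size v) (size x)))
        (size-ifNode x (m≤n+m _ (size e) » fit (1 + size x) (eq₃ (size r) (size e) (size u) (size v) (size x)))
          (m≤n+m _ (size r) » fit (1 + size x) (eq₄ (size r) (size e) (size u) (size v) (size x)))))
    where
    eq₀ : ∀ a x → 3 + a + (x + 7) ≡ a + (x + 10)
    eq₀ = solve-∀
    eq₁ : ∀ r e u v x → suc (r + suc (e + suc (u + suc (x + v)))) + 3 ≡ (r + (e + (u + v))) + (x + 7)
    eq₁ = solve-∀
    eq₂ : ∀ r e u v x → e + suc (r + suc (1 + suc (suc (x + u) + v))) + 2 ≡ (r + (e + (u + v))) + (x + 7)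
    eq₂ = solve-∀
    eq₃ : ∀ r e u v x → e + suc (r + suc (3 + suc (u + v))) + (1 + x) ≡ (r + (e + (u + v))) + (x + 7)
    eq₃ = solve-∀
    eq₄ : ∀ r e u v x → r + suc (3 + suc (e + suc (u + v))) + (1 + x) ≡ (r + (e + (u + v))) + (x + 7)
    eq₄ = solve-∀

splitBits-pair : ∀ x y → splitBits (pair x y) ≡ (true , false , reverse x , reverse y)
splitBits-pair x y = loop x []
  where
  rest : ∀ y u v → foldl (λ s b → splitStep (b , s)) (true , false , u , v) y ≡ (true , false , u , y ʳ++ v)
  rest [] u v = refl
  rest (b ∷ y) u v = rest y u (b ∷ v)
  loop : ∀ x u → foldl (λ s b → splitStep (b , s)) (false , false , u , []) (pair x y) ≡ (true , false , x ʳ++ u , reverse y)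
  loop [] u = rest y u []
  loop (b ∷ x) u = loop x (b ∷ u)

size-code-parse : ∀ C (c : El C) → dec C (fore (foldl (λ s b → parseStep (b , s)) leaf (reverse (enc (codeTree C c))))) ≡ c
size-code-parse C c = cong (λ t → dec C (fore t)) (parse-enc (codeTree C c) leaf) ∙ dec-code C c

-- Splitting a pair leaves the certificate reversed, which is the order in which it is parsed.
parsed : (C : U) → Word → El C
parsed C w = dec C (fore (foldl (λ s b → parseStep (b , s)) leaf w))

decodePair : (C : U) → Word → Word × El C
decodePair C v = reverse (fst (snd (snd (splitBits v)))) , parsed C (snd (snd (snd (splitBits v))))

decodePairF : (C : U) → PF {list bool} {list bool ⊗ C} (decodePair C)
decodePairF C = reverseF {bool} ∘F fstF {list bool} {list bool} ∘F rest ,F decF ∘F leftF ∘F parseRevF ∘F sndF {list bool} {list bool} ∘F rest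
  where
  decF : PF {tree} {C} (λ t → dec C t)
  decF = pf (λ t → t) PT-id (λ _ → refl)
  leftF : PF {tree} {tree} fore
  leftF = pf fore PT-left (λ _ → refl)
  rest : PF {list bool} {list bool ⊗ list bool} (λ v → snd (snd (splitBits v)))
  rest = sndF {bool} ∘F sndF {bool} {bool ⊗ list bool ⊗ list bool} ∘F splitF

decodePair-pair : ∀ C w y → decodePair C (dec (list bool) (wordTree (pair w y))) ≡ (w , parsed C (reverse y))
decodePair-pair C w y = cong (decodePair C) (dec-bits (wordTree (pair w y)) ∙ dec-wordTree (pair w y)) ∙
  cong (λ (s : El Split) → reverse (fst (snd (snd s))) , parsed C (snd (snd (snd s)))) (splitBits-pair w y) ∙
    cong (_, parsed C (reverse y)) (reverse-involutive w)

PT-asBool : ∀ {b : Word → Bool} → PF {list bool} {bool} b → PT (asBool (λ t → b (dec (list bool) t)))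
PT-asBool p = PT-ext (λ t → cong (λ u → node u leaf) (bit-eq (raw p t) ∙ cong bitTree (sound p t)))
    (PT-node (PT-if (pt p) (PT-const (node leaf leaf)) PT-leaf) PT-leaf)
  where
  bit-eq : ∀ t → ifNode t (node leaf leaf) leaf ≡ bitTree (isNode t)
  bit-eq leaf = refl
  bit-eq (node _ _) = refl

from-reflects : ∀ {Q : Set} {b} → Reflects Q b → Q → b ≡ true
from-reflects (ofʸ _) _ = refl
from-reflects (ofⁿ ¬q) q = ⊥-elim (¬q q)

to-reflects : ∀ {Q : Set} {b} → Reflects Q b → b ≡ true → Q
to-reflects (ofʸ q) _ = q

module _ {L : Language} (C : U) {P : Word × El C → Set} (p : Prd (list bool ⊗ C) P) (q : Pol)
  (certified : ∀ w c → P (w , c) → L w)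
  (certificate : ∀ w → L w → ∃[ c ] (P (w , c) × size (codeTree C c) ≤ ⟦ q ⟧ (length w))) where
  decision : Tree → Bool
  decision t = test p (decodePair C (dec (list bool) t))

  abstract
    verifier : PT (asBool decision)
    verifier = PT-asBool (program p ∘F decodePairF C)

  reflects-pair : ∀ w y → Reflects (P (w , parsed C (reverse y))) (decision (wordTree (pair w y)))
  reflects-pair w y = subst (λ z → Reflects (P z) (decision (wordTree (pair w y)))) (decodePair-pair C w y)
    (reflects p (decodePair C (dec (list bool) (wordTree (pair w y)))))

  HasCertificate : Word → Set
  HasCertificate w = ∃[ y ] (length y ≤ eval (toPolynomial q) (length w) × Accepts (decider {decision} verifier) (pair w y))

  certify : ∀ w → ∃[ c ] (P (w , c) × size (codeTree C c) ≤ ⟦ q ⟧ (length w)) → HasCertificate w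
  certify w (c , h , le) =
    enc (codeTree C c) ,
    subst₂ _≤_ (sym (length-enc (codeTree C c))) (sym (eval-toPolynomial q (length w))) le ,
    Equivalence.from (decider-accepts {decision} verifier (pair w (enc (codeTree C c))))
      (from-reflects (reflects-pair w (enc (codeTree C c))) (subst (λ d → P (w , d)) (sym (size-code-parse C c)) h))

  accepted⇒ : ∀ w y → Accepts (decider {decision} verifier) (pair w y) → L w
  accepted⇒ w y a = certified w _ (to-reflects (reflects-pair w y)
    (Equivalence.to (decider-accepts {decision} verifier (pair w y)) a))

  -- A certificate is sent as the code of a tree. Conversely every word decodes to some certificate,
  -- so malformed words need no separate treatment: whatever the predicate accepts proves
  -- membership.
  NP-intro : NP L
  NP-intro = decider {decision} verifier , toPolynomial (wordBound verifier) , toPolynomial q ,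
    decider-time {decision} verifier , λ w → mk⇔ (λ l → certify w (certificate w l)) (λ { (y , _ , a) → accepted⇒ w y a })

-- Neighbouring cells, and orderings that certify connectedness

east west north south : Cell → Cell
east (x , y) = ℤ.suc x , y
west (x , y) = ℤ.pred x , y
north (x , y) = x , ℤ.suc y
south (x , y) = x , ℤ.pred y

-- `sides` in terms of successors: the additions of 0 have disappeared, which suits pattern matching
-- as well as programs.
edges : Cell → List Segment
edges c = (horizontal , c) ∷ (horizontal , north c) ∷ (vertical , c) ∷ (vertical , east c) ∷ []

infixr 6 _»ᶻ_
_»ᶻ_ : ∀ {i j k} → i ℤ.≤ j → j ℤ.≤ k → i ℤ.≤ k
_»ᶻ_ = Z.≤-trans

sides≡edges : ∀ c → sides c ≡ edges c
sides≡edges (x , y) = cong₂ (λ n e → (horizontal , x , y) ∷ (horizontal , n) ∷ (vertical , x , y) ∷ (vertical , e) ∷ [])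
  (cong₂ _,_ (Z.+-identityʳ x) (Z.+-comm y 1ℤ)) (cong₂ _,_ (Z.+-comm x 1ℤ) (Z.+-identityʳ y))

neighbours : Cell → List Cell
neighbours c = east c ∷ west c ∷ north c ∷ south c ∷ []

-- Turns a quantifier over all cells with a given side into a search among two cells.
owners : Segment → List Cell
owners (horizontal , p) = p ∷ south p ∷ []
owners (vertical , p) = p ∷ west p ∷ []

∈edges⇒∈owners : ∀ {s c} → s ∈ edges c → c ∈ owners s
∈edges⇒∈owners 1st = 1st
∈edges⇒∈owners 2nd = there (here (cong (_ ,_) (sym (Z.pred-suc _))))
∈edges⇒∈owners 3rd = 1st
∈edges⇒∈owners 4th = there (here (cong (_, _) (sym (Z.pred-suc _))))

∈owners⇒∈edges : ∀ s {c} → c ∈ owners s → s ∈ edges c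
∈owners⇒∈edges (horizontal , p) 1st = 1st
∈owners⇒∈edges (horizontal , p) 2nd = there (here (cong (λ y → horizontal , _ , y) (sym (Z.suc-pred _))))
∈owners⇒∈edges (vertical , p) 1st = 3rd
∈owners⇒∈edges (vertical , p) 2nd = there (there (there (here (cong (λ x → vertical , x , _) (sym (Z.suc-pred _))))))

∈sides⇒∈owners : ∀ {s} c → s ∈ sides c → c ∈ owners s
∈sides⇒∈owners {s} c i = ∈edges⇒∈owners (subst (s ∈_) (sides≡edges c) i)

∈owners⇒∈sides : ∀ s {c} → c ∈ owners s → s ∈ sides c
∈owners⇒∈sides s {c} i = subst (s ∈_) (sym (sides≡edges c)) (∈owners⇒∈edges s i)

sucℤ≢ : ∀ x → ℤ.suc x ≢ x
sucℤ≢ x e = Z.<-irrefl refl (Z.suc[i]≤j⇒i<j (Z.≤-reflexive e))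

predℤ≢ : ∀ x → ℤ.pred x ≢ x
predℤ≢ x e = sucℤ≢ x (sym (cong ℤ.suc e) ∙ Z.suc-pred x)

neighbour⇒adjacent : ∀ c {d} → d ∈ neighbours c → Adjacent c d
neighbour⇒adjacent c 1st = (λ e → sucℤ≢ _ (sym (cong fst e))) , (vertical , east c) ,
  ∈owners⇒∈sides _ (there (here (cong (_, _) (sym (Z.pred-suc _))))) , ∈owners⇒∈sides _ 1st
neighbour⇒adjacent c 2nd = (λ e → predℤ≢ _ (sym (cong fst e))) , (vertical , c) ,
  ∈owners⇒∈sides _ 1st , ∈owners⇒∈sides _ 2nd
neighbour⇒adjacent c 3rd = (λ e → sucℤ≢ _ (sym (cong snd e))) , (horizontal , north c) ,
  ∈owners⇒∈sides _ (there (here (cong (_ ,_) (sym (Z.pred-suc _))))) , ∈owners⇒∈sides _ 1st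
neighbour⇒adjacent c 4th = (λ e → predℤ≢ _ (sym (cong snd e))) , (horizontal , c) ,
  ∈owners⇒∈sides _ 1st , ∈owners⇒∈sides _ 2nd

two-owners : ∀ s {c d} → c ∈ owners s → d ∈ owners s → c ≢ d → d ∈ neighbours c
two-owners (horizontal , p) 1st 1st n = ⊥-elim (n refl)
two-owners (horizontal , p) 1st 2nd n = 4th
two-owners (horizontal , p) 2nd 1st n = there (there (here (cong (_ ,_) (sym (Z.suc-pred _)))))
two-owners (horizontal , p) 2nd 2nd n = ⊥-elim (n refl)
two-owners (vertical , p) 1st 1st n = ⊥-elim (n refl)
two-owners (vertical , p) 1st 2nd n = 2nd
two-owners (vertical , p) 2nd 1st n = here (cong (_, _) (sym (Z.suc-pred _)))
two-owners (vertical , p) 2nd 2nd n = ⊥-elim (n refl)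

adjacent⇒neighbour : ∀ {c d} → Adjacent c d → d ∈ neighbours c
adjacent⇒neighbour {c} {d} (n , s , i , j) = two-owners s (∈sides⇒∈owners c i) (∈sides⇒∈owners d j) n

Path : (Cell → Set) → Cell → Cell → Set
Path P = Star (λ u v → P u × P v × Adjacent u v)

adjacent-sym : ∀ {c d} → Adjacent c d → Adjacent d c
adjacent-sym (n , s , i , j) = n ∘ sym , s , j , i

path-sym : ∀ {P c d} → Path P c d → Path P d c
path-sym = Star.reverse (λ { (p , q , a) → q , p , adjacent-sym a })

path-step : ∀ {P c d} → P c → P d → d ∈ neighbours c → Path P c d
path-step {c = c} p q i = (p , q , neighbour⇒adjacent c i) ◅ ε

Near : Cell → Cell → Set
Near c d = c ≡ d ⊎ d ∈ neighbours c

-- If every cell of a list touches an earlier one, the list is connected; unlike a family of paths,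
-- this is checked in one pass.
Linked : Cell → List Cell → Set
Linked c seen = seen ≡ [] ⊎ ∃[ d ] (d ∈ seen × Near c d)

module _ {P : Cell → Set} where

  AllConnected : List Cell → Set
  AllConnected L = ∀ c d → c ∈ L → d ∈ L → Path P c d

  linked-to : ∀ {c seen d} → P c → (∀ d → d ∈ seen → P d) → Linked c seen → AllConnected seen → d ∈ seen → Path P c d
  linked-to p ps (inl refl) connect ()
  linked-to p ps (inr (e , i , inl refl)) connect j = connect e _ i j
  linked-to p ps (inr (e , i , inr n)) connect j = path-step p (ps e i) n ◅◅ connect e _ i j

  linked-connected : ∀ {c seen} → P c → (∀ d → d ∈ seen → P d) → Linked c seen → AllConnected seen → AllConnected (c ∷ seen)
  linked-connected p ps l connect a b 1st 1st = ε
  linked-connected p ps l connect a b 1st (there j) = linked-to p ps l connect j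
  linked-connected p ps l connect a b (there i) 1st = path-sym (linked-to p ps l connect i)
  linked-connected p ps l connect a b (there i) (there j) = connect a b i j

  scan-connected : ∀ {seen L} → (∀ c → c ∈ seen → P c) → (∀ c → c ∈ L → P c) →
    AllConnected seen → Scan Linked seen L →
    ∀ c d → c ∈ seen ⊎ c ∈ L → d ∈ seen ⊎ d ∈ L → Path P c d
  scan-connected ps qs connect [] c d (inl i) (inl j) = connect c d i j
  scan-connected {seen} {x ∷ L} ps qs connect (l ∷ ls) c d i j = scan-connected
    (λ { e 1st → qs e 1st ; e (there k) → ps e k }) (λ e k → qs e (there k))
    (linked-connected (qs x 1st) ps l connect) ls c d (shift-in i) (shift-in j)
    where
    shift-in : ∀ {e} → e ∈ seen ⊎ e ∈ (x ∷ L) → e ∈ (x ∷ seen) ⊎ e ∈ L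
    shift-in (inl k) = inl (there k)
    shift-in (inr 1st) = inl 1st
    shift-in (inr (there k)) = inr k

  ordered⇒connected : ∀ {L} → (∀ c → c ∈ L → P c) → Scan Linked [] L → AllConnected L
  ordered⇒connected qs s c d i j = scan-connected (λ _ ()) qs (λ _ _ ()) s c d (inr i) (inr j)

module _ (U : List Cell) (connect : ∀ c d → c ∈ U → d ∈ U → Path (_∈ U) c d) where

  next-linked : ∀ done todo {a b} → (∀ {c} → c ∈ U → c ∈ done ⊎ c ∈ todo) → a ∈ done → b ∈ todo →
    Path (_∈ U) a b → ∃[ t ] (t ∈ todo × ∃[ d ] (d ∈ done × Near t d))
  next-linked done todo cover i j ε = _ , j , _ , i , inl refl
  next-linked done todo cover i j (_◅_ {j = a'} (_ , u' , adj) path) with cover u'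
  ... | inl i' = next-linked done todo cover i' j path
  ... | inr j' = a' , j' , _ , i , inr (adjacent⇒neighbour (adjacent-sym adj))

  -- A path from a listed cell to one that is still missing leaves the listed part somewhere; the
  -- first cell beyond is the next to be listed.
  extend : ∀ n done todo → List.length todo ≡ n → ∃[ a ] a ∈ done → (∀ {c} → c ∈ U → c ∈ done ⊎ c ∈ todo) →
    (∀ {c} → c ∈ done ⊎ c ∈ todo → c ∈ U) → ∃[ L ] (L ↭ todo × Scan Linked done L)
  extend zero done [] e _ _ _ = [] , ↭-refl , []
  extend (suc n) done todo@(t₀ ∷ _) e (a , i) cover back
    with next-linked done todo cover i 1st (connect a t₀ (back (inl i)) (back (inr 1st)))
  ... | t , j , d , k , near with xs , ys , eq ← ∈-∃++ j =
    let rest = xs ++ ys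
        perm : todo ↭ t ∷ rest
        perm = subst (_↭ t ∷ rest) (sym eq) (shift t xs ys)
        L , p , s = extend n (t ∷ done) rest
          (suc-injective (sym (↭-length perm) ∙ e)) (t , 1st)
          (λ m → move perm (cover m))
          (λ { (inl 1st) → back (inr j) ; (inl (there m)) → back (inl m)
             ; (inr m) → back (inr (∈-resp-↭ (↭-sym perm) (there m))) })
    in t ∷ L , ↭-trans (prep t p) (↭-sym perm) , inr (d , k , near) ∷ s
    where
    move : ∀ {c t rest} → todo ↭ t ∷ rest → c ∈ done ⊎ c ∈ todo → c ∈ (t ∷ done) ⊎ c ∈ rest
    move perm (inl m) = inl (there m)
    move perm (inr m) with ∈-resp-↭ perm m
    ... | 1st = inl 1st
    ... | there m' = inr m'

connected⇒ordered : ∀ U → (∀ c d → c ∈ U → d ∈ U → Path (_∈ U) c d) → ∃[ L ] (L ↭ U × Scan Linked [] L)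
connected⇒ordered [] connect = [] , ↭-refl , []
connected⇒ordered (u ∷ U) connect =
  let L , p , s = extend (u ∷ U) connect (List.length U) (u ∷ []) U refl (u , 1st)
        (λ { 1st → inl 1st ; (there m) → inr m })
        (λ { (inl 1st) → 1st ; (inr m) → there m })
  in u ∷ L , prep u p , inl refl ∷ s

-- Straight paths, and rings that certify the absence of holes

straight : ∀ {P} (f : ℤ → Cell) → (∀ z → f (ℤ.suc z) ∈ neighbours (f z)) → ∀ y n → (∀ k → k ≤ n → P (f (y ℤ.+ + k))) → Path P (f y) (f (y ℤ.+ + n))
straight {P} f step y zero h = subst (λ z → Path P (f y) (f z)) (sym (Z.+-identityʳ y)) ε
straight f step y (suc n) h =
  straight f step y n (λ k le → h k (m≤n⇒m≤1+n le)) ◅◅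
  path-step (h n (n≤1+n n)) (h (suc n) ≤-refl) (subst (λ z → f z ∈ neighbours (f (y ℤ.+ + n))) (lemma y (+ n)) (step (y ℤ.+ + n)))
  where
  lemma : ∀ y n → 1ℤ ℤ.+ (y ℤ.+ n) ≡ y ℤ.+ (1ℤ ℤ.+ n)
  lemma y n = sym (Z.+-assoc 1ℤ y n) ∙ cong (ℤ._+ n) (Z.+-comm 1ℤ y) ∙ Z.+-assoc y 1ℤ n

≤-offset : ∀ {a b} → a ℤ.≤ b → ∃[ n ] b ≡ a ℤ.+ + n
≤-offset {a} {b} le with b ℤ.- a in e | Z.i≤j⇒0≤j-i le
... | + n | _ = n , lemma a b ∙ cong (λ d → a ℤ.+ d) e
  where
  lemma : ∀ a b → b ≡ a ℤ.+ (b ℤ.- a)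
  lemma a b = sym (cong (λ u → a ℤ.+ u) (Z.+-comm b (ℤ.- a)) ∙ sym (Z.+-assoc a (ℤ.- a) b) ∙
    cong (ℤ._+ b) (Z.+-inverseʳ a) ∙ Z.+-identityˡ b)

Between : ℤ → ℤ → ℤ → Set
Between y y' z = (y ℤ.≤ z × z ℤ.≤ y') ⊎ (y' ℤ.≤ z × z ℤ.≤ y)

between : ∀ {P} (f : ℤ → Cell) → (∀ z → f (ℤ.suc z) ∈ neighbours (f z)) → ∀ {y y'} → (∀ z → Between y y' z → P (f z)) → Path P (f y) (f y')
between f step {y} {y'} h with Z.≤-total y y'
... | inl le with n , refl ← ≤-offset le = straight f step y n (λ k kn → h _ (inl (Z.i≤i+j y (+ k) , Z.+-monoʳ-≤ y (ℤ.+≤+ kn))))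
... | inr le with n , refl ← ≤-offset le = path-sym (straight f step y' n (λ k kn → h _ (inr (Z.i≤i+j y' (+ k) , Z.+-monoʳ-≤ y' (ℤ.+≤+ kn)))))

between-path : ∀ {P : Cell → Set} {x y y'} → (∀ z → Between y y' z → P (x , z)) → Path P (x , y) (x , y')
between-path {x = x} = between (x ,_) (λ _ → 3rd)

between-pathʰ : ∀ {P : Cell → Set} {y x x'} → (∀ z → Between x x' z → P (z , y)) → Path P (x , y) (x' , y)
between-pathʰ {y = y} = between (_, y) (λ _ → 1st)

least : (f : Cell → ℤ) (area : List Cell) → area ≢ [] → ∃[ m ] (m ∈ area × ∀ c → c ∈ area → f m ℤ.≤ f c)
least f [] n = ⊥-elim (n refl)
least f (c ∷ []) n = c , 1st , λ { _ 1st → Z.≤-refl }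
least f (c ∷ area@(_ ∷ _)) n with m , i , h ← least f area (λ ()) with Z.≤-total (f c) (f m)
... | inl le = c , 1st , λ { _ 1st → Z.≤-refl ; d (there j) → le »ᶻ h d j }
... | inr le = m , there i , λ { _ 1st → le ; d (there j) → h d j }

_≟ᶜ_ : DecidableEquality Cell
_≟ᶜ_ = ≡-dec Z._≟_ Z._≟_

open import Data.List.Membership.DecPropositional _≟ᶜ_ using (_∈?_)

∉? : ∀ area c → Dec (c ∉ area)
∉? area c = ¬? (c ∈? area)

pred< : ∀ x → ℤ.pred x ℤ.< x
pred< x = Z.i≤pred[j]⇒i<j Z.≤-refl

module _ {cells ring : List Cell} (ne : cells ≢ []) (outside : ∀ c → c ∈ ring → c ∉ cells)
  (closed : ∀ c → c ∈ cells → ∀ d → d ∈ neighbours c → d ∈ cells ⊎ d ∈ ring) where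
  m : Cell
  m = fst (least fst cells ne)

  m∈ : m ∈ cells
  m∈ = fst (snd (least fst cells ne))

  leftmost : ∀ {c} → c ∈ cells → fst m ℤ.≤ fst c
  leftmost i = snd (snd (least fst cells ne)) _ i

  free : ∀ {x y} → x ℤ.< fst m → (x , y) ∉ cells
  free lt i = Z.<-irrefl refl (Z.<-≤-trans lt (leftmost i))

  Reaches : Cell → Set
  Reaches c = ∃[ b ] (b ∈ ring × Path (_∉ cells) c b)

  reach-left : ∀ {x y} → x ℤ.< fst m → Reaches (x , y)
  reach-left {x} {y} lt with closed m m∈ (west m) 2nd
  ... | inl i = ⊥-elim (free (pred< (fst m)) i)
  ... | inr i = west m , i ,
    (between-path (λ _ _ → free lt) ◅◅ between-pathʰ (λ { z (inl (_ , le)) → free (Z.≤-<-trans le (pred< _)) ; z (inr (_ , le)) → free (Z.≤-<-trans le lt) }))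

  -- Going west from an outside cell, one is either stopped by a cell of the polyomino, and then
  -- stands on the ring, or gets to the left of all cells, where the way to the western neighbour of
  -- the leftmost cell is free. `n` bounds the number of columns to be crossed.
  walk : ∀ n c → c ∉ cells → fst c ℤ.≤ fst m ℤ.+ + n → Reaches c
  walk n c out le with west c ∈? cells
  ... | yes i with closed (west c) i c (here (cong (_, _) (sym (Z.suc-pred _))))
  ... | inl j = ⊥-elim (out j)
  ... | inr j = c , j , ε
  walk zero c out le | no w = let b , i , p = reach-left {ℤ.pred (fst c)} {snd c} lt in b , i , (path-step out w 2nd ◅◅ p)
    where
    lt : ℤ.pred (fst c) ℤ.< fst m
    lt = Z.<-≤-trans (pred< (fst c)) (le »ᶻ Z.≤-reflexive (Z.+-identityʳ _))
  walk (suc n) c out le | no w = let b , i , p = walk n (west c) w le' in b , i , (path-step out w 2nd ◅◅ p)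
    where
    shifted : ∀ x n → ℤ.pred (x ℤ.+ (1ℤ ℤ.+ n)) ≡ x ℤ.+ n
    shifted x n = cong ℤ.pred (cong (λ u → x ℤ.+ u) (Z.+-comm 1ℤ n) ∙ sym (Z.+-assoc x n 1ℤ) ∙ Z.+-comm (x ℤ.+ n) 1ℤ) ∙ Z.pred-suc (x ℤ.+ n)
    le' : ℤ.pred (fst c) ℤ.≤ fst m ℤ.+ + n
    le' = Z.pred-mono le »ᶻ Z.≤-reflexive (shifted (fst m) (+ n))

  reach : ∀ c → c ∉ cells → Reaches c
  reach c out with Z.≤-total (fst c) (fst m)
  ... | inl le = walk 0 c out (le »ᶻ Z.≤-reflexive (sym (Z.+-identityʳ _)))
  ... | inr le with n , e ← ≤-offset le = walk n c out (Z.≤-reflexive e)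

  ring⇒no-holes : Scan Linked [] ring → EdgeConnected (_∉ cells)
  ring⇒no-holes ord {c} {d} out out' =
    let b , i , p = reach c out
        b' , i' , p' = reach d out'
    in p ◅◅ ordered⇒connected outside ord b b' i i' ◅◅ path-sym p'

-- Finite certificates for regions

record Certified (cells : List Cell) (boundary : List (Segment × Colour)) (order ring : List Cell) : Set where
  constructor certified
  field
    nonempty' : cells ≢ []
    distinct' : Unique cells
    order⊆ : ∀ c → c ∈ order → c ∈ cells
    order⊇ : ∀ c → c ∈ cells → c ∈ order
    ordered : Scan Linked [] order
    outside : ∀ c → c ∈ ring → c ∉ cells
    closed : ∀ c → c ∈ cells → ∀ d → d ∈ neighbours c → d ∈ cells ⊎ d ∈ ring
    ring-ordered : Scan Linked [] ring
    boundary⊆ : ∀ s → s ∈ map fst boundary → (∃[ c ] (c ∈ owners s × c ∈ cells)) × (∃[ c ] (c ∈ owners s × c ∉ cells))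
    boundary⊇ : ∀ c → c ∈ cells → ∀ s → s ∈ edges c → (∃[ d ] (d ∈ owners s × d ∉ cells)) → s ∈ map fst boundary
    one-colour' : Unique (map fst boundary)

toRegion : ∀ {area bs order ring} → Certified area bs order ring → ColouredPolyomino
toRegion {area} {bs} V = record
  { cells = area
  ; boundary = bs
  ; nonempty = nonempty'
  ; distinct = distinct'
  ; connected = λ i j → ordered⇒connected order⊆ ordered _ _ (order⊇ _ i) (order⊇ _ j)
  ; no-holes = ring⇒no-holes nonempty' outside closed ring-ordered
  ; coloured = λ s → mk⇔
      (λ i → let (c , o , ci) , (d , o' , di) = boundary⊆ s i in
        (c , ci , ∈owners⇒∈sides s o) , (d , di , ∈owners⇒∈sides s o'))
      (λ { ((c , ci , i) , (d , di , j)) →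
        boundary⊇ c ci s (subst (s ∈_) (sides≡edges c) i) (d , ∈sides⇒∈owners d j , di) })
  ; one-colour = one-colour' }
  where open Certified V

-- Conversely, the complement within a box suffices as a ring.

around : (Cell → ℤ) → Cell → List ℤ
around f c = ℤ.pred (f c) ∷ f c ∷ ℤ.suc (f c) ∷ []

module _ (D : ColouredPolyomino) where
  area = cells D

  spread : (Cell → ℤ) → List ℤ
  spread f = concatMap (around f) area

  box : List Cell
  box = cartesianProduct (spread fst) (spread snd)

  ringOf : List Cell
  ringOf = filter (∉? area) box

  -- A discrete intermediate value theorem: a coordinate rises by at most one per step of a path, so
  -- the projection of a connected area has no gaps. This makes the box a full rectangle.
  ivt : ∀ (f : Cell → ℤ) (step≤ : ∀ c d → d ∈ neighbours c → f d ℤ.≤ ℤ.suc (f c)) {a b} → Path (_∈ area) a b → b ∈ area → ∀ z → f a ℤ.≤ z → z ℤ.≤ f b →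
    ∃[ c ] (c ∈ area × f c ≡ z)
  ivt f step≤ {a} ε i z le le' = a , i , Z.≤-antisym le le'
  ivt f step≤ {a} (_◅_ {j = a'} (ia , ia' , adj) path) i z le le' with f a Z.≟ z
  ... | yes e = a , ia , e
  ... | no ne = ivt f step≤ path i z (step≤ a a' (adjacent⇒neighbour adj) »ᶻ Z.i<j⇒suc[i]≤j (Z.≤∧≢⇒< le ne)) le'

  pred≤ : ∀ x → ℤ.pred x ℤ.≤ x
  pred≤ x = Z.<⇒≤ (pred< x)

  step₁ : ∀ c d → d ∈ neighbours c → fst d ℤ.≤ ℤ.suc (fst c)
  step₁ c d 1st = Z.≤-refl
  step₁ c d 2nd = pred≤ (fst c) »ᶻ Z.i≤suc[i] (fst c)
  step₁ c d 3rd = Z.i≤suc[i] _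
  step₁ c d 4th = Z.i≤suc[i] _

  step₂ : ∀ c d → d ∈ neighbours c → snd d ℤ.≤ ℤ.suc (snd c)
  step₂ c d 1st = Z.i≤suc[i] _
  step₂ c d 2nd = Z.i≤suc[i] _
  step₂ c d 3rd = Z.≤-refl
  step₂ c d 4th = pred≤ (snd c) »ᶻ Z.i≤suc[i] (snd c)

  module Clamp (f : Cell → ℤ) (step≤ : ∀ c d → d ∈ neighbours c → f d ℤ.≤ ℤ.suc (f c)) where
    lo∈ = least f area (nonempty D)
    hi∈ = least (λ c → ℤ.- f c) area (nonempty D)

    lo hi : ℤ
    lo = f (fst lo∈)
    hi = f (fst hi∈)

    lo≤ : ∀ {c} → c ∈ area → lo ℤ.≤ f c
    lo≤ i = snd (snd lo∈) _ i

    ≤hi : ∀ {c} → c ∈ area → f c ℤ.≤ hi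
    ≤hi i = Z.neg-cancel-≤ (snd (snd hi∈) _ i)

    lo≤hi : lo ℤ.≤ hi
    lo≤hi = lo≤ (fst (snd hi∈))

    -- The retraction of the integers onto the interval of the coordinates, widened by one on either
    -- side. By `ivt` the entries of `spread f` are just the numbers of that interval.
    clamp : ℤ → ℤ
    clamp z = ℤ.pred lo ℤ.⊔ (z ℤ.⊓ ℤ.suc hi)

    low : ∀ {z} → z ℤ.≤ ℤ.pred lo → clamp z ≡ ℤ.pred lo
    low le = Z.i≥j⇒i⊔j≡i (Z.i⊓j≤i _ _ »ᶻ le)

    range : ℤ.pred lo ℤ.≤ ℤ.suc hi
    range = pred≤ lo »ᶻ lo≤hi »ᶻ Z.i≤suc[i] hi

    high : ∀ {z} → ℤ.suc hi ℤ.≤ z → clamp z ≡ ℤ.suc hi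
    high le = cong (ℤ.pred lo ℤ.⊔_) (Z.i≥j⇒i⊓j≡j le) ∙ Z.i≤j⇒i⊔j≡j range

    mid : ∀ {z} → ℤ.pred lo ℤ.≤ z → z ℤ.≤ ℤ.suc hi → clamp z ≡ z
    mid le le' = cong (ℤ.pred lo ℤ.⊔_) (Z.i≤j⇒i⊓j≡i le') ∙ Z.i≤j⇒i⊔j≡j le

    spread-in : ∀ {c} {z} → c ∈ area → z ∈ around f c → z ∈ spread f
    spread-in {c} i j = ∈-concatMap⁺ _ (lose i j)

    clamp∈ : ∀ z → clamp z ∈ spread f
    clamp∈ z with Z.≤-total z (ℤ.pred lo) | Z.≤-total (ℤ.suc hi) z
    ... | inl le | _ = subst (_∈ spread f) (sym (low le)) (spread-in (fst (snd lo∈)) 1st)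
    ... | inr _ | inl le = subst (_∈ spread f) (sym (high le)) (spread-in (fst (snd hi∈)) 3rd)
    ... | inr le | inr le' = subst (_∈ spread f) (sym (mid le le')) inside
      where
      inside : z ∈ spread f
      inside with z Z.≟ ℤ.pred lo | z Z.≟ ℤ.suc hi
      ... | yes refl | _ = spread-in (fst (snd lo∈)) 1st
      ... | no _ | yes refl = spread-in (fst (snd hi∈)) 3rd
      ... | no n | no n'
        with c , i , refl ← ivt f step≤ (connected D (fst (snd lo∈)) (fst (snd hi∈))) (fst (snd hi∈)) z
          (subst (ℤ._≤ z) (Z.suc-pred lo) (Z.i<j⇒suc[i]≤j (Z.≤∧≢⇒< le (n ∘ sym))))
          (subst (z ℤ.≤_) (Z.pred-suc hi) (Z.i<j⇒i≤pred[j] (Z.≤∧≢⇒< le' n')))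
        = spread-in i 2nd

    clamp-inside : ∀ z → lo ℤ.≤ clamp z → clamp z ℤ.≤ hi → clamp z ≡ z
    clamp-inside z le le' with Z.≤-total z (ℤ.pred lo) | Z.≤-total (ℤ.suc hi) z
    ... | inl q | _ = ⊥-elim (Z.<-irrefl refl (Z.≤-<-trans (subst (lo ℤ.≤_) (low q) le) (pred< lo)))
    ... | inr _ | inl q = ⊥-elim (Z.<-irrefl refl (Z.suc[i]≤j⇒i<j (subst (ℤ._≤ hi) (high q) le')))
    ... | inr q | inr q' = mid q q'

    spread-mid : ∀ {z} → z ∈ spread f → clamp z ≡ z
    spread-mid {z} i with c , j , k ← find (∈-concatMap⁻ (around f) i) with k
    ... | 1st = mid (Z.pred-mono (lo≤ j)) (pred≤ _ »ᶻ ≤hi j »ᶻ Z.i≤suc[i] hi)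
    ... | 2nd = mid (pred≤ lo »ᶻ lo≤ j) (≤hi j »ᶻ Z.i≤suc[i] hi)
    ... | 3rd = mid (pred≤ lo »ᶻ lo≤ j »ᶻ Z.i≤suc[i] _) (Z.suc-mono (≤hi j))

    clamp-suc : ∀ z → clamp (ℤ.suc z) ≡ clamp z ⊎ clamp (ℤ.suc z) ≡ ℤ.suc (clamp z)
    clamp-suc z with Z.≤-total (ℤ.suc z) (ℤ.pred lo) | Z.≤-total (ℤ.suc hi) z
    ... | inl q | _ = inl (low q ∙ sym (low (Z.i≤suc[i] z »ᶻ q)))
    ... | inr _ | inl q = inl (high (q »ᶻ Z.i≤suc[i] z) ∙ sym (high q))
    ... | inr q | inr q' with z Z.≟ ℤ.suc hi | ℤ.suc z Z.≟ ℤ.pred lo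
    ... | yes refl | _ = inl (high (Z.i≤suc[i] z) ∙ sym (high Z.≤-refl))
    ... | no _ | yes e = inl (low (Z.≤-reflexive e) ∙ sym (low (Z.i≤suc[i] z »ᶻ Z.≤-reflexive e)))
    ... | no n | no n' = inr (mid q (Z.i<j⇒suc[i]≤j (Z.≤∧≢⇒< q' n)) ∙
        cong ℤ.suc (sym (mid (subst (ℤ.pred lo ℤ.≤_) (Z.pred-suc z) (Z.i<j⇒i≤pred[j] (Z.≤∧≢⇒< q (n' ∘ sym)))) q')))

  module CX = Clamp fst step₁
  module CY = Clamp snd step₂

  -- Clamping both coordinates takes neighbours to near cells, never enters the area from outside,
  -- and fixes the box. So it turns paths in the complement into paths in the ring, which is
  -- therefore connected.
  retraction : Cell → Cell
  retraction (x , y) = CX.clamp x , CY.clamp y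

  retract-out : ∀ c → c ∉ area → retraction c ∉ area
  retract-out (x , y) out i = out (subst (_∈ area)
    (cong₂ _,_ (CX.clamp-inside x (CX.lo≤ i) (CX.≤hi i)) (CY.clamp-inside y (CY.lo≤ i) (CY.≤hi i))) i)

  retract∈ : ∀ c → c ∉ area → retraction c ∈ ringOf
  retract∈ c@(x , y) out = ∈-filter⁺ (∉? area) (∈-cartesianProduct⁺ (CX.clamp∈ x) (CY.clamp∈ y)) (retract-out c out)

  east-near : ∀ x y → Near (CX.clamp x , y) (CX.clamp (ℤ.suc x) , y)
  east-near x y with CX.clamp-suc x
  ... | inl e = inl (cong (_, y) (sym e))
  ... | inr e = inr (here (cong (_, y) e))

  north-near : ∀ x y → Near (x , CY.clamp y) (x , CY.clamp (ℤ.suc y))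
  north-near x y with CY.clamp-suc y
  ... | inl e = inl (cong (x ,_) (sym e))
  ... | inr e = inr (there (there (here (cong (x ,_) e))))

  near-sym : ∀ {c d} → Near c d → Near d c
  near-sym (inl e) = inl (sym e)
  near-sym {c} {d} (inr i) = inr (adjacent⇒neighbour (adjacent-sym (neighbour⇒adjacent c i)))

  retract-near : ∀ c d → d ∈ neighbours c → Near (retraction c) (retraction d)
  retract-near (x , y) d 1st = east-near x (CY.clamp y)
  retract-near (x , y) d 2nd =
    near-sym (subst (λ z → Near (CX.clamp (ℤ.pred x) , CY.clamp y) (CX.clamp z , CY.clamp y)) (Z.suc-pred x) (east-near (ℤ.pred x) (CY.clamp y)))
  retract-near (x , y) d 3rd = north-near (CX.clamp x) y
  retract-near (x , y) d 4th =
    near-sym (subst (λ z → Near (CX.clamp x , CY.clamp (ℤ.pred y)) (CX.clamp x , CY.clamp z)) (Z.suc-pred y) (north-near (CX.clamp x) (ℤ.pred y)))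

  near-path : ∀ {P c d} → P c → P d → Near c d → Path P c d
  near-path p q (inl refl) = ε
  near-path p q (inr n) = path-step p q n

  retract-path : ∀ {c d} → Path (_∉ area) c d → Path (_∈ ringOf) (retraction c) (retraction d)
  retract-path ε = ε
  retract-path (_◅_ {i = c} {j = d} (p , q , adj) path) =
    near-path (retract∈ c p) (retract∈ d q) (retract-near c d (adjacent⇒neighbour adj)) ◅◅ retract-path path

  ring-out : ∀ c → c ∈ ringOf → c ∉ area
  ring-out c i = snd (∈-filter⁻ (∉? area) {xs = box} i)

  ring-fixed : ∀ c → c ∈ ringOf → retraction c ≡ c
  ring-fixed (x , y) i with j , k ← ∈-cartesianProduct⁻ (spread fst) (spread snd) (fst (∈-filter⁻ (∉? area) {xs = box} i))
    = cong₂ _,_ (CX.spread-mid j) (CY.spread-mid k)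

  ring-connected : ∀ c d → c ∈ ringOf → d ∈ ringOf → Path (_∈ ringOf) c d
  ring-connected c d i j = subst₂ (Path (_∈ ringOf)) (ring-fixed c i) (ring-fixed d j)
    (retract-path (no-holes D (ring-out c i) (ring-out d j)))

  neighbour∈box : ∀ c → c ∈ area → ∀ d → d ∈ neighbours c → d ∈ box
  neighbour∈box c i d j = ∈-cartesianProduct⁺ (CX.spread-in i (x∈ j)) (CY.spread-in i (y∈ j))
    where
    x∈ : ∀ {d} → d ∈ neighbours c → fst d ∈ around fst c
    x∈ 1st = 3rd
    x∈ 2nd = 1st
    x∈ 3rd = 2nd
    x∈ 4th = 2nd
    y∈ : ∀ {d} → d ∈ neighbours c → snd d ∈ around snd c
    y∈ 1st = 2nd
    y∈ 2nd = 2nd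
    y∈ 3rd = 3rd
    y∈ 4th = 1st

  region-certified : ∃[ order ] ∃[ ring ] (order ↭ cells D × ring ↭ ringOf × Certified (cells D) (boundary D) order ring)
  region-certified
    with order , p , s ← connected⇒ordered area (λ c d i j → connected D i j)
    with ring , q , t ← connected⇒ordered ringOf ring-connected = order , ring , p , q , certified
      (nonempty D) (distinct D) (λ c → ∈-resp-↭ p) (λ c → ∈-resp-↭ (↭-sym p)) s
      (λ c i → ring-out c (∈-resp-↭ q i))
      closed' t
      (λ s i → let (c , ci , k) , (d , di , l) = to (coloured D s) i in (c , ∈sides⇒∈owners c k , ci) , (d , ∈sides⇒∈owners d l , di))
      (λ { c ci s k (d , o , di) → from (coloured D s) ((c , ci , subst (s ∈_) (sym (sides≡edges c)) k) , (d , di , ∈owners⇒∈sides s o)) })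
      (one-colour D)
    where
    open Function.Bundles.Equivalence
    closed' : ∀ c → c ∈ area → ∀ d → d ∈ neighbours c → d ∈ area ⊎ d ∈ ring
    closed' c i d j with d ∈? area
    ... | yes k = inl k
    ... | no n = inr (∈-resp-↭ (↭-sym q) (∈-filter⁺ (∉? area) (neighbour∈box c i d j) n))

-- Programs that check regions and tilings

point seg : U
point = int ⊗ int
seg = axis ⊗ point

eqAxis : Eq axis
eqAxis = mapP (λ {y} → inj (fst y) (snd y)) (cong axisBit) (eqP eqBool (axisBitF ∘F fstF {axis} {axis}) (axisBitF ∘F sndF {axis} {axis}))
  where
  axisBit : Axis → Bool
  axisBit horizontal = false
  axisBit vertical = true
  axisBitF : PF {axis} {bool} axisBit
  axisBitF = caseAxisF {h = λ a _ → axisBit a} idF (constF {A = bool} false) (constF {A = bool} true)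
  inj : ∀ a b → axisBit a ≡ axisBit b → a ≡ b
  inj horizontal horizontal _ = refl
  inj vertical vertical _ = refl

eqPt : Eq point
eqPt = eqPair eqInt eqInt

eqSeg : Eq seg
eqSeg = eqPair eqAxis eqPt

xF : PF {point} {int} fst
xF = fstF {int} {int}

yF : PF {point} {int} snd
yF = sndF {int} {int}

eastF : PF {point} {point} east
eastF = sucF ∘F xF ,F yF

westF : PF {point} {point} west
westF = predF ∘F xF ,F yF

northF : PF {point} {point} north
northF = xF ,F sucF ∘F yF

southF : PF {point} {point} south
southF = xF ,F predF ∘F yF

edgesF : PF {point} {list seg} edges
edgesF = (constF {A = axis} horizontal ,F idF) ∷F (constF {A = axis} horizontal ,F northF) ∷F
  (constF {A = axis} vertical ,F idF) ∷F (constF {A = axis} vertical ,F eastF) ∷F nilF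

neighboursF : PF {point} {list point} neighbours
neighboursF = eastF ∷F westF ∷F northF ∷F southF ∷F nilF

ownersF : PF {seg} {list point} owners
ownersF = extF (λ { (horizontal , p) → refl ; (vertical , p) → refl })
  (caseAxisF {h = λ a γ → owners (a , snd γ)} (fstF {axis} {point}) (p ∷F (southF ∘F p) ∷F nilF) (p ∷F (westF ∘F p) ∷F nilF))
  where
  p : PF {seg} {point} snd
  p = sndF {axis} {point}

memberP : ∀ {Γ A} {x : El Γ → El A} {xs : El Γ → List (El A)} → Eq A → PF {Γ} {A} x → PF {Γ} {list A} xs →
  Prd Γ (λ γ → x γ ∈ xs γ)
memberP {Γ} {A} {x} {xs} e p q = mapP (λ { {γ} (a , i , eq) → subst (_∈ xs γ) eq i }) (λ {γ} i → x γ , i , refl)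
  (anyP {A = A} q (eqP e (sndF {Γ} {A}) (p ∘F fstF {Γ} {A})))

nullP : ∀ {Γ A} {xs : El Γ → List (El A)} → PF {Γ} {list A} xs → Prd Γ (λ γ → xs γ ≡ [])
nullP {Γ} {A} {xs} p = mapP (λ {γ} → to' (xs γ)) (λ {γ} e → cong (λ l → caseList l true (λ _ → false)) e)
  (trueP (nullF {A = A} {B = bool} p (constF {A = bool} true) (constF {A = bool} false)))
  where
  to' : (l : List (El A)) → caseList l true (λ _ → false) ≡ true → l ≡ []
  to' [] _ = refl

linkedP : Prd (point ⊗ list point) (λ y → Linked (fst y) (snd y))
linkedP = nullP {A = point} (sndF {point} {list point}) ⊎P anyP {A = point} (sndF {point} {list point})
  (eqP eqPt c d ⊎P memberP eqPt d (neighboursF ∘F c))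
  where
  c : PF {(point ⊗ list point) ⊗ point} {point} (λ y → fst (fst y))
  c = fstF {point} {list point} ∘F fstF
  d : PF {(point ⊗ list point) ⊗ point} {point} snd
  d = sndF

module _ {Γ : U} {cs order ring : El Γ → List Cell} {bs : El Γ → List (Segment × Colour)}
  (csF : PF {Γ} {list point} cs) (bsF : PF {Γ} {list (seg ⊗ nat)} bs)
  (orderF : PF {Γ} {list point} order) (ringF : PF {Γ} {list point} ring) where

  orderedP : ∀ {l : El Γ → List Cell} → PF {Γ} {list point} l → Prd Γ (λ γ → Scan Linked [] (l γ))
  orderedP p = scanP {A = point} p (substP linkedP (sndF {Γ} {point ⊗ list point}))

  subsetP : ∀ {l m : El Γ → List Cell} → PF {Γ} {list point} l → PF {Γ} {list point} m → Prd Γ (λ γ → ∀ c → c ∈ l γ → c ∈ m γ)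
  subsetP p q = allP {A = point} p (memberP eqPt (sndF {Γ} {point}) (q ∘F fstF {Γ} {point}))

  segsF : PF {Γ} {list seg} (λ γ → map fst (bs γ))
  segsF = mapF {A = seg ⊗ nat} bsF (fstF {seg} {nat} ∘F sndF)

  uniqueP : ∀ {A} {l : El Γ → List (El A)} → Eq A → PF {Γ} {list A} l → Prd Γ (λ γ → Unique (l γ))
  uniqueP {A} e p = allPairsP {A = A} {R = λ _ a b → a ≢ b} (λ n eq → n (sym eq)) p
    (¬P (eqP e (sndF {Γ} {A} ∘F fstF {Γ ⊗ A} {A}) (sndF {Γ ⊗ A} {A})))

  closedP : Prd Γ (λ γ → ∀ c → c ∈ cs γ → ∀ d → d ∈ neighbours c → d ∈ cs γ ⊎ d ∈ ring γ)
  closedP = allP {A = point} csF (allP {A = point} (neighboursF ∘F sndF {Γ} {point})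
    (memberP eqPt (sndF {Γ ⊗ point} {point}) (csF ∘F fstF {Γ} {point} ∘F fstF) ⊎P
     memberP eqPt (sndF {Γ ⊗ point} {point}) (ringF ∘F fstF {Γ} {point} ∘F fstF)))

  boundary⊆P : Prd Γ (λ γ → ∀ s → s ∈ map fst (bs γ) →
    (∃[ c ] (c ∈ owners s × c ∈ cs γ)) × (∃[ c ] (c ∈ owners s × c ∉ cs γ)))
  boundary⊆P = allP {A = seg} segsF
    (anyP {A = point} own mem ×P anyP {A = point} own (¬P mem))
    where
    own : PF {Γ ⊗ seg} {list point} (λ y → owners (snd y))
    own = ownersF ∘F sndF {Γ} {seg}
    mem : Prd ((Γ ⊗ seg) ⊗ point) (λ y → snd y ∈ cs (fst (fst y)))
    mem = memberP eqPt (sndF {Γ ⊗ seg} {point}) (csF ∘F fstF {Γ} {seg} ∘F fstF)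

  boundary⊇P : Prd Γ (λ γ → ∀ c → c ∈ cs γ → ∀ s → s ∈ edges c → (∃[ d ] (d ∈ owners s × d ∉ cs γ)) → s ∈ map fst (bs γ))
  boundary⊇P = allP {A = point} csF (allP {A = seg} (edgesF ∘F sndF {Γ} {point})
    (anyP {A = point} (ownersF ∘F sndF {Γ ⊗ point} {seg})
       (¬P (memberP eqPt (sndF {(Γ ⊗ point) ⊗ seg} {point}) (csF ∘F fstF {Γ} {point} ∘F fstF {Γ ⊗ point} {seg} ∘F fstF)))
     →P memberP eqSeg (sndF {Γ ⊗ point} {seg}) (segsF ∘F fstF {Γ} {point} ∘F fstF)))

  certifiedP : Prd Γ (λ γ → Certified (cs γ) (bs γ) (order γ) (ring γ))
  certifiedP = mapP
    (λ { (a , b , c , d , e , f , g , h , i , j , k) → certified a b c d e f g h i j k })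
    (λ { (certified a b c d e f g h i j k) → (a , b , c , d , e , f , g , h , i , j , k) })
    (¬P (nullP {A = point} csF) ×P uniqueP eqPt csF ×P subsetP orderF csF ×P subsetP csF orderF ×P orderedP orderF ×P
     allP {A = point} ringF (¬P (memberP eqPt (sndF {Γ} {point}) (csF ∘F fstF {Γ} {point}))) ×P
     closedP ×P orderedP ringF ×P boundary⊆P ×P boundary⊇P ×P uniqueP eqSeg segsF)

addNatF : ∀ n → PF {int} {int} (λ z → z ℤ.+ (+ n))
addNatF zero = extF (λ z → sym (Z.+-identityʳ z)) idF
addNatF (suc n) = extF (λ z → lemma z (+ n)) (sucF ∘F addNatF n)
  where
  lemma : ∀ y n → 1ℤ ℤ.+ (y ℤ.+ n) ≡ y ℤ.+ (1ℤ ℤ.+ n)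
  lemma y n = sym (Z.+-assoc 1ℤ y n) ∙ cong (ℤ._+ n) (Z.+-comm 1ℤ y) ∙ Z.+-assoc y 1ℤ n

subNatF : ∀ n → PF {int} {int} (λ z → z ℤ.+ -[1+ n ])
subNatF zero = extF (λ z → Z.+-comm -[1+ 0 ] z) predF
subNatF (suc n) = extF (λ z → (Z.+-comm -[1+ 0 ] (z ℤ.+ -[1+ n ])) ∙ (Z.+-assoc z -[1+ n ] -[1+ 0 ]) ∙
    cong (λ k → z ℤ.+ -[1+ suc k ]) (+-identityʳ n)) (predF ∘F subNatF n)

addF : ∀ c → PF {int} {int} (λ z → z ℤ.+ c)
addF (+ n) = addNatF n
addF -[1+ n ] = subNatF n

translateF : (d : Point) → PF {point} {point} (λ v → v ⊕ d)
translateF (a , b) = addF a ∘F xF ,F addF b ∘F yF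

translateCellsF : ∀ ds → PF {point} {list point} (λ v → translateCells v ds)
translateCellsF [] = nilF
translateCellsF (d ∷ ds) = translateF d ∷F translateCellsF ds

translateBoundaryF : ∀ bs → PF {point} {list (seg ⊗ nat)} (λ v → translateBoundary v bs)
translateBoundaryF [] = nilF
translateBoundaryF (((a , p) , k) ∷ bs) =
  ((constF {A = axis} a ,F translateF p) ,F constF {A = nat} k) ∷F translateBoundaryF bs

module _ {n : ℕ} (T : TileSet (suc n)) where

  placement : U
  placement = fin n ⊗ point

  copyCellsF : PF {placement} {list point} (copyCells T)
  copyCellsF = caseFinF n {h = λ i v → translateCells v (cells (tile T i))} (λ i → translateCellsF (cells (tile T i)))

  copyBoundaryF : PF {placement} {list (seg ⊗ nat)} (copyBoundary T)
  copyBoundaryF = caseFinF n {h = λ i v → translateBoundary v (boundary (tile T i))} (λ i → translateBoundaryF (boundary (tile T i)))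

  -- `IsTiling` with all quantifiers ranging over lists, the form in which a program can check it.
  record TilingOf (cs : List Cell) (bs : List (Segment × Colour)) (ps : List (Placement T)) : Set where
    constructor tilingOf
    field
      covered : ∀ c → c ∈ cs → ∃[ p ] (p ∈ ps × c ∈ copyCells T p)
      within' : ∀ p → p ∈ ps → ∀ c → c ∈ copyCells T p → c ∈ cs
      apart : AllPairs (λ p q → ∀ c → c ∈ copyCells T p → ¬ c ∈ copyCells T q) ps
      agree : ∀ p → p ∈ ps → ∀ q → q ∈ ps → ∀ x → x ∈ copyBoundary T p → ∀ y → y ∈ copyBoundary T q → fst x ≡ fst y → snd x ≡ snd y
      rim : ∀ p → p ∈ ps → ∀ x → x ∈ copyBoundary T p → ∀ y → y ∈ bs → fst x ≡ fst y → snd x ≡ snd y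

  tilingOf⇒isTiling : ∀ {D ps} → TilingOf (cells D) (boundary D) ps → IsTiling T D ps
  tilingOf⇒isTiling t = record
    { union = λ c → mk⇔ (covered c) (λ { (p , i , j) → within' p i c j })
    ; disjoint = AllPairs.map (λ h c (i , j) → h c i j) apart
    ; matching = λ p q i j s a b k l → agree p i q j (s , a) k (s , b) l refl
    ; border = λ p i s a b k l → rim p i (s , a) k (s , b) l refl }
    where open TilingOf t

  isTiling⇒tilingOf : ∀ {D ps} → IsTiling T D ps → TilingOf (cells D) (boundary D) ps
  isTiling⇒tilingOf t = tilingOf
    (λ c → Equivalence.to (union c))
    (λ p i c j → Equivalence.from (union c) (p , i , j))
    (AllPairs.map (λ h c i j → h c (i , j)) disjoint)
    (λ { p i q j (s , a) k (.s , b) l refl → matching p q i j s a b k l })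
    (λ { p i (s , a) k (.s , b) l refl → border p i s a b k l })
    where open IsTiling t

  module _ {Γ : U} {cs : El Γ → List Cell} {bs : El Γ → List (Segment × Colour)} {ps : El Γ → List (Placement T)}
    (csF : PF {Γ} {list point} cs) (bsF : PF {Γ} {list (seg ⊗ nat)} bs) (psF : PF {Γ} {list placement} ps) where
    B : U
    B = seg ⊗ nat

    sameP : ∀ {Δ} {x y : El Δ → Segment × Colour} → PF {Δ} {B} x → PF {Δ} {B} y →
      Prd Δ (λ γ → fst (x γ) ≡ fst (y γ) → snd (x γ) ≡ snd (y γ))
    sameP p q = eqP eqSeg (fstF {seg} {nat} ∘F p) (fstF {seg} {nat} ∘F q) →P eqP eqNat (sndF {seg} {nat} ∘F p) (sndF {seg} {nat} ∘F q)

    tilingP : Prd Γ (λ γ → TilingOf (cs γ) (bs γ) (ps γ))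
    tilingP = mapP (λ { (a , b , c , d , e) → tilingOf a b c d e }) (λ { (tilingOf a b c d e) → a , b , c , d , e })
      (allP {A = point} csF (anyP {A = placement} (psF ∘F fstF {Γ} {point})
         (memberP eqPt (sndF {Γ} {point} ∘F fstF {Γ ⊗ point} {placement}) (copyCellsF ∘F sndF {Γ ⊗ point} {placement}))) ×P
       allP {A = placement} psF (allP {A = point} (copyCellsF ∘F sndF {Γ} {placement})
         (memberP eqPt (sndF {Γ ⊗ placement} {point}) (csF ∘F fstF {Γ} {placement} ∘F fstF))) ×P
       allPairsP {A = placement} {R = λ _ p q → ∀ c → c ∈ copyCells T p → ¬ c ∈ copyCells T q} (λ h c i j → h c j i) psF
         (allP {A = point} (copyCellsF ∘F sndF {Γ} {placement} ∘F fstF {Γ ⊗ placement} {placement})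
           (¬P (memberP eqPt (sndF {(Γ ⊗ placement) ⊗ placement} {point}) (copyCellsF ∘F sndF {Γ ⊗ placement} {placement} ∘F fstF)))) ×P
       allP {A = placement} psF (allP {A = placement} (psF ∘F fstF {Γ} {placement})
         (allP {A = B} (copyBoundaryF ∘F sndF {Γ} {placement} ∘F fstF {Γ ⊗ placement} {placement})
           (allP {A = B} (copyBoundaryF ∘F sndF {Γ ⊗ placement} {placement} ∘F fstF {(Γ ⊗ placement) ⊗ placement} {B})
             (sameP (sndF {(Γ ⊗ placement) ⊗ placement} {B} ∘F fstF {((Γ ⊗ placement) ⊗ placement) ⊗ B} {B}) sndF)))) ×P
       allP {A = placement} psF (allP {A = B} (copyBoundaryF ∘F sndF {Γ} {placement})
         (allP {A = B} (bsF ∘F fstF {Γ} {placement} ∘F fstF {Γ ⊗ placement} {B})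
           (sameP (sndF {Γ ⊗ placement} {B} ∘F fstF {(Γ ⊗ placement) ⊗ B} {B}) sndF))))

encodeCellsBoundary : List Cell → List (Segment × Colour) → Word
encodeCellsBoundary cs bs = encodeList encodePoint cs ++ encodeList encodeColouredSegment bs

encodePointF : PF {point} {list bool} encodePoint
encodePointF = (encodeℤF ∘F xF) ++ʷ (encodeℤF ∘F yF)

encodeColouredSegmentF : PF {seg ⊗ nat} {list bool} encodeColouredSegment
encodeColouredSegmentF = (caseAxisF {h = λ a _ → encodeAxis a} (fstF {axis} {point} ∘F fstF {seg} {nat})
    (constF {A = list bool} (false ∷ [])) (constF {A = list bool} (true ∷ []))) ++ʷ ((encodePointF ∘F sndF {axis} {point} ∘F fstF {seg} {nat}) ++ʷ (encodeℕF ∘F sndF {seg} {nat}))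

encodeCellsBoundaryF : ∀ {Γ} {cs : El Γ → List Cell} {bs : El Γ → List (Segment × Colour)} →
  PF {Γ} {list point} cs → PF {Γ} {list (seg ⊗ nat)} bs → PF {Γ} {list bool} (λ γ → encodeCellsBoundary (cs γ) (bs γ))
encodeCellsBoundaryF p q = (encodeListF encodePointF ∘F p) ++ʷ (encodeListF encodeColouredSegmentF ∘F q)

-- Certificates of polynomial size, and membership in NP

codeSize : ∀ A → El A → ℕ
codeSize A x = size (codeTree A x)

-- The extra one on the left pays for the node that joins two codes, so the estimate passes to pairs
-- and lists.
Compact : (A : U) → (El A → Word) → Set
Compact A e = ∀ x → suc (codeSize A x) ≤ 4 * length (e x)

length-encodeℕᵇ : ∀ b → length (encodeℕᵇ b) ≡ suc (2 * length (digits b))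
length-encodeℕᵇ ℕᵇ.zero = refl
length-encodeℕᵇ 2[1+ b ] = cong (λ k → 2 + k) (length-encodeℕᵇ b) ∙ lemma (length (digits b))
  where
  lemma : ∀ l → 2 + suc (2 * l) ≡ suc (2 * suc l)
  lemma = solve-∀
length-encodeℕᵇ 1+[2 b ] = cong (λ k → 2 + k) (length-encodeℕᵇ b) ∙ lemma (length (digits b))
  where
  lemma : ∀ l → 2 + suc (2 * l) ≡ suc (2 * suc l)
  lemma = solve-∀

compact-nat : Compact nat encodeℕ
compact-nat n rewrite length-encodeℕᵇ (ℕᵇ.fromℕ n) = s≤s (size-wordTree (natDigits n)) »
  m≤m+n _ (2 + 4 * length (natDigits n)) » ≤-reflexive (lemma (length (natDigits n)))
  where
  lemma : ∀ d → suc (1 + 4 * d) + (2 + 4 * d) ≡ 4 * suc (2 * d)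
  lemma = solve-∀

size-intDigits : ∀ z → codeSize int z ≤ 5 + 4 * length (snd (intDigits z))
size-intDigits z = size-codeSD (intDigits z) _ ≤-refl

compact-int : Compact int encodeℤ
compact-int (+ n) = s≤s (size-intDigits (+ n)) » m≤m+n _ (2 + 4 * length (natDigits n)) »
  ≤-reflexive (lemma (length (natDigits n)) ∙ cong (λ l → 4 * suc l) (sym (length-encodeℕᵇ (ℕᵇ.fromℕ n))))
  where
  lemma : ∀ d → suc (5 + 4 * d) + (2 + 4 * d) ≡ 4 * suc (suc (2 * d))
  lemma = solve-∀
compact-int -[1+ n ] = s≤s (size-intDigits -[1+ n ]) » m≤m+n _ (2 + 4 * length (natDigits n)) »
  ≤-reflexive (lemma (length (natDigits n)) ∙ cong (λ l → 4 * suc l) (sym (length-encodeℕᵇ (ℕᵇ.fromℕ n))))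
  where
  lemma : ∀ d → suc (5 + 4 * d) + (2 + 4 * d) ≡ 4 * suc (suc (2 * d))
  lemma = solve-∀

compact-axis : Compact axis encodeAxis
compact-axis horizontal = s≤s (s≤s z≤n)
compact-axis vertical = ≤-refl

compact-⊗ : ∀ {a b} {v w : Word} → suc a ≤ 4 * length v → suc b ≤ 4 * length w → suc (suc (a + b)) ≤ 4 * length (v ++ w)
compact-⊗ {a} {b} {v} {w} p q = ≤-reflexive (cong suc (sym (+-suc a b))) »
  +-mono-≤ p q » ≤-reflexive (sym (*-distribˡ-+ 4 (length v) (length w)) ∙ cong (4 *_) (sym (length-++ v)))

compact-point : Compact point encodePoint
compact-point (x , y) = compact-⊗ {v = encodeℤ x} {encodeℤ y} (compact-int x) (compact-int y)

compact-coloured : Compact (seg ⊗ nat) encodeColouredSegment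
compact-coloured ((a , p) , k) = compact-⊗ {v = encodeAxis a ++ encodePoint p} {encodeℕ k}
    (compact-⊗ {v = encodeAxis a} {encodePoint p} (compact-axis a) (compact-point p)) (compact-nat k) »
  ≤-reflexive (cong (λ w → 4 * length w) (Data.List.Properties.++-assoc (encodeAxis a) (encodePoint p) (encodeℕ k)))

compact-list : ∀ {A e} → Compact A e → Compact (list A) (encodeList e)
compact-list h [] = s≤s (s≤s z≤n)
compact-list {A} {e} h (x ∷ xs) = s≤s (n≤1+n _) » s≤s (compact-⊗ {v = e x} {encodeList e xs} (h x) (compact-list {A} {e} h xs)) »
  +-monoˡ-≤ (4 * length (e x ++ encodeList e xs)) {1} {4} (s≤s z≤n) » ≤-reflexive (lemma (length (e x ++ encodeList e xs)))
  where
  lemma : ∀ l → 4 + 4 * l ≡ 4 * suc l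
  lemma = solve-∀

exchange : ∀ x y s → 1 + (x + (1 + (y + s))) ≡ 1 + (y + (1 + (x + s)))
exchange = solve-∀

codeSize-↭ : ∀ {A} {xs ys : List (El A)} → xs ↭ ys → codeSize (list A) xs ≡ codeSize (list A) ys
codeSize-↭ refl = refl
codeSize-↭ {A} (prep x p) = cong (λ s → suc (codeSize A x + s)) (codeSize-↭ p)
codeSize-↭ {A} (swap {xs} {ys} x y p) = cong (λ s → suc (codeSize A x + suc (codeSize A y + s))) (codeSize-↭ p) ∙
  exchange (codeSize A x) (codeSize A y) (codeSize (list A) ys)
codeSize-↭ (↭trans p q) = codeSize-↭ p ∙ codeSize-↭ q

codeSize-∈ : ∀ {A x} {xs : List (El A)} → x ∈ xs → codeSize A x ≤ codeSize (list A) xs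
codeSize-∈ 1st = m≤m+n _ _ » n≤1+n _
codeSize-∈ (there i) = codeSize-∈ i » m≤n+m _ _ » n≤1+n _

length≤codeSize : ∀ {A} (xs : List (El A)) → length xs ≤ codeSize (list A) xs
length≤codeSize [] = z≤n
length≤codeSize (x ∷ xs) = s≤s (length≤codeSize xs » m≤n+m _ _)

codeSize-all : ∀ {A} M (xs : List (El A)) → (∀ x → x ∈ xs → codeSize A x ≤ M) → codeSize (list A) xs ≤ 1 + length xs * suc M
codeSize-all M [] h = ≤-refl
codeSize-all M (x ∷ xs) h = s≤s (+-mono-≤ (h x 1st) (codeSize-all M xs (λ y i → h y (there i)))) »
  ≤-reflexive (lemma M (length xs * suc M))
  where
  lemma : ∀ M l → suc (M + (1 + l)) ≡ 1 + (suc M + l)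
  lemma = solve-∀

codeSize-suc : ∀ z → codeSize int (ℤ.suc z) ≤ 9 + 4 * length (snd (intDigits z))
codeSize-suc z = size-codeSD (intDigits (ℤ.suc z)) _
    (≤-reflexive (cong (length ∘ snd) (cong (intDigits ∘ ℤ.suc) (sym (toInt-intDigits z)) ∙
      cong intDigits (sym (toInt-up (intDigits z))) ∙ intDigits-toInt (up (intDigits z)))) »
    length-up (intDigits z)) » ≤-reflexive (lemma (length (snd (intDigits z))))
  where
  lemma : ∀ d → 5 + 4 * suc d ≡ 9 + 4 * d
  lemma = solve-∀

length-down : ∀ x → length (snd (down x)) ≤ suc (length (snd x))
length-down (true , ds) = length-increment ds
length-down (false , []) = z≤n
length-down (false , d ∷ ds) = length-decrement (d ∷ ds)

codeSize-pred : ∀ z → codeSize int (ℤ.pred z) ≤ 9 + 4 * length (snd (intDigits z))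
codeSize-pred z = size-codeSD (intDigits (ℤ.pred z)) _
    (≤-reflexive (cong (length ∘ snd) (cong (intDigits ∘ ℤ.pred) (sym (toInt-intDigits z)) ∙
      cong intDigits (sym (toInt-down (intDigits z))) ∙ intDigits-toInt (down (intDigits z)))) »
    length-down (intDigits z)) » ≤-reflexive (lemma (length (snd (intDigits z))))
  where
  lemma : ∀ d → 5 + 4 * suc d ≡ 9 + 4 * d
  lemma = solve-∀

length-intDigits : ∀ z → length (snd (intDigits z)) ≤ codeSize int z
length-intDigits z = len (snd (intDigits z)) » m≤n+m _ (size (bitTree (fst (intDigits z)))) » n≤1+n _
  where
  len : ∀ w → length w ≤ size (wordTree w)
  len [] = z≤n
  len (b ∷ w) = s≤s (len w » m≤n+m _ (size (bitTree b)))

codeSize-spread : ∀ (f : Cell → ℤ) (cs : List Cell) M → (∀ c → c ∈ cs → codeSize int (f c) ≤ M) →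
  ∀ z → z ∈ concatMap (around f) cs → codeSize int z ≤ 9 + 4 * M
codeSize-spread f cs M h z i with c , j , k ← find (∈-concatMap⁻ (around f) {xs = cs} i) with k
... | 1st = codeSize-pred (f c) » +-monoʳ-≤ 9 (*-monoʳ-≤ 4 (length-intDigits (f c) » h c j))
... | 2nd = h c j » m≤m+n M (3 * M) » m≤n+m _ 9
... | 3rd = codeSize-suc (f c) » +-monoʳ-≤ 9 (*-monoʳ-≤ 4 (length-intDigits (f c) » h c j))

length-spread : ∀ (f : Cell → ℤ) (cs : List Cell) → length (concatMap (around f) cs) ≡ 3 * length cs
length-spread f [] = refl
length-spread f (c ∷ cs) = cong (λ k → 3 + k) (length-spread f cs) ∙ sym (*-suc 3 (length cs))

length-product : ∀ {A B : Set} (xs : List A) (ys : List B) → length (cartesianProduct xs ys) ≡ length xs * length ys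
length-product [] ys = refl
length-product (x ∷ xs) ys = length-++ (map (x ,_) ys) ∙ (cong₂ _+_ (length-map (x ,_) ys) (length-product xs ys))

-- Each list of coordinates has three entries per cell, and their numerals are at most one digit
-- longer than those of the region.
ringOf-size : ∀ D M → codeSize (list point) (cells D) ≤ M →
  codeSize (list point) (ringOf D) ≤ 1 + (3 * M) * (3 * M) * suc (19 + 8 * M)
ringOf-size D M h = codeSize-all (19 + 8 * M) (ringOf D) small » s≤s (*-monoˡ-≤ (suc (19 + 8 * M)) few)
  where
  cell : ∀ c → c ∈ cells D → codeSize point c ≤ M
  cell c i = codeSize-∈ {point} i » h
  few : length (ringOf D) ≤ (3 * M) * (3 * M)
  few = length-filter (∉? (cells D)) (box D) »
    ≤-reflexive (length-product (concatMap (around fst) (cells D)) _) »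
      *-mono-≤ (spr fst) (spr snd)
    where
    spr : ∀ (f : Cell → ℤ) → length (concatMap (around f) (cells D)) ≤ 3 * M
    spr f = ≤-reflexive (length-spread f (cells D)) » *-monoʳ-≤ 3 (length≤codeSize {point} (cells D) » h)
  small : ∀ c → c ∈ ringOf D → codeSize point c ≤ 19 + 8 * M
  small (x , y) i
    with j , k ← ∈-cartesianProduct⁻ (concatMap (around fst) (cells D)) (concatMap (around snd) (cells D))
        (fst (∈-filter⁻ (∉? (cells D)) {xs = box D} i))
    = s≤s (+-mono-≤ (codeSize-spread fst (cells D) M (λ c m → (m≤m+n _ _ » n≤1+n _) » cell c m) x j)
        (codeSize-spread snd (cells D) M (λ c m → (m≤n+m _ (codeSize int (fst c)) » n≤1+n _) » cell c m) y k)) »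
      ≤-reflexive (lemma M)
    where
    lemma : ∀ M → suc (9 + 4 * M + (9 + 4 * M)) ≡ 19 + 8 * M
    lemma = solve-∀

unique-length : ∀ {A : Set} {xs : List A} ys → Unique xs → (∀ x → x ∈ xs → x ∈ ys) → length xs ≤ length ys
unique-length ys [] h = z≤n
unique-length {xs = x ∷ xs} ys (n ∷ u) h with as , bs , refl ← ∈-∃++ (h x 1st) =
  s≤s (unique-length (as ++ bs) u rest) » ≤-reflexive (cong suc (length-++ as) ∙
    sym (+-suc (length as) (length bs)) ∙ sym (length-++ as))
  where
  rest : ∀ y → y ∈ xs → y ∈ as ++ bs
  rest y i with ∈-++⁻ as (h y (there i))
  ... | inl j = ∈-++⁺ˡ j
  ... | inr 1st = ⊥-elim (All.lookup n i refl)
  ... | inr (there j) = ∈-++⁺ʳ as j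

module _ {n : ℕ} (T : TileSet (suc n)) (origin : ∀ i → (0ℤ , 0ℤ) ∈ cells (tile T i)) where
  corner∈ : ∀ i v → v ∈ copyCells T (i , v)
  corner∈ i v = subst (_∈ copyCells T (i , v)) (cong₂ _,_ (Z.+-identityʳ (fst v)) (Z.+-identityʳ (snd v)))
    (∈-map⁺ (v ⊕_) (origin i))

  -- Every tile contains the cell at the origin, so different placements put it on different cells
  -- of the region. For the same reason their translation vectors are cells of the region, hence
  -- short.
  length-placements : ∀ {cs bs ps} → TilingOf T cs bs ps → length ps ≤ length cs
  length-placements {cs} {bs} {ps} t = subst (_≤ length cs) (length-map snd ps)
    (unique-length cs (distinct-corners apart) inside)
    where
    open TilingOf t
    distinct-corners : ∀ {ps} → AllPairs (λ p q → ∀ c → c ∈ copyCells T p → ¬ c ∈ copyCells T q) ps → Unique (map snd ps)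
    distinct-corners [] = []
    distinct-corners {(i , v) ∷ ps} (h ∷ hs) = All.tabulate (λ {w} k e → no-repeat w k e) ∷ distinct-corners hs
      where
      no-repeat : ∀ w → w ∈ map snd ps → v ≢ w
      no-repeat w k refl with (j , .v) , l , refl ← ∈-map⁻ snd k = All.lookup h l v (corner∈ i v) (corner∈ j v)
    inside : ∀ v → v ∈ map snd ps → v ∈ cs
    inside v k with (i , .v) , l , refl ← ∈-map⁻ snd k = within' _ l v (corner∈ i v)

  size-fin : ∀ n i → codeSize (fin n) i ≤ suc (2 * n)
  size-fin n zero = s≤s z≤n
  size-fin (suc n) (suc i) = s≤s (s≤s (size-fin n i)) » ≤-reflexive (lemma n)
    where
    lemma : ∀ n → 3 + 2 * n ≡ 1 + 2 * (1 + n)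
    lemma = solve-∀

  size-placements : ∀ {cs bs ps} M → TilingOf T cs bs ps → codeSize (list point) cs ≤ M →
    codeSize (list (placement T)) ps ≤ 1 + M * suc (suc (suc (2 * n) + M))
  size-placements {cs} {bs} {ps} M t h = codeSize-all {placement T} (suc (suc (2 * n) + M)) ps (λ { (i , v) k → s≤s (+-mono-≤ (size-fin n i)
      (codeSize-∈ {point} (within' _ k v (corner∈ i v)) » h)) }) »
    s≤s (*-monoˡ-≤ (suc (suc (suc (2 * n) + M))) (length-placements t » length≤codeSize {point} cs » h))
    where open TilingOf t

  Γ C : U
  C = list point ⊗ list (seg ⊗ nat) ⊗ list point ⊗ list point ⊗ list (placement T)
  Γ = list bool ⊗ C

  -- The certificate repeats the cells and the boundary: the verifier encodes them and compares,
  -- which spares it the parsing of the word.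
  Good : Word × El C → Set
  Good (w , cs , bs , order , ring , ps) = (encodeCellsBoundary cs bs ≡ w) × Certified cs bs order ring × TilingOf T cs bs ps

  goodP : Prd Γ Good
  goodP = eqP eqWord (encodeCellsBoundaryF csF bsF) (fstF {list bool} {C}) ×P certifiedP csF bsF orderF ringF ×P tilingP T csF bsF psF
    where
    C₁ = list (seg ⊗ nat) ⊗ list point ⊗ list point ⊗ list (placement T)
    C₂ = list point ⊗ list point ⊗ list (placement T)
    C₃ = list point ⊗ list (placement T)
    csF : PF {Γ} {list point} (λ γ → fst (snd γ))
    csF = fstF {list point} {C₁} ∘F sndF
    r₁ : PF {Γ} {C₁} (λ γ → snd (snd γ))
    r₁ = sndF {list point} {C₁} ∘F sndF
    bsF : PF {Γ} {list (seg ⊗ nat)} (λ γ → fst (snd (snd γ)))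
    bsF = fstF {list (seg ⊗ nat)} {C₂} ∘F r₁
    r₂ : PF {Γ} {C₂} (λ γ → snd (snd (snd γ)))
    r₂ = sndF {list (seg ⊗ nat)} {C₂} ∘F r₁
    orderF : PF {Γ} {list point} (λ γ → fst (snd (snd (snd γ))))
    orderF = fstF {list point} {C₃} ∘F r₂
    r₃ : PF {Γ} {C₃} (λ γ → snd (snd (snd (snd γ))))
    r₃ = sndF {list point} {C₃} ∘F r₂
    ringF : PF {Γ} {list point} (λ γ → fst (snd (snd (snd (snd γ)))))
    ringF = fstF {list point} {list (placement T)} ∘F r₃
    psF : PF {Γ} {list (placement T)} (λ γ → snd (snd (snd (snd (snd γ)))))
    psF = sndF {list point} {list (placement T)} ∘F r₃

  ringBound placementsBound certificateBound : Pol
  ringBound = con 1 ⊞ (con 12 ⊠ X) ⊠ (con 12 ⊠ X) ⊠ (con 20 ⊞ con 32 ⊠ X)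
  placementsBound = con 1 ⊞ (con 4 ⊠ X) ⊠ (con (3 + 2 * n) ⊞ con 4 ⊠ X)
  certificateBound = con 4 ⊞ (con 4 ⊠ X ⊞ (con 4 ⊠ X ⊞ (con 4 ⊠ X ⊞ (ringBound ⊞ placementsBound))))

  sound' : ∀ w c → Good (w , c) → TilingProblem T w
  sound' w (cs , bs , order , ring , ps) (e , V , t) = toRegion V , e , ps , tilingOf⇒isTiling T t

  complete : ∀ w → TilingProblem T w → ∃[ c ] (Good (w , c) × codeSize C c ≤ ⟦ certificateBound ⟧ (length w))
  complete w (D , refl , ps , t) with order , ring , p , q , V ← region-certified D =
    (cells D , boundary D , order , ring , ps) , (refl , V , isTiling⇒tilingOf T t) , bounded
    where
    N = length (encodeRegion D)
    cells≤ : codeSize (list point) (cells D) ≤ 4 * N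
    cells≤ = n≤1+n _ » compact-list {point} {encodePoint} compact-point (cells D) »
      *-monoʳ-≤ 4 (subst (length (encodeList encodePoint (cells D)) ≤_) (sym (length-++ (encodeList encodePoint (cells D)))) (m≤m+n _ _))
    boundary≤ : codeSize (list (seg ⊗ nat)) (boundary D) ≤ 4 * N
    boundary≤ = n≤1+n _ » compact-list {seg ⊗ nat} {encodeColouredSegment} compact-coloured (boundary D) »
      *-monoʳ-≤ 4 (subst (length (encodeList encodeColouredSegment (boundary D)) ≤_) (sym (length-++ (encodeList encodePoint (cells D)))) (m≤n+m _ _))
    ring≤ : codeSize (list point) ring ≤ ⟦ ringBound ⟧ N
    ring≤ = subst (_≤ ⟦ ringBound ⟧ N) (sym (codeSize-↭ {point} q)) (ringOf-size D (4 * N) cells≤ » ≤-reflexive (lemma N))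
      where
      lemma : ∀ N → 1 + (3 * (4 * N)) * (3 * (4 * N)) * suc (19 + 8 * (4 * N)) ≡ 1 + (12 * N) * (12 * N) * (20 + 32 * N)
      lemma = solve-∀
    placements≤ : codeSize (list (placement T)) ps ≤ ⟦ placementsBound ⟧ N
    placements≤ = size-placements (4 * N) (isTiling⇒tilingOf T t) cells≤ » ≤-reflexive (lemma N n)
      where
      lemma : ∀ N n → 1 + 4 * N * suc (suc (suc (2 * n) + 4 * N)) ≡ 1 + (4 * N) * (3 + 2 * n + 4 * N)
      lemma = solve-∀
    bounded : codeSize C (cells D , boundary D , order , ring , ps) ≤ ⟦ certificateBound ⟧ N
    bounded = ≤-reflexive (lemma (codeSize (list point) (cells D)) (codeSize (list (seg ⊗ nat)) (boundary D)) (codeSize (list point) order) (codeSize (list point) ring) (codeSize (list (placement T)) ps)) »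
      +-monoʳ-≤ 4 (+-mono-≤ cells≤ (+-mono-≤ boundary≤ (+-mono-≤ (subst (_≤ 4 * N) (sym (codeSize-↭ {point} p)) cells≤) (+-mono-≤ ring≤ placements≤))))
      where
      lemma : ∀ a b c d e → 1 + (a + (1 + (b + (1 + (c + (1 + (d + e))))))) ≡ 4 + (a + (b + (c + (d + e))))
      lemma = solve-∀

  TilingProblem∈NP : NP (TilingProblem T)
  TilingProblem∈NP = NP-intro C goodP certificateBound sound' complete

-- The fourteen tiles

rawP : Prd (list point ⊗ list (seg ⊗ nat) ⊗ list point ⊗ list point) (λ γ → Certified (fst γ) (fst (snd γ)) (fst (snd (snd γ))) (snd (snd (snd γ))))
rawP = certifiedP
  (fstF {list point} {list (seg ⊗ nat) ⊗ list point ⊗ list point})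
  (fstF {list (seg ⊗ nat)} {list point ⊗ list point} ∘F sndF {list point} {list (seg ⊗ nat) ⊗ list point ⊗ list point})
  (fstF {list point} {list point} ∘F sndF {list (seg ⊗ nat)} {list point ⊗ list point} ∘F sndF {list point} {list (seg ⊗ nat) ⊗ list point ⊗ list point})
  (sndF {list point} {list point} ∘F sndF {list (seg ⊗ nat)} {list point ⊗ list point} ∘F sndF {list point} {list (seg ⊗ nat) ⊗ list point ⊗ list point})

-- A tile is shown to be a simply connected coloured polyomino by evaluating the test that the
-- verifier uses.
fromTests : ∀ cs bs order ring → test rawP (cs , bs , order , ring) ≡ true → ColouredPolyomino
fromTests cs bs order ring e = toRegion (to-reflects (reflects rawP (cs , bs , order , ring)) e)

-- Colours 0 and 1 are bits on wires, 2 marks the staircase on the left of the region, and 3, 4 and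
-- 5 are the inks of the devices that pass, swap and apply the gate.
bit# : Bool → Colour
bit# false = 0
bit# true = 1

at : Axis → ℕ → ℕ → Colour → Segment × Colour
at a x y k = (a , + x , + y) , k

-1ℤ : ℤ
-1ℤ = -[1+ 0 ]

unitTile : (left right bottom top : Colour) → ColouredPolyomino
unitTile l r b t = fromTests ((+ 0 , + 0) ∷ [])
  (at horizontal 0 0 b ∷ at horizontal 0 1 t ∷ at vertical 0 0 l ∷ at vertical 1 0 r ∷ [])
  ((+ 0 , + 0) ∷ [])
  ((+ 1 , + 0) ∷ (+ 1 , + 1) ∷ (+ 0 , + 1) ∷ (-1ℤ , + 1) ∷ (-1ℤ , + 0) ∷ (-1ℤ , -1ℤ) ∷ (+ 0 , -1ℤ) ∷ [])
  refl

-- An L: the wire enters at the lower left and leaves upwards one column further right. The notch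
-- has the ink of `turn`, so the wire of the next row turns up inside it, and the two wires change
-- places.
longTile : Bool → ColouredPolyomino
longTile b = fromTests cs
  (at horizontal 0 0 4 ∷ at horizontal 1 0 4 ∷ at vertical 2 0 4 ∷ at vertical 2 1 4 ∷
   at horizontal 0 1 3 ∷ at vertical 1 1 3 ∷ at vertical 0 0 (bit# b) ∷ at horizontal 1 2 (bit# b) ∷ [])
  cs
  ((-1ℤ , + 0) ∷ (-1ℤ , -1ℤ) ∷ (+ 0 , -1ℤ) ∷ (+ 1 , -1ℤ) ∷ (+ 2 , -1ℤ) ∷ (+ 2 , + 0) ∷ (+ 2 , + 1) ∷
   (+ 2 , + 2) ∷ (+ 1 , + 2) ∷ (+ 0 , + 2) ∷ (+ 0 , + 1) ∷ [])
  refl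
  where
  cs : List Cell
  cs = (+ 0 , + 0) ∷ (+ 1 , + 0) ∷ (+ 1 , + 1) ∷ []

Triple : Set
Triple = Bool × Bool × Bool

gateTile : Triple → Triple → ColouredPolyomino
gateTile (i , j , k) (x , y , z) = fromTests cs
  (at horizontal 0 0 5 ∷ at horizontal 1 0 5 ∷ at horizontal 2 0 5 ∷
   at vertical 3 0 5 ∷ at vertical 3 1 5 ∷ at vertical 3 2 5 ∷
   at vertical 0 0 (bit# i) ∷ at vertical 0 1 (bit# j) ∷ at vertical 0 2 (bit# k) ∷
   at horizontal 0 3 (bit# x) ∷ at horizontal 1 3 (bit# y) ∷ at horizontal 2 3 (bit# z) ∷ [])
  cs
  ((-1ℤ , + 0) ∷ (-1ℤ , -1ℤ) ∷ (+ 0 , -1ℤ) ∷ (+ 1 , -1ℤ) ∷ (+ 2 , -1ℤ) ∷ (+ 3 , -1ℤ) ∷ (+ 3 , + 0) ∷ (+ 3 , + 1) ∷ (+ 3 , + 2) ∷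
   (+ 3 , + 3) ∷ (+ 2 , + 3) ∷ (+ 1 , + 3) ∷ (+ 0 , + 3) ∷ (-1ℤ , + 3) ∷ (-1ℤ , + 2) ∷ (-1ℤ , + 1) ∷ [])
  refl
  where
  cs : List Cell
  cs = (+ 0 , + 0) ∷ (+ 1 , + 0) ∷ (+ 2 , + 0) ∷ (+ 0 , + 1) ∷ (+ 1 , + 1) ∷ (+ 2 , + 1) ∷ (+ 0 , + 2) ∷ (+ 1 , + 2) ∷ (+ 2 , + 2) ∷ []

data Kind : Set where
  cross : (h v : Bool) → Kind
  rise turn long : Bool → Kind
  gate : Fin 4 → Kind

-- The gate relates two equal bits and a third one: a pair of ones may pass, and may be
-- exchanged for a one on the third wire, and conversely.
gateIn gateOut : Fin 4 → Triple
gateIn 0F = false , false , false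
gateIn 1F = true , true , false
gateIn 2F = false , false , true
gateIn 3F = true , true , false
gateOut 0F = false , false , false
gateOut 1F = true , true , false
gateOut 2F = true , true , false
gateOut 3F = false , false , true

-- A wire going up is made to go right by rise, and one going right is made to go up by turn.
kindTile : Kind → ColouredPolyomino
kindTile (cross h v) = unitTile (bit# h) (bit# h) (bit# v) (bit# v)
kindTile (rise b) = unitTile 2 (bit# b) (bit# b) 2
kindTile (turn b) = unitTile (bit# b) 3 3 (bit# b)
kindTile (long b) = longTile b
kindTile (gate g) = gateTile (gateIn g) (gateOut g)

kinds : Fin 14 → Kind
kinds 0F = cross false false
kinds 1F = cross false true
kinds 2F = cross true false
kinds 3F = cross true true
kinds 4F = rise false
kinds 5F = rise true
kinds 6F = turn false
kinds 7F = turn true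
kinds 8F = long false
kinds 9F = long true
kinds (suc (suc (suc (suc (suc (suc (suc (suc (suc (suc g)))))))))) = gate g

index : Kind → Fin 14
index (cross false false) = 0F
index (cross false true) = 1F
index (cross true false) = 2F
index (cross true true) = 3F
index (rise false) = 4F
index (rise true) = 5F
index (turn false) = 6F
index (turn true) = 7F
index (long false) = 8F
index (long true) = 9F
index (gate g) = suc (suc (suc (suc (suc (suc (suc (suc (suc (suc g)))))))))

kinds-index : ∀ k → kinds (index k) ≡ k
kinds-index (cross false false) = refl
kinds-index (cross false true) = refl
kinds-index (cross true false) = refl
kinds-index (cross true true) = refl
kinds-index (rise false) = refl
kinds-index (rise true) = refl
kinds-index (turn false) = refl
kinds-index (turn true) = refl
kinds-index (long false) = refl
kinds-index (long true) = refl
kinds-index (gate g) = refl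

-- An invariant of tiles under translation.
edgeWeight : Segment × Colour → ℕ
edgeWeight ((horizontal , _) , k) = 10 ^ k
edgeWeight ((vertical , _) , k) = 7 * 10 ^ k

weight : ColouredPolyomino → ℕ
weight t = sum (map edgeWeight (boundary t))

weight-same : ∀ t u → SameTile t u → weight t ≡ weight u
weight-same t u (v , _ , p) = cong sum (shifted (boundary t)) ∙ sum-↭ (↭ₚ.map⁺ edgeWeight p)
  where
  shifted : ∀ bs → map edgeWeight bs ≡ map edgeWeight (translateBoundary v bs)
  shifted [] = refl
  shifted (((horizontal , p) , k) ∷ bs) = cong (_ ∷_) (shifted bs)
  shifted (((vertical , p) , k) ∷ bs) = cong (_ ∷_) (shifted bs)

tileset : TileSet 14
tileset = record
  { tile = kindTile ∘ kinds
  ; pairwise-different = λ i j n s → n (weights-differ i j (weight-same (kindTile (kinds i)) (kindTile (kinds j)) s)) }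
  where
  -- The factors 7 and 10 are chosen such that the fourteen sums are different, which is decided by
  -- evaluation.
  weights-differ : ∀ i j → weight (kindTile (kinds i)) ≡ weight (kindTile (kinds j)) → i ≡ j
  weights-differ = toWitness {a? = Finₚ.all? λ i → Finₚ.all? λ j →
    (weight (kindTile (kinds i)) ≟ weight (kindTile (kinds j))) →-dec (i ≟F j)} _

tile-origin : ∀ i → (0ℤ , 0ℤ) ∈ cells (tile tileset i)
tile-origin i = go (kinds i)
  where
  go : ∀ k → (0ℤ , 0ℤ) ∈ cells (kindTile k)
  go (cross h v) = 1st
  go (rise b) = 1st
  go (turn b) = 1st
  go (long b) = 1st
  go (gate g) = 1st

-- The shape of the region of a list of operations

data Op : Set where
  pass swap gate : Op

width : Op → ℕ
width pass = 1
width swap = 2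
width gate = 3

ink : Op → Colour
ink pass = 3
ink swap = 4
ink gate = 5

height : List Op → ℕ
height [] = 0
height (op ∷ ops) = width op + height ops

device : Op → List (ℕ × ℕ)
device pass = (0 , 0) ∷ []
device swap = (0 , 0) ∷ (1 , 0) ∷ (1 , 1) ∷ (0 , 1) ∷ []
device gate = (0 , 0) ∷ (1 , 0) ∷ (2 , 0) ∷ (0 , 1) ∷ (1 , 1) ∷ (2 , 1) ∷ (0 , 2) ∷ (1 , 2) ∷ (2 , 2) ∷ []

row : ℕ → ℕ → ℕ → List Cell
row zero x y = []
row (suc n) x y = (+ x , + y) ∷ row n (suc x) y

-- A row has taken off a wire, so the next one starts a column further right; both end in the same
-- column, where the device begins.
rows : ℕ → ℕ → ℕ → List Cell
rows zero n r = []
rows (suc k) n r = row n r r ++ rows k (pred n) (suc r)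

wires : ℕ → ℕ → List Bool → List (Segment × Colour)
wires x y [] = []
wires x y (b ∷ q) = at horizontal x y (bit# b) ∷ wires (suc x) y q

hseg vseg : ℕ → ℕ → Segment
hseg x y = horizontal , + x , + y
vseg x y = vertical , + x , + y

line : (ℕ → Segment) → Colour → ℕ → ℕ → List (Segment × Colour)
line f k zero r = []
line f k (suc n) r = (f r , k) ∷ line f k n (suc r)

line-++ : ∀ f k w h r → line f k (w + h) r ≡ line f k w r ++ line f k h (w + r)
line-++ f k zero h r = refl
line-++ f k (suc w) h r = cong (_ ∷_) (line-++ f k w h (suc r) ∙ cong (λ z → line f k w (suc r) ++ line f k h z) (+-suc w r))

raised : ∀ w h r → w + h + r ≡ h + (w + r)
raised = solve-∀

-- Together the staircase along the diagonal: the left sides and the tops of the tiles `rise`.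
leftV leftH : ℕ → ℕ → List (Segment × Colour)
leftV = line (λ y → vseg y y) 2
leftH = line (λ y → hseg y (suc y)) 2

bottomOf rightOf : Op → ℕ → ℕ → List (Segment × Colour)
bottomOf op x y = line (λ z → hseg z y) (ink op) (width op) x
rightOf op x y = line (vseg (width op + x)) (ink op) (width op) y

translateℕ : ℕ → ℕ → List (ℕ × ℕ) → List Cell
translateℕ x y = map (λ d → + (x + fst d) , + (y + snd d))

-- The region for queues of n wires: the operation starting in row r occupies width op rows;
-- the row y among them is [ y , width op + (r + n) ).
module Block (n : ℕ) where

  cellsFrom : ℕ → List Op → List Cell
  cellsFrom r [] = []
  cellsFrom r (op ∷ ops) = (rows (width op) n r ++ translateℕ (r + n) r (device op)) ++ cellsFrom (width op + r) ops

  rightH rightV : ℕ → List Op → List (Segment × Colour)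
  rightH r [] = []
  rightH r (op ∷ ops) = bottomOf op (r + n) r ++ rightH (width op + r) ops
  rightV r [] = []
  rightV r (op ∷ ops) = rightOf op (r + n) r ++ rightV (width op + r) ops

  boundaryOf : List Op → List Bool → List Bool → List (Segment × Colour)
  boundaryOf ops u v = leftV (height ops) 0 ++ leftH (height ops) 0 ++ rightH 0 ops ++ rightV 0 ops ++
    wires 0 0 u ++ wires (height ops) (height ops) v

  Inside : ℕ → List Op → ℕ → ℕ → Set
  Inside r [] x y = ⊥
  Inside r (op ∷ ops) x y = (r ≤ y × y < width op + r × y ≤ x × x < width op + (r + n)) ⊎ Inside (width op + r) ops x y

row⇒ : ∀ n x y {c} → c ∈ row n x y → ∃[ z ] (c ≡ (+ z , + y) × x ≤ z × z < n + x)
row⇒ (suc n) x y 1st = x , refl , ≤-refl , s≤s (m≤n+m x n)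
row⇒ (suc n) x y (there i) = let z , e , le , lt = row⇒ n (suc x) y i in
  z , e , n≤1+n x » le , subst (z <_) (+-suc n x) lt

row⇐ : ∀ n x y {z} → x ≤ z → z < n + x → (+ z , + y) ∈ row n x y
row⇐ zero x y le lt = ⊥-elim (<⇒≱ lt le)
row⇐ (suc n) x y {z} le lt with x ≟ z
... | yes refl = 1st
... | no ne = there (row⇐ n (suc x) y (≤∧≢⇒< le ne) (subst (z <_) (sym (+-suc n x)) lt))

pred+suc : ∀ {n} r → 1 ≤ n → pred n + suc r ≡ n + r
pred+suc {suc n} r _ = +-suc n r

rows⇒ : ∀ k n r {c} → k ≤ n → c ∈ rows k n r → ∃[ x ] ∃[ y ] (c ≡ (+ x , + y) × r ≤ y × y < k + r × y ≤ x × x < n + r)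
rows⇒ (suc k) n r kn i with ∈-++⁻ (row n r r) i
... | inl j = let z , e , le , lt = row⇒ n r r j in z , r , e , ≤-refl , s≤s (m≤n+m r k) , le , lt
... | inr j = let x , y , e , a , b , c , d = rows⇒ k (pred n) (suc r) (suc[m]≤n⇒m≤pred[n] kn) j in
  x , y , e , n≤1+n r » a , subst (y <_) (+-suc k r) b , c , subst (x <_) (pred+suc r (s≤s z≤n » kn)) d

rows⇐ : ∀ k n r {x y} → k ≤ n → r ≤ y → y < k + r → y ≤ x → x < n + r → (+ x , + y) ∈ rows k n r
rows⇐ zero n r kn a b c d = ⊥-elim (<⇒≱ b a)
rows⇐ (suc k) n r {x} {y} kn a b c d with r ≟ y
... | yes refl = ∈-++⁺ˡ (row⇐ n r r c d)
... | no ne = ∈-++⁺ʳ (row n r r) (rows⇐ k (pred n) (suc r) (suc[m]≤n⇒m≤pred[n] kn) (≤∧≢⇒< a ne)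
  (subst (y <_) (sym (+-suc k r)) b) c (subst (x <_) (sym (pred+suc r (s≤s z≤n » kn))) d))

device-bound : ∀ op {d e} → (d , e) ∈ device op → d < width op × e < width op
device-bound op i = All.lookup (bounds op) i
  where
  bounds : ∀ op → All (λ d → fst d < width op × snd d < width op) (device op)
  bounds pass = toWitness {a? = All.all? (λ d → (fst d <? 1) ×-dec (snd d <? 1)) (device pass)} _
  bounds swap = toWitness {a? = All.all? (λ d → (fst d <? 2) ×-dec (snd d <? 2)) (device swap)} _
  bounds gate = toWitness {a? = All.all? (λ d → (fst d <? 3) ×-dec (snd d <? 3)) (device gate)} _

device-complete : ∀ op {d e} → d < width op → e < width op → (d , e) ∈ device op
device-complete op l m = subst₂ (λ d e → (d , e) ∈ device op) (Finₚ.toℕ-fromℕ< l) (Finₚ.toℕ-fromℕ< m) (square op (fromℕ< l) (fromℕ< m))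
  where
  square? : ∀ op → Dec (∀ (i j : Fin (width op)) → (toℕ i , toℕ j) ∈ device op)
  square? op = Finₚ.all? λ i → Finₚ.all? λ j → (toℕ i , toℕ j) ∈ℕ? device op
  square : ∀ op (i j : Fin (width op)) → (toℕ i , toℕ j) ∈ device op
  square pass = toWitness {a? = square? pass} _
  square swap = toWitness {a? = square? swap} _
  square gate = toWitness {a? = square? gate} _

width≤3 : ∀ op → width op ≤ 3
width≤3 pass = s≤s z≤n
width≤3 swap = s≤s (s≤s z≤n)
width≤3 gate = ≤-refl

1≤width : ∀ op → 1 ≤ width op
1≤width pass = s≤s z≤n
1≤width swap = s≤s z≤n
1≤width gate = s≤s z≤n

module Region (n : ℕ) (3≤n : 3 ≤ n) where
  open Block n

  w≤n : ∀ op → width op ≤ n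
  w≤n op = width≤3 op » 3≤n

  block⇒ : ∀ op r {c} → c ∈ rows (width op) n r ++ translateℕ (r + n) r (device op) →
    ∃[ x ] ∃[ y ] (c ≡ (+ x , + y) × r ≤ y × y < width op + r × y ≤ x × x < width op + (r + n))
  block⇒ op r i with ∈-++⁻ (rows (width op) n r) i
  ... | inl j = let x , y , e , a , b , c , d = rows⇒ (width op) n r (w≤n op) j in
    x , y , e , a , b , c , d » ≤-reflexive (+-comm n r) » m≤n+m (r + n) (width op)
  ... | inr j with (d , e) , k , refl ← ∈-map⁻ _ j = let dw , ew = device-bound op k in
    r + n + d , r + e , refl , m≤m+n r e , <-≤-trans (+-monoʳ-< r ew) (≤-reflexive (+-comm r (width op))) ,
    +-monoʳ-≤ r ((<⇒≤ ew) » w≤n op) » m≤m+n (r + n) d ,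
    <-≤-trans (+-monoʳ-< (r + n) dw) (≤-reflexive (+-comm (r + n) (width op)))

  block⇐ : ∀ op r {x y} → r ≤ y → y < width op + r → y ≤ x → x < width op + (r + n) →
    (+ x , + y) ∈ rows (width op) n r ++ translateℕ (r + n) r (device op)
  block⇐ op r {x} {y} a b c d with x <? n + r
  ... | yes lt = ∈-++⁺ˡ (rows⇐ (width op) n r (w≤n op) a b c lt)
  ... | no ge with d' , refl ← m≤n⇒∃[o]m+o≡n (≤-reflexive (+-comm r n) » (≮⇒≥ ge)) | e , refl ← m≤n⇒∃[o]m+o≡n a =
    ∈-++⁺ʳ (rows (width op) n r) (∈-map⁺ (λ d → + (r + n + fst d) , + (r + snd d)) (device-complete op
      (+-cancelˡ-< (r + n) d' (width op) (<-≤-trans d (≤-reflexive (+-comm (width op) (r + n)))))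
      (+-cancelˡ-< r e (width op) (<-≤-trans b (≤-reflexive (+-comm (width op) r))))))

  ∈⇒Inside : ∀ r ops {c} → c ∈ cellsFrom r ops → ∃[ x ] ∃[ y ] (c ≡ (+ x , + y) × Inside r ops x y)
  ∈⇒Inside r (op ∷ ops) i with ∈-++⁻ (rows (width op) n r ++ translateℕ (r + n) r (device op)) i
  ... | inl j = let x , y , e , h = block⇒ op r j in x , y , e , inl h
  ... | inr j = let x , y , e , h = ∈⇒Inside (width op + r) ops j in x , y , e , inr h

  Inside⇒∈ : ∀ r ops {x y} → Inside r ops x y → (+ x , + y) ∈ cellsFrom r ops
  Inside⇒∈ r (op ∷ ops) (inl (a , b , c , d)) = ∈-++⁺ˡ (block⇐ op r a b c d)
  Inside⇒∈ r (op ∷ ops) (inr h) = ∈-++⁺ʳ (rows (width op) n r ++ translateℕ (r + n) r (device op)) (Inside⇒∈ (width op + r) ops h)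

  ∈Inside : ∀ r ops {x y} → (+ x , + y) ∈ cellsFrom r ops → Inside r ops x y
  ∈Inside r ops i with x , y , refl , h ← ∈⇒Inside r ops i = h

  Inside-low : ∀ r ops {x y} → Inside r ops x y → r ≤ y
  Inside-low r (op ∷ ops) (inl (a , _)) = a
  Inside-low r (op ∷ ops) (inr h) = m≤n+m r (width op) » Inside-low (width op + r) ops h

  Inside-diagonal : ∀ r ops {x y} → Inside r ops x y → y ≤ x
  Inside-diagonal r (op ∷ ops) (inl (_ , _ , c , _)) = c
  Inside-diagonal r (op ∷ ops) (inr h) = Inside-diagonal (width op + r) ops h

  Inside-high : ∀ r ops {x y} → Inside r ops x y → y < height ops + r
  Inside-high r (op ∷ ops) {y = y} (inl (_ , b , _ , _)) = <-≤-trans b (+-monoˡ-≤ r (m≤m+n (width op) (height ops)))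
  Inside-high r (op ∷ ops) {y = y} (inr h) = subst (y <_) (sym (raised (width op) (height ops) r)) (Inside-high (width op + r) ops h)

  Inside-right : ∀ r ops {x y} → Inside r ops x y → x < height ops + (r + n)
  Inside-right r (op ∷ ops) (inl (_ , _ , _ , d)) = <-≤-trans d (+-monoˡ-≤ (r + n) (m≤m+n (width op) (height ops)))
  Inside-right r (op ∷ ops) {x} (inr h) = subst (x <_) (lemma (width op) (height ops) r n) (Inside-right (width op + r) ops h)
    where
    lemma : ∀ w h r n → h + (w + r + n) ≡ w + h + (r + n)
    lemma = solve-∀

  Inside-west : ∀ r ops {x y z} → Inside r ops x y → y ≤ z → z ≤ x → Inside r ops z y
  Inside-west r (op ∷ ops) (inl (a , b , c , d)) l l' = inl (a , b , l , ≤-<-trans l' d)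
  Inside-west r (op ∷ ops) (inr h) l l' = inr (Inside-west (width op + r) ops h l l')

  unique-row : ∀ m x y → Unique (row m x y)
  unique-row zero x y = []
  unique-row (suc m) x y = All.tabulate (λ {c} i e → absurd i e) ∷ unique-row m (suc x) y
    where
    absurd : ∀ {c} → c ∈ row m (suc x) y → (+ x , + y) ≢ c
    absurd i refl with z , refl , le , _ ← row⇒ m (suc x) y i = <-irrefl refl le

  unique-rows : ∀ k m r → k ≤ m → Unique (rows k m r)
  unique-rows zero m r km = []
  unique-rows (suc k) m r km = Uniqueₚ.++⁺ (unique-row m r r) (unique-rows k (pred m) (suc r) (suc[m]≤n⇒m≤pred[n] km))
    (λ { (i , j) → absurd i j })
    where
    absurd : ∀ {c} → c ∈ row m r r → c ∈ rows k (pred m) (suc r) → ⊥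
    absurd i j with z , refl , _ ← row⇒ m r r i | x , y , refl , le , _ ← rows⇒ k (pred m) (suc r) (suc[m]≤n⇒m≤pred[n] km) j = <-irrefl refl le

  unique-device : ∀ op → Unique (device op)
  unique-device pass = toWitness {a? = unique? (device pass)} _
  unique-device swap = toWitness {a? = unique? (device swap)} _
  unique-device gate = toWitness {a? = unique? (device gate)} _

  unique-cells : ∀ r ops → Unique (cellsFrom r ops)
  unique-cells r [] = []
  unique-cells r (op ∷ ops) = Uniqueₚ.++⁺
    (Uniqueₚ.++⁺ (unique-rows (width op) n r (w≤n op))
      (Uniqueₚ.map⁺ (λ {d} {e} → injective {d} {e}) (unique-device op)) (λ { (i , j) → apart i j }))
    (unique-cells (width op + r) ops)
    (λ { (i , j) → above i j })
    where
    injective : ∀ {d e : ℕ × ℕ} → (+ (r + n + fst d) , + (r + snd d)) ≡ (+ (r + n + fst e) , + (r + snd e)) → d ≡ e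
    injective {d} {e} eq = cong₂ _,_ (+-cancelˡ-≡ (r + n) (fst d) (fst e) (Z.+-injective (cong fst eq)))
      (+-cancelˡ-≡ r (snd d) (snd e) (Z.+-injective (cong snd eq)))
    apart : ∀ {c} → c ∈ rows (width op) n r → c ∈ translateℕ (r + n) r (device op) → ⊥
    apart i j with x , y , e , _ , _ , _ , lt ← rows⇒ (width op) n r (w≤n op) i | (d , _) , _ , e' ← ∈-map⁻ _ j
      with refl ← Z.+-injective (cong fst (sym e ∙ e')) =
      <⇒≱ lt (≤-reflexive (+-comm n r) » m≤m+n (r + n) d)
    above : ∀ {c} → c ∈ rows (width op) n r ++ translateℕ (r + n) r (device op) → c ∈ cellsFrom (width op + r) ops → ⊥
    above i j with x , y , e , _ , lt , _ ← block⇒ op r i | x' , y' , e' , h ← ∈⇒Inside (width op + r) ops j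
      with refl ← Z.+-injective (cong snd (sym e ∙ e')) = <⇒≱ lt (Inside-low (width op + r) ops h)

  -- From any cell one gets to the bottom left one by going west, then south, and so on.

  Inside-south : ∀ r ops {y} → Inside r ops y y → y ≡ r ⊎ Inside r ops y (pred y)
  Inside-south r (op ∷ ops) {y} (inl (a , b , c , d)) with y ≟ r
  ... | yes e = inl e
  ... | no ne = inr (inl (suc[m]≤n⇒m≤pred[n] (≤∧≢⇒< a (ne ∘ sym)) , ≤-<-trans pred[n]≤n b , pred[n]≤n , d))
  Inside-south r (op ∷ ops) {y} (inr h) with Inside-south (width op + r) ops h
  ... | inr h' = inr (inr h')
  ... | inl refl = inr (inl (subst (r ≤_) (sym (pred-width op)) (m≤n+m r (pred (width op))) ,
      ≤-reflexive (suc-pred (width op + r) {{>-nonZero (1≤width op » m≤m+n _ r)}}) , pred[n]≤n ,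
      +-monoʳ-< (width op) (<-≤-trans (n<1+n r) (≤-reflexive (+-comm 1 r) » +-monoʳ-≤ r (s≤s z≤n » 3≤n)))))
    where
    pred-width : ∀ op → pred (width op + r) ≡ pred (width op) + r
    pred-width pass = refl
    pred-width swap = refl
    pred-width gate = refl

  module _ (ops : List Op) where
    region-cells = cellsFrom 0 ops

    west-path : ∀ {x y} → Inside 0 ops x y → Path (_∈ region-cells) (+ x , + y) (+ y , + y)
    west-path {x} {y} h = path-sym (between-pathʰ (λ { (+ z) (inl (+≤+ a , +≤+ b)) → Inside⇒∈ 0 ops (Inside-west 0 ops h a b)
        ; (+ z) (inr (+≤+ a , +≤+ b)) → Inside⇒∈ 0 ops (Inside-west 0 ops h (Inside-diagonal 0 ops h » a) (b » Inside-diagonal 0 ops h)) }))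

    home : ∀ y {x} → Inside 0 ops x y → Path (_∈ region-cells) (+ x , + y) (+ 0 , + 0)
    home zero h = west-path h
    home (suc y) h with Inside-south 0 ops (Inside-west 0 ops h ≤-refl (Inside-diagonal 0 ops h))
    ... | inr h' = west-path h ◅◅ path-step (Inside⇒∈ 0 ops (Inside-west 0 ops h ≤-refl (Inside-diagonal 0 ops h))) (Inside⇒∈ 0 ops h')
        4th ◅◅ home y h'

    connected-cells : EdgeConnected (_∈ region-cells)
    connected-cells i j with x , y , refl , h ← ∈⇒Inside 0 ops i | x' , y' , refl , h' ← ∈⇒Inside 0 ops j =
      home y h ◅◅ path-sym (home y' h')

    -- A row is an interval starting on the diagonal.
    Interval : ℕ → List Op → ℕ → Set
    Interval r ops y = (∀ x → ¬ Inside r ops x y) ⊎ ∃[ e ] (∀ x → Inside r ops x y ⇔ (y ≤ x × x < e))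

    interval : ∀ r ops y → Interval r ops y
    interval r [] y = inl (λ _ ())
    interval r (op ∷ ops) y with r ≤? y | y <? width op + r
    ... | yes a | yes b = inr (width op + (r + n) , λ x → mk⇔
        (λ { (inl (_ , _ , c , d)) → c , d ; (inr h) → ⊥-elim (<⇒≱ b (Inside-low _ ops h)) })
        (λ { (c , d) → inl (a , b , c , d) }))
    ... | no a | _ = inl (λ { x (inl (a' , _)) → a a' ; x (inr h) → a (m≤n+m r (width op) » Inside-low _ ops h) })
    ... | yes _ | no b with interval (width op + r) ops y
    ... | inl none = inl (λ { x (inl (_ , b' , _)) → b b' ; x (inr h) → none x h })
    ... | inr (e , f) = inr (e , λ x → mk⇔ (λ { (inl (_ , b' , _)) → ⊥-elim (b b') ; (inr h) → Equivalence.to (f x) h })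
        (λ h → inr (Equivalence.from (f x) h)))
      where open Function.Bundles using (module Equivalence)

    Out : Cell → Set
    Out c = c ∉ region-cells

    below : ∀ x k → Out (x , -[1+ k ])
    below x k i with _ , _ , () , _ ← ∈⇒Inside 0 ops i

    beyond : ∀ k y → Out (-[1+ k ] , y)
    beyond k y i with _ , _ , () , _ ← ∈⇒Inside 0 ops i

    far : ∀ y z → height ops + n ≤ z → Out (+ z , y)
    far y z le i with x , y' , refl , h ← ∈⇒Inside 0 ops i = <⇒≱ (Inside-right 0 ops h) le

    neg≤ : ∀ {k z} → z ℤ.≤ -[1+ k ] → ∃[ m ] z ≡ -[1+ m ]
    neg≤ (ℤ.-≤- {m = m} _) = m , refl

    base : Cell
    base = -[1+ 0 ] , -[1+ 0 ]

    from-below : ∀ x k → Path Out (x , -[1+ k ]) base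
    from-below x k = between-path (λ { z (inl (_ , le)) → at-neg z le ; z (inr (_ , le)) → at-neg z le }) ◅◅ between-pathʰ (λ z _ → below z 0)
      where
      at-neg : ∀ {k} z → z ℤ.≤ -[1+ k ] → Out (x , z)
      at-neg z le with m , refl ← neg≤ le = below x m

    -- Each row is an interval from the diagonal on, so from a cell outside the way is free to the
    -- west or to the east. Beyond all rows one can descend below the region.
    to-base : ∀ c → Out c → Path Out c base
    to-base (x , -[1+ k ]) out = from-below x k
    to-base (-[1+ k ] , y) out = between-path {y' = -[1+ 0 ]} (λ z _ → beyond k z) ◅◅ from-below _ 0
    to-base (+ x , + y) out with interval 0 ops y
    ... | inl none = between-pathʰ {x' = -[1+ 0 ]} (λ { (+ z) _ i → none z (∈Inside 0 ops i) ; -[1+ k ] _ → beyond k (+ y) }) ◅◅ to-base-left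
      where
      to-base-left : Path Out (-[1+ 0 ] , + y) base
      to-base-left = between-path (λ z _ → beyond 0 z)
    ... | inr (e , f) with y ≤? x
    ... | no lt = between-pathʰ {x' = -[1+ 0 ]} (λ { (+ z) (inr (_ , +≤+ le)) i → lt (Inside-diagonal 0 ops (∈Inside 0 ops i) » le)
        ; -[1+ k ] _ → beyond k (+ y) ; (+ z) (inl (_ , ())) i }) ◅◅ between-path (λ z _ → beyond 0 z)
    ... | yes le = between-pathʰ {x' = + (x + (height ops + n))}
        (λ { (+ z) (inl (+≤+ a , _)) i → out (Inside⇒∈ 0 ops (Equivalence.from (f x) (le , ≤-<-trans a (snd (Equivalence.to (f z) (∈Inside 0 ops i))))))
            ; (+ z) (inr (+≤+ a , +≤+ b)) i → out (Inside⇒∈ 0 ops (Equivalence.from (f x) (le ,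
                ≤-<-trans (m≤m+n x _ » a) (snd (Equivalence.to (f z) (∈Inside 0 ops i))))))
                 ; -[1+ k ] _ → beyond k (+ y) }) ◅◅
            between-path {y' = -[1+ 0 ]} (λ z _ → far z _ (m≤n+m _ x)) ◅◅ from-below _ 0
      where open Function.Bundles using (module Equivalence)

    no-holes-cells : EdgeConnected (_∉ region-cells)
    no-holes-cells out out' = to-base _ out ◅◅ path-sym (to-base _ out')

-- The boundary of the region

segs : List (Segment × Colour) → List Segment
segs = map fst

line⇒ : ∀ f c k r {s} → s ∈ segs (line f c k r) → ∃[ y ] (s ≡ f y × r ≤ y × y < k + r)
line⇒ f c (suc k) r 1st = r , refl , ≤-refl , s≤s (m≤n+m r k)
line⇒ f c (suc k) r (there i) = let y , e , a , b = line⇒ f c k (suc r) i in y , e , <⇒≤ a , subst (y <_) (+-suc k r) b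

line⇐ : ∀ f c k r {y} → r ≤ y → y < k + r → f y ∈ segs (line f c k r)
line⇐ f c zero r a b = ⊥-elim (<⇒≱ b a)
line⇐ f c (suc k) r {y} a b with r ≟ y
... | yes refl = 1st
... | no ne = there (line⇐ f c k (suc r) (≤∧≢⇒< a ne) (subst (y <_) (sym (+-suc k r)) b))

unique-line : ∀ {f c} → (∀ {y z} → f y ≡ f z → y ≡ z) → ∀ k r → Unique (segs (line f c k r))
unique-line inj zero r = []
unique-line {f} {c} inj (suc k) r = All.tabulate (λ i e → new i e) ∷ unique-line inj k (suc r)
  where
  new : ∀ {s} → s ∈ segs (line f c k (suc r)) → f r ≢ s
  new i e with y , refl , le , _ ← line⇒ f c k (suc r) i with refl ← inj e = <-irrefl refl le

segs-wires : ∀ x y q → segs (wires x y q) ≡ segs (line (λ z → hseg z y) 0 (length q) x)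
segs-wires x y [] = refl
segs-wires x y (b ∷ q) = cong (hseg x y ∷_) (segs-wires (suc x) y q)

wires⇒ : ∀ x y q {s} → s ∈ segs (wires x y q) → ∃[ z ] (s ≡ hseg z y × x ≤ z × z < length q + x)
wires⇒ x y q {s} i = line⇒ _ 0 (length q) x (subst (s ∈_) (segs-wires x y q) i)

wires⇐ : ∀ x y q {z} → x ≤ z → z < length q + x → hseg z y ∈ segs (wires x y q)
wires⇐ x y q {z} a b = subst (hseg z y ∈_) (sym (segs-wires x y q)) (line⇐ _ 0 (length q) x a b)

hseg-injective : ∀ {x y x' y'} → hseg x y ≡ hseg x' y' → x ≡ x' × y ≡ y'
hseg-injective e = Z.+-injective (cong (fst ∘ snd) e) , Z.+-injective (cong (snd ∘ snd) e)

vseg-injective : ∀ {x y x' y'} → vseg x y ≡ vseg x' y' → x ≡ x' × y ≡ y'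
vseg-injective e = Z.+-injective (cong (fst ∘ snd) e) , Z.+-injective (cong (snd ∘ snd) e)

unique-wires : ∀ x y q → Unique (segs (wires x y q))
unique-wires x y q = subst Unique (sym (segs-wires x y q)) (unique-line (λ e → fst (hseg-injective e)) (length q) x)

module Boundary (n : ℕ) (3≤n : 3 ≤ n) where
  open Block n
  open Region n 3≤n

  -- Coordinates of the segments below the devices, and of those to the right of them; both are
  -- described by inequalities, like `Inside`.
  Foot Rim : ℕ → List Op → ℕ → ℕ → Set
  Foot r [] x y = ⊥
  Foot r (op ∷ ops) x y = (y ≡ r × r + n ≤ x × x < width op + (r + n)) ⊎ Foot (width op + r) ops x y
  Rim r [] x y = ⊥
  Rim r (op ∷ ops) x y = (x ≡ width op + (r + n) × r ≤ y × y < width op + r) ⊎ Rim (width op + r) ops x y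

  seg-++ : ∀ {s} as {bs} → s ∈ segs (as ++ bs) → s ∈ segs as ⊎ s ∈ segs bs
  seg-++ as {bs} i = ∈-++⁻ (segs as) (subst (_ ∈_) (map-++ fst as bs) i)

  seg-++ˡ : ∀ {s as} bs → s ∈ segs as → s ∈ segs (as ++ bs)
  seg-++ˡ {s} {as} bs i = subst (s ∈_) (sym (map-++ fst as bs)) (∈-++⁺ˡ i)

  seg-++ʳ : ∀ {s} as {bs} → s ∈ segs bs → s ∈ segs (as ++ bs)
  seg-++ʳ {s} as {bs} i = subst (s ∈_) (sym (map-++ fst as bs)) (∈-++⁺ʳ (segs as) i)

  either : ∀ as {bs} {P : Segment → Set} → (∀ {s} → s ∈ segs as → P s) → (∀ {s} → s ∈ segs bs → P s) → ∀ {s} → s ∈ segs (as ++ bs) → P s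
  either as f g i with seg-++ as i
  ... | inl j = f j
  ... | inr j = g j

  unique-++ : ∀ as {bs} → Unique (segs as) → Unique (segs bs) → (∀ {s} → s ∈ segs as → s ∈ segs bs → ⊥) → Unique (segs (as ++ bs))
  unique-++ as {bs} u v d = subst Unique (sym (map-++ fst as bs)) (Uniqueₚ.++⁺ u v (λ { (i , j) → d i j }))

  rightH⇒ : ∀ r ops {s} → s ∈ segs (rightH r ops) → ∃[ x ] ∃[ y ] (s ≡ hseg x y × Foot r ops x y)
  rightH⇒ r (op ∷ ops) i with seg-++ (bottomOf op (r + n) r) i
  ... | inl j = let x , e , a , b = line⇒ _ _ (width op) (r + n) j in x , r , e , inl (refl , a , b)
  ... | inr j = let x , y , e , f = rightH⇒ (width op + r) ops j in x , y , e , inr f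

  rightH⇐ : ∀ r ops {x y} → Foot r ops x y → hseg x y ∈ segs (rightH r ops)
  rightH⇐ r (op ∷ ops) (inl (refl , a , b)) = seg-++ˡ _ (line⇐ _ _ (width op) (r + n) a b)
  rightH⇐ r (op ∷ ops) (inr f) = seg-++ʳ (bottomOf op (r + n) r) (rightH⇐ (width op + r) ops f)

  rightV⇒ : ∀ r ops {s} → s ∈ segs (rightV r ops) → ∃[ x ] ∃[ y ] (s ≡ vseg x y × Rim r ops x y)
  rightV⇒ r (op ∷ ops) i with seg-++ (rightOf op (r + n) r) i
  ... | inl j = let y , e , a , b = line⇒ _ _ (width op) r j in _ , y , e , inl (refl , a , b)
  ... | inr j = let x , y , e , f = rightV⇒ (width op + r) ops j in x , y , e , inr f

  rightV⇐ : ∀ r ops {x y} → Rim r ops x y → vseg x y ∈ segs (rightV r ops)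
  rightV⇐ r (op ∷ ops) (inl (refl , a , b)) = seg-++ˡ _ (line⇐ _ _ (width op) r a b)
  rightV⇐ r (op ∷ ops) (inr f) = seg-++ʳ (rightOf op (r + n) r) (rightV⇐ (width op + r) ops f)

  Foot-low : ∀ r ops {x y} → Foot r ops x y → r ≤ y
  Foot-low r (op ∷ ops) (inl (refl , _)) = ≤-refl
  Foot-low r (op ∷ ops) (inr f) = m≤n+m r (width op) » Foot-low _ ops f

  Foot-right : ∀ r ops {x y} → Foot r ops x y → y + n ≤ x
  Foot-right r (op ∷ ops) (inl (refl , a , _)) = a
  Foot-right r (op ∷ ops) (inr f) = Foot-right _ ops f

  Foot-inside : ∀ r ops {x y} → Foot r ops x y → Inside r ops x y
  Foot-inside r (op ∷ ops) (inl (refl , a , b)) = inl (≤-refl , +-monoˡ-≤ r (1≤width op) , m≤m+n r n » a , b)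
  Foot-inside r (op ∷ ops) (inr f) = inr (Foot-inside _ ops f)

  -- An operation ends exactly at the column where the device of the next one begins, and still
  -- earlier ones end further left.
  Foot-above-outside : ∀ r ops {x y} → Foot r ops x (suc y) → ¬ Inside r ops x y
  Foot-above-outside r (op ∷ ops) (inl (refl , a , b)) h = <-irrefl refl (Inside-low r (op ∷ ops) h)
  Foot-above-outside r (op ∷ ops) (inr f) (inr h) = Foot-above-outside _ ops f h
  Foot-above-outside r (op ∷ ops) {x} {y} (inr f) (inl (_ , b , _ , d)) = <-irrefl refl (<-≤-trans d
    ((≤-reflexive (sym (+-assoc (width op) r n)) » +-monoˡ-≤ n (Foot-low _ ops f)) » Foot-right _ ops f))

  Rim-low : ∀ r ops {x y} → Rim r ops x y → r ≤ y
  Rim-low r (op ∷ ops) (inl (_ , a , _)) = a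
  Rim-low r (op ∷ ops) (inr f) = m≤n+m r (width op) » Rim-low _ ops f

  Rim-west : ∀ r ops {x y} → Rim r ops x y → ∃[ z ] (x ≡ suc z × Inside r ops z y)
  Rim-west r (op ∷ ops) {y = y} (inl (refl , a , b)) = pred (width op) + (r + n) , split op ,
    inl (a , b , suc[m]≤n⇒m≤pred[n] b » ≤-reflexive (pred-w op) » +-monoʳ-≤ (pred (width op)) (m≤m+n r n) , ≤-reflexive (sym (split op)))
    where
    split : ∀ op → width op + (r + n) ≡ suc (pred (width op) + (r + n))
    split pass = refl
    split swap = refl
    split gate = refl
    pred-w : ∀ op → pred (width op + r) ≡ pred (width op) + r
    pred-w pass = refl
    pred-w swap = refl
    pred-w gate = refl
  Rim-west r (op ∷ ops) (inr f) = let z , e , h = Rim-west _ ops f in z , e , inr h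

  Rim-outside : ∀ r ops {x y} → Rim r ops x y → ¬ Inside r ops x y
  Rim-outside r (op ∷ ops) (inl (refl , _ , _)) (inl (_ , _ , _ , d)) = <-irrefl refl d
  Rim-outside r (op ∷ ops) (inl (refl , _ , b)) (inr h) = <⇒≱ b (Inside-low _ ops h)
  Rim-outside r (op ∷ ops) (inr f) (inl (_ , b , _ , _)) = <⇒≱ b (Rim-low _ ops f)
  Rim-outside r (op ∷ ops) (inr f) (inr h) = Rim-outside _ ops f h

  Rim-diagonal : ∀ r ops {x y} → Rim r ops x y → y < x
  Rim-diagonal r ops f with z , refl , h ← Rim-west r ops f = s≤s (Inside-diagonal r ops h)

  -- Like `south-of` and `north-of`: a step either stays inside or names the family of boundary
  -- segments that it crosses. This shows that the listed boundary is complete.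
  east-of : ∀ r ops {x y} → Inside r ops x y → Inside r ops (suc x) y ⊎ Rim r ops (suc x) y
  east-of r (op ∷ ops) {x} (inl (a , b , c , d)) with suc x ≟ width op + (r + n)
  ... | yes e = inr (inl (e , a , b))
  ... | no ne = inl (inl (a , b , c » n≤1+n x , ≤∧≢⇒< d ne))
  east-of r (op ∷ ops) (inr h) with east-of _ ops h
  ... | inl h' = inl (inr h')
  ... | inr f = inr (inr f)

  south-of : ∀ r ops {x y} → Inside r ops x y → (y ≡ r × x < n + r) ⊎ Foot r ops x y ⊎ ∃[ z ] (y ≡ suc z × Inside r ops x z)
  south-of r (op ∷ ops) {x} {y} (inl (a , b , c , d)) with r ≟ y
  ... | no ne = inr (inr (beneath y a ne b c))
    where
    beneath : ∀ y → r ≤ y → r ≢ y → y < width op + r → y ≤ x → ∃[ z ] (y ≡ suc z × Inside r (op ∷ ops) x z)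
    beneath zero a ne b c = ⊥-elim (ne (n≤0⇒n≡0 a))
    beneath (suc z) a ne b c = z , refl , inl (≤-pred (≤∧≢⇒< a ne) , <⇒≤ b , <⇒≤ c , d)
  ... | yes refl with x <? n + r
  ... | yes lt = inl (refl , lt)
  ... | no ge = inr (inl (inl (refl , ≤-reflexive (+-comm r n) » (≮⇒≥ ge) , d)))
  south-of r (op ∷ ops) {x} {y} (inr h) with south-of _ ops h
  ... | inr (inl f) = inr (inl (inr f))
  ... | inr (inr (z , e , h')) = inr (inr (z , e , inr h'))
  ... | inl (refl , lt) = inr (inr (pred (width op) + r , split op , inl (m≤n+m r _ , ≤-reflexive (sym (split op)) ,
      <⇒≤ (<-≤-trans (≤-reflexive (sym (split op))) (Inside-diagonal _ ops h)) ,
      <-≤-trans lt (≤-reflexive (+-comm n (width op + r) ∙ +-assoc (width op) r n)))))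
    where
    split : ∀ op → width op + r ≡ suc (pred (width op) + r)
    split pass = refl
    split swap = refl
    split gate = refl

  north-of : ∀ r ops {x y} → Inside r ops x y → x ≡ y ⊎ (suc y ≡ height ops + r × suc y ≤ x × x < n + suc y) ⊎ Inside r ops x (suc y)
  north-of r (op ∷ ops) {x} {y} (inl (a , b , c , d)) with x ≟ y
  ... | yes e = inl e
  ... | no ne with suc y ≟ width op + r
  ... | no ne' = inr (inr (inl (a » n≤1+n y , ≤∧≢⇒< b ne' , ≤∧≢⇒< c (ne ∘ sym) , d)))
  ... | yes e with ops
  ... | [] = inr (inl (e ∙ cong (_+ r) (sym (+-identityʳ (width op))) , ≤∧≢⇒< c (ne ∘ sym) ,
      <-≤-trans d (≤-reflexive (sym (+-assoc (width op) r n) ∙ +-comm (width op + r) n ∙ cong (λ k → n + k) (sym e)))))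
  ... | op' ∷ ops' = inr (inr (inr (inl (≤-reflexive (sym e) , <-≤-trans (≤-reflexive (cong suc e)) (+-monoˡ-≤ (width op + r) (1≤width op')) ,
      ≤∧≢⇒< c (ne ∘ sym) , <-≤-trans d (≤-reflexive (sym (+-assoc (width op) r n)) » m≤n+m _ (width op'))))))
  north-of r (op ∷ ops) {x} {y} (inr h) with north-of _ ops h
  ... | inl e = inl e
  ... | inr (inl (e , a , b)) = inr (inl (e ∙ sym (+-assoc (height ops) (width op) r) ∙ cong (_+ r) (+-comm (height ops) (width op)) , a , b))
  ... | inr (inr h') = inr (inr (inr h'))

  diagonal-inside : ∀ r ops {y} → r ≤ y → y < height ops + r → Inside r ops y y
  diagonal-inside r [] a b = ⊥-elim (<⇒≱ b a)
  diagonal-inside r (op ∷ ops) {y} a b with y <? width op + r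
  ... | yes lt = inl (a , lt , ≤-refl , <-≤-trans lt (+-monoʳ-≤ (width op) (m≤m+n r n)))
  ... | no ge = inr (diagonal-inside (width op + r) ops (≮⇒≥ ge)
      (subst (y <_) (cong (_+ r) (+-comm (width op) (height ops)) ∙ +-assoc (height ops) (width op) r) b))

  top-inside : ∀ r ops {x y} → r ≤ y → suc y ≡ height ops + r → suc y ≤ x → x < n + suc y → Inside r ops x y
  top-inside r [] a e b c = ⊥-elim (<-irrefl refl (≤-reflexive e » a))
  top-inside r (op ∷ []) {x} {y} a e b c = inl (a , ≤-reflexive e' , <⇒≤ b , <-≤-trans c (≤-reflexive
      (cong (λ k → n + k) e' ∙ +-comm n (width op + r) ∙ +-assoc (width op) r n)))
    where
    e' : suc y ≡ width op + r
    e' = e ∙ cong (_+ r) (+-identityʳ (width op))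
  top-inside r (op ∷ ops@(op' ∷ _)) {x} {y} a e b c = inr (top-inside (width op + r) ops (≤-pred (+-monoˡ-≤ (width op + r) 1≤h » ≤-reflexive (sym e'))) e' b c)
    where
    e' : suc y ≡ height ops + (width op + r)
    e' = e ∙ cong (_+ r) (+-comm (width op) (height ops)) ∙ +-assoc (height ops) (width op) r
    1≤h : 1 ≤ height ops
    1≤h = 1≤width op' » m≤m+n _ _

  west-of-diagonal : ∀ ops y → (ℤ.pred (+ y) , + y) ∉ cellsFrom 0 ops
  west-of-diagonal ops zero i with _ , _ , () , _ ← ∈⇒Inside 0 ops i
  west-of-diagonal ops (suc y) i with Inside-diagonal 0 ops (∈Inside 0 ops i)
  ... | le = <-irrefl refl le

  south-of-foot : ∀ ops y {x} → Foot 0 ops x y → (+ x , ℤ.pred (+ y)) ∉ cellsFrom 0 ops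
  south-of-foot ops zero f i with _ , _ , () , _ ← ∈⇒Inside 0 ops i
  south-of-foot ops (suc y) f i = Foot-above-outside 0 ops f (∈Inside 0 ops i)

  module _ (ops : List Op) (u v : List Bool) (lu : length u ≡ n) (lv : length v ≡ n) (nonempty-ops : 1 ≤ height ops) where
    H = height ops
    cs = cellsFrom 0 ops
    B₆ = wires H H v
    B₅ = wires 0 0 u ++ B₆
    B₄ = rightV 0 ops ++ B₅
    B₃ = rightH 0 ops ++ B₄
    B₂ = leftH H 0 ++ B₃

    HasOwners : Segment → Set
    HasOwners s = (∃[ c ] (c ∈ owners s × c ∈ cs)) × (∃[ c ] (c ∈ owners s × c ∉ cs))

    out : ∀ {x y} → ¬ Inside 0 ops x y → (+ x , + y) ∉ cs
    out h i = h (∈Inside 0 ops i)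

    leftV-ok : ∀ {s} → s ∈ segs (leftV H 0) → HasOwners s
    leftV-ok i with y , refl , _ , lt ← line⇒ _ 2 H 0 i =
      (_ , 1st , Inside⇒∈ 0 ops (diagonal-inside 0 ops z≤n lt)) ,
      (_ , 2nd , west-of-diagonal ops y)

    leftH-ok : ∀ {s} → s ∈ segs (leftH H 0) → HasOwners s
    leftH-ok i with y , refl , _ , lt ← line⇒ _ 2 H 0 i =
      (_ , 2nd , Inside⇒∈ 0 ops (diagonal-inside 0 ops z≤n lt)) ,
      (_ , 1st , out (λ h → <-irrefl refl (Inside-diagonal 0 ops h)))

    rightH-ok : ∀ {s} → s ∈ segs (rightH 0 ops) → HasOwners s
    rightH-ok i with x , y , refl , f ← rightH⇒ 0 ops i = (_ , 1st , Inside⇒∈ 0 ops (Foot-inside 0 ops f)) ,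
      (_ , 2nd , south-of-foot ops y f)

    rightV-ok : ∀ {s} → s ∈ segs (rightV 0 ops) → HasOwners s
    rightV-ok i with x , y , refl , f ← rightV⇒ 0 ops i with z , refl , h ← Rim-west 0 ops f =
      (_ , 2nd , Inside⇒∈ 0 ops h) , (_ , 1st , out (Rim-outside 0 ops f))

    first-row : ∀ ops → 1 ≤ height ops → ∀ z → z < n → Inside 0 ops z 0
    first-row (op ∷ ops) _ z lt = inl (z≤n , 1≤width op » m≤m+n _ 0 , z≤n , <-≤-trans lt (m≤n+m n (width op)))

    wires-ok : ∀ {s} → s ∈ segs (wires 0 0 u) → HasOwners s
    wires-ok i with z , refl , _ , lt ← wires⇒ 0 0 u i =
      (_ , 1st , Inside⇒∈ 0 ops (first-row ops nonempty-ops z (subst (z <_) (+-identityʳ (length u) ∙ lu) lt))) ,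
      (_ , 2nd , λ j → negative j)
      where
      negative : ∀ {x} → (x , -[1+ 0 ]) ∈ cs → ⊥
      negative j with _ , _ , () , _ ← ∈⇒Inside 0 ops j

    top-ok : ∀ {s} → s ∈ segs (wires H H v) → HasOwners s
    top-ok i with z , refl , le , lt ← wires⇒ H H v i =
      (_ , 2nd , inside H refl nonempty-ops le lt) ,
      (_ , 1st , out (λ h → <-irrefl (sym (+-identityʳ H)) (Inside-high 0 ops h)))
      where
      inside : ∀ h → h ≡ H → 1 ≤ h → h ≤ z → z < length v + h → (+ z , ℤ.pred (+ h)) ∈ cs
      inside (suc h) e _ le lt = Inside⇒∈ 0 ops (top-inside 0 ops z≤n (e ∙ sym (+-identityʳ H)) le (subst (λ k → z < k + suc h) lv lt))

    On : Segment → Set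
    On s = s ∈ segs (boundaryOf ops u v)

    boundary-owned : ∀ {s} → On s → HasOwners s
    boundary-owned = either (leftV H 0) leftV-ok (either (leftH H 0) leftH-ok (either (rightH 0 ops) rightH-ok
      (either (rightV 0 ops) rightV-ok (either (wires 0 0 u) wires-ok top-ok))))

    in₁ : ∀ {s} → s ∈ segs (leftV H 0) → On s
    in₁ = seg-++ˡ B₂
    in₂ : ∀ {s} → s ∈ segs (leftH H 0) → On s
    in₂ = seg-++ʳ (leftV H 0) ∘ seg-++ˡ B₃
    after₂ : ∀ {s} → s ∈ segs B₃ → On s
    after₂ = seg-++ʳ (leftV H 0) ∘ seg-++ʳ (leftH H 0)
    in₃ : ∀ {s} → s ∈ segs (rightH 0 ops) → On s
    in₃ = after₂ ∘ seg-++ˡ B₄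
    in₄ : ∀ {s} → s ∈ segs (rightV 0 ops) → On s
    in₄ = after₂ ∘ seg-++ʳ (rightH 0 ops) ∘ seg-++ˡ B₅
    after₄ : ∀ {s} → s ∈ segs B₅ → On s
    after₄ = after₂ ∘ seg-++ʳ (rightH 0 ops) ∘ seg-++ʳ (rightV 0 ops)

    bottom-side : ∀ x y → Inside 0 ops x y → (+ x , ℤ.pred (+ y)) ∉ cs → On (hseg x y)
    bottom-side x y h o with south-of 0 ops h
    ... | inl (refl , lt) = after₄ (seg-++ˡ B₆ (wires⇐ 0 0 u z≤n (subst (λ k → x < k + 0) (sym lu) lt)))
    ... | inr (inl f) = in₃ (rightH⇐ 0 ops f)
    ... | inr (inr (z , refl , h')) = ⊥-elim (o (Inside⇒∈ 0 ops h'))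

    top-side : ∀ x y → Inside 0 ops x y → (+ x , + suc y) ∉ cs → On (hseg x (suc y))
    top-side x y h o with north-of 0 ops h
    ... | inl refl = in₂ (line⇐ _ 2 H 0 z≤n (Inside-high 0 ops h))
    ... | inr (inl (e , a , b)) = after₄ (seg-++ʳ (wires 0 0 u) (top (e ∙ +-identityʳ H)))
      where
      top : suc y ≡ H → hseg x (suc y) ∈ segs (wires H H v)
      top e = subst (λ k → hseg x (suc y) ∈ segs (wires k k v)) e (wires⇐ (suc y) (suc y) v a (subst (λ k → x < k + suc y) (sym lv) b))
    ... | inr (inr h') = ⊥-elim (o (Inside⇒∈ 0 ops h'))

    left-side : ∀ x y → Inside 0 ops x y → (ℤ.pred (+ x) , + y) ∉ cs → On (vseg x y)
    left-side x y h o with x ≟ y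
    ... | yes refl = in₁ (line⇐ _ 2 H 0 z≤n (Inside-high 0 ops h))
    ... | no ne = ⊥-elim (o (west-in x (≤∧≢⇒< (Inside-diagonal 0 ops h) (ne ∘ sym)) h))
      where
      west-in : ∀ x → y < x → Inside 0 ops x y → (ℤ.pred (+ x) , + y) ∈ cs
      west-in (suc x) (s≤s le) h = Inside⇒∈ 0 ops (Inside-west 0 ops h le (n≤1+n x))

    right-side : ∀ x y → Inside 0 ops x y → (+ suc x , + y) ∉ cs → On (vseg (suc x) y)
    right-side x y h o with east-of 0 ops h
    ... | inl h' = ⊥-elim (o (Inside⇒∈ 0 ops h'))
    ... | inr f = in₄ (rightV⇐ 0 ops f)

    boundary-complete : ∀ c → c ∈ cs → ∀ s → s ∈ edges c → (∃[ d ] (d ∈ owners s × d ∉ cs)) → On s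
    boundary-complete c i s j k with x , y , refl , h ← ∈⇒Inside 0 ops i with j | k
    ... | 1st | (d , 1st , o) = ⊥-elim (o i)
    ... | 1st | (d , 2nd , o) = bottom-side x y h o
    ... | 2nd | (d , 1st , o) = top-side x y h o
    ... | 2nd | (d , 2nd , o) = ⊥-elim (o i)
    ... | 3rd | (d , 1st , o) = ⊥-elim (o i)
    ... | 3rd | (d , 2nd , o) = left-side x y h o
    ... | 4th | (d , 1st , o) = right-side x y h o
    ... | 4th | (d , 2nd , o) = ⊥-elim (o i)

    unique-rightH : ∀ r ops → Unique (segs (rightH r ops))
    unique-rightH r [] = []
    unique-rightH r (op ∷ ops) = unique-++ (bottomOf op (r + n) r) (unique-line (λ e → fst (hseg-injective e)) (width op) (r + n)) (unique-rightH (width op + r) ops) apart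
      where
      apart : ∀ {s} → s ∈ segs (bottomOf op (r + n) r) → s ∈ segs (rightH (width op + r) ops) → ⊥
      apart i j with x , e , _ ← line⇒ _ _ (width op) (r + n) i | x' , y' , e' , f ← rightH⇒ (width op + r) ops j
        with _ , refl ← hseg-injective (sym e ∙ e') = <-irrefl refl (+-monoˡ-≤ r (1≤width op) » Foot-low _ ops f)

    unique-rightV : ∀ r ops → Unique (segs (rightV r ops))
    unique-rightV r [] = []
    unique-rightV r (op ∷ ops) = unique-++ (rightOf op (r + n) r) (unique-line (λ e → snd (vseg-injective e)) (width op) r) (unique-rightV (width op + r) ops) apart
      where
      apart : ∀ {s} → s ∈ segs (rightOf op (r + n) r) → s ∈ segs (rightV (width op + r) ops) → ⊥
      apart i j with y , e , _ , lt ← line⇒ _ _ (width op) r i | x' , y' , e' , f ← rightV⇒ (width op + r) ops j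
        with _ , refl ← vseg-injective (sym e ∙ e') = <⇒≱ lt (Rim-low _ ops f)

    -- Which family of boundary segments a segment belongs to can be read off its place.
    apart₅ : ∀ {s} → s ∈ segs (wires 0 0 u) → s ∈ segs B₆ → ⊥
    apart₅ i j with z , refl , _ ← wires⇒ 0 0 u i | z' , e , _ ← wires⇒ H H v j = <-irrefl refl (nonempty-ops » ≤-reflexive (sym (snd (hseg-injective e))))

    apart₄ : ∀ {s} → s ∈ segs (rightV 0 ops) → s ∈ segs B₅ → ⊥
    apart₄ i j with x , y , refl , _ ← rightV⇒ 0 ops i with seg-++ (wires 0 0 u) {B₆} j
    ... | inl k with _ , () , _ ← wires⇒ 0 0 u k
    ... | inr k with _ , () , _ ← wires⇒ H H v k

    apart₃ : ∀ {s} → s ∈ segs (rightH 0 ops) → s ∈ segs B₄ → ⊥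
    apart₃ i j with x , y , refl , f ← rightH⇒ 0 ops i with seg-++ (rightV 0 ops) {B₅} j
    ... | inl k with _ , _ , () , _ ← rightV⇒ 0 ops k
    ... | inr k with seg-++ (wires 0 0 u) {B₆} k
    ... | inl l with z , e , _ , lt ← wires⇒ 0 0 u l with refl , refl ← hseg-injective e =
        <⇒≱ lt (≤-reflexive (+-identityʳ (length u) ∙ lu) » Foot-right 0 ops f)
    ... | inr l with z , e , _ ← wires⇒ H H v l with refl , refl ← hseg-injective e =
        <-irrefl refl (subst (H <_) (+-identityʳ H) (Inside-high 0 ops (Foot-inside 0 ops f)))

    apart₂ : ∀ {s} → s ∈ segs (leftH H 0) → s ∈ segs B₃ → ⊥
    apart₂ i j with y , refl , _ ← line⇒ _ 2 H 0 i with seg-++ (rightH 0 ops) {B₄} j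
    ... | inl k with x' , y' , e , f ← rightH⇒ 0 ops k with refl , refl ← hseg-injective e = <-irrefl refl (m≤m+n (suc y) n » Foot-right 0 ops f)
    ... | inr k with seg-++ (rightV 0 ops) {B₅} k
    ... | inl l with _ , _ , () , _ ← rightV⇒ 0 ops l
    ... | inr l with seg-++ (wires 0 0 u) {B₆} l
    ... | inl m with _ , () , _ ← wires⇒ 0 0 u m
    ... | inr m with z , e , le , _ ← wires⇒ H H v m with e₁ , e₂ ← hseg-injective e =
        <-irrefl refl (≤-reflexive e₂ » le » ≤-reflexive (sym e₁))

    apart₁ : ∀ {s} → s ∈ segs (leftV H 0) → s ∈ segs B₂ → ⊥
    apart₁ i j with y , refl , _ ← line⇒ _ 2 H 0 i with seg-++ (leftH H 0) {B₃} j
    ... | inl k with _ , () , _ ← line⇒ _ 2 H 0 k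
    ... | inr k with seg-++ (rightH 0 ops) {B₄} k
    ... | inl l with _ , _ , () , _ ← rightH⇒ 0 ops l
    ... | inr l with seg-++ (rightV 0 ops) {B₅} l
    ... | inl m with x' , y' , e , f ← rightV⇒ 0 ops m with refl , refl ← vseg-injective e = <-irrefl refl (Rim-diagonal 0 ops f)
    ... | inr m with seg-++ (wires 0 0 u) {B₆} m
    ... | inl o with _ , () , _ ← wires⇒ 0 0 u o
    ... | inr o with _ , () , _ ← wires⇒ H H v o

    unique-boundary : Unique (segs (boundaryOf ops u v))
    unique-boundary = unique-++ (leftV H 0) (unique-line (λ e → fst (vseg-injective e)) H 0)
      (unique-++ (leftH H 0) (unique-line (λ e → fst (hseg-injective e)) H 0)
        (unique-++ (rightH 0 ops) (unique-rightH 0 ops)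
          (unique-++ (rightV 0 ops) (unique-rightV 0 ops)
            (unique-++ (wires 0 0 u) (unique-wires 0 0 u) (unique-wires H H v) apart₅) apart₄) apart₃) apart₂) apart₁

    region : ColouredPolyomino
    region = record
      { cells = cs
      ; boundary = boundaryOf ops u v
      ; nonempty = has-cells ops nonempty-ops
      ; distinct = unique-cells 0 ops
      ; connected = connected-cells ops
      ; no-holes = no-holes-cells ops
      ; coloured = λ s → mk⇔
          (λ i → let (c , o , ci) , (d , o' , di) = boundary-owned i in (c , ci , ∈owners⇒∈sides s o) , (d , di , ∈owners⇒∈sides s o'))
          (λ { ((c , ci , i) , (d , di , j)) → boundary-complete c ci s (subst (s ∈_) (sides≡edges c) i) (d , ∈sides⇒∈owners d j , di) })
      ; one-colour = unique-boundary }
      where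
      has-cells : ∀ ops → 1 ≤ height ops → cellsFrom 0 ops ≢ []
      has-cells ops h e with () ← subst ((+ 0 , + 0) ∈_) e (Inside⇒∈ 0 ops (first-row ops h 0 (s≤s z≤n » 3≤n)))

-- Runs of operations, and the tilings made from them

bits : Triple → List Bool
bits (x , y , z) = x ∷ y ∷ z ∷ []

-- Given enough wires, only `gate` can fail, and only it has two outcomes: gates 1 and 3 both take
-- two ones and a zero.
data Step : Op → List Bool → List Bool → Set where
  pass : ∀ {x q} → Step pass (x ∷ q) (q ++ x ∷ [])
  swap : ∀ {x y q} → Step swap (x ∷ y ∷ q) (q ++ y ∷ x ∷ [])
  gate : ∀ (g : Fin 4) {q} → Step gate (bits (gateIn g) ++ q) (q ++ bits (gateOut g))

infixr 5 _∷_

data Run : List Op → List Bool → List Bool → Set where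
  [] : ∀ {q} → Run [] q q
  _∷_ : ∀ {op ops q q' q″} → Step op q q' → Run ops q' q″ → Run (op ∷ ops) q q″

Step-length : ∀ {op q q'} → Step op q q' → length q' ≡ length q
Step-length (pass {x} {q}) = length-++ q ∙ +-comm (length q) 1
Step-length (swap {x} {y} {q}) = length-++ q ∙ +-comm (length q) 2
Step-length (gate g {q}) = length-++ q ∙ +-comm (length q) 3

T₁₄ : TileSet 14
T₁₄ = tileset

copy≡ : ∀ k v → copyCells T₁₄ (index k , v) ≡ translateCells v (cells (kindTile k))
copy≡ k v = cong (λ k → translateCells v (cells (kindTile k))) (kinds-index k)

copyB≡ : ∀ k v → copyBoundary T₁₄ (index k , v) ≡ translateBoundary v (boundary (kindTile k))
copyB≡ k v = cong (λ k → translateBoundary v (boundary (kindTile k))) (kinds-index k)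

pos : ℕ → ℕ → Point
pos x y = + x , + y

crossRow : Bool → ℕ → ℕ → List Bool → List (Placement T₁₄)
crossRow h x y [] = []
crossRow h x y (v ∷ q) = (index (cross h v) , pos x y) ∷ crossRow h (suc x) y q

fullRow : ℕ → Bool → List Bool → List (Placement T₁₄)
fullRow r b q = (index (rise b) , pos r r) ∷ crossRow b (suc r) r q

fullRows : ℕ → List Bool → List Bool → List (Placement T₁₄)
fullRows r [] q = []
fullRows r (b ∷ p) q = fullRow r b (p ++ q) ++ fullRows (suc r) p q

-- A wire that is taken off, with the colours on the horizontal segments of the device at the
-- bottom of its row, and on the vertical ones after the first.
Taken : Set
Taken = Bool × List Colour × List Colour

-- The lists of vertical colours also run through the interior of wide tiles, where any colour would
-- do; there the ink is repeated.
removed : ∀ {op q q'} → Step op q q' → List Taken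
removed (pass {x}) = (x , 3 ∷ [] , 3 ∷ []) ∷ []
removed (swap {x} {y}) = (x , 4 ∷ 4 ∷ [] , 4 ∷ 4 ∷ []) ∷ (y , 3 ∷ [] , 3 ∷ 4 ∷ []) ∷ []
removed (gate g) = let (i , j , k) = gateIn g in
  (i , 5 ∷ 5 ∷ 5 ∷ [] , 5 ∷ 5 ∷ 5 ∷ []) ∷ (j , [] , 5 ∷ 5 ∷ 5 ∷ []) ∷ (k , [] , 5 ∷ 5 ∷ 5 ∷ []) ∷ []

kept returned : ∀ {op q q'} → Step op q q' → List Bool
kept (pass {q = q}) = q
kept (swap {q = q}) = q
kept (gate g {q}) = q
returned (pass {x}) = x ∷ []
returned (swap {x} {y}) = y ∷ x ∷ []
returned (gate g) = bits (gateOut g)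

taken-width : ∀ {op q q'} (s : Step op q q') → length (removed s) ≡ width op
taken-width pass = refl
taken-width swap = refl
taken-width (gate g) = refl

deviceTiles : ∀ {op q q'} → ℕ → ℕ → Step op q q' → List (Placement T₁₄)
deviceTiles x y (pass {b}) = (index (turn b) , pos x y) ∷ []
deviceTiles x y (swap {b} {c}) = (index (long b) , pos x y) ∷ (index (turn c) , pos x (suc y)) ∷ []
deviceTiles x y (gate g) = (index (gate g) , pos x y) ∷ []

runTiles : ∀ {ops q q'} → ℕ → ℕ → Run ops q q' → List (Placement T₁₄)
runTiles n r [] = []
runTiles n r (_∷_ {op} s run) = (fullRows r (map fst (removed s)) (kept s) ++ deviceTiles (r + n) r s) ++ runTiles n (width op + r) run

pos-0 : ∀ x y → (+ (x + 0) , + (y + 0)) ≡ pos x y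
pos-0 x y = cong₂ pos (+-identityʳ x) (+-identityʳ y)

covered : List (Placement T₁₄) → List Cell
covered = concatMap (copyCells T₁₄)

cells-crossRow : ∀ h x y q → covered (crossRow h x y q) ≡ row (length q) x y
cells-crossRow h x y [] = refl
cells-crossRow h x y (v ∷ q) = cong₂ _++_ (copy≡ (cross h v) (pos x y) ∙ cong (_∷ []) (pos-0 x y)) (cells-crossRow h (suc x) y q)

cells-fullRows : ∀ r p q → covered (fullRows r p q) ≡ rows (length p) (length (p ++ q)) r
cells-fullRows r [] q = refl
cells-fullRows r (b ∷ p) q = concatMap-++ (copyCells T₁₄) (fullRow r b (p ++ q)) _ ∙ (cong₂ _++_
  (cong₂ _++_ (copy≡ (rise b) (pos r r) ∙ cong (_∷ []) (pos-0 r r)) (cells-crossRow b (suc r) r (p ++ q)))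
  (cells-fullRows (suc r) p q))

cells-device : ∀ {op q q'} x y (s : Step op q q') → covered (deviceTiles x y s) ≡ translateℕ x y (device op)
cells-device x y (pass {b}) = cong (_++ []) (copy≡ (turn b) (pos x y))
cells-device x y (swap {b} {c}) = cong₂ _++_ (copy≡ (long b) (pos x y))
  (cong (_++ []) (copy≡ (turn c) (pos x (suc y)) ∙ cong (λ z → (+ (x + 0) , + z) ∷ []) (+-identityʳ (suc y) ∙ +-comm 1 y)))
cells-device x y (gate g) = cong (_++ []) (copy≡ (gate g) (pos x y))

taken-rows : ∀ {op q q' n} r (s : Step op q q') → length q ≡ n →
  rows (length (map fst (removed s))) (length (map fst (removed s) ++ kept s)) r ≡ rows (width op) n r
taken-rows r pass refl = refl
taken-rows r swap refl = refl
taken-rows r (gate g) refl = refl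

cells-run : ∀ n {ops q q'} r (run : Run ops q q') → length q ≡ n → covered (runTiles n r run) ≡ Block.cellsFrom n r ops
cells-run n r [] e = refl
cells-run n r (_∷_ {op} s run) e = concatMap-++ (copyCells T₁₄) (fullRows r p (kept s) ++ deviceTiles (r + n) r s) _ ∙ (cong₂ _++_
  (concatMap-++ (copyCells T₁₄) (fullRows r p (kept s)) _ ∙
    cong₂ _++_ (cells-fullRows r p (kept s) ∙ taken-rows r s e) (cells-device (r + n) r s))
  (cells-run n (width op + r) run (Step-length s ∙ e)))
  where
  p = map fst (removed s)

nth : {A : Set} → A → List A → ℕ → A
nth d [] n = d
nth d (x ∷ xs) zero = x
nth d (x ∷ xs) (suc n) = nth d xs n

nth-drop : ∀ {A : Set} d r (xs : List A) {y ys} → drop r xs ≡ y ∷ ys → nth d xs r ≡ y × drop (suc r) xs ≡ ys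
nth-drop d zero (x ∷ xs) refl = refl , refl
nth-drop d (suc r) (x ∷ xs) e = nth-drop d r xs e

-- Lists of colours are indexed by absolute columns. Among the leading twos only the last one, on
-- the staircase, belongs to the region.
hrow : ℕ → List Bool → List Colour → List Colour
hrow r q dev = replicate r 2 ++ (map bit# q ++ dev)

vrow : ℕ → Bool → List Bool → List Colour → List Colour
vrow r b q dev = replicate r 2 ++ (2 ∷ (replicate (suc (length q)) (bit# b) ++ dev))

dealRows : (ℕ → Taken → List Bool → List Colour) → ℕ → List Taken → List Bool → List (List Colour)
dealRows f r [] q = []
dealRows f r (c ∷ p) q = f r c (map fst p ++ q) ∷ dealRows f (suc r) p q

length-dealRows : ∀ f r p q → length (dealRows f r p q) ≡ length p
length-dealRows f r [] q = refl
length-dealRows f r (c ∷ p) q = cong suc (length-dealRows f (suc r) p q)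

rowsH rowsV : ℕ → List Taken → List Bool → List (List Colour)
rowsH = dealRows (λ r (b , h , v) q → hrow r (b ∷ q) h)
rowsV = dealRows (λ r (b , h , v) q → vrow r b q v)

runH runV : ∀ {ops q q'} → ℕ → Run ops q q' → List (List Colour)
runH r ([] {q}) = hrow r q [] ∷ []
runH r (_∷_ {op} s run) = rowsH r (removed s) (kept s) ++ runH (width op + r) run
runV r [] = []
runV r (_∷_ {op} s run) = rowsV r (removed s) (kept s) ++ runV (width op + r) run

runH-head : ∀ {ops q q'} r (run : Run ops q q') → ∃[ dev ] ∃[ L ] runH r run ≡ hrow r q dev ∷ L
runH-head r [] = _ , _ , refl
runH-head r (pass ∷ run) = _ , _ , refl
runH-head r (swap ∷ run) = _ , _ , refl
runH-head r (gate g ∷ run) = _ , _ , refl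

module Colouring (hs vs : List (List Colour)) where

  colH colV : ℕ → ℕ → Colour
  colH x y = nth 0 (nth [] hs y) x
  colV x y = nth 0 (nth [] vs y) x

  -- One colouring of all segments. If every copy and the boundary of the region agree with it,
  -- shared segments match automatically, and no pair of copies has to be compared.
  col : Segment → Colour
  col (horizontal , + x , + y) = colH x y
  col (vertical , + x , + y) = colV x y
  col _ = 0

  Along : (ℕ → Colour) → ℕ → List Colour → Set
  Along f x [] = ⊤
  Along f x (k ∷ L) = f x ≡ k × Along f (suc x) L

  HAt VAt : ℕ → ℕ → List Colour → Set
  HAt x y = Along (λ x → colH x y) x
  VAt x y = Along (λ x → colV x y) x

  Along-++ : ∀ f x L {M} → Along f x (L ++ M) → Along f (length L + x) M
  Along-++ f x [] h = h
  Along-++ f x (k ∷ L) {M} (_ , h) = subst (λ z → Along f z M) (+-suc (length L) x) (Along-++ f (suc x) L h)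

  Along-nth : ∀ f (row : List Colour) x L → (∀ z → f z ≡ nth 0 row z) → drop x row ≡ L → Along f x L
  Along-nth f row x [] h e = tt
  Along-nth f row x (k ∷ L) h e = let p , q = nth-drop 0 x row e in h x ∙ p , Along-nth f row (suc x) L h q

  drop-replicate : ∀ r {k} (L : List Colour) → drop r (replicate r k ++ L) ≡ L
  drop-replicate zero L = refl
  drop-replicate (suc r) L = drop-replicate r L

  HAt-row : ∀ r q dev {L} → drop r hs ≡ hrow r q dev ∷ L → HAt r r (map bit# q ++ dev)
  HAt-row r q dev e = Along-nth _ (hrow r q dev) r _ (λ z → cong (λ row → nth 0 row z) (fst (nth-drop [] r hs e))) (drop-replicate r _)

  HAt-stair : ∀ r q dev {L} → drop (suc r) hs ≡ hrow (suc r) q dev ∷ L → HAt r (suc r) (2 ∷ map bit# q ++ dev)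
  HAt-stair r q dev e = Along-nth _ (hrow (suc r) q dev) r _ (λ z → cong (λ row → nth 0 row z) (fst (nth-drop [] (suc r) hs e))) (shape r)
    where
    shape : ∀ r {L} → drop r (replicate (suc r) 2 ++ L) ≡ 2 ∷ L
    shape zero = refl
    shape (suc r) = shape r

  VAt-row : ∀ r b q dev {L} → drop r vs ≡ vrow r b q dev ∷ L → VAt r r (2 ∷ replicate (suc (length q)) (bit# b) ++ dev)
  VAt-row r b q dev e = Along-nth _ (vrow r b q dev) r _ (λ z → cong (λ row → nth 0 row z) (fst (nth-drop [] r vs e))) (drop-replicate r _)

  Agreeing : List (Segment × Colour) → Set
  Agreeing = All (λ e → snd e ≡ col (fst e))

  AgreeingTiles : List (Placement T₁₄) → Set
  AgreeingTiles = All (λ p → Agreeing (copyBoundary T₁₄ p))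

  h₀ : ∀ {x y k} a b → colH (a + x) (b + y) ≡ k → k ≡ colH (x + a) (y + b)
  h₀ {x} {y} a b e = sym (cong₂ colH (+-comm x a) (+-comm y b) ∙ e)
  v₀ : ∀ {x y k} a b → colV (a + x) (b + y) ≡ k → k ≡ colV (x + a) (y + b)
  v₀ {x} {y} a b e = sym (cong₂ colV (+-comm x a) (+-comm y b) ∙ e)

  good-unit : ∀ {x y l r b t} → colV x y ≡ l → colV (suc x) y ≡ r → colH x y ≡ b → colH x (suc y) ≡ t →
    Agreeing (translateBoundary (pos x y) (boundary (unitTile l r b t)))
  good-unit {x} {y} el er eb et = h₀ 0 0 eb ∷ h₀ 0 1 et ∷ v₀ 0 0 el ∷ v₀ 1 0 er ∷ []

  good-tile : ∀ k v → Agreeing (translateBoundary v (boundary (kindTile k))) → Agreeing (copyBoundary T₁₄ (index k , v))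
  good-tile k v g = subst Agreeing (sym (copyB≡ k v)) g

  good-crossRow : ∀ h x y q {L M N} → HAt x y (map bit# q ++ L) → HAt x (suc y) (map bit# q ++ M) →
    VAt x y (replicate (suc (length q)) (bit# h) ++ N) → AgreeingTiles (crossRow h x y q)
  good-crossRow h x y [] _ _ _ = []
  good-crossRow h x y (v ∷ q) (b , hb) (t , ht) (l , (r , hv)) =
    good-tile (cross h v) (pos x y) (good-unit l r b t) ∷ good-crossRow h (suc x) y q hb ht (r , hv)

  good-fullRow : ∀ r b q {L M N} → HAt r r (map bit# (b ∷ q) ++ L) → HAt r (suc r) (2 ∷ map bit# q ++ M) →
    VAt r r (2 ∷ replicate (suc (length q)) (bit# b) ++ N) → AgreeingTiles (fullRow r b q)
  good-fullRow r b q (eb , hb) (et , ht) (el , (er , hv)) = good-tile (rise b) (pos r r) (good-unit el er eb et) ∷ good-crossRow b (suc r) r q hb ht (er , hv)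

  VAt-last : ∀ l x y k {L} → VAt x y (replicate (suc l) k ++ L) → colV (l + x) y ≡ k × VAt (suc (l + x)) y L
  VAt-last zero x y k (e , h) = e , h
  VAt-last (suc l) x y k {L} (_ , h) = let p , q = VAt-last l (suc x) y k h in
    subst (λ z → colV z y ≡ k) (+-suc l x) p , subst (λ z → VAt (suc z) y L) (+-suc l x) q

  shift-HAt : ∀ {a b L} → a ≡ b → HAt a a L → HAt b b L
  shift-HAt refl h = h

  Families : ℕ → ℕ → List Op → List Bool → Set
  Families n r ops q = Agreeing (leftV (height ops) r) × Agreeing (leftH (height ops) r) × Agreeing (Block.rightH n r ops) × Agreeing (Block.rightV n r ops) ×
    HAt (height ops + r) (height ops + r) (map bit# q)

  beyond : ∀ r q {L y} R → length q + r ≡ R → HAt r y (map bit# q ++ L) → HAt R y L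
  beyond r q {L} {y} R e h = subst (λ z → HAt z y L) (cong (_+ r) (length-map bit# q) ∙ e) (Along-++ (λ x → colH x y) r (map bit# q) h)

  past : ∀ {xs : List (List Colour)} r A {B k} → length A ≡ k → drop r xs ≡ A ++ B → drop (k + r) xs ≡ B
  past r [] refl e = e
  past {xs} r (a ∷ A) {B} refl e = subst (λ z → drop z xs ≡ B) (+-suc (length A) r) (past (suc r) A refl (snd (nth-drop [] r xs e)))

  -- For a device in column `R`: row by row, the colours below it, the wire arriving from the left
  -- and the colours from the next column on. `K` are the colours above it.
  Corners : ℕ → ℕ → List Taken → List Colour → Set
  Corners R r [] K = HAt R r K
  Corners R r ((b , h , v) ∷ p) K = (HAt R r h × colV R r ≡ bit# b × VAt (suc R) r v) × Corners R (suc r) p K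

  rowsH-head : ∀ r p q {K L} → ∃[ dev ] ∃[ M ] rowsH r p q ++ hrow (length p + r) q K ∷ L ≡ hrow r (map fst p ++ q) dev ∷ M
  rowsH-head r [] q = _ , _ , refl
  rowsH-head r (_ ∷ p) q = _ , _ , refl

  good-fullRows : ∀ r p q {K L M} R → length (map fst p ++ q) + r ≡ R → drop r hs ≡ rowsH r p q ++ hrow (length p + r) q K ∷ L →
    drop r vs ≡ rowsV r p q ++ M →
    AgreeingTiles (fullRows r (map fst p) q) × Agreeing (leftV (length p) r) × Agreeing (leftH (length p) r) × Corners R r p K
  good-fullRows r [] q R e eh ev = [] , [] , [] , beyond r q R e (HAt-row r q _ eh)
  good-fullRows r ((b , h , v) ∷ p) q {K} {L} R e eh ev =
    let q' = map fst p ++ q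
        e' = +-suc (length q') r ∙ e
        eh' = snd (nth-drop [] r hs eh) ∙ cong (λ z → rowsH (suc r) p q ++ hrow z q K ∷ L) (sym (+-suc (length p) r))
        tiles , lv , lh , cs = good-fullRows (suc r) p q R e' eh' (snd (nth-drop [] r vs ev))
        dev , _ , hd = rowsH-head (suc r) p q
        H = HAt-row r (b ∷ q') h eh
        T = HAt-stair r q' dev (eh' ∙ hd)
        V = VAt-row r b q' v ev
        dV , dW = VAt-last (length q') (suc r) r (bit# b) (snd V)
    in Allₚ.++⁺ (good-fullRow r b q' H T V) tiles , sym (fst V) ∷ lv , sym (fst T) ∷ lh ,
       (beyond r (b ∷ q') R e H , subst (λ z → colV z r ≡ bit# b) e' dV , subst (λ z → VAt (suc z) r v) e' dW) , cs

  hrow-++ : ∀ r q p {dev} → hrow r (q ++ p) dev ≡ hrow r q (map bit# p ++ dev)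
  hrow-++ r q p {dev} = cong (λ L → replicate r 2 ++ L) (cong (_++ dev) (map-++ bit# q p) ∙ ++-assoc (map bit# q) (map bit# p) dev)

  good-step : ∀ {op q q'} (s : Step op q q') r {dev L M} R → length q + r ≡ R →
    drop r hs ≡ rowsH r (removed s) (kept s) ++ hrow (width op + r) q' dev ∷ L → drop r vs ≡ rowsV r (removed s) (kept s) ++ M →
    AgreeingTiles (fullRows r (map fst (removed s)) (kept s)) × Agreeing (leftV (width op) r) × Agreeing (leftH (width op) r) ×
    Corners R r (removed s) (map bit# (returned s) ++ dev)
  good-step s@(pass {q = q}) r {L = L} R e eh = good-fullRows r (removed s) q R e (eh ∙ cong (λ w → rowsH r (removed s) q ++ w ∷ L) (hrow-++ (1 + r) q (returned s) {_}))
  good-step s@(swap {q = q}) r {L = L} R e eh = good-fullRows r (removed s) q R e (eh ∙ cong (λ w → rowsH r (removed s) q ++ w ∷ L) (hrow-++ (2 + r) q (returned s) {_}))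
  good-step s@(gate g {q}) r {L = L} R e eh = good-fullRows r (removed s) q R e (eh ∙ cong (λ w → rowsH r (removed s) q ++ w ∷ L) (hrow-++ (3 + r) q (returned s) {_}))

  good-device : ∀ {op q q'} (s : Step op q q') R r {dev} → Corners R r (removed s) (map bit# (returned s) ++ dev) →
    AgreeingTiles (deviceTiles R r s) × Agreeing (bottomOf op R r) × Agreeing (rightOf op R r)
  good-device (pass {x}) R r (((a , _) , v , w , _) , t , _) = good-tile (turn x) (pos R r) (good-unit v w a t) ∷ [] , sym a ∷ [] , sym w ∷ []
  good-device (swap {x} {y}) R r (((a₀ , a₁ , _) , d₀ , _ , d₂ , _) , ((b₀ , _) , g₀ , g₁ , g₂ , _) , c₀ , c₁ , _) =
    good-tile (long x) (pos R r) (h₀ 0 0 a₀ ∷ h₀ 1 0 a₁ ∷ v₀ 2 0 d₂ ∷ v₀ 2 1 g₂ ∷ h₀ 0 1 b₀ ∷ v₀ 1 1 g₁ ∷ v₀ 0 0 d₀ ∷ h₀ 1 2 c₁ ∷ []) ∷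
    good-tile (turn y) (pos R (suc r)) (good-unit g₀ g₁ b₀ c₀) ∷ [] ,
    sym a₀ ∷ sym a₁ ∷ [] , sym d₂ ∷ sym g₂ ∷ []
  good-device (gate g) R r (((a₀ , a₁ , a₂ , _) , d₀ , _ , _ , d₃ , _) , (_ , l₀ , _ , _ , l₃ , _) , (_ , m₀ , _ , _ , m₃ , _) , c₀ , c₁ , c₂ , _) =
    good-tile (gate g) (pos R r) (h₀ 0 0 a₀ ∷ h₀ 1 0 a₁ ∷ h₀ 2 0 a₂ ∷ v₀ 3 0 d₃ ∷ v₀ 3 1 l₃ ∷ v₀ 3 2 m₃ ∷
      v₀ 0 0 d₀ ∷ v₀ 0 1 l₀ ∷ v₀ 0 2 m₀ ∷ h₀ 0 3 c₀ ∷ h₀ 1 3 c₁ ∷ h₀ 2 3 c₂ ∷ []) ∷ [] ,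
    sym a₀ ∷ sym a₁ ∷ sym a₂ ∷ [] , sym d₃ ∷ sym l₃ ∷ sym m₃ ∷ []

  good-run : ∀ n {ops q q'} r (run : Run ops q q') → length q ≡ n → drop r hs ≡ runH r run → drop r vs ≡ runV r run →
    AgreeingTiles (runTiles n r run) × Families n r ops q'
  good-run n r ([] {q}) e eh ev = [] , [] , [] , [] , [] , subst (HAt r r) (++-identityʳ (map bit# q)) (HAt-row r q [] eh)
  good-run n {op ∷ ops} r (s ∷ run) e eh ev with dev , L , hd ← runH-head (width op + r) run =
    let tiles , lv , lh , cs = good-step s r (r + n) (cong (_+ r) e ∙ +-comm n r)
          (eh ∙ cong (λ L → rowsH r (removed s) (kept s) ++ L) hd) ev
        dt , db , dr = good-device s (r + n) r cs
        tiles' , f₁ , f₂ , f₃ , f₄ , f₅ = good-run n (width op + r) run (Step-length s ∙ e)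
          (past r (rowsH r (removed s) (kept s)) (length-dealRows _ r (removed s) (kept s) ∙ taken-width s) eh)
          (past r (rowsV r (removed s) (kept s)) (length-dealRows _ r (removed s) (kept s) ∙ taken-width s) ev)
    in Allₚ.++⁺ (Allₚ.++⁺ tiles dt) tiles' ,
       subst Agreeing (sym (line-++ _ 2 (width op) (height ops) r)) (Allₚ.++⁺ lv f₁) ,
       subst Agreeing (sym (line-++ _ 2 (width op) (height ops) r)) (Allₚ.++⁺ lh f₂) ,
       Allₚ.++⁺ db f₃ , Allₚ.++⁺ dr f₄ , shift-HAt (sym (raised (width op) (height ops) r)) f₅

  good-wires : ∀ x y q → HAt x y (map bit# q) → Agreeing (wires x y q)
  good-wires x y [] h = []
  good-wires x y (b ∷ q) (e , h) = sym e ∷ good-wires (suc x) y q h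

unique-concatMap : ∀ {A B : Set} (f : A → List B) xs → Unique (concatMap f xs) → AllPairs (λ a b → ∀ c → (c ∈ f a × c ∈ f b) → ⊥) xs
unique-concatMap f [] u = []
unique-concatMap f (x ∷ xs) u = All.tabulate (λ {b} i c (j , k) → clash (f x) u j (∈-concatMap⁺ f (lose i k))) ∷ unique-concatMap f xs (rest (f x) u)
  where
  clash : ∀ {c} as {bs} → Unique (as ++ bs) → c ∈ as → c ∈ bs → ⊥
  clash (a ∷ as) (n ∷ u) 1st k = All.lookup n (∈-++⁺ʳ as k) refl
  clash (a ∷ as) (n ∷ u) (there j) k = clash as u j k
  rest : ∀ as {bs} → Unique (as ++ bs) → Unique bs
  rest [] u = u
  rest (a ∷ as) (_ ∷ u) = rest as u

module _ {n : ℕ} (3≤n : 3 ≤ n) {ops : List Op} {u v : List Bool} (lu : length u ≡ n) (lv : length v ≡ n) (ne : 1 ≤ height ops) where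
  open Boundary n 3≤n using (region)

  -- The copies list the cells of the region in the order of the region, so that covering and
  -- disjointness both come from one equation between lists without repetition.
  run⇒tiles : Run ops u v → Tiles T₁₄ (region ops u v lu lv ne)
  run⇒tiles run = ps , record
    { union = λ c → mk⇔ (λ i → let p , j , k = find (∈-concatMap⁻ (copyCells T₁₄) {xs = ps} (subst (c ∈_) (sym cover) i)) in p , j , k)
                        (λ { (p , j , k) → subst (c ∈_) cover (∈-concatMap⁺ (copyCells T₁₄) (lose j k)) })
    ; disjoint = unique-concatMap (copyCells T₁₄) ps (subst Unique (sym cover) (Region.unique-cells n 3≤n 0 ops))
    ; matching = λ p q i j s a b k l → All.lookup (All.lookup tiles i) k ∙ sym (All.lookup (All.lookup tiles j) l)
    ; border = λ p i s a b k l → All.lookup (All.lookup tiles i) k ∙ sym (All.lookup boundary-good l) }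
    where
    ps = runTiles n 0 run
    cover : covered ps ≡ Block.cellsFrom n 0 ops
    cover = cells-run n 0 run lu
    open Colouring (runH 0 run) (runV 0 run)
    goods = good-run n 0 run lu refl refl
    tiles = fst goods
    fams = snd goods
    bottom : HAt 0 0 (map bit# u)
    bottom with dev , L , hd ← runH-head 0 run = prefix (map bit# u) (HAt-row 0 u dev hd)
      where
      prefix : ∀ L {M x y} → HAt x y (L ++ M) → HAt x y L
      prefix [] h = tt
      prefix (k ∷ L) (e , h) = e , prefix L h
    boundary-good : Agreeing (Block.boundaryOf n ops u v)
    boundary-good = Allₚ.++⁺ (fst fams) (Allₚ.++⁺ (fst (snd fams)) (Allₚ.++⁺ (fst (snd (snd fams)))
      (Allₚ.++⁺ (fst (snd (snd (snd fams)))) (Allₚ.++⁺ (good-wires 0 0 u bottom)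
        (good-wires (height ops) (height ops) v (subst (λ h → HAt h h (map bit# v)) (+-identityʳ (height ops)) (snd (snd (snd (snd fams))))))))))

-- Tilings are forced, hence come from runs

open import Data.List.Membership.DecPropositional (Finₚ._≟_ {14}) using () renaming (_∈?_ to _∈F?_)

-- The tiles with the given colours to the left of and below their lower left cell. No two tiles
-- other than gates share both.
cornerKinds : Colour → Colour → List (Fin 14)
cornerKinds 0 0 = index (cross false false) ∷ []
cornerKinds 0 1 = index (cross false true) ∷ []
cornerKinds 1 0 = index (cross true false) ∷ []
cornerKinds 1 1 = index (cross true true) ∷ []
cornerKinds 2 0 = index (rise false) ∷ []
cornerKinds 2 1 = index (rise true) ∷ []
cornerKinds 0 3 = index (turn false) ∷ []
cornerKinds 1 3 = index (turn true) ∷ []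
cornerKinds 0 4 = index (long false) ∷ []
cornerKinds 1 4 = index (long true) ∷ []
cornerKinds 0 5 = index (gate zero) ∷ index (gate (suc (suc zero))) ∷ []
cornerKinds 1 5 = index (gate (suc zero)) ∷ index (gate (suc (suc (suc zero)))) ∷ []
cornerKinds _ _ = []

_≟ᵃ_ : (a b : Axis) → Dec (a ≡ b)
horizontal ≟ᵃ horizontal = yes refl
horizontal ≟ᵃ vertical = no λ ()
vertical ≟ᵃ horizontal = no λ ()
vertical ≟ᵃ vertical = yes refl

_≟ˢ_ : (s t : Segment) → Dec (s ≡ t)
_≟ˢ_ = ≡-dec _≟ᵃ_ _≟ᶜ_

Corner : Fin 14 → Cell → Segment × Colour → Segment × Colour → Set
Corner i d e e' = fst e ≡ (vertical , d) → fst e' ≡ (horizontal , d) → d ≡ (0ℤ , 0ℤ) × i ∈ cornerKinds (snd e) (snd e')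

-- Found by inspecting all tiles. It locates a tile from a single cell: if the cells to the west and
-- south belong to other copies, the cell is the origin of its copy, and the two colours name the
-- tile.
corners : ∀ i → All (λ d → All (λ e → All (Corner i d e) (boundary (tile T₁₄ i))) (boundary (tile T₁₄ i))) (cells (tile T₁₄ i))
corners = toWitness {a? = Finₚ.all? λ i → All.all? (λ d → All.all? (λ e → All.all? (λ e' →
  (fst e ≟ˢ (vertical , d)) →-dec ((fst e' ≟ˢ (horizontal , d)) →-dec ((d ≟ᶜ (0ℤ , 0ℤ)) ×-dec (i ∈F? cornerKinds (snd e) (snd e')))))
  (boundary (tile T₁₄ i))) (boundary (tile T₁₄ i))) (cells (tile T₁₄ i))} _

bit#-injective : ∀ {a b} → bit# a ≡ bit# b → a ≡ b
bit#-injective {false} {false} _ = refl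
bit#-injective {true} {true} _ = refl

west-⊕ : ∀ v d → west (v ⊕ d) ≡ v ⊕ west d
west-⊕ (x , y) (a , b) = cong (_, y ℤ.+ b) ((Z.+-comm -[1+ 0 ] (x ℤ.+ a)) ∙ (Z.+-assoc x a -[1+ 0 ]) ∙ cong (λ z → x ℤ.+ z) (Z.+-comm a -[1+ 0 ]))

south-⊕ : ∀ v d → south (v ⊕ d) ≡ v ⊕ south d
south-⊕ (x , y) (a , b) = cong (x ℤ.+ a ,_) ((Z.+-comm -[1+ 0 ] (y ℤ.+ b)) ∙ (Z.+-assoc y b -[1+ 0 ]) ∙ cong (λ z → y ℤ.+ z) (Z.+-comm b -[1+ 0 ]))

⊕-0 : ∀ v → v ⊕ (0ℤ , 0ℤ) ≡ v
⊕-0 (x , y) = cong₂ _,_ (Z.+-identityʳ x) (Z.+-identityʳ y)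

∈translate : ∀ {a p k} v {bs} → ((a , p) , k) ∈ bs → ((a , v ⊕ p) , k) ∈ translateBoundary v bs
∈translate v 1st = 1st
∈translate v (there i) = there (∈translate v i)

self : ∀ dir d → d ∈ owners (dir , d)
self horizontal d = 1st
self vertical d = 1st

module Tiled {D : ColouredPolyomino} {ps : List (Placement T₁₄)} (t : IsTiling T₁₄ D ps) where
  open IsTiling t

  Known : Segment → Colour → Set
  Known s a = (∃[ p ] (p ∈ ps × (s , a) ∈ copyBoundary T₁₄ p)) ⊎ (s , a) ∈ boundary D

  agrees : ∀ {s a b p} → Known s a → p ∈ ps → (s , b) ∈ copyBoundary T₁₄ p → b ≡ a
  agrees (inl (q , j , k)) i l = matching _ q i j _ _ _ l k
  agrees (inr k) i l = border _ i _ _ _ l k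

  -- This puts the side between two neighbouring cells on the boundary of the copy covering `c`, so
  -- that its colour must match.
  Separate : Cell → Cell → Set
  Separate c d = ∀ p → p ∈ ps → c ∈ copyCells T₁₄ p → d ∉ copyCells T₁₄ p

  outside-split : ∀ {c d} → d ∉ cells D → Separate c d
  outside-split o p i _ k = o (Equivalence.from (union _) (p , i , k))

  same-tile : ∀ {p q c} → p ∈ ps → q ∈ ps → c ∈ copyCells T₁₄ p → c ∈ copyCells T₁₄ q → p ≡ q
  same-tile = go disjoint
    where
    go : ∀ {qs} → AllPairs (λ p q → ∀ c → ¬ (c ∈ copyCells T₁₄ p × c ∈ copyCells T₁₄ q)) qs →
      ∀ {p q c} → p ∈ qs → q ∈ qs → c ∈ copyCells T₁₄ p → c ∈ copyCells T₁₄ q → p ≡ q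
    go (h ∷ hs) 1st 1st k l = refl
    go (h ∷ hs) 1st (there j) k l = ⊥-elim (All.lookup h j _ (k , l))
    go (h ∷ hs) (there i) 1st k l = ⊥-elim (All.lookup h i _ (l , k))
    go (h ∷ hs) (there i) (there j) k l = go hs i j k l

  edge-of : ∀ {i v d a s} dir → (i , v) ∈ ps → d ∈ cells (tile T₁₄ i) → (dir , d) ≡ s →
    (∃[ e ] (e ∈ owners s × e ∉ cells (tile T₁₄ i))) → Known (dir , v ⊕ d) a → (s , a) ∈ boundary (tile T₁₄ i)
  edge-of {i} {v} {d} {a} dir p∈ d∈ refl (e , o , out) known
    with (_ , k) , m , refl ← ∈-map⁻ fst (Equivalence.from (coloured (tile T₁₄ i) (dir , d))
        ((d , d∈ , ∈owners⇒∈sides (dir , d) (self dir d)) , (e , out , ∈owners⇒∈sides (dir , d) o)))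
    with refl ← agrees known p∈ (∈translate v m) = m

  Placed : Kind → Cell → Set
  Placed k c = (index k , c) ∈ ps

  corner : ∀ {c a b} → c ∈ cells D → Separate c (west c) → Separate c (south c) → Known (vertical , c) a → Known (horizontal , c) b →
    ∃[ i ] (i ∈ cornerKinds a b × (i , c) ∈ ps)
  corner {c} {a} {b} c∈ w s kv kh with (i , v) , p∈ , j ← Equivalence.to (union c) c∈ with d , d∈ , refl ← ∈-map⁻ (v ⊕_) j =
    i , snd here-only , subst (λ z → (i , z) ∈ ps) (sym (cong (v ⊕_) (fst here-only) ∙ ⊕-0 v)) p∈
    where
    away : ∀ {e} → v ⊕ e ∉ copyCells T₁₄ (i , v) → e ∉ cells (tile T₁₄ i)
    away o k = o (∈-map⁺ (v ⊕_) k)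
    here-only : d ≡ (0ℤ , 0ℤ) × i ∈ cornerKinds a b
    here-only = All.lookup (All.lookup (All.lookup (corners i) d∈)
        (edge-of vertical p∈ d∈ refl (west d , 2nd , away (subst (_∉ copyCells T₁₄ (i , v)) (west-⊕ v d) (w _ p∈ j))) kv))
        (edge-of horizontal p∈ d∈ refl (south d , 2nd , away (subst (_∉ copyCells T₁₄ (i , v)) (south-⊕ v d) (s _ p∈ j))) kh)
      refl refl

  record Site (c : Cell) (a b : Colour) : Set where
    constructor site
    field
      inside : c ∈ cells D
      w : Separate c (west c)
      s : Separate c (south c)
      kv : Known (vertical , c) a
      kh : Known (horizontal , c) b

  corner' : ∀ {c a b} → Site c a b → ∃[ i ] (i ∈ cornerKinds a b × (i , c) ∈ ps)
  corner' (site i w s kv kh) = corner i w s kv kh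

  only : ∀ {i j : Fin 14} → i ∈ (j ∷ []) → i ≡ j
  only (here e) = e

  place-cross : ∀ {c} h v → Site c (bit# h) (bit# v) → Placed (cross h v) c
  place-cross false false st with i , 1st , p ← corner' st = p
  place-cross false true st with i , 1st , p ← corner' st = p
  place-cross true false st with i , 1st , p ← corner' st = p
  place-cross true true st with i , 1st , p ← corner' st = p

  place-rise : ∀ {c} b → Site c 2 (bit# b) → Placed (rise b) c
  place-rise false st with i , 1st , p ← corner' st = p
  place-rise true st with i , 1st , p ← corner' st = p

  place-turn : ∀ {c} b → Site c (bit# b) 3 → Placed (turn b) c
  place-turn false st with i , 1st , p ← corner' st = p
  place-turn true st with i , 1st , p ← corner' st = p

  place-long : ∀ {c} b → Site c (bit# b) 4 → Placed (long b) c
  place-long false st with i , 1st , p ← corner' st = p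
  place-long true st with i , 1st , p ← corner' st = p

  place-gate : ∀ {c} b → Site c (bit# b) 5 → ∃[ g ] Placed (gate g) c
  place-gate false st with corner' st
  ... | i , 1st , p = _ , p
  ... | i , 2nd , p = _ , p
  place-gate true st with corner' st
  ... | i , 1st , p = _ , p
  ... | i , 2nd , p = _ , p

  edge : ∀ {k c a d col} → Placed k c → ((a , d) , col) ∈ boundary (kindTile k) → Known (a , c ⊕ d) col
  edge {k} {c} p i = inl (_ , p , subst (_ ∈_) (sym (copyB≡ k c)) (∈translate c i))

  placed-split : ∀ {k c d} → Placed k c → d ∈ cells (kindTile k) → ∀ e → e ∉ translateCells c (cells (kindTile k)) → Separate e (c ⊕ d)
  placed-split {k} {c} {d} p d∈ e e∉ q q∈ m l
    with refl ← same-tile q∈ p l (subst (c ⊕ d ∈_) (sym (copy≡ k c)) (∈-map⁺ (c ⊕_) d∈)) = e∉ (subst (e ∈_) (copy≡ k c) m)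

  at-seg : ∀ {a x y x' y' k} → x ≡ x' → y ≡ y' → Known (a , pos x y) k → Known (a , pos x' y') k
  at-seg refl refl h = h

  at-split : ∀ {c x y x' y'} → x ≡ x' → y ≡ y' → Separate c (pos x y) → Separate c (pos x' y')
  at-split refl refl h = h

  -- A colour alone does not place a tile: the cell above the wire must also be known to be cut off
  -- from the one below.
  Wires : ℕ → ℕ → List Bool → Set
  Wires x y [] = ⊤
  Wires x y (b ∷ q) = (Known (hseg x y) (bit# b) × Separate (pos x y) (south (pos x y))) × Wires (suc x) y q

  Wires-++ : ∀ x y p {q} → Wires x y p → Wires (length p + x) y q → Wires x y (p ++ q)
  Wires-++ x y [] _ h = h
  Wires-++ x y (b ∷ p) {q} (e , g) h = e , Wires-++ (suc x) y p g (subst (λ z → Wires z y q) (sym (+-suc (length p) x)) h)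

  Enters : ℕ → ℕ → Bool → Set
  Enters x y h = Known (vseg x y) (bit# h) × Separate (pos x y) (west (pos x y))

  translated∉ : ∀ v {t cs} → t ∉ cs → v ⊕ t ∉ translateCells v cs
  translated∉ v@(x , y) {t@(a , b)} {cs} n i with (c , d) , d∈ , e ← ∈-map⁻ (v ⊕_) i =
    n (subst (_∈ cs) (sym (cong₂ _,_ (cancel x a c (cong fst e)) (cancel y b d (cong snd e)))) d∈)
    where
    cancel : ∀ x a c → x ℤ.+ a ≡ x ℤ.+ c → a ≡ c
    cancel = ∙-cancelˡ

  goes-up : ∀ k {x y} d e {b} → Placed k (pos x y) → at horizontal d (suc e) b ∈ boundary (kindTile k) → (+ d , + e) ∈ cells (kindTile k) →
    (+ d , + suc e) ∉ cells (kindTile k) → Known (hseg (d + x) (suc e + y)) b × Separate (pos (d + x) (suc e + y)) (south (pos (d + x) (suc e + y)))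
  goes-up k {x} {y} d e p b∈ i o = at-seg (+-comm x d) (+-comm y (suc e)) (edge {k} p b∈) ,
    at-split (+-comm x d) (+-comm y e) (placed-split {k} p i (pos (d + x) (suc e + y))
      (subst (_∉ translateCells (pos x y) (cells (kindTile k))) (cong₂ pos (+-comm x d) (+-comm y (suc e))) (translated∉ (pos x y) o)))

  goes-right : ∀ k {x y b} → Placed k (pos x y) → at vertical 1 0 b ∈ boundary (kindTile k) → (+ 0 , + 0) ∈ cells (kindTile k) →
    (+ 1 , + 0) ∉ cells (kindTile k) → Known (vseg (suc x) y) b × Separate (pos (suc x) y) (west (pos (suc x) y))
  goes-right k {x} {y} p b∈ i o = at-seg (+-comm x 1) (+-identityʳ y) (edge {k} p b∈) ,
    at-split (+-identityʳ x) (+-identityʳ y) (placed-split {k} p i (pos (suc x) y)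
      (subst (_∉ translateCells (pos x y) (cells (kindTile k))) (cong₂ pos (+-comm x 1) (+-identityʳ y)) (translated∉ (pos x y) o)))

  -- From west to east, the tile just placed supplies the colour and the cut on the left of the next
  -- cell.
  cross-row : ∀ h x y q → (∀ c → c ∈ row (length q) x y → c ∈ cells D) → Enters x y h → Wires x y q →
    Wires x (suc y) q × Enters (length q + x) y h
  cross-row h x y [] inD en ws = tt , en
  cross-row h x y (b ∷ q) inD (kv , w) ((kh , s) , ws) =
    let p = place-cross h b (site (inD _ 1st) w s kv kh)
        ws' , en' = cross-row h (suc x) y q (λ c i → inD c (there i)) (goes-right (cross h b) p 4th 1st λ { (here ()) }) ws
    in (goes-up (cross h b) 0 0 p 2nd 1st (λ { (here ()) }) , ws') , subst (λ z → Enters z y h) (+-suc (length q) x) en'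

  full-row : ∀ r b q → (∀ c → c ∈ row (suc (length q)) r r → c ∈ cells D) → (vseg r r , 2) ∈ boundary D →
    west (pos r r) ∉ cells D → Wires r r (b ∷ q) → Wires (suc r) (suc r) q × Enters (length q + suc r) r b
  full-row r b q inD l o ((kh , s) , ws) =
    let p = place-rise b (site (inD _ 1st) (outside-split o) s (inr l) kh)
    in cross-row b (suc r) r q (λ c i → inD c (there i)) (goes-right (rise b) p 4th 1st λ { (here ()) }) ws

  Entering : ℕ → ℕ → List Bool → Set
  Entering x y [] = ⊤
  Entering x y (b ∷ p) = Enters x y b × Entering x (suc y) p

  full-rows : ∀ p r q R → length (p ++ q) + r ≡ R → (∀ c → c ∈ rows (length p) (length (p ++ q)) r → c ∈ cells D) →
    (∀ e → e ∈ leftV (length p) r → e ∈ boundary D) → (∀ y → west (pos y y) ∉ cells D) →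
    Wires r r (p ++ q) → Wires (length p + r) (length p + r) q × Entering R r p
  full-rows [] r q R e inD l o ws = ws , tt
  full-rows (b ∷ p) r q R e inD l o ws =
    let ws₁ , en = full-row r b (p ++ q) (λ c i → inD c (∈-++⁺ˡ i)) (l _ 1st) (o r) ws
        e' = +-suc (length (p ++ q)) r ∙ e
        ws₂ , ens = full-rows p (suc r) q R e' (λ c i → inD c (∈-++⁺ʳ (row (suc (length (p ++ q))) r r) i)) (λ f i → l f (there i)) o ws₁
    in subst (λ z → Wires z z q) (+-suc (length p) r) ws₂ , subst (λ z → Enters z r b) e' en , ens

  module _ (n : ℕ) (3≤n : 3 ≤ n) where
    open Block n
    open Boundary n 3≤n

    -- What the remaining operations need to know about `D`. In contrast to equality with a whole
    -- region, this is inherited by the tail of the list.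
    record Part (r : ℕ) (ops : List Op) : Set where
      field
        cells-in : ∀ c → c ∈ cellsFrom r ops → c ∈ cells D
        left-in : ∀ e → e ∈ leftV (height ops) r → e ∈ boundary D
        foot-in : ∀ e → e ∈ rightH r ops → e ∈ boundary D
        foot-out : ∀ x y → Foot r ops x y → south (pos x y) ∉ cells D
    open Part

    left-split : ∀ {r op ops} → Part r (op ∷ ops) → ∀ e → e ∈ leftV (width op) r ++ leftV (height ops) (width op + r) → e ∈ boundary D
    left-split {r} {op} {ops} P e i = left-in P e (subst (e ∈_) (sym (line-++ _ 2 (width op) (height ops) r)) i)

    rest : ∀ {r op ops} → Part r (op ∷ ops) → Part (width op + r) ops
    rest {r} {op} {ops} P = record
      { cells-in = λ c i → cells-in P c (∈-++⁺ʳ (rows (width op) n r ++ translateℕ (r + n) r (device op)) i)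
      ; left-in = λ e i → left-split P e (∈-++⁺ʳ (leftV (width op) r) i)
      ; foot-in = λ e i → foot-in P e (∈-++⁺ʳ (bottomOf op (r + n) r) i)
      ; foot-out = λ x y f → foot-out P x y (inr f) }

    row-in : ∀ {r op ops} → Part r (op ∷ ops) → ∀ c → c ∈ rows (width op) n r → c ∈ cells D
    row-in P c i = cells-in P c (∈-++⁺ˡ (∈-++⁺ˡ i))

    device-in : ∀ {r op ops} → Part r (op ∷ ops) → ∀ c → c ∈ translateℕ (r + n) r (device op) → c ∈ cells D
    device-in {r} {op} P c i = cells-in P c (∈-++⁺ˡ (∈-++⁺ʳ (rows (width op) n r) i))

    anchor : ∀ {r op ops b} → Part r (op ∷ ops) → Enters (r + n) r b → Site (pos (r + n) r) (bit# b) (ink op)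
    anchor {r} {op} P (kv , w) = site
      (subst (_∈ cells D) (cong₂ pos (+-identityʳ (r + n)) (+-identityʳ r)) (device-in P _ (∈-map⁺ _ (device-corner op)))) w
      (outside-split (foot-out P (r + n) r (inl (refl , ≤-refl , +-monoˡ-≤ (r + n) (1≤width op))))) kv
      (inr (foot-in P _ (∈-++⁺ˡ (bottom-corner op))))
      where
      device-corner : ∀ op → (0 , 0) ∈ device op
      device-corner pass = 1st
      device-corner swap = 1st
      device-corner gate = 1st
      bottom-corner : ∀ op → (hseg (r + n) r , ink op) ∈ bottomOf op (r + n) r
      bottom-corner pass = 1st
      bottom-corner swap = 1st
      bottom-corner gate = 1st

    -- A wire arriving here comes from a copy, which has to match the boundary, or, when there are
    -- no operations, from the boundary itself, whose colours are unique.
    final-row : ∀ x y q v → length q ≡ length v → (∀ e → e ∈ wires x y v → e ∈ boundary D) → Wires x y q → q ≡ v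
    final-row x y [] [] e h ws = refl
    final-row x y (b ∷ q) (c ∷ v) e h ((k , _) , ws) =
      cong₂ _∷_ (bit#-injective (same k)) (final-row (suc x) y q v (suc-injective e) (λ f i → h f (there i)) ws)
      where
      functional : ∀ {bs s j k} → Unique (map fst bs) → (s , j) ∈ bs → (s , k) ∈ bs → j ≡ k
      functional (n ∷ u) 1st 1st = refl
      functional (n ∷ u) 1st (there j) = ⊥-elim (All.lookup n (∈-map⁺ fst j) refl)
      functional (n ∷ u) (there i) 1st = ⊥-elim (All.lookup n (∈-map⁺ fst i) refl)
      functional (n ∷ u) (there i) (there j) = functional u i j
      same : Known (hseg x y) (bit# b) → bit# b ≡ bit# c
      same (inl (p , p∈ , i)) = border p p∈ _ _ _ i (h _ 1st)
      same (inr i) = functional (one-colour D) i (h _ 1st)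

    short : ∀ {m} → m ≤ 2 → m ≢ n
    short le refl = <-irrefl refl (3≤n » le)

    -- The rows bring the first wires to the device, whose tile is then placed by its lower left
    -- corner. The wires above the rows, followed by those above the device, form the queue of the
    -- remaining operations.
    tiled-run : ∀ r ops q {v} → Part r ops → (∀ y → west (pos y y) ∉ cells D) → length q ≡ n → length v ≡ n → Wires r r q →
      (∀ e → e ∈ wires (height ops + r) (height ops + r) v → e ∈ boundary D) → Run ops q v

    onward : ∀ {r op ops} q out {v} → Part r (op ∷ ops) → (∀ y → west (pos y y) ∉ cells D) → length (q ++ out) ≡ n → width op + length q ≡ n →
      length v ≡ n → Wires (width op + r) (width op + r) q → Wires (r + n) (width op + r) out →
      (∀ e → e ∈ wires (height (op ∷ ops) + r) (height (op ∷ ops) + r) v → e ∈ boundary D) → Run ops (q ++ out) v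
    onward {r} {op} {ops} q out {v} P o lq e lv ws wo top = tiled-run (width op + r) ops (q ++ out) (rest P) o lq lv
      (Wires-++ (width op + r) (width op + r) q ws (subst (λ z → Wires z (width op + r) out) (cong (λ k → r + k) (sym e) ∙ turned (length q) (width op) r) wo))
      (subst (λ h → ∀ e → e ∈ wires h h v → e ∈ boundary D) (raised (width op) (height ops) r) top)
      where
      turned : ∀ l w r → r + (w + l) ≡ l + (w + r)
      turned = solve-∀

    entering : ∀ {r op ops} p q → Part r (op ∷ ops) → (∀ y → west (pos y y) ∉ cells D) → length p ≡ width op → length (p ++ q) ≡ n →
      Wires r r (p ++ q) → Wires (length p + r) (length p + r) q × Entering (r + n) r p
    entering {r} p q P o e refl ws = full-rows p r q (r + n) (+-comm n r)
      (λ c i → row-in P c (subst (λ w → c ∈ rows w n r) e i)) (λ f i → left-split P f (∈-++⁺ˡ (subst (λ w → f ∈ leftV w r) e i))) o ws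

    tiled-run r [] q {v} P o lq lv ws top with refl ← final-row r r q v (lq ∙ sym lv) top ws = []
    tiled-run r (pass ∷ ops) [] P o e lv ws top = ⊥-elim (short z≤n e)
    tiled-run r (pass ∷ ops) (x ∷ q) P o e lv ws top =
      let ws₁ , en , _ = entering (x ∷ []) q P o refl e ws
          p = place-turn x (anchor P en)
      in pass ∷ onward q (x ∷ []) P o (Step-length (pass {x} {q}) ∙ e) e lv ws₁ (goes-up (turn x) 0 0 p 2nd 1st (λ { (here ()) }) , tt) top
    tiled-run r (swap ∷ ops) [] P o e lv ws top = ⊥-elim (short z≤n e)
    tiled-run r (swap ∷ ops) (x ∷ []) P o e lv ws top = ⊥-elim (short (s≤s z≤n) e)
    tiled-run r (swap ∷ ops) (x ∷ y ∷ q) P o e lv ws top =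
      let ws₁ , en , (kv , w) , _ = entering (x ∷ y ∷ []) q P o refl e ws
          R = r + n
          p = place-long x (anchor P en)
          -- The long tile provides the lower side of its notch, so the cell in the notch is a
          -- corner in its turn.
          kh , s = goes-up (long x) 0 0 p 5th 1st (λ { (there (there (here ()))) })
          p' = place-turn y (site (subst (_∈ cells D) (cong₂ pos (+-identityʳ R) (+-comm r 1))
              (device-in P _ (∈-map⁺ (λ d → + (R + fst d) , + (r + snd d)) {x = 0 , 1} 4th))) w s kv kh)
      in swap ∷ onward q (y ∷ x ∷ []) P o (Step-length (swap {x} {y} {q}) ∙ e) e lv ws₁
          (goes-up (turn y) 0 0 p' 2nd 1st (λ { (here ()) }) , goes-up (long x) 1 1 p 8th 3rd (λ { (there (there (here ()))) }) , tt) top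
    tiled-run r (gate ∷ ops) [] P o e lv ws top = ⊥-elim (short z≤n e)
    tiled-run r (gate ∷ ops) (x ∷ []) P o e lv ws top = ⊥-elim (short (s≤s z≤n) e)
    tiled-run r (gate ∷ ops) (x ∷ y ∷ []) P o e lv ws top = ⊥-elim (short ≤-refl e)
    tiled-run r (gate ∷ ops) (x ∷ y ∷ z ∷ q) {v} P o e lv ws top =
      let ws₁ , en₁ , en₂ , en₃ , _ = entering (x ∷ y ∷ z ∷ []) q P o refl e ws
          R = r + n
          g , p = place-gate x (anchor P en₁)
          -- The corner has left two gates. Whichever was placed, the arriving wires match its left
          -- side, hence they are its input.
          read : ∀ {e b b'} → Known (vertical , pos R (e + r)) (bit# b) → ((vertical , + 0 , + e) , bit# b') ∈ boundary (kindTile (gate g)) → b' ≡ b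
          read {e} {b} {b'} k m = bit#-injective (agrees (at-seg (sym (+-identityʳ R)) (+-comm e r) k) p
            (subst (((vertical , pos R r ⊕ (+ 0 , + e)) , bit# b') ∈_) (sym (copyB≡ (gate g) (pos R r))) (∈translate (pos R r) m)))
      in subst₂ (λ a q' → Run (gate ∷ ops) (a ∷ q') v) (read {0} (fst en₁) 7th) (cong₂ (λ b c → b ∷ c ∷ q) (read {1} (fst en₂) 8th) (read {2} (fst en₃) 9th))
        (gate g ∷ onward q (bits (gateOut g)) P o (Step-length (gate g {q}) ∙ e) e lv ws₁
           (goes-up (gate g) 0 2 p 10th 7th above , goes-up (gate g) 1 2 p 11th 8th above , goes-up (gate g) 2 2 p 12th 9th above , tt) top)
      where
      above : ∀ {d} → (+ d , + 3) ∉ cells (kindTile (gate zero))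
      above i with () ← All.lookup {P = λ (c : Cell) → snd c ≢ + 3} ((λ ()) ∷ (λ ()) ∷ (λ ()) ∷ (λ ()) ∷ (λ ()) ∷ (λ ()) ∷ (λ ()) ∷ (λ ()) ∷ (λ ()) ∷ []) i refl

    tiles⇒run : ∀ {ops u v} → cells D ≡ cellsFrom 0 ops → boundary D ≡ boundaryOf ops u v → length u ≡ n → length v ≡ n → Run ops u v
    tiles⇒run {ops} {u} {v} ec eb lu lv = tiled-run 0 ops u
      (record { cells-in = λ c → subst (c ∈_) (sym ec)
          ; left-in = λ e i → in-b (∈-++⁺ˡ i)
          ; foot-in = λ e i → in-b (∈-++⁺ʳ (leftV (height ops) 0) (∈-++⁺ʳ (leftH (height ops) 0) (∈-++⁺ˡ i)))
          ; foot-out = λ x y f → subst (south (pos x y) ∉_) (sym ec) (south-of-foot ops y f) })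
      (λ y → subst (west (pos y y) ∉_) (sym ec) (west-of-diagonal ops y)) lu lv
      (entry-wires 0 u (λ e i → in-b (∈-++⁺ʳ (leftV (height ops) 0) (∈-++⁺ʳ (leftH (height ops) 0) (∈-++⁺ʳ (rightH 0 ops) (∈-++⁺ʳ (rightV 0 ops) (∈-++⁺ˡ i)))))))
      (λ e i → in-b (∈-++⁺ʳ (leftV (height ops) 0) (∈-++⁺ʳ (leftH (height ops) 0) (∈-++⁺ʳ (rightH 0 ops) (∈-++⁺ʳ (rightV 0 ops) (∈-++⁺ʳ (wires 0 0 u)
        (subst (λ h → e ∈ wires h h v) (+-identityʳ (height ops)) i)))))))
      where
      in-b : ∀ {e} → e ∈ boundaryOf ops u v → e ∈ boundary D
      in-b {e} = subst (e ∈_) (sym eb)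
      negative : ∀ x → south (pos x 0) ∉ cells D
      negative x i with _ , _ , () , _ ← Region.∈⇒Inside n 3≤n 0 ops (subst (south (pos x 0) ∈_) ec i)
      entry-wires : ∀ x q → (∀ e → e ∈ wires x 0 q → e ∈ boundary D) → Wires x 0 q
      entry-wires x [] h = tt
      entry-wires x (b ∷ q) h = (inr (h _ 1st) , outside-split (negative x)) , entry-wires (suc x) q (λ e i → h e (there i))

-- Encodings determine regions

PrefixFree : {A : Set} → (A → Word) → Set
PrefixFree enc = ∀ a b {r s} → enc a ++ r ≡ enc b ++ s → a ≡ b × r ≡ s

prefixFree-injective : ∀ {A} {enc : A → Word} → PrefixFree enc → ∀ {a b} → enc a ≡ enc b → a ≡ b
prefixFree-injective p e = fst (p _ _ (cong (_++ []) e))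

prefixFree-× : ∀ {A B} {f : A → Word} {g : B → Word} → PrefixFree f → PrefixFree g → PrefixFree (λ (x : A × B) → f (fst x) ++ g (snd x))
prefixFree-× {f = f} {g} p q (a , b) (c , d) e
  with refl , e' ← p a c (sym (++-assoc (f a) (g b) _) ∙ e ∙ ++-assoc (f c) (g d) _)
  with refl , e″ ← q b d e' = refl , e″

prefixFree-ℕᵇ : PrefixFree encodeℕᵇ
prefixFree-ℕᵇ ℕᵇ.zero ℕᵇ.zero refl = refl , refl
prefixFree-ℕᵇ 2[1+ x ] 2[1+ y ] e with refl , e' ← prefixFree-ℕᵇ x y (∷-injectiveʳ (∷-injectiveʳ e)) = refl , e'
prefixFree-ℕᵇ 1+[2 x ] 1+[2 y ] e with refl , e' ← prefixFree-ℕᵇ x y (∷-injectiveʳ (∷-injectiveʳ e)) = refl , e'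

prefixFree-ℕ : PrefixFree encodeℕ
prefixFree-ℕ m n e with e₁ , e₂ ← prefixFree-ℕᵇ (ℕᵇ.fromℕ m) (ℕᵇ.fromℕ n) e =
  sym (toℕ-fromℕ m) ∙ cong ℕᵇ.toℕ e₁ ∙ toℕ-fromℕ n , e₂

prefixFree-ℤ : PrefixFree encodeℤ
prefixFree-ℤ (+ m) (+ n) e with refl , e' ← prefixFree-ℕ m n (∷-injectiveʳ e) = refl , e'
prefixFree-ℤ -[1+ m ] -[1+ n ] e with refl , e' ← prefixFree-ℕ m n (∷-injectiveʳ e) = refl , e'

prefixFree-point : PrefixFree encodePoint
prefixFree-point = prefixFree-× prefixFree-ℤ prefixFree-ℤ

prefixFree-axis : PrefixFree encodeAxis
prefixFree-axis horizontal horizontal refl = refl , refl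
prefixFree-axis vertical vertical refl = refl , refl

prefixFree-colouredSegment : PrefixFree encodeColouredSegment
prefixFree-colouredSegment ((a , p) , k) ((b , q) , l) e
  with refl , refl ← prefixFree-× prefixFree-axis (prefixFree-× prefixFree-point prefixFree-ℕ) (a , p , k) (b , q , l) e = refl , refl

prefixFree-list : ∀ {A} {enc : A → Word} → PrefixFree enc → PrefixFree (encodeList enc)
prefixFree-list p [] [] refl = refl , refl
prefixFree-list {enc = enc} p (x ∷ xs) (y ∷ ys) e
  with refl , e' ← p x y (sym (++-assoc (enc x) (encodeList enc xs) _) ∙ ∷-injectiveʳ e ∙ ++-assoc (enc y) (encodeList enc ys) _)
  with refl , e″ ← prefixFree-list p xs ys e' = refl , e″

-- A witness of the tiling problem contains some region with the given code; this identifies its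
-- cells and boundary with those constructed.
encodeCellsBoundary-injective : ∀ {cs bs ds es} → encodeCellsBoundary cs bs ≡ encodeCellsBoundary ds es → cs ≡ ds × bs ≡ es
encodeCellsBoundary-injective {cs} {bs} {ds} {es} e
  with refl ← prefixFree-injective (prefixFree-× (prefixFree-list prefixFree-point) (prefixFree-list prefixFree-colouredSegment)) {cs , bs} {ds , es} e = refl , refl

-- Operations applied anywhere in the queue, and permutations of wires

Run-++⁺ : ∀ {as bs q r s} → Run as q r → Run bs r s → Run (as ++ bs) q s
Run-++⁺ [] y = y
Run-++⁺ (s ∷ x) y = s ∷ Run-++⁺ x y

Run-++⁻ : ∀ as {bs q s} → Run (as ++ bs) q s → ∃[ r ] (Run as q r × Run bs r s)
Run-++⁻ [] y = _ , [] , y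
Run-++⁻ (a ∷ as) (s ∷ y) = let r , x , z = Run-++⁻ as y in r , s ∷ x , z

Run-length : ∀ {ops q r} → Run ops q r → length r ≡ length q
Run-length [] = refl
Run-length (s ∷ x) = Run-length x ∙ Step-length s

rotate⁺ : ∀ xs {ys} → Run (replicate (length xs) pass) (xs ++ ys) (ys ++ xs)
rotate⁺ [] {ys} = subst (Run [] ys) (sym (++-identityʳ ys)) []
rotate⁺ (x ∷ xs) {ys} = pass ∷ subst₂ (Run (replicate (length xs) pass)) (sym (++-assoc xs ys (x ∷ []))) (++-assoc ys (x ∷ []) xs) (rotate⁺ xs)

pass-deterministic : ∀ n {q r s} → Run (replicate n pass) q r → Run (replicate n pass) q s → r ≡ s
pass-deterministic zero [] [] = refl
pass-deterministic (suc n) (pass ∷ x) (pass ∷ y) = pass-deterministic n x y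

data Front : Op → List Bool → List Bool → Set where
  pass : ∀ {x} → Front pass (x ∷ []) (x ∷ [])
  swap : ∀ {x y} → Front swap (x ∷ y ∷ []) (y ∷ x ∷ [])
  gate : ∀ g → Front gate (bits (gateIn g)) (bits (gateOut g))

Front⇒Step : ∀ {op ys zs} q → Front op ys zs → Step op (ys ++ q) (q ++ zs)
Front⇒Step q pass = pass
Front⇒Step q swap = swap
Front⇒Step q (gate g) = gate g

Step⇒Front : ∀ {op q r} → Step op q r → ∃[ ys ] ∃[ zs ] ∃[ p ] (Front op ys zs × q ≡ ys ++ p × r ≡ p ++ zs)
Step⇒Front pass = _ , _ , _ , pass , refl , refl
Step⇒Front swap = _ , _ , _ , swap , refl , refl
Step⇒Front (gate g) = _ , _ , _ , gate g , refl , refl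

Front-length : ∀ {op ys zs} → Front op ys zs → length ys ≡ width op × length zs ≡ width op
Front-length pass = refl , refl
Front-length swap = refl , refl
Front-length (gate g) = refl , refl

Instr : Set
Instr = Op × ℕ

data At : Instr → List Bool → List Bool → Set where
  acts : ∀ {op ys zs} xs q → Front op ys zs → At (op , length xs) (xs ++ ys ++ q) (xs ++ zs ++ q)

Fits : ℕ → Instr → Set
Fits n (op , o) = o + width op ≤ n

-- In a queue of n wires: the wires in front are passed, and so are those behind afterwards.
local : ℕ → Instr → List Op
local n (op , o) = replicate o pass ++ op ∷ replicate (n ∸ (o + width op)) pass

rotate-back : ∀ {op ys zs} xs q → Front op ys zs →
  Run (replicate (length (xs ++ ys ++ q) ∸ (length xs + width op)) pass) ((q ++ xs) ++ zs) (xs ++ zs ++ q)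
rotate-back {op} {ys} {zs} xs q f = subst₂ (λ n p → Run (replicate n pass) p (xs ++ zs ++ q)) len (sym (++-assoc q xs zs))
  (subst (Run (replicate (length q) pass) (q ++ xs ++ zs)) (++-assoc xs zs q) (rotate⁺ q))
  where
  open ≡-Reasoning
  len : length q ≡ length (xs ++ ys ++ q) ∸ (length xs + width op)
  len = begin
    length q ≡⟨ m+n∸m≡n (length xs + length ys) (length q) ⟨
    length xs + length ys + length q ∸ (length xs + length ys) ≡⟨ cong₂ _∸_ (+-assoc (length xs) _ _) (cong (λ k → length xs + k) (fst (Front-length f))) ⟩
    length xs + (length ys + length q) ∸ (length xs + width op) ≡⟨ cong (λ k → length xs + k ∸ (length xs + width op)) (length-++ ys) ⟨
    length xs + length (ys ++ q) ∸ (length xs + width op) ≡⟨ cong (_∸ (length xs + width op)) (length-++ xs) ⟨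
    length (xs ++ ys ++ q) ∸ (length xs + width op) ∎

local⁺ : ∀ {i q r} → At i q r → Run (local (length q) i) q r
local⁺ (acts {op} {ys} {zs} xs q f) =
  Run-++⁺ (rotate⁺ xs) (subst (λ p → Step op p ((q ++ xs) ++ zs)) (sym (++-assoc ys q xs)) (Front⇒Step (q ++ xs) f) ∷ rotate-back xs q f)

length-take≤ : ∀ {A : Set} n (xs : List A) → n ≤ length xs → length (take n xs) ≡ n
length-take≤ n xs le = length-take n xs ∙ m≤n⇒m⊓n≡m le

++-splits : ∀ {A : Set} (xs ys : List A) {us vs} → length xs ≡ length ys → xs ++ us ≡ ys ++ vs → xs ≡ ys × us ≡ vs
++-splits [] [] e eq = refl , eq
++-splits (x ∷ xs) (y ∷ ys) e eq with refl ← ∷-injectiveˡ eq =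
  let e₁ , e₂ = ++-splits xs ys (suc-injective e) (∷-injectiveʳ eq) in cong (x ∷_) e₁ , e₂

-- Passing is deterministic, so the rotations before and after are known and only the one operation
-- between them is left open.
local⁻ : ∀ i {q r} → Fits (length q) i → Run (local (length q) i) q r → At i q r
local⁻ (op , o) {q} {r} fits run = go (take o q) (drop o q) (take++drop≡id o q) (length-take≤ o q (m≤m+n o _ » fits)) run
  where
  go : ∀ xs us → xs ++ us ≡ q → length xs ≡ o → Run (local (length q) (op , o)) q r → At (op , o) q r
  go xs us refl refl run with p , x , s ∷ y ← Run-++⁻ (replicate (length xs) pass) run
    with refl ← pass-deterministic (length xs) x (rotate⁺ xs) | ys , zs , p' , f , e , refl ← Step⇒Front s = finish (take (width op) us) (drop (width op) us) (take++drop≡id (width op) us)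
      (length-take≤ (width op) us (+-cancelˡ-≤ (length xs) _ _ (fits » ≤-reflexive (length-++ xs)))) e y
    where
    finish : ∀ as bs → as ++ bs ≡ us → length as ≡ width op → us ++ xs ≡ ys ++ p' →
      Run (replicate (length (xs ++ us) ∸ (length xs + width op)) pass) (p' ++ zs) r → At (op , length xs) (xs ++ us) r
    finish as bs refl la e y with e₁ , e₂ ← ++-splits as ys (la ∙ sym (fst (Front-length f))) (sym (++-assoc as bs xs) ∙ e)
      with refl ← e₁ | refl ← e₂ = subst (At (op , length xs) (xs ++ as ++ bs)) (pass-deterministic _ (rotate-back xs bs f) y) (acts xs bs f)

data Micro : List Instr → List Bool → List Bool → Set where
  [] : ∀ {q} → Micro [] q q
  _∷_ : ∀ {i is p q r} → At i p q → Micro is q r → Micro (i ∷ is) p r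

At-length : ∀ {i q r} → At i q r → length r ≡ length q
At-length (acts {op} {ys} {zs} xs q f) = length-++ xs ∙ cong (λ k → length xs + k)
  (length-++ zs ∙ cong (_+ length q) (snd (Front-length f) ∙ sym (fst (Front-length f))) ∙ sym (length-++ ys)) ∙
  sym (length-++ xs)

micro⁺ : ∀ {is q r} → Micro is q r → Run (concatMap (local (length q)) is) q r
micro⁺ [] = []
micro⁺ {q = q} {r} (_∷_ {is = is} {q = p} a x) = Run-++⁺ (local⁺ a) (subst (λ n → Run (concatMap (local n) is) p r) (At-length a) (micro⁺ x))

micro⁻ : ∀ {is n q r} → n ≡ length q → All (Fits n) is → Run (concatMap (local n) is) q r → Micro is q r
micro⁻ {[]} refl [] [] = []
micro⁻ {i ∷ is} {q = q} refl (f ∷ fs) x = let p , y , z = Run-++⁻ (local (length q) i) x ; a = local⁻ i f y in a ∷ micro⁻ (sym (At-length a)) fs z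

Micro-++⁺ : ∀ {is js p q r} → Micro is p q → Micro js q r → Micro (is ++ js) p r
Micro-++⁺ [] y = y
Micro-++⁺ (a ∷ x) y = a ∷ Micro-++⁺ x y

Micro-++⁻ : ∀ is {js p r} → Micro (is ++ js) p r → ∃[ q ] (Micro is p q × Micro js q r)
Micro-++⁻ [] y = _ , [] , y
Micro-++⁻ (i ∷ is) (a ∷ y) = let q , x , z = Micro-++⁻ is y in q , a ∷ x , z

later : Instr → Instr
later (op , o) = op , suc o

later⁺ : ∀ {is q r} x → Micro is q r → Micro (map later is) (x ∷ q) (x ∷ r)
later⁺ x [] = []
later⁺ x (acts xs q f ∷ m) = acts (x ∷ xs) q f ∷ later⁺ x m

acts⁻ : ∀ {op o p r} → At (op , o) p r → ∃[ xs ] ∃[ ys ] ∃[ zs ] ∃[ q ] (Front op ys zs × length xs ≡ o × xs ++ ys ++ q ≡ p × r ≡ xs ++ zs ++ q)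
acts⁻ (acts xs q f) = xs , _ , _ , q , f , refl , refl , refl

acts-later⁻ : ∀ {op o x q r} → At (op , suc o) (x ∷ q) r → ∃[ s ] (r ≡ x ∷ s × At (op , o) q s)
acts-later⁻ a with x ∷ xs , ys , zs , q , f , refl , refl , refl ← acts⁻ a = _ , refl , acts xs q f

later⁻ : ∀ is {x q r} → Micro (map later is) (x ∷ q) r → ∃[ s ] (r ≡ x ∷ s × Micro is q s)
later⁻ [] [] = _ , refl , []
later⁻ (i ∷ is) (a ∷ m) with s , refl , a' ← acts-later⁻ a with t , e , m' ← later⁻ is m = t , e , a' ∷ m'

acts-swap⁻ : ∀ {x y q r} → At (swap , 0) (x ∷ y ∷ q) r → r ≡ y ∷ x ∷ q
acts-swap⁻ a with [] , _ , _ , q , swap , _ , refl , refl ← acts⁻ a = refl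

acts-gate⁻ : ∀ {q r} → At (gate , 0) q r → ∃[ g ] ∃[ p ] (q ≡ bits (gateIn g) ++ p × r ≡ bits (gateOut g) ++ p)
acts-gate⁻ a with [] , _ , _ , q , gate g , _ , refl , refl ← acts⁻ a = g , q , refl , refl

module _ {L : Set} where

  -- A derivation of `↭` is itself a program: `prep` moves the instructions past a wire, `swap`
  -- exchanges the two wires in front, and transitivity is sequencing.
  permute : {ls ms : List L} → ls ↭ ms → List Instr
  permute refl = []
  permute (prep x p) = map later (permute p)
  permute (swap x y p) = (swap , 0) ∷ map later (map later (permute p))
  permute (↭trans p q) = permute p ++ permute q

  permute⁺ : ∀ {ls ms : List L} (p : ls ↭ ms) (f : L → Bool) {zs} → Micro (permute p) (map f ls ++ zs) (map f ms ++ zs)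
  permute⁺ refl f = []
  permute⁺ (prep x p) f = later⁺ (f x) (permute⁺ p f)
  permute⁺ (swap x y p) f = acts [] _ swap ∷ later⁺ (f y) (later⁺ (f x) (permute⁺ p f))
  permute⁺ (↭trans p q) f = Micro-++⁺ (permute⁺ p f) (permute⁺ q f)

  permute⁻ : ∀ {ls ms : List L} (p : ls ↭ ms) (f : L → Bool) {zs r} → Micro (permute p) (map f ls ++ zs) r → r ≡ map f ms ++ zs
  permute⁻ refl f [] = refl
  permute⁻ (prep x p) f m with s , refl , m' ← later⁻ (permute p) m = cong (f x ∷_) (permute⁻ p f m')
  permute⁻ (swap x y p) f (a ∷ m) with refl ← acts-swap⁻ a with s , refl , m' ← later⁻ (map later (permute p)) m
    with t , refl , m″ ← later⁻ (permute p) m' = cong (λ q → f y ∷ f x ∷ q) (permute⁻ p f m″)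
  permute⁻ (↭trans p q) f {zs} m with r , m₁ , m₂ ← Micro-++⁻ (permute p) m
    with refl ← permute⁻ p f {zs} m₁ = permute⁻ q f m₂

  fits-mono : ∀ {m n is} → m ≤ n → All (Fits m) is → All (Fits n) is
  fits-mono le = All.map (λ f → f » le)

  fits-later : ∀ {n is} → All (Fits n) is → All (Fits (suc n)) (map later is)
  fits-later [] = []
  fits-later (f ∷ fs) = s≤s f ∷ fits-later fs

  permute-fits : ∀ {ls ms : List L} (p : ls ↭ ms) → All (Fits (length ls)) (permute p)
  permute-fits refl = []
  permute-fits (prep x p) = fits-later (permute-fits p)
  permute-fits (swap x y p) = s≤s (s≤s z≤n) ∷ fits-later (fits-later (permute-fits p))
  permute-fits (↭trans p q) = Allₚ.++⁺ (permute-fits p) (subst (λ n → All (Fits n) (permute q)) (sym (↭-length p)) (permute-fits q))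

-- The gate applied to wires given by labels

module Labelled {L : Set} (_≟_ : DecidableEquality L) (ls : List L) (unique : Unique ls) (complete : ∀ l → l ∈ ls) where

  record Use : Set where
    constructor use
    field
      i j k : L
      i≢j : i ≢ j
      i≢k : i ≢ k
      j≢k : j ≢ k

  reads : Use → (L → Bool) → Triple
  reads (use i j k _ _ _) f = f i , f j , f k

  abstract
    update : Use → Triple → (L → Bool) → L → Bool
    update (use i j k _ _ _) (x , y , z) f l = if does (l ≟ i) then x else if does (l ≟ j) then y else if does (l ≟ k) then z else f l

    update-cong : ∀ u t {f f'} → f ≗ f' → update u t f ≗ update u t f'
    update-cong (use i j k _ _ _) (x , y , z) e l with does (l ≟ i) | does (l ≟ j) | does (l ≟ k)
    ... | true | _ | _ = refl
    ... | false | true | _ = refl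
    ... | false | false | true = refl
    ... | false | false | false = e l

    update-i : ∀ u t f → update u t f (Use.i u) ≡ fst t
    update-i (use i j k i≢j i≢k j≢k) t f with i ≟ i
    ... | yes _ = refl
    ... | no n = contradiction refl n

    update-j : ∀ u t f → update u t f (Use.j u) ≡ fst (snd t)
    update-j (use i j k i≢j i≢k j≢k) t f with j ≟ i | j ≟ j
    ... | yes e | _ = contradiction (sym e) i≢j
    ... | no _ | yes _ = refl
    ... | no _ | no n = contradiction refl n

    update-k : ∀ u t f → update u t f (Use.k u) ≡ snd (snd t)
    update-k (use i j k i≢j i≢k j≢k) t f with k ≟ i | k ≟ j | k ≟ k
    ... | yes e | _ | _ = contradiction (sym e) i≢k
    ... | no _ | yes e | _ = contradiction (sym e) j≢k
    ... | no _ | no _ | yes _ = refl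
    ... | no _ | no _ | no n = contradiction refl n

    update-other : ∀ u t f {l} → Use.i u ≢ l → Use.j u ≢ l → Use.k u ≢ l → update u t f l ≡ f l
    update-other (use i j k _ _ _) t f {l} a b c with l ≟ i | l ≟ j | l ≟ k
    ... | yes e | _ | _ = contradiction (sym e) a
    ... | no _ | yes e | _ = contradiction (sym e) b
    ... | no _ | no _ | yes e = contradiction (sym e) c
    ... | no _ | no _ | no _ = refl

  -- Valuations are functions, so the final one is determined only up to pointwise equality.
  data Fires : List Use → (L → Bool) → (L → Bool) → Set where
    done : ∀ {f h} → f ≗ h → Fires [] f h
    next : ∀ {u us f h} g → reads u f ≡ gateIn g → Fires us (update u (gateOut g) f) h → Fires (u ∷ us) f h

  Fires-cong : ∀ us {f f' h} → f ≗ f' → Fires us f h → Fires us f' h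
  Fires-cong [] e (done x) = done λ l → trans (sym (e l)) (x l)
  Fires-cong (u@(use i j k _ _ _) ∷ us) e (next g r x) =
    next g (cong₂ _,_ (sym (e i)) (cong₂ _,_ (sym (e j)) (sym (e k))) ∙ r) (Fires-cong us (update-cong u (gateOut g) e) x)

  bring : ∀ {x : L} {xs} → x ∈ xs → ∃[ ys ] xs ↭ x ∷ ys
  bring {x} i with ys , zs , refl ← ∈-∃++ i = ys ++ zs , shift x ys zs

  later-∈ : ∀ {x y : L} {ys} → x ≢ y → x ∈ y ∷ ys → x ∈ ys
  later-∈ n (here e) = contradiction e n
  later-∈ n (there i) = i

  front : ∀ u → ∃[ rest ] ls ↭ Use.i u ∷ Use.j u ∷ Use.k u ∷ rest
  front (use i j k i≢j i≢k j≢k) =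
    let xs , p = bring (complete i)
        ys , q = bring (later-∈ (i≢j ∘ sym) (∈-resp-↭ p (complete j)))
        zs , r = bring (later-∈ (j≢k ∘ sym) (later-∈ (i≢k ∘ sym) (∈-resp-↭ (↭trans p (prep i q)) (complete k))))
    in zs , ↭trans p (↭trans (prep i q) (prep i (prep j r)))

  updated-front : ∀ u t f {rest} → ls ↭ Use.i u ∷ Use.j u ∷ Use.k u ∷ rest →
    map (update u t f) (Use.i u ∷ Use.j u ∷ Use.k u ∷ rest) ≡ bits t ++ map f rest
  updated-front u@(use i j k _ _ _) t f {rest} p = go (↭ₛ.Unique-resp-↭ (setoid L) (↭⇒↭ₛ p) unique)
    where
    go : Unique (i ∷ j ∷ k ∷ rest) → map (update u t f) (i ∷ j ∷ k ∷ rest) ≡ bits t ++ map f rest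
    go ((_ ∷ _ ∷ a) ∷ (_ ∷ b) ∷ c ∷ _) = cong₂ _∷_ (update-i u t f) (cong₂ _∷_ (update-j u t f) (cong₂ _∷_ (update-k u t f)
      (map-cong-local (All.zipWith (λ (x , y , z) → update-other u t f x y z) (a , All.zipWith (λ (x , y) → x , y) (b , c))))))

  bits-injective : ∀ {s t p q} → bits s ++ p ≡ bits t ++ q → s ≡ t × p ≡ q
  bits-injective refl = refl , refl

  around⁻ : ∀ u {f zs r rest} (p : ls ↭ Use.i u ∷ Use.j u ∷ Use.k u ∷ rest) →
    Micro (permute p ++ (gate , 0) ∷ permute (↭-sym p)) (map f ls ++ zs) r →
    ∃[ g ] (reads u f ≡ gateIn g × r ≡ map (update u (gateOut g) f) ls ++ zs)
  around⁻ u {f} {zs} {r} {rest} p m with r₁ , m₁ , a ∷ m₂ ← Micro-++⁻ (permute p) m = go (permute⁻ p f {zs} m₁) (acts-gate⁻ a) m₂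
    where
    go : ∀ {r₁ r₂} → r₁ ≡ bits (reads u f) ++ map f rest ++ zs →
      ∃[ g ] ∃[ q ] (r₁ ≡ bits (gateIn g) ++ q × r₂ ≡ bits (gateOut g) ++ q) → Micro (permute (↭-sym p)) r₂ r →
      ∃[ g ] (reads u f ≡ gateIn g × r ≡ map (update u (gateOut g) f) ls ++ zs)
    go e₁ (g , q , e₂ , e₃) m₂ =
      let e , e' = bits-injective {reads u f} {gateIn g} (sym e₁ ∙ e₂) in
      g , e , permute⁻ (↭-sym p) (update u (gateOut g) f)
        (subst (λ q → Micro (permute (↭-sym p)) q r)
          (e₃ ∙ cong (bits (gateOut g) ++_) (sym e') ∙ sym (cong (_++ zs) (updated-front u (gateOut g) f p))) m₂)

  abstract
    -- The way back inverts the permutation that brought the three wires to the front, so every wire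
    -- returns to its position whatever the gate has done.
    instrs : Use → List Instr
    instrs u = let _ , p = front u in permute p ++ (gate , 0) ∷ permute (↭-sym p)

    instrs⁺ : ∀ u {f g zs} → reads u f ≡ gateIn g → Micro (instrs u) (map f ls ++ zs) (map (update u (gateOut g) f) ls ++ zs)
    instrs⁺ u {f} {g} {zs} e = let rest , p = front u in
      Micro-++⁺ (subst (λ t → Micro (permute p) (map f ls ++ zs) (bits t ++ map f rest ++ zs)) e (permute⁺ p f))
        (acts [] (map f rest ++ zs) (gate g) ∷
          subst (λ q → Micro (permute (↭-sym p)) (q ++ zs) (map (update u (gateOut g) f) ls ++ zs)) (updated-front u (gateOut g) f p)
            (permute⁺ (↭-sym p) (update u (gateOut g) f)))

    instrs⁻ : ∀ u {f zs r} → Micro (instrs u) (map f ls ++ zs) r →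
      ∃[ g ] (reads u f ≡ gateIn g × r ≡ map (update u (gateOut g) f) ls ++ zs)
    instrs⁻ u = around⁻ u (snd (front u))

    instrs-fit : ∀ u → All (Fits (length ls)) (instrs u)
    instrs-fit u = around-fits (snd (front u))
      where
      around-fits : ∀ {i j k rest} (p : ls ↭ i ∷ j ∷ k ∷ rest) → All (Fits (length ls)) (permute p ++ (gate , 0) ∷ permute (↭-sym p))
      around-fits p = Allₚ.++⁺ (permute-fits p)
        (subst (λ n → All (Fits n) ((gate , 0) ∷ permute (↭-sym p))) (sym (↭-length p)) (s≤s (s≤s (s≤s z≤n)) ∷ permute-fits (↭-sym p)))

  execs⁺ : ∀ us {f h zs} → Fires us f h → Micro (concatMap instrs us) (map f ls ++ zs) (map h ls ++ zs)
  execs⁺ [] {f} {h} {zs} (done x) = subst (λ q → Micro [] (map f ls ++ zs) (q ++ zs)) (map-cong x ls) []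
  execs⁺ (u ∷ us) (next g e x) = Micro-++⁺ (instrs⁺ u {g = g} e) (execs⁺ us x)

  execs⁻ : ∀ us {f zs r} → Micro (concatMap instrs us) (map f ls ++ zs) r → ∃[ h ] (Fires us f h × r ≡ map h ls ++ zs)
  execs⁻ [] {f} [] = f , done (λ _ → refl) , refl
  execs⁻ (u ∷ us) {f} {zs} {r} m = go (Micro-++⁻ (instrs u) m)
    where
    go : ∃[ p ] (Micro (instrs u) (map f ls ++ zs) p × Micro (concatMap instrs us) p r) → ∃[ h ] (Fires (u ∷ us) f h × r ≡ map h ls ++ zs)
    go (p , m₁ , m₂) =
      let g , e , e₁ = instrs⁻ u {f} {zs} m₁
          h , x , e₂ = execs⁻ us {zs = zs} (subst (λ p → Micro (concatMap instrs us) p r) e₁ m₂)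
      in h , next g e x , e₂

  execs-fit : ∀ us → All (Fits (length ls)) (concatMap instrs us)
  execs-fit [] = []
  execs-fit (u ∷ us) = Allₚ.++⁺ (instrs-fit u) (execs-fit us)

-- A rule of the finite device made of gates

module Gadget (K : ℕ) where

  -- A place has two wires, which always agree between two rules; a block also has scratch wires.
  Wire Label : Set
  Wire = (Fin K × Bool) ⊎ Fin 5
  Label = Fin 3 × Wire

  wiresOf : List Wire
  wiresOf = map inl (cartesianProduct (allFin K) (false ∷ true ∷ [])) ++ map inr (allFin 5)

  labels : List Label
  labels = cartesianProduct (allFin 3) wiresOf

  unique-wiresOf : Unique wiresOf
  unique-wiresOf = Uniqueₚ.++⁺
    (Uniqueₚ.map⁺ Sumₚ.inj₁-injective (Uniqueₚ.cartesianProduct⁺ (Uniqueₚ.allFin⁺ K) (((λ ()) ∷ []) ∷ [] ∷ [])))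
    (Uniqueₚ.map⁺ Sumₚ.inj₂-injective (Uniqueₚ.allFin⁺ 5))
    (λ { (i , j) → apart (∈-map⁻ inl i) (∈-map⁻ inr j) })
    where
    apart : ∀ {w : Wire} {P : Fin K × Bool → Set} {Q : Fin 5 → Set} → ∃[ x ] (P x × w ≡ inl x) → ∃[ x ] (Q x × w ≡ inr x) → ⊥
    apart (_ , _ , refl) (_ , _ , ())

  complete-wiresOf : ∀ w → w ∈ wiresOf
  complete-wiresOf (inl (p , b)) = ∈-++⁺ˡ (∈-map⁺ inl (∈-cartesianProduct⁺ (∈-allFin p) (both b)))
    where
    both : ∀ b → b ∈ false ∷ true ∷ []
    both false = 1st
    both true = 2nd
  complete-wiresOf (inr s) = ∈-++⁺ʳ (map inl (cartesianProduct (allFin K) (false ∷ true ∷ []))) (∈-map⁺ inr (∈-allFin s))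

  unique-labels : Unique labels
  unique-labels = Uniqueₚ.cartesianProduct⁺ (Uniqueₚ.allFin⁺ 3) unique-wiresOf

  complete-labels : ∀ l → l ∈ labels
  complete-labels (β , w) = ∈-cartesianProduct⁺ (∈-allFin β) (complete-wiresOf w)

  _≟L_ : DecidableEquality Label
  _≟L_ = ≡-dec _≟F_ (Sumₚ.≡-dec (≡-dec _≟F_ _≟B_) _≟F_)

  open Labelled _≟L_ labels unique-labels complete-labels public

  State : Set
  State = Fin 3 → Fin K → Bool

  infix 4 _≈_
  _≈_ : State → State → Set
  S ≈ S' = ∀ β p → S β p ≡ S' β p

  -- Both wires of a place carry its bit. Only the scratch wires of block 0 are put to use; those of
  -- the other blocks stay off.
  st : State → (Fin 5 → Bool) → Label → Bool
  st S σ (β , inl (p , _)) = S β p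
  st S σ (0F , inr s) = σ s
  st S σ (suc _ , inr _) = false

  plain : State → Label → Bool
  plain S = st S (λ _ → false)

  set : State → Fin 3 → Fin K → Bool → State
  set S β p b γ r = if does (γ ≟F β) then (if does (r ≟F p) then b else S γ r) else S γ r

  setScratch : (Fin 5 → Bool) → Fin 5 → Bool → Fin 5 → Bool
  setScratch σ s w t = if does (t ≟F s) then w else σ t

  st-cong : ∀ {S S' σ σ'} → S ≈ S' → σ ≗ σ' → st S σ ≗ st S' σ'
  st-cong e e' (β , inl (p , _)) = e β p
  st-cong e e' (0F , inr s) = e' s
  st-cong e e' (suc _ , inr _) = refl

  -- The effect of the gate on a pair and a scratch wire. There is no case with both on: an occupied
  -- place cannot be written to.
  data Exchange : Bool → Bool → Bool → Bool → Set where
    none : Exchange false false false false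
    keep : Exchange true false true false
    put : Exchange false true true false
    get : Exchange true false false true

  scratch : Fin 5 → Label
  scratch s = 0F , inr s

  pairUse : Fin 3 → Fin K → Fin 5 → Use
  pairUse β p s = use (β , inl (p , false)) (β , inl (p , true)) (scratch s) (λ ()) (λ ()) (λ ())

  -- Scratch wires 3 and 4 stay off, so a gate on them and a further wire tests that wire for zero.
  -- `agree` compares wires 0 and 1, provided that wire 2 is off before and after.
  agree clear₀ clear₁ clear₂ : Use
  agree = use (scratch 0F) (scratch 1F) (scratch 2F) (λ ()) (λ ()) (λ ())
  clear₀ = use (scratch 0F) (scratch 3F) (scratch 4F) (λ ()) (λ ()) (λ ())
  clear₁ = use (scratch 1F) (scratch 3F) (scratch 4F) (λ ()) (λ ()) (λ ())
  clear₂ = use (scratch 2F) (scratch 3F) (scratch 4F) (λ ()) (λ ()) (λ ())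

  -- No wire of the place p of block 0 is on.
  off : Fin K → Use
  off p = use (0F , inl (p , false)) (scratch 3F) (scratch 4F) (λ ()) (λ ()) (λ ())

  set-same : ∀ S β p v → set S β p v β p ≡ v
  set-same S β p v with β ≟F β | p ≟F p
  ... | yes _ | yes _ = refl
  ... | yes _ | no n = contradiction refl n
  ... | no n | _ = contradiction refl n

  set-other : ∀ S β p v {γ r} → (β , p) ≢ (γ , r) → set S β p v γ r ≡ S γ r
  set-other S β p v {γ} {r} n with γ ≟F β | r ≟F p
  ... | yes refl | yes refl = contradiction refl n
  ... | yes _ | no _ = refl
  ... | no _ | _ = refl

  pair-updated : ∀ S σ β p s v w → update (pairUse β p s) (v , v , w) (st S σ) ≗ st (set S β p v) (setScratch σ s w)
  pair-updated S σ β p s v w l with (β , inl (p , false)) ≟L l | (β , inl (p , true)) ≟L l | scratch s ≟L l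
  ... | yes refl | _ | _ = update-i (pairUse β p s) _ _ ∙ sym (set-same S β p v)
  ... | no _ | yes refl | _ = update-j (pairUse β p s) _ _ ∙ sym (set-same S β p v)
  ... | no _ | no _ | yes refl = update-k (pairUse β p s) _ _ ∙ sym same
    where
    same : setScratch σ s w s ≡ w
    same with s ≟F s
    ... | yes _ = refl
    ... | no n = contradiction refl n
  ... | no x | no y | no z = update-other (pairUse β p s) _ _ x y z ∙ sym (other l x y z)
    where
    other : ∀ l → (β , inl (p , false)) ≢ l → (β , inl (p , true)) ≢ l → scratch s ≢ l → st (set S β p v) (setScratch σ s w) l ≡ st S σ l
    other (γ , inl (r , false)) m n o = set-other S β p v (λ { refl → m refl })
    other (γ , inl (r , true)) m n o = set-other S β p v (λ { refl → n refl })
    other (0F , inr t) m n o with t ≟F s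
    ... | yes refl = contradiction refl o
    ... | no _ = refl
    other (suc _ , inr _) m n o = refl

  update-idle : ∀ u f {a b c} → reads u f ≡ (a , b , c) → update u (a , b , c) f ≗ f
  update-idle u@(use i j k _ _ _) f refl l with i ≟L l | j ≟L l | k ≟L l
  ... | yes refl | _ | _ = update-i u (reads u f) f
  ... | no _ | yes refl | _ = update-j u (reads u f) f
  ... | no _ | no _ | yes refl = update-k u (reads u f) f
  ... | no x | no y | no z = update-other u (reads u f) f x y z

  move⁻ : ∀ {s x} g → (s , s , x) ≡ gateIn g → ∃[ v ] ∃[ w ] (Exchange s x v w × gateOut g ≡ (v , v , w))
  move⁻ 0F refl = _ , _ , none , refl
  move⁻ 1F refl = _ , _ , keep , refl
  move⁻ 2F refl = _ , _ , put , refl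
  move⁻ 3F refl = _ , _ , get , refl

  move⁺ : ∀ {s x v w} → Exchange s x v w → ∃[ g ] ((s , s , x) ≡ gateIn g × gateOut g ≡ (v , v , w))
  move⁺ none = 0F , refl , refl
  move⁺ keep = 1F , refl , refl
  move⁺ put = 2F , refl , refl
  move⁺ get = 3F , refl , refl

  module _ {us : List Use} {h : Label → Bool} where

    pair⁻ : ∀ β p s {S σ} → Fires (pairUse β p s ∷ us) (st S σ) h →
      ∃[ v ] ∃[ w ] (Exchange (S β p) (σ s) v w × Fires us (st (set S β p v) (setScratch σ s w)) h)
    pair⁻ β p s {S} {σ} (next g e W) = let v , w , m , o = move⁻ g e in
      v , w , m , Fires-cong us (λ l → cong (λ t → update (pairUse β p s) t (st S σ) l) o ∙ pair-updated S σ β p s v w l) W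

    pair⁺ : ∀ β p s {S σ v w} → Exchange (S β p) (σ s) v w → Fires us (st (set S β p v) (setScratch σ s w)) h → Fires (pairUse β p s ∷ us) (st S σ) h
    pair⁺ β p s {S} {σ} {v} {w} m W = let g , e , o = move⁺ m in
      next g e (Fires-cong us (λ l → sym (cong (λ t → update (pairUse β p s) t (st S σ) l) o ∙ pair-updated S σ β p s v w l)) W)

    idle⁺ : ∀ u {f} g → reads u f ≡ gateIn g → gateOut g ≡ gateIn g → Fires us f h → Fires (u ∷ us) f h
    idle⁺ u {f} g e o W = next g e (Fires-cong us (λ l → sym (cong (λ t → update u t f l) o ∙ update-idle u f e l)) W)

    -- With the last two wires off, the gate can only be idle, and its first wire has to be off.
    clear⁻ : ∀ u {f x} → reads u f ≡ (x , false , false) → Fires (u ∷ us) f h → x ≡ false × Fires us f h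
    clear⁻ u {f} r (next g e W) = only g (sym r ∙ e) e W
      where
      only : ∀ {x} g → (x , false , false) ≡ gateIn g → reads u f ≡ gateIn g → Fires us (update u (gateOut g) f) h → x ≡ false × Fires us f h
      only 0F refl e W = refl , Fires-cong us (update-idle u f e) W
      only 1F () e W
      only 2F () e W
      only 3F () e W

  -- Two of the gates change nothing and have equal first wires. Gate 2 would need wire 2 on
  -- beforehand, and gate 3 would leave it on, which `clear₂` rules out.
  agree⁻ : ∀ {us f h} → reads clear₂ f ≡ (false , false , false) → Fires (agree ∷ clear₂ ∷ us) f h → f (scratch 0F) ≡ f (scratch 1F) × Fires us f h
  agree⁻ {us} {f} {h} r (next g e W) = go g e W
    where
    ignored : ∀ {t} → reads agree f ≡ t → Fires (clear₂ ∷ us) (update agree t f) h → Fires us f h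
    ignored e W = snd (clear⁻ clear₂ r (Fires-cong (clear₂ ∷ us) (update-idle agree f e) W))
    go : ∀ g → reads agree f ≡ gateIn g → Fires (clear₂ ∷ us) (update agree (gateOut g) f) h → f (scratch 0F) ≡ f (scratch 1F) × Fires us f h
    go 0F e W = cong fst e ∙ sym (cong (fst ∘ snd) e) , ignored e W
    go 1F e W = cong fst e ∙ sym (cong (fst ∘ snd) e) , ignored e W
    go 2F e W = contradiction (sym (cong fst r) ∙ cong (snd ∘ snd) e) λ ()
    go 3F e W = contradiction (fst (clear⁻ clear₂ (cong₂ _,_ (update-k agree (gateOut 3F) f) (cong₂ _,_
      (update-other agree (gateOut 3F) f (λ ()) (λ ()) (λ ()) ∙ cong (fst ∘ snd) r)
      (update-other agree (gateOut 3F) f (λ ()) (λ ()) (λ ()) ∙ cong (snd ∘ snd) r))) W)) λ ()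

  -- State, letter read, letter written, next state. States and letters share the same places, so
  -- any block can hold either.
  Rule : Set
  Rule = Fin K × Fin K × Fin K × Fin K

  -- A rule moves the pairs of its left-hand side to the scratch wires, or leaves them; as the scratch
  -- wires have to agree, it does so with both. Then it puts them on its right-hand side.
  ruleUses : Rule → List Use
  ruleUses (q , a , b , r) = pairUse 0F q 0F ∷ pairUse 2F a 1F ∷ agree ∷ clear₂ ∷
    pairUse 1F b 0F ∷ clear₀ ∷ pairUse 2F r 1F ∷ clear₁ ∷ []

  applied : Rule → State → State
  applied (q , a , b , r) S = set (set (set (set S 0F q false) 2F a false) 1F b true) 2F r true

  set-idle : ∀ S β p {v} → S β p ≡ v → set S β p v ≈ S
  set-idle S β p e γ r with γ ≟F β | r ≟F p
  ... | yes refl | yes refl = sym e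
  ... | yes _ | no _ = refl
  ... | no _ | _ = refl

  set-idles : ∀ S v₁ v₂ v₃ ((q , a , b , r) : Rule) {v₄} → S 0F q ≡ v₁ → set S 0F q v₁ 2F a ≡ v₂ → set (set S 0F q v₁) 2F a v₂ 1F b ≡ v₃ →
    set (set (set S 0F q v₁) 2F a v₂) 1F b v₃ 2F r ≡ v₄ → set (set (set (set S 0F q v₁) 2F a v₂) 1F b v₃) 2F r v₄ ≈ S
  set-idles S v₁ v₂ v₃ (q , a , b , r) e₁ e₂ e₃ e₄ β p =
    set-idle (set (set (set S 0F q v₁) 2F a v₂) 1F b v₃) 2F r e₄ β p ∙ set-idle (set (set S 0F q v₁) 2F a v₂) 1F b e₃ β p ∙
      set-idle (set S 0F q v₁) 2F a e₂ β p ∙ set-idle S 0F q e₁ β p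

  scratch-off : ∀ w → setScratch (setScratch (setScratch (setScratch (λ _ → false) 0F w) 1F w) 0F false) 1F false ≗ λ _ → false
  scratch-off w 0F = refl
  scratch-off w 1F = refl
  scratch-off w 2F = refl
  scratch-off w 3F = refl
  scratch-off w 4F = refl

  unmoved : ∀ {s v} → Exchange s false v false → s ≡ v
  unmoved none = refl
  unmoved keep = refl

  Applied : Rule → List Use → State → (Label → Bool) → Set
  Applied ρ@(q , a , _) us S h = Fires us (plain S) h ⊎ (S 0F q ≡ true × S 2F a ≡ true × Fires us (plain (applied ρ S)) h)

  -- A scratch wire that is on proves that its place was on. After `agree` either both are on, and
  -- the tests for zero force both to be put down on the right-hand side, or both are off and
  -- nothing has moved.
  rule⁻ : ∀ ρ {us S h} → Fires (ruleUses ρ ++ us) (plain S) h → Applied ρ us S h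
  rule⁻ ρ@(q , a , b , r) {us} {S} {h} X₀ =
    let v₁ , w₁ , m₁ , X₁ = pair⁻ 0F q 0F X₀
        v₂ , w₂ , m₂ , X₂ = pair⁻ 2F a 1F X₁
        e , X₃ = agree⁻ refl X₂
        v₃ , w₃ , m₃ , X₄ = pair⁻ 1F b 0F X₃
        e₃ , X₅ = clear⁻ clear₀ refl X₄
        v₄ , w₄ , m₄ , X₆ = pair⁻ 2F r 1F X₅
        e₄ , X₇ = clear⁻ clear₁ refl X₆
    in go m₁ m₂ m₃ m₄ e e₃ e₄ (Fires-cong us (st-cong (λ _ _ → refl) λ { 0F → e₃ ; 1F → e₄ ; 2F → refl ; 3F → refl ; 4F → refl }) X₇)
    where
    written : ∀ {s v v₁ v₂ v₄} → Exchange s true v false → v₁ ≡ false → v₂ ≡ false → v₄ ≡ true →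
      Fires us (plain (set (set (set (set S 0F q v₁) 2F a v₂) 1F b v) 2F r v₄)) h → Fires us (plain (applied ρ S)) h
    written put refl refl refl W = W
    taken : ∀ {s v} → Exchange s false v true → s ≡ true × v ≡ false
    taken get = refl , refl
    placed : ∀ {s v} → Exchange s true v false → v ≡ true
    placed put = refl
    go : ∀ {v₁ v₂ v₃ v₄ w₁ w₂ w₃ w₄} → Exchange (S 0F q) false v₁ w₁ → Exchange (set S 0F q v₁ 2F a) false v₂ w₂ →
      Exchange (set (set S 0F q v₁) 2F a v₂ 1F b) w₁ v₃ w₃ → Exchange (set (set (set S 0F q v₁) 2F a v₂) 1F b v₃ 2F r) w₂ v₄ w₄ →
      w₁ ≡ w₂ → w₃ ≡ false → w₄ ≡ false →
      Fires us (plain (set (set (set (set S 0F q v₁) 2F a v₂) 1F b v₃) 2F r v₄)) h → Applied ρ us S h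
    go {v₁} {v₂} {v₃} {w₁ = false} m₁ m₂ m₃ m₄ refl refl refl W = inl (Fires-cong us (st-cong (set-idles S v₁ v₂ v₃ ρ
      (unmoved m₁) (unmoved m₂) (unmoved m₃) (unmoved m₄)) (λ _ → refl)) W)
    go {v₁} {w₁ = true} m₁ m₂ m₃ m₄ refl refl refl W = inr
      (fst (taken m₁) , sym (set-other S 0F q v₁ (λ ())) ∙ fst (taken m₂) , written m₃ (snd (taken m₁)) (snd (taken m₂)) (placed m₄) W)

  stays : ∀ s → Exchange s false s false
  stays false = none
  stays true = keep

  rule-idle : ∀ ρ {us S h} → Fires us (plain S) h → Fires (ruleUses ρ ++ us) (plain S) h
  rule-idle ρ@(q , a , b , r) {us} {S} {h} W =
    pair⁺ 0F q 0F (stays _) (pair⁺ 2F a 1F (stays _) (idle⁺ agree 0F refl refl (idle⁺ clear₂ 0F refl refl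
      (pair⁺ 1F b 0F (stays _) (idle⁺ clear₀ 0F refl refl (pair⁺ 2F r 1F (stays _) (idle⁺ clear₁ 0F refl refl
        (Fires-cong us (λ l → sym (st-cong (set-idles S _ _ _ ρ refl refl refl refl) (scratch-off false) l)) W))))))))

  rule⁺ : ∀ (ρ@(q , a , b , r) : Rule) {us S h} → S 0F q ≡ true → S 2F a ≡ true → S 1F b ≡ false → set S 2F a false 2F r ≡ false →
    Fires us (plain (applied ρ S)) h → Fires (ruleUses ρ ++ us) (plain S) h
  rule⁺ (q , a , b , r) {us} {S} {h} e₁ e₂ e₃ e₄ W =
    pair⁺ 0F q 0F (subst (λ s → Exchange s false false true) (sym e₁) get)
      (pair⁺ 2F a 1F (subst (λ s → Exchange s false false true) (sym e₂) get)
        (idle⁺ agree 1F refl refl (idle⁺ clear₂ 0F refl refl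
          (pair⁺ 1F b 0F (subst (λ s → Exchange s true true false) (sym e₃) put)
            (idle⁺ clear₀ 0F refl refl
              (pair⁺ 2F r 1F (subst (λ s → Exchange s true true false) (sym e₄) put)
                (idle⁺ clear₁ 0F refl refl (Fires-cong us (λ l → sym (st-cong (λ _ _ → refl) (scratch-off true) l)) W))))))))

  hot : Fin K → Fin K → Bool
  hot q p = does (p ≟F q)

  -- Block 1 is the free room for the letter written. The new state takes the block of the letter
  -- read, and thus stands just before the next cell.
  before after : Fin K → Fin K → State
  before q a 0F = hot q
  before q a 1F = λ _ → false
  before q a 2F = hot a
  after b r 0F = λ _ → false
  after b r 1F = hot b
  after b r 2F = hot r

  hot-true : ∀ q p → hot q p ≡ true → p ≡ q
  hot-true q p e with p ≟F q
  ... | yes eq = eq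

  hot-self : ∀ q → hot q q ≡ true
  hot-self q = dec-true (q ≟F q) refl

  erased : ∀ q p → (if does (p ≟F q) then false else hot q p) ≡ false
  erased q p with p ≟F q
  ... | yes _ = refl
  ... | no _ = refl

  written : ∀ q p {b} → b ≡ false → (if does (p ≟F q) then true else b) ≡ hot q p
  written q p e with p ≟F q
  ... | yes _ = refl
  ... | no _ = e

  applied-before : ∀ q a b r → applied (q , a , b , r) (before q a) ≈ after b r
  applied-before q a b r 0F p = erased q p
  applied-before q a b r 1F p = written b p refl
  applied-before q a b r 2F p = written r p (erased a p)

  rulesUses : List Rule → List Use
  rulesUses ρs = concatMap ruleUses ρs

  offs : List (Fin K) → List Use
  offs = map off

  offs⁻ : ∀ ps {S h} → Fires (offs ps) (plain S) h → (∀ p → p ∈ ps → S 0F p ≡ false) × plain S ≗ h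
  offs⁻ [] (done W) = (λ _ ()) , W
  offs⁻ (p ∷ ps) W with e , Y ← clear⁻ (off p) refl W with es , f ← offs⁻ ps Y = (λ { _ 1st → e ; q (there i) → es q i }) , f

  offs⁺ : ∀ ps {S} → (∀ p → S 0F p ≡ false) → Fires (offs ps) (plain S) (plain S)
  offs⁺ [] e = done λ _ → refl
  offs⁺ (p ∷ ps) e = idle⁺ (off p) 0F (cong (_, false , false) (e p)) refl (offs⁺ ps e)

  -- Every rule may be skipped. As block 0 has to be empty in the end, at least one is applied; this
  -- removes the state, so no second one can be.
  ruleProgram : List Rule → List Use
  ruleProgram ρs = rulesUses ρs ++ offs (allFin K)

  Result : List Use → Fin K → Fin K → (Label → Bool) → List Rule → Set
  Result us q a h ρs = Fires us (plain (before q a)) h ⊎ ∃[ b ] ∃[ r ] ((q , a , b , r) ∈ ρs × Fires us (plain (after b r)) h)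

  one-rule⁻ : ∀ ρs {us q a h} → Fires (rulesUses ρs ++ us) (plain (before q a)) h → Result us q a h ρs
  no-rule⁻ : ∀ ρs {us b r h} → Fires (rulesUses ρs ++ us) (plain (after b r)) h → Fires us (plain (after b r)) h

  one-rule⁻ [] W = inl W
  one-rule⁻ (ρ@(q , a , b , r) ∷ ρs) {us} {q₀} {a₀} {h} W =
    go (rule⁻ ρ (subst (λ l → Fires l (plain (before q₀ a₀)) h) (++-assoc (ruleUses ρ) (rulesUses ρs) us) W))
    where
    further : Result us q₀ a₀ h ρs → Result us q₀ a₀ h (ρ ∷ ρs)
    further (inl Z) = inl Z
    further (inr (b , r , i , Z)) = inr (b , r , there i , Z)
    go : Applied ρ (rulesUses ρs ++ us) (before q₀ a₀) h → Result us q₀ a₀ h (ρ ∷ ρs)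
    go (inl Y) = further (one-rule⁻ ρs Y)
    go (inr (e₁ , e₂ , Y)) with refl ← hot-true q₀ q e₁ | refl ← hot-true a₀ a e₂ =
      inr (b , r , 1st , no-rule⁻ ρs (Fires-cong (rulesUses ρs ++ us) (st-cong (applied-before q a b r) (λ _ → refl)) Y))

  no-rule⁻ [] W = W
  no-rule⁻ (ρ@(q , a , b , r) ∷ ρs) {us} {b₀} {r₀} {h} W =
    go (rule⁻ ρ (subst (λ l → Fires l (plain (after b₀ r₀)) h) (++-assoc (ruleUses ρ) (rulesUses ρs) us) W))
    where
    go : Applied ρ (rulesUses ρs ++ us) (after b₀ r₀) h → Fires us (plain (after b₀ r₀)) h
    go (inl Y) = no-rule⁻ ρs Y

  no-rule⁺ : ∀ ρs {us S h} → Fires us (plain S) h → Fires (rulesUses ρs ++ us) (plain S) h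
  no-rule⁺ [] W = W
  no-rule⁺ (ρ ∷ ρs) {us} {S} {h} W = subst (λ l → Fires l (plain S) h) (sym (++-assoc (ruleUses ρ) (rulesUses ρs) us))
    (rule-idle ρ (no-rule⁺ ρs W))

  one-rule⁺ : ∀ {ρs us q a b r h} → (q , a , b , r) ∈ ρs → Fires us (plain (after b r)) h →
    Fires (rulesUses ρs ++ us) (plain (before q a)) h
  one-rule⁺ {ρ ∷ ρs} {us} {q} {a} {b} {r} {h} i W =
    subst (λ l → Fires l (plain (before q a)) h) (sym (++-assoc (ruleUses ρ) (rulesUses ρs) us)) (go i)
    where
    go : (q , a , b , r) ∈ ρ ∷ ρs → Fires (ruleUses ρ ++ rulesUses ρs ++ us) (plain (before q a)) h
    go 1st = rule⁺ ρ (hot-self q) (hot-self a) refl (erased a r)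
      (Fires-cong (rulesUses ρs ++ us) (λ l → sym (st-cong (applied-before q a b r) (λ _ → refl) l)) (no-rule⁺ ρs W))
    go (there i) = rule-idle ρ (one-rule⁺ i W)

  program⁻ : ∀ ρs {q a h} → Fires (ruleProgram ρs) (plain (before q a)) h →
    ∃[ b ] ∃[ r ] ((q , a , b , r) ∈ ρs × plain (after b r) ≗ h)
  program⁻ ρs {q} {a} {h} W = go (one-rule⁻ ρs W)
    where
    go : Result (offs (allFin K)) q a h ρs → ∃[ b ] ∃[ r ] ((q , a , b , r) ∈ ρs × plain (after b r) ≗ h)
    go (inl Y) = contradiction (sym (hot-self q) ∙ fst (offs⁻ (allFin K) Y) q (∈-allFin q)) λ ()
    go (inr (b , r , i , Y)) = b , r , i , snd (offs⁻ (allFin K) Y)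

  program⁺ : ∀ {ρs q a b r} → (q , a , b , r) ∈ ρs → Fires (ruleProgram ρs) (plain (before q a)) (plain (after b r))
  program⁺ i = one-rule⁺ i (offs⁺ (allFin K) (λ _ → refl))

-- Sweeps of the device over a queue of cells

data Sweep {A : Set} (ρs : List (A × A × A × A)) : A → List A → List A → A → Set where
  [] : ∀ {q} → Sweep ρs q [] [] q
  _∷_ : ∀ {q a b r s as bs} → (q , a , b , r) ∈ ρs → Sweep ρs r as bs s → Sweep ρs q (a ∷ as) (b ∷ bs) s

data Sweeps {A : Set} (ρs : List (A × A × A × A)) : ℕ → A → List A → List A → A → Set where
  [] : ∀ {q as} → Sweeps ρs 0 q as as q
  _∷_ : ∀ {m q as bs r cs s} → Sweep ρs q as bs r → Sweeps ρs m r bs cs s → Sweeps ρs (suc m) q as cs s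

Sweep-length : ∀ {A ρs} {q r : A} {as bs} → Sweep ρs q as bs r → length bs ≡ length as
Sweep-length [] = refl
Sweep-length (_ ∷ s) = cong suc (Sweep-length s)

module Queue (K : ℕ) where
  open Gadget K

  wireBits : (Fin K → Bool) → Wire → Bool
  wireBits f (inl (p , _)) = f p
  wireBits f (inr _) = false

  block : Fin K → List Bool
  block q = map (wireBits (hot q)) wiresOf

  empty : List Bool
  empty = map (wireBits (λ _ → false)) wiresOf

  -- Each cell brings along the empty block into which its new letter is written, and has one in
  -- front again afterwards.
  cellBits : List (Fin K) → List Bool
  cellBits = concatMap (λ a → empty ++ block a)

  length-pair : ∀ b → length (empty ++ block b) ≡ length (empty ++ empty)
  length-pair b = length-++ empty ∙ cong (λ k → length empty + k) (length-map _ wiresOf ∙ sym (length-map _ wiresOf)) ∙ sym (length-++ empty)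

  block-length : ∀ p q → length (block p) ≡ length (block q)
  block-length p q = length-map _ wiresOf ∙ sym (length-map _ wiresOf)

  length-cellBits : ∀ as bs → length as ≡ length bs → length (cellBits as) ≡ length (cellBits bs)
  length-cellBits [] [] e = refl
  length-cellBits (a ∷ as) (b ∷ bs) e = length-++ (empty ++ block a) ∙ cong₂ _+_ (length-pair a ∙ sym (length-pair b))
    (length-cellBits as bs (suc-injective e)) ∙ sym (length-++ (empty ++ block b))

  5≤wires : 5 ≤ length wiresOf
  5≤wires = m≤n+m 5 (length (map {B = Wire} inl (cartesianProduct (allFin K) (false ∷ true ∷ [])))) »
    ≤-reflexive (sym (length-++ (map inl (cartesianProduct (allFin K) (false ∷ true ∷ [])))))

  5≤block : ∀ q → 5 ≤ length (block q)
  5≤block q = 5≤wires » ≤-reflexive (sym (length-map _ wiresOf))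

  1≤pair : 1 ≤ length (empty ++ empty)
  1≤pair = ((s≤s z≤n » 5≤wires) » ≤-reflexive (sym (length-map _ wiresOf))) »
    m≤m+n (length empty) (length empty) » ≤-reflexive (sym (length-++ empty))

  module _ (ρs : List Rule) where

    instructions : List Instr
    instructions = concatMap instrs (ruleProgram ρs)

    -- After the rules, two blocks are passed: the cell just rewritten goes to the back, and the new
    -- state comes to the front.
    cellProgram : ℕ → List Op
    cellProgram n = concatMap (local n) instructions ++ replicate (length (empty ++ empty)) pass

    sweepProgram : ℕ → ℕ → List Op
    sweepProgram n k = concat (replicate k (cellProgram n))

    sweepsProgram : ℕ → ℕ → ℕ → List Op
    sweepsProgram n k m = concat (replicate m (sweepProgram n k))

  window : State → List Bool
  window S = map (plain S) labels

  window-blocks : ∀ S → window S ≡ map (wireBits (S 0F)) wiresOf ++ map (wireBits (S 1F)) wiresOf ++ map (wireBits (S 2F)) wiresOf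
  window-blocks S = map-++ (plain S) (map (0F ,_) wiresOf) _ ∙ cong₂ _++_ (part 0F) (map-++ (plain S) (map (1F ,_) wiresOf) _ ∙
    cong₂ _++_ (part 1F) (cong (map (plain S)) (++-identityʳ (map (2F ,_) wiresOf)) ∙ part 2F))
    where
    wire : ∀ β w → plain S (β , w) ≡ wireBits (S β) w
    wire β (inl _) = refl
    wire 0F (inr _) = refl
    wire (suc _) (inr _) = refl
    part : ∀ β → map (plain S) (map (β ,_) wiresOf) ≡ map (wireBits (S β)) wiresOf
    part β = sym (map-∘ wiresOf) ∙ map-cong (wire β) wiresOf

  window-read : ∀ q a zs → window (before q a) ++ zs ≡ block q ++ (empty ++ block a) ++ zs
  window-read q a zs = cong (_++ zs) (window-blocks (before q a)) ∙ ++-assoc (block q) (empty ++ block a) zs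

  window-written : ∀ b r zs → window (after b r) ++ zs ≡ (empty ++ block b) ++ block r ++ zs
  window-written b r zs = cong (_++ zs) (window-blocks (after b r) ∙ sym (++-assoc empty (block b) (block r))) ∙
    ++-assoc (empty ++ block b) (block r) zs

  module _ {ρs : List Rule} where

    cell⁺ : ∀ {n q a b r} zs → n ≡ length (block q ++ (empty ++ block a) ++ zs) → (q , a , b , r) ∈ ρs →
      Run (cellProgram ρs n) (block q ++ (empty ++ block a) ++ zs) (block r ++ zs ++ (empty ++ block b))
    cell⁺ {q = q} {a} {b} {r} zs refl i = Run-++⁺
      (micro⁺ (subst₂ (Micro (instructions ρs)) (window-read q a zs) (window-written b r zs) (execs⁺ (ruleProgram ρs) {zs = zs} (program⁺ i))))
      (subst₂ (λ k p → Run (replicate k pass) ((empty ++ block b) ++ block r ++ zs) p) (length-pair b) (++-assoc (block r) zs _)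
        (rotate⁺ (empty ++ block b)))

    cell⁻ : ∀ {n q a p} zs → n ≡ length (block q ++ (empty ++ block a) ++ zs) →
      Run (cellProgram ρs n) (block q ++ (empty ++ block a) ++ zs) p →
      ∃[ b ] ∃[ r ] ((q , a , b , r) ∈ ρs × p ≡ block r ++ zs ++ (empty ++ block b))
    cell⁻ {n} {q} {a} {p} zs e x =
      let s , y , z = Run-++⁻ (concatMap (local n) (instructions ρs)) x
          h , ex , es = execs⁻ (ruleProgram ρs) {zs = zs} (subst (λ w → Micro (instructions ρs) w s) (sym (window-read q a zs)) (micro⁻ e fits y))
          b , r , i , eq = program⁻ ρs ex
          es' = es ∙ cong (_++ zs) (sym (map-cong eq labels)) ∙ window-written b r zs
      in b , r , i , sym (pass-deterministic (length (empty ++ empty))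
          (subst₂ (λ k p → Run (replicate k pass) ((empty ++ block b) ++ block r ++ zs) p) (length-pair b) (++-assoc (block r) zs _) (rotate⁺ (empty ++ block b)))
          (subst (λ w → Run (replicate (length (empty ++ empty)) pass) w p) es' z))
      where
      fits : All (Fits n) (instructions ρs)
      fits = fits-mono {L = Label} ((m≤m+n (length labels) (length zs) » ≤-reflexive (cong (_+ length zs) (sym (length-map _ labels)) ∙
        sym (length-++ (window (before q a))) ∙ cong length (window-read q a zs))) » ≤-reflexive (sym e)) (execs-fit (ruleProgram ρs))

    shifted : ∀ r b as cs → block r ++ (cellBits as ++ cellBits cs) ++ (empty ++ block b) ≡ block r ++ cellBits as ++ cellBits (cs ++ b ∷ [])
    shifted r b as cs = cong (block r ++_) (++-assoc (cellBits as) (cellBits cs) _ ∙ cong (cellBits as ++_)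
      (cong (cellBits cs ++_) (sym (++-identityʳ (empty ++ block b))) ∙ sym (concatMap-++ (λ a → empty ++ block a) cs (b ∷ []))))

    unshifted : ∀ q a as cs → block q ++ cellBits (a ∷ as) ++ cellBits cs ≡ block q ++ (empty ++ block a) ++ (cellBits as ++ cellBits cs)
    unshifted q a as cs = cong (block q ++_) (++-assoc (empty ++ block a) (cellBits as) (cellBits cs))

    -- In the induction `cs` are the cells that this sweep has already sent to the back.
    sweep-front⁺ : ∀ {n q as bs r} cs → n ≡ length (block q ++ cellBits as ++ cellBits cs) → Sweep ρs q as bs r →
      Run (sweepProgram ρs n (length as)) (block q ++ cellBits as ++ cellBits cs) (block r ++ cellBits (cs ++ bs))
    sweep-front⁺ {q = q} cs e [] = subst (λ w → Run [] (block q ++ cellBits cs) (block q ++ cellBits w)) (sym (++-identityʳ cs)) []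
    sweep-front⁺ {n} {q} {r = s} cs e (_∷_ {a = a} {b} {r} {as = as} {bs} i x) = Run-++⁺
      (subst₂ (Run (cellProgram ρs n)) (sym (unshifted q a as cs)) (shifted r b as cs) cell-run)
      (subst (λ w → Run (sweepProgram ρs n (length as)) (block r ++ cellBits as ++ cellBits (cs ++ b ∷ [])) (block s ++ cellBits w)) (++-assoc cs (b ∷ []) bs)
        (sweep-front⁺ (cs ++ b ∷ []) (e' ∙ sym (Run-length cell-run) ∙ cong length (shifted r b as cs)) x))
      where
      e' = e ∙ cong length (unshifted q a as cs)
      cell-run = cell⁺ (cellBits as ++ cellBits cs) e' i

    sweep-front⁻ : ∀ {n q p} as cs → n ≡ length (block q ++ cellBits as ++ cellBits cs) →
      Run (sweepProgram ρs n (length as)) (block q ++ cellBits as ++ cellBits cs) p →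
      ∃[ bs ] ∃[ r ] (Sweep ρs q as bs r × p ≡ block r ++ cellBits (cs ++ bs))
    sweep-front⁻ {q = q} [] cs e [] = [] , q , [] , cong (λ w → block q ++ cellBits w) (sym (++-identityʳ cs))
    sweep-front⁻ {n} {q} {p} (a ∷ as) cs e x =
      let e' = e ∙ cong length (unshifted q a as cs)
          p₁ , y , z = Run-++⁻ (cellProgram ρs n) x
          y' = subst (λ w → Run (cellProgram ρs n) w p₁) (unshifted q a as cs) y
          b , r , i , e₁ = cell⁻ (cellBits as ++ cellBits cs) e' y'
          e₂ = e₁ ∙ shifted r b as cs
          bs , s , w , e₃ = sweep-front⁻ as (cs ++ b ∷ []) (e' ∙ sym (Run-length y') ∙ cong length e₂)
            (subst (λ w → Run (sweepProgram ρs n (length as)) w p) e₂ z)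
      in b ∷ bs , s , i ∷ w , e₃ ∙ cong (λ w → block s ++ cellBits w) (++-assoc cs (b ∷ []) bs)

    nothing-behind : ∀ q as → block q ++ cellBits as ++ cellBits [] ≡ block q ++ cellBits as
    nothing-behind q as = cong (block q ++_) (++-identityʳ (cellBits as))

    sweeps⁺ : ∀ {n m q as bs r} → n ≡ length (block q ++ cellBits as) → Sweeps ρs m q as bs r →
      Run (sweepsProgram ρs n (length as) m) (block q ++ cellBits as) (block r ++ cellBits bs)
    sweeps⁺ e [] = []
    sweeps⁺ {n} {suc m} {q} {as} {r = r} e (_∷_ {bs = bs} {r = s} {cs = cs} x xs) = Run-++⁺ cell-run
      (subst (λ k → Run (sweepsProgram ρs n k m) (block s ++ cellBits bs) (block r ++ cellBits cs)) (Sweep-length x)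
        (sweeps⁺ (e ∙ sym (Run-length cell-run)) xs))
      where
      cell-run = subst (λ w → Run (sweepProgram ρs n (length as)) w (block s ++ cellBits bs)) (nothing-behind q as)
        (sweep-front⁺ [] (e ∙ cong length (sym (nothing-behind q as))) x)

    sweeps⁻ : ∀ {n q p} m as → n ≡ length (block q ++ cellBits as) →
      Run (sweepsProgram ρs n (length as) m) (block q ++ cellBits as) p →
      ∃[ bs ] ∃[ r ] (Sweeps ρs m q as bs r × p ≡ block r ++ cellBits bs × length bs ≡ length as)
    sweeps⁻ {q = q} zero as e [] = as , q , [] , refl , refl
    sweeps⁻ {n} {q} {p} (suc m) as e x =
      let p₁ , y , z = Run-++⁻ (sweepProgram ρs n (length as)) x
          bs , r , w , e₁ = sweep-front⁻ as [] (e ∙ cong length (sym (nothing-behind q as)))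
            (subst (λ w → Run (sweepProgram ρs n (length as)) w p₁) (sym (nothing-behind q as)) y)
          cs , s , ws , e₂ , l = sweeps⁻ m bs (e ∙ sym (Run-length y) ∙ cong length e₁)
            (subst₂ (λ k v → Run (sweepsProgram ρs n k m) v p) (sym (Sweep-length w)) e₁ z)
      in cs , s , w ∷ ws , e₂ , l ∙ Sweep-length w

    block-injective : ∀ {p q} → block p ≡ block q → p ≡ q
    block-injective {p} {q} e = hot-true q p (sym (same wiresOf e (complete-wiresOf (inl (p , false)))) ∙ hot-self p)
      where
      same : ∀ {f g : Wire → Bool} ws {w} → map f ws ≡ map g ws → w ∈ ws → f w ≡ g w
      same (w ∷ ws) e 1st = ∷-injectiveˡ e
      same (w ∷ ws) e (there i) = same ws (∷-injectiveʳ e) i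

    cellBits-injective : ∀ as bs → length as ≡ length bs → cellBits as ≡ cellBits bs → as ≡ bs
    cellBits-injective [] [] l e = refl
    cellBits-injective (a ∷ as) (b ∷ bs) l e =
      let e₁ , e₂ = ++-splits (empty ++ block a) (empty ++ block b) (length-pair a ∙ sym (length-pair b)) e
      in cong₂ _∷_ (block-injective (++-cancelˡ empty (block a) (block b) e₁)) (cellBits-injective as bs (suc-injective l) e₂)

    sweeps-exact⁻ : ∀ {n m q r} as bs → length bs ≡ length as → n ≡ length (block q ++ cellBits as) →
      Run (sweepsProgram ρs n (length as) m) (block q ++ cellBits as) (block r ++ cellBits bs) → Sweeps ρs m q as bs r
    sweeps-exact⁻ {n} {m} {q} {r} as bs l e x =
      let cs , s , w , e₁ , l' = sweeps⁻ m as e x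
          e₂ , e₃ = ++-splits (block r) (block s) (block-length r s) e₁
      in subst₂ (λ b c → Sweeps ρs m q as b c) (sym (cellBits-injective bs cs (l ∙ sym l') e₃)) (sym (block-injective e₂)) w

-- Rules over an arbitrary finite alphabet

module Renamed {A : Set} (F : Finite A) (ρs : List (A × A × A × A)) where

  renamed : A × A × A × A → Fin (card F) × Fin (card F) × Fin (card F) × Fin (card F)
  renamed (q , a , b , r) = rank F q , rank F a , rank F b , rank F r

  rules : List (Fin (card F) × Fin (card F) × Fin (card F) × Fin (card F))
  rules = map renamed ρs

  sweep⁺ : ∀ {q as bs r} → Sweep ρs q as bs r → Sweep rules (rank F q) (map (rank F) as) (map (rank F) bs) (rank F r)
  sweep⁺ [] = []
  sweep⁺ (i ∷ s) = ∈-map⁺ renamed i ∷ sweep⁺ s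

  rule⁻ : ∀ {q a b r} → (rank F q , rank F a , b , r) ∈ rules → ∃[ b' ] ∃[ r' ] ((q , a , b' , r') ∈ ρs × b ≡ rank F b' × r ≡ rank F r')
  rule⁻ i with (q' , a' , b' , r') , j , e ← ∈-map⁻ renamed i
    with refl ← rank-injective F (cong fst e) | refl ← rank-injective F (cong (λ x → fst (snd x)) e) =
    b' , r' , j , cong (λ x → fst (snd (snd x))) e , cong (λ x → snd (snd (snd x))) e

  sweep⁻ : ∀ {q bs r} as → Sweep rules (rank F q) (map (rank F) as) bs r →
    ∃[ bs' ] ∃[ r' ] (Sweep ρs q as bs' r' × bs ≡ map (rank F) bs' × r ≡ rank F r')
  sweep⁻ {q} [] [] = [] , q , [] , refl , refl
  sweep⁻ (a ∷ as) (i ∷ s) with b' , r' , j , refl , refl ← rule⁻ i =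
    let bs' , s' , w , e , e' = sweep⁻ as s in b' ∷ bs' , s' , j ∷ w , cong (rank F b' ∷_) e , e'

  sweeps⁺ : ∀ {m q as bs r} → Sweeps ρs m q as bs r → Sweeps rules m (rank F q) (map (rank F) as) (map (rank F) bs) (rank F r)
  sweeps⁺ [] = []
  sweeps⁺ (s ∷ ss) = sweep⁺ s ∷ sweeps⁺ ss

  sweeps⁻ : ∀ {m q as bs r} → Sweeps rules m (rank F q) (map (rank F) as) (map (rank F) bs) (rank F r) → Sweeps ρs m q as bs r
  sweeps⁻ ss = let bs' , r' , w , e , e' = go _ ss in
    subst₂ (λ b r → Sweeps ρs _ _ _ b r) (sym (maps e)) (sym (rank-injective F e')) w
    where
    maps : ∀ {xs ys} → map (rank F) xs ≡ map (rank F) ys → xs ≡ ys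
    maps = map-injective (rank-injective F)
    go : ∀ {m q bs r} as → Sweeps rules m (rank F q) (map (rank F) as) bs r →
      ∃[ bs' ] ∃[ r' ] (Sweeps ρs m q as bs' r' × bs ≡ map (rank F) bs' × r ≡ rank F r')
    go {q = q} as [] = as , q , [] , refl , refl
    go as (s ∷ ss) with bs' , r' , w , refl , refl ← sweep⁻ as s =
      let cs , s' , ws , e , e' = go bs' ss in cs , s' , w ∷ ws , e , e'

-- Simulating a Turing machine by sweeps

module Automaton (M : Machine) where
  open Machine M public

  k : ℕ
  k = suc workTapes

  Sign : Set
  Sign = Symbol extras

  -- What is to be done to a stack whose n-th entry is in the n-th cell, on the way through the
  -- cells: to pop the symbol e is to push it in reverse, so e is to be checked, and the entry
  -- of the next cell, which is not known yet, becomes the one of this cell and is to be checked there.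
  data Task : Set where
    keep : Task
    push pop : Sign → Task

  -- All that happens to one half tape in one cell: the tasks arriving and leaving, and the symbols
  -- before and after, are functions of it. A sweeping rule is thus a vector of pairs of entries.
  data Entry : Set where
    keep : Sign → Entry
    push pop : Sign → Sign → Entry

  task task' : Entry → Task
  task (keep _) = keep
  task (push s _) = push s
  task (pop e _) = pop e
  task' (keep _) = keep
  task' (push _ s) = push s
  task' (pop _ e) = pop e

  old new : Entry → Sign
  old (keep s) = s
  old (push _ s) = s
  old (pop s _) = s
  new (keep s) = s
  new (push s _) = s
  new (pop _ s) = s

  on-both : ∀ {X Y : Set} → (X → Y) → X × X → Y × Y
  on-both f (x , y) = f x , f y

  -- States are `guess`, `running` and `done`; the other letters stand in cells. A running state
  -- carries the symbols under the heads, and for each tape the tasks for its two halves.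
  Letter : Set
  Letter = Bool ⊎ (Fin states × Vec Sign k × Vec (Task × Task) k) ⊎ Bool ⊎ Fin 5 ⊎ Vec (Sign × Sign) k

  pattern guess e = inl e
  pattern running q hs ts = inr (inl (q , hs , ts))
  pattern known b = inr (inr (inl b))
  pattern special i = inr (inr (inr (inl i)))
  pattern done = special 0F
  pattern unknown = special 1F
  pattern unused = special 2F
  pattern marker = special 3F
  pattern wiped = special 4F
  pattern cell c = inr (inr (inr (inr c)))

  finite-Sign : Finite Sign
  finite-Sign = retract to from (λ { blank → refl ; (bit b) → refl ; (extra i) → refl }) (finite-⊤ ⊎-finite finite-Bool ⊎-finite finite-Fin extras)
    where
    to : Sign → ⊤ ⊎ Bool ⊎ Fin extras
    to blank = inl tt
    to (bit b) = inr (inl b)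
    to (extra i) = inr (inr i)
    from : ⊤ ⊎ Bool ⊎ Fin extras → Sign
    from (inl _) = blank
    from (inr (inl b)) = bit b
    from (inr (inr i)) = extra i

  finite-Task : Finite Task
  finite-Task = retract to from (λ { keep → refl ; (push s) → refl ; (pop s) → refl }) (finite-⊤ ⊎-finite finite-Sign ⊎-finite finite-Sign)
    where
    to : Task → ⊤ ⊎ Sign ⊎ Sign
    to keep = inl tt
    to (push s) = inr (inl s)
    to (pop s) = inr (inr s)
    from : ⊤ ⊎ Sign ⊎ Sign → Task
    from (inl _) = keep
    from (inr (inl s)) = push s
    from (inr (inr s)) = pop s

  finite-Entry : Finite Entry
  finite-Entry = retract to from (λ { (keep s) → refl ; (push s t) → refl ; (pop s t) → refl })
    (finite-Sign ⊎-finite (finite-Sign ×-finite finite-Sign) ⊎-finite (finite-Sign ×-finite finite-Sign))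
    where
    to : Entry → Sign ⊎ (Sign × Sign) ⊎ (Sign × Sign)
    to (keep s) = inl s
    to (push s t) = inr (inl (s , t))
    to (pop s t) = inr (inr (s , t))
    from : Sign ⊎ (Sign × Sign) ⊎ (Sign × Sign) → Entry
    from (inl s) = keep s
    from (inr (inl (s , t))) = push s t
    from (inr (inr (s , t))) = pop s t

  finite-Letter : Finite Letter
  finite-Letter = finite-Bool ⊎-finite (finite-Fin states ×-finite finite-Vec finite-Sign k ×-finite finite-Vec (finite-Task ×-finite finite-Task) k) ⊎-finite
    finite-Bool ⊎-finite finite-Fin 5 ⊎-finite finite-Vec (finite-Sign ×-finite finite-Sign) k

  inputCell : Sign → Vec (Sign × Sign) k
  inputCell s = (blank , s) ∷ Vec.replicate workTapes (blank , blank)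

  -- The tasks for the two halves of a tape, and the symbol under the head afterwards; g is a guess.
  tasks : Sign × Move → Sign → Task × Task
  tasks (s , left) g = pop g , push s
  tasks (s , stay) g = keep , keep
  tasks (s , right) g = push s , pop g

  headAfter : Sign × Move → Sign → Sign
  headAfter (s , left) g = g
  headAfter (s , stay) g = s
  headAfter (s , right) g = g

  -- The symbols `gs` that come under moving heads are guessed. Each of them is also the symbol to
  -- be popped, so the coming sweep checks it.
  started : Fin states → Vec (Sign × Move) k → Vec Sign k → Letter
  started q as gs = running q (Vec.zipWith headAfter as gs) (Vec.zipWith tasks as gs)

  -- The input is first put behind the head of the first tape, and read by moving right.
  loading : Vec (Sign × Move) k
  loading = (blank , right) ∷ Vec.replicate workTapes (blank , stay)

  -- At the marker a symbol still to be pushed would be lost, and one still to be popped would come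
  -- from beyond the cells: both have to be blank.
  data Clean : Task → Set where
    keep : Clean keep
    push : Clean (push blank)
    pop : Clean (pop blank)

  cleanTask : Fin 3 → Task
  cleanTask zero = keep
  cleanTask (suc zero) = push blank
  cleanTask (suc (suc zero)) = pop blank

  cleanTasks : Vec (Fin 3 × Fin 3) k → Vec (Task × Task) k
  cleanTasks = Vec.map (on-both cleanTask)

  Rule : Set
  Rule = Letter × Letter × Letter × Letter

  -- The first sweep enters the known bits, guesses the certificate, and after its end, noted by
  -- `guess true`, writes blanks. Each later one completes an action and looks up the next at the
  -- marker. Once the machine has accepted, all cells are wiped, so that the last queue does not
  -- depend on the computation.
  data Transition : Rule → Set where
    enter : ∀ b → Transition (guess false , known b , cell (inputCell (bit b)) , guess false)
    guessBit : ∀ b → Transition (guess false , unknown , cell (inputCell (bit b)) , guess false)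
    end : ∀ b → Transition (guess b , unknown , cell (inputCell blank) , guess true)
    vacate : ∀ b → Transition (guess b , unused , cell (inputCell blank) , guess true)
    toStart : ∀ b gs → Transition (guess b , marker , marker , started start loading gs)
    sweep : ∀ q hs (es : Vec (Entry × Entry) k) → Transition (running q hs (Vec.map (on-both task) es) , cell (Vec.map (on-both old) es) ,
        cell (Vec.map (on-both new) es) , running q hs (Vec.map (on-both task') es))
    next : ∀ q hs cl gs {q' as} → δ q hs ≡ just (q' , as) → Transition (running q hs (cleanTasks cl) , marker , marker , started q' as gs)
    accepted : ∀ q hs cl → δ q hs ≡ nothing → accept q ≡ true → Transition (running q hs (cleanTasks cl) , marker , marker , done)
    wipe : ∀ c → Transition (done , cell c , wiped , done)
    rewipe : Transition (done , wiped , wiped , done)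
    rest : Transition (done , marker , marker , done)

  guessRule : Bool × Vec Sign k → List Rule
  guessRule (b , gs) = (guess false , known b , cell (inputCell (bit b)) , guess false)
    ∷ (guess false , unknown , cell (inputCell (bit b)) , guess false)
    ∷ (guess b , unknown , cell (inputCell blank) , guess true)
    ∷ (guess b , unused , cell (inputCell blank) , guess true)
    ∷ (guess b , marker , marker , started start loading gs) ∷ []

  sweepRule : Fin states × Vec Sign k × Vec (Entry × Entry) k → Rule
  sweepRule (q , hs , es) = running q hs (Vec.map (on-both task) es) , cell (Vec.map (on-both old) es) ,
    cell (Vec.map (on-both new) es) , running q hs (Vec.map (on-both task') es)

  markerRule : Maybe (Fin states × Vec (Sign × Move) k) → Bool → Letter → Vec Sign k → List Rule
  markerRule (just (q' , as)) a c gs = (c , marker , marker , started q' as gs) ∷ []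
  markerRule nothing true c gs = (c , marker , marker , done) ∷ []
  markerRule nothing false c gs = []

  markerRules : Fin states × Vec Sign k × Vec (Fin 3 × Fin 3) k × Vec Sign k → List Rule
  markerRules (q , hs , cl , gs) = markerRule (δ q hs) (accept q) (running q hs (cleanTasks cl)) gs

  wipeRule : Vec (Sign × Sign) k → List Rule
  wipeRule c = (done , cell c , wiped , done) ∷ (done , wiped , wiped , done) ∷ (done , marker , marker , done) ∷ []

  F₁ : Finite (Bool × Vec Sign k)
  F₁ = finite-Bool ×-finite finite-Vec finite-Sign k
  F₂ : Finite (Fin states × Vec Sign k × Vec (Entry × Entry) k)
  F₂ = finite-Fin states ×-finite finite-Vec finite-Sign k ×-finite finite-Vec (finite-Entry ×-finite finite-Entry) k
  F₃ : Finite (Fin states × Vec Sign k × Vec (Fin 3 × Fin 3) k × Vec Sign k)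
  F₃ = finite-Fin states ×-finite finite-Vec finite-Sign k ×-finite finite-Vec (finite-Fin 3 ×-finite finite-Fin 3) k ×-finite finite-Vec finite-Sign k
  F₄ : Finite (Vec (Sign × Sign) k)
  F₄ = finite-Vec (finite-Sign ×-finite finite-Sign) k

  union : {X : Set} → Finite X → (X → List Rule) → List Rule
  union F f = concatMap f (Finite.all F)

  union⁻ : {X : Set} (F : Finite X) {f : X → List Rule} → (∀ x → All Transition (f x)) → All Transition (union F f)
  union⁻ F h = Allₚ.concat⁺ (Allₚ.map⁺ (All.universal h (Finite.all F)))

  union⁺ : {X : Set} (F : Finite X) {f : X → List Rule} {ρ : Rule} (x : X) → ρ ∈ f x → ρ ∈ union F f
  union⁺ F {f} {ρ} x i = ∈-concat⁺′ i (∈-map⁺ f (Finite.∈all F x))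

  abstract
    rules : List Rule
    rules = union F₁ guessRule ++ union F₂ (λ x → sweepRule x ∷ []) ++ union F₃ markerRules ++ union F₄ wipeRule

    rules⁻ : ∀ {ρ} → ρ ∈ rules → Transition ρ
    rules⁻ i = All.lookup (Allₚ.++⁺ (union⁻ F₁ (λ (b , gs) → enter b ∷ guessBit b ∷ end b ∷ vacate b ∷ toStart b gs ∷ []))
      (Allₚ.++⁺ (union⁻ F₂ (λ (q , hs , es) → sweep q hs es ∷ []))
        (Allₚ.++⁺ (union⁻ F₃ (λ (q , hs , cl , gs) → go q hs cl gs (δ q hs) (accept q) refl refl)) (union⁻ F₄ (λ c → wipe c ∷ rewipe ∷ rest ∷ []))))) i
      where
      go : ∀ q hs cl gs o a → δ q hs ≡ o → accept q ≡ a → All Transition (markerRule o a (running q hs (cleanTasks cl)) gs)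
      go q hs cl gs (just (q' , as)) a e e' = next q hs cl gs e ∷ []
      go q hs cl gs nothing true e e' = accepted q hs cl e e' ∷ []
      go q hs cl gs nothing false e e' = []

    onwards : ∀ {ρ} → ρ ∈ union F₃ markerRules ++ union F₄ wipeRule → ρ ∈ rules
    onwards i = ∈-++⁺ʳ (union F₁ guessRule) (∈-++⁺ʳ (union F₂ (λ x → sweepRule x ∷ [])) i)

    rules⁺ : ∀ {ρ} → Transition ρ → ρ ∈ rules
    rules⁺ (enter b) = ∈-++⁺ˡ (union⁺ F₁ (b , Vec.replicate k blank) 1st)
    rules⁺ (guessBit b) = ∈-++⁺ˡ (union⁺ F₁ (b , Vec.replicate k blank) 2nd)
    rules⁺ (end b) = ∈-++⁺ˡ (union⁺ F₁ (b , Vec.replicate k blank) 3rd)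
    rules⁺ (vacate b) = ∈-++⁺ˡ (union⁺ F₁ (b , Vec.replicate k blank) 4th)
    rules⁺ (toStart b gs) = ∈-++⁺ˡ (union⁺ F₁ (b , gs) 5th)
    rules⁺ (sweep q hs es) = ∈-++⁺ʳ (union F₁ guessRule) (∈-++⁺ˡ (union⁺ F₂ (q , hs , es) 1st))
    rules⁺ (next q hs cl gs {q'} {as} e) = onwards (∈-++⁺ˡ (union⁺ F₃ (q , hs , cl , gs)
      (subst (λ o → (running q hs (cleanTasks cl) , marker , marker , started q' as gs) ∈ markerRule o (accept q) (running q hs (cleanTasks cl)) gs) (sym e) 1st)))
    rules⁺ (accepted q hs cl e e') = onwards (∈-++⁺ˡ (union⁺ F₃ (q , hs , cl , Vec.replicate k blank)
      (subst₂ (λ o a → (running q hs (cleanTasks cl) , marker , marker , done) ∈ markerRule o a (running q hs (cleanTasks cl)) (Vec.replicate k blank)) (sym e) (sym e') 1st)))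
    rules⁺ (wipe c) = onwards (∈-++⁺ʳ (union F₃ markerRules) (union⁺ F₄ c 1st))
    rules⁺ rewipe = onwards (∈-++⁺ʳ (union F₃ markerRules) (union⁺ F₄ (Vec.replicate k (blank , blank)) 2nd))
    rules⁺ rest = onwards (∈-++⁺ʳ (union F₃ markerRules) (union⁺ F₄ (Vec.replicate k (blank , blank)) 3rd))

-- Soundness of the sweeps

symbolAt : ∀ {g} → List (Symbol g) → ℕ → Symbol g
symbolAt [] n = blank
symbolAt (x ∷ xs) zero = x
symbolAt (x ∷ xs) (suc n) = symbolAt xs n

infix 4 _~_
-- Tapes are blank beyond their lists, so halves of tapes are compared up to trailing blanks.
_~_ : ∀ {g} → List (Symbol g) → List (Symbol g) → Set
xs ~ ys = ∀ n → symbolAt xs n ≡ symbolAt ys n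

~-cons : ∀ {g} {x} {xs ys : List (Symbol g)} → xs ~ ys → (x ∷ xs) ~ (x ∷ ys)
~-cons e zero = refl
~-cons e (suc n) = e n

~-blank : ∀ {g} → (blank {g} ∷ []) ~ []
~-blank zero = refl
~-blank (suc n) = refl

lookup-ext : ∀ {A : Set} {n} {xs ys : Vec A n} → (∀ i → lookup xs i ≡ lookup ys i) → xs ≡ ys
lookup-ext {xs = xs} {ys} e = sym (tabulate∘lookup xs) ∙ tabulate-cong e ∙ tabulate∘lookup ys

module Sound (M : Machine) where
  open Automaton M

  data Track : Task → List Sign → List Sign → Task → Set where
    [] : ∀ {t} → Track t [] [] t
    _∷_ : ∀ {t a b u} → (∃[ e ] (t ≡ task e × a ≡ old e × b ≡ new e × u ≡ task' e)) → ∀ {as bs v} → Track u as bs v → Track t (a ∷ as) (b ∷ bs) v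

  -- A pop is a push read backwards: the two lists change roles.
  Effect : Task → List Sign → List Sign → Set
  Effect keep as bs = as ~ bs
  Effect (push s) as bs = bs ~ s ∷ as
  Effect (pop s) as bs = as ~ s ∷ bs

  -- Along the cells the symbols are handed on by one place; a clean last task means that only a
  -- blank crosses the end, which `~` does not see.
  effect : ∀ {t as bs u} → Track t as bs u → Clean u → Effect t as bs
  effect [] keep = λ _ → refl
  effect [] push = λ n → sym (~-blank n)
  effect [] pop = λ n → sym (~-blank n)
  effect ((keep s , refl , refl , refl , refl) ∷ x) c = ~-cons (effect x c)
  effect ((push s a , refl , refl , refl , refl) ∷ x) c = ~-cons (effect x c)
  effect ((pop e f , refl , refl , refl , refl) ∷ x) c = ~-cons (effect x c)

  Cells : Set
  Cells = List (Vec (Sign × Sign) k)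

  column : (Sign × Sign → Sign) → Fin k → Cells → List Sign
  column d i cs = map (λ c → d (lookup c i)) cs

  Tracks : Vec (Task × Task) k → Cells → Cells → Vec (Task × Task) k → Set
  Tracks ts cs ds us = ∀ i →
    Track (fst (lookup ts i)) (column fst i cs) (column fst i ds) (fst (lookup us i)) ×
    Track (snd (lookup ts i)) (column snd i cs) (column snd i ds) (snd (lookup us i))

  sweep⁻ : ∀ {q hs ts bs r} cs → Sweep rules (running q hs ts) (map cell cs) bs r →
    ∃[ ds ] ∃[ us ] (bs ≡ map cell ds × r ≡ running q hs us × Tracks ts cs ds us)
  sweep⁻ {ts = ts} [] [] = [] , ts , refl , refl , λ i → [] , []
  sweep⁻ {q} {hs} {ts} (c ∷ cs) (i ∷ s) = go (rules⁻ i) s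
    where
    go : ∀ {b r bs s} → Transition (running q hs ts , cell c , b , r) → Sweep rules r (map cell cs) bs s →
      ∃[ ds ] ∃[ us ] (b ∷ bs ≡ map cell ds × s ≡ running q hs us × Tracks ts (c ∷ cs) ds us)
    go (sweep q hs es) s with ds , us , refl , refl , h ← sweep⁻ cs s = Vec.map (on-both new) es ∷ ds , us , refl , refl , λ i →
      ((fst (lookup es i) , cong fst (lookup-map i (on-both task) es) , cong fst (lookup-map i (on-both old) es) ,
        cong fst (lookup-map i (on-both new) es) , cong fst (lookup-map i (on-both task') es)) ∷ fst (h i)) ,
      ((snd (lookup es i) , cong snd (lookup-map i (on-both task) es) , cong snd (lookup-map i (on-both old) es) ,
        cong snd (lookup-map i (on-both new) es) , cong snd (lookup-map i (on-both task') es)) ∷ snd (h i))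

  record Holds (cs : Cells) (hs : Vec Sign k) (ts : Vec (Tape extras) k) : Set where
    field
      heads : ∀ i → lookup hs i ≡ head (lookup ts i)
      lefts : ∀ i → column fst i cs ~ left-of (lookup ts i)
      rights : ∀ i → column snd i cs ~ right-of (lookup ts i)
  open Holds

  Effects : Vec (Task × Task) k → Cells → Cells → Set
  Effects us cs ds = ∀ i → Effect (fst (lookup us i)) (column fst i cs) (column fst i ds) ×
      Effect (snd (lookup us i)) (column snd i cs) (column snd i ds)

  after-tape : ∀ a g t {l r l' r'} → l ~ left-of t → r ~ right-of t →
    Effect (fst (tasks a g)) l l' → Effect (snd (tasks a g)) r r' →
    headAfter a g ≡ head (write a t) × l' ~ left-of (write a t) × r' ~ right-of (write a t)
  after-tape (s , left) g (tape [] x rs) el er fl fr =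
    sym (fl 0) ∙ el 0 , (λ n → sym (fl (suc n)) ∙ el (suc n)) , λ { zero → fr 0 ; (suc n) → fr (suc n) ∙ er n }
  after-tape (s , left) g (tape (l ∷ ls) x rs) el er fl fr =
    sym (fl 0) ∙ el 0 , (λ n → sym (fl (suc n)) ∙ el (suc n)) , λ { zero → fr 0 ; (suc n) → fr (suc n) ∙ er n }
  after-tape (s , stay) g (tape ls x rs) el er fl fr = refl , (λ n → sym (fl n) ∙ el n) , λ n → trans (sym (fr n)) (er n)
  after-tape (s , right) g (tape ls x []) el er fl fr =
    sym (fr 0) ∙ er 0 , (λ { zero → fl 0 ; (suc n) → fl (suc n) ∙ el n }) , λ n → trans (sym (fr (suc n))) (er (suc n))
  after-tape (s , right) g (tape ls x (r ∷ rs)) el er fl fr =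
    sym (fr 0) ∙ er 0 , (λ { zero → fl 0 ; (suc n) → fl (suc n) ∙ el n }) , λ n → sym (fr (suc n)) ∙ er (suc n)

  holds-write : ∀ {cs hs ds} as gs ts → Holds cs hs ts → Effects (Vec.zipWith tasks as gs) cs ds →
    Holds ds (Vec.zipWith headAfter as gs) (Vec.zipWith write as ts)
  holds-write {cs} {hs} {ds} as gs ts H E = record
    { heads = λ i → lookup-zipWith headAfter i as gs ∙ fst (tapewise i) ∙ cong head (sym (written i))
    ; lefts = λ i → subst (λ t → column fst i ds ~ left-of t) (sym (written i)) (fst (snd (tapewise i)))
    ; rights = λ i → subst (λ t → column snd i ds ~ right-of t) (sym (written i)) (snd (snd (tapewise i))) }
    where
    written : ∀ i → lookup (Vec.zipWith write as ts) i ≡ write (lookup as i) (lookup ts i)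
    written i = lookup-zipWith write i as ts
    tapewise = λ i → after-tape (lookup as i) (lookup gs i) (lookup ts i) (lefts H i) (rights H i)
      (subst (λ u → Effect (fst u) (column fst i cs) (column fst i ds)) (lookup-zipWith tasks i as gs) (fst (E i)))
      (subst (λ u → Effect (snd u) (column snd i cs) (column snd i ds)) (lookup-zipWith tasks i as gs) (snd (E i)))

  clean-cleanTask : ∀ c → Clean (cleanTask c)
  clean-cleanTask zero = keep
  clean-cleanTask (suc zero) = push
  clean-cleanTask (suc (suc zero)) = pop

  step-halts : ∀ {q} ts → δ q (Vec.map head ts) ≡ nothing → stepM M (config q ts) ≡ nothing
  step-halts ts e rewrite e = refl

  step-goes : ∀ {q q' as} ts → δ q (Vec.map head ts) ≡ just (q' , as) → stepM M (config q ts) ≡ just (config q' (Vec.zipWith write as ts))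
  step-goes ts e rewrite e = refl

  Accepting : Config M → Set
  Accepting c = ∃[ t ] ∃[ d ] (HaltsAfter M t c d × accept (Config.state d) ≡ true)

  sweep-++⁻ : ∀ {A : Set} {ρs : List (A × A × A × A)} {q r} as {bs cs} → Sweep ρs q (as ++ bs) cs r →
    ∃[ cs₁ ] ∃[ cs₂ ] ∃[ s ] (cs ≡ cs₁ ++ cs₂ × Sweep ρs q as cs₁ s × Sweep ρs s bs cs₂ r)
  sweep-++⁻ [] w = [] , _ , _ , refl , [] , w
  sweep-++⁻ (a ∷ as) (i ∷ w) with cs₁ , cs₂ , s , refl , w₁ , w₂ ← sweep-++⁻ as w = _ ∷ cs₁ , cs₂ , s , refl , i ∷ w₁ , w₂

  clean : ∀ cl i → Clean (fst (lookup (cleanTasks cl) i)) × Clean (snd (lookup (cleanTasks cl) i))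
  clean cl i = subst (λ t → Clean (fst t) × Clean (snd t)) (sym (lookup-map i (on-both cleanTask) cl))
    (clean-cleanTask (fst (lookup cl i)) , clean-cleanTask (snd (lookup cl i)))

  effects : ∀ {us cs ds} cl → Tracks us cs ds (cleanTasks cl) → Effects us cs ds
  effects cl h i = effect (fst (h i)) (fst (clean cl i)) , effect (snd (h i)) (snd (clean cl i))

  -- The cells are one sweep behind: `ts` are the tapes that they hold once the tasks `us` have been
  -- carried out, whatever cells result.
  Pending : Vec Sign k → Vec (Task × Task) k → Cells → Vec (Tape extras) k → Set
  Pending hs us cs ts = ∀ ds → Effects us cs ds → Holds ds hs ts

  -- Guessed symbols are confirmed only at the marker, where the tasks turn out clean. The symbols
  -- in the state are then those under the heads, and `δ` is applied to the true ones.
  run-sound : ∀ m {q hs us cs zs} ts → Pending hs us cs ts → Sweeps rules m (running q hs us) (map cell cs ++ marker ∷ []) zs done → Accepting (config q ts)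
  run-sound (suc m) {q} {hs} {us} {cs} ts P (w ∷ ws) = swept (sweep-++⁻ (map cell cs) w) ws
    where
    marked : ∀ {vs ds b r zs} → Tracks us cs ds vs → Transition (running q hs vs , marker , b , r) →
      Sweeps rules m r (map cell ds ++ b ∷ []) zs done → Accepting (config q ts)
    marked {ds = ds} h (next q hs cl gs {q'} {as} e) ws =
      let H = P ds (effects {us} {cs} {ds} cl h)
          same = lookup-ext (λ i → heads H i ∙ sym (lookup-map i head ts))
          t , d , x , a = run-sound m (Vec.zipWith write as ts) (λ es → holds-write as gs ts H) ws
      in suc t , d , next (step-goes ts (cong (δ q) (sym same) ∙ e)) x , a
    marked {ds = ds} h (accepted q hs cl e e') ws =
      let H = P ds (effects {us} {cs} {ds} cl h)
          same = lookup-ext (λ i → heads H i ∙ sym (lookup-map i head ts))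
      in 0 , config q ts , halted (step-halts ts (cong (δ q) (sym same) ∙ e)) , e'
    swept : ∀ {bs r zs} → ∃[ cs₁ ] ∃[ cs₂ ] ∃[ s ] (bs ≡ cs₁ ++ cs₂ × Sweep rules (running q hs us) (map cell cs) cs₁ s × Sweep rules s (marker ∷ []) cs₂ r) →
      Sweeps rules m r bs zs done → Accepting (config q ts)
    swept (_ , _ , _ , refl , w₁ , i ∷ []) ws with ds , vs , refl , refl , h ← sweep⁻ cs w₁ = marked h (rules⁻ i) ws

  letters : List Sign → List Letter
  letters ss = map cell (map inputCell ss)

  vacant : ℕ → ℕ → List Letter
  vacant m n = replicate m unknown ++ replicate n unused

  Unguessed : List Letter → Letter → Set
  Unguessed bs r = ∃[ ss ] ∃[ e ] (bs ≡ letters ss × r ≡ guess e × ss ~ [])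

  unused⁻ : ∀ n {e bs r} → Sweep rules (guess e) (replicate n unused) bs r → Unguessed bs r
  unused⁻ zero {e} [] = [] , e , refl , refl , λ _ → refl
  unused⁻ (suc n) {e} (i ∷ w) = go (rules⁻ i) w
    where
    go : ∀ {b r bs s} → Transition (guess e , unused , b , r) → Sweep rules r (replicate n unused) bs s → Unguessed (b ∷ bs) s
    go (vacate _) w with ss , e' , refl , refl , h ← unused⁻ n w = blank ∷ ss , e' , refl , refl , λ { zero → refl ; (suc n) → h n }

  ended⁻ : ∀ m n {bs r} → Sweep rules (guess true) (vacant m n) bs r → Unguessed bs r
  ended⁻ zero n w = unused⁻ n w
  ended⁻ (suc m) n (i ∷ w) = go (rules⁻ i) w
    where
    go : ∀ {b r bs s} → Transition (guess true , unknown , b , r) → Sweep rules r (vacant m n) bs s → Unguessed (b ∷ bs) s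
    go (end _) w with ss , e' , refl , refl , h ← ended⁻ m n w = blank ∷ ss , e' , refl , refl , λ { zero → refl ; (suc n) → h n }

  Guessed : ℕ → Word → List Letter → Letter → Set
  Guessed m kb bs r = ∃[ ss ] ∃[ e' ] ∃[ y ] (bs ≡ letters ss × r ≡ guess e' × length y ≤ m × ss ~ map bit (kb ++ y))

  unknown⁻ : ∀ m n {bs r} → Sweep rules (guess false) (vacant m n) bs r → Guessed m [] bs r
  unknown⁻ zero n w = let ss , e' , p , q , h = unused⁻ n w in ss , e' , [] , p , q , z≤n , h
  unknown⁻ (suc m) n (i ∷ w) = go (rules⁻ i) w
    where
    go : ∀ {b r bs s} → Transition (guess false , unknown , b , r) → Sweep rules r (vacant m n) bs s →
      Guessed (suc m) [] (b ∷ bs) s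
    go (guessBit b) w with ss , e' , y , refl , refl , le , h ← unknown⁻ m n w = bit b ∷ ss , e' , b ∷ y , refl , refl , s≤s le , ~-cons h
    go (end _) w with ss , e' , refl , refl , h ← ended⁻ m n w = blank ∷ ss , e' , [] , refl , refl , z≤n , λ { zero → refl ; (suc n) → h n }

  known⁻ : ∀ kb m n {bs r} → Sweep rules (guess false) (map known kb ++ vacant m n) bs r → Guessed m kb bs r
  known⁻ [] m n w = unknown⁻ m n w
  known⁻ (x ∷ kb) m n (i ∷ w) = go (rules⁻ i) w
    where
    go : ∀ {b r bs s} → Transition (guess false , known x , b , r) → Sweep rules r (map known kb ++ vacant m n) bs s →
      Guessed m (x ∷ kb) (b ∷ bs) s
    go (enter b) w with ss , e' , y , refl , refl , le , h ← known⁻ kb m n w = bit b ∷ ss , e' , y , refl , refl , le , ~-cons h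

  -- The tapes whose result under the action loading is the initial configuration.
  preTapes : Word → Vec (Tape extras) k
  preTapes w = tape [] blank (map bit w) ∷ Vec.replicate workTapes (tape [] blank [])

  initialTapes : Word → Vec (Tape extras) k
  initialTapes w = fromSymbols (map bit w) ∷ Vec.replicate workTapes (fromSymbols [])

  pre-initial : ∀ w i → let t = lookup (Vec.zipWith write loading (preTapes w)) i ; u = lookup (initialTapes w) i in
    head t ≡ head u × left-of t ~ left-of u × right-of t ~ right-of u
  pre-initial [] zero = refl , ~-blank , λ _ → refl
  pre-initial (b ∷ w) zero = refl , ~-blank , λ _ → refl
  pre-initial w (suc i) rewrite lookup-zipWith write i (Vec.replicate workTapes (blank , stay)) (Vec.replicate workTapes (tape {extras} [] blank []))
    | lookup-replicate i (Sign × Move ∋ (blank , stay)) | lookup-replicate i (tape {extras} [] blank []) = refl , (λ _ → refl) , (λ _ → refl)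

  column-loaded : ∀ ss → column snd zero (map inputCell ss) ≡ ss
  column-loaded [] = refl
  column-loaded (s ∷ ss) = cong (s ∷_) (column-loaded ss)

  blanks : ∀ d i ss → (∀ s → d (lookup (inputCell s) i) ≡ blank) → column d i (map inputCell ss) ~ []
  blanks d i [] e n = refl
  blanks d i (s ∷ ss) e zero = e s
  blanks d i (s ∷ ss) e (suc n) = blanks d i ss e n

  loaded-holds : ∀ {ss w} → ss ~ map bit w → Holds (map inputCell ss) (Vec.replicate k blank) (preTapes w)
  loaded-holds {ss} {w} h = record
    { heads = λ { zero → refl ; (suc i) → lookup-replicate i blank ∙ sym (cong head (lookup-replicate i (tape [] blank []))) }
    ; lefts = λ { zero → blanks fst zero ss (λ _ → refl)
        ; (suc i) → subst (λ t → column fst (suc i) (map inputCell ss) ~ left-of t) (sym (lookup-replicate i (tape [] blank [])))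
            (blanks fst (suc i) ss (λ _ → cong fst (lookup-replicate i (blank , blank)))) }
    ; rights = λ { zero → subst (_~ map bit w) (sym (column-loaded ss)) h
        ; (suc i) → subst (λ t → column snd (suc i) (map inputCell ss) ~ right-of t) (sym (lookup-replicate i (tape [] blank [])))
            (blanks snd (suc i) ss (λ _ → cong snd (lookup-replicate i (blank , blank)))) } }

  start-pending : ∀ {ss w} gs → ss ~ map bit w →
    Pending (Vec.zipWith headAfter loading gs) (Vec.zipWith tasks loading gs) (map inputCell ss) (initialTapes w)
  start-pending {ss} {w} gs h ds E = let H = holds-write loading gs (preTapes w) (loaded-holds h) E in record
    { heads = λ i → heads H i ∙ fst (pre-initial w i)
    ; lefts = λ i n → lefts H i n ∙ fst (snd (pre-initial w i)) n
    ; rights = λ i n → rights H i n ∙ snd (snd (pre-initial w i)) n }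

  guess-sound : ∀ l kb m n {zs} → Sweeps rules (suc l) (guess false) ((map known kb ++ vacant m n) ++ marker ∷ []) zs done →
    ∃[ y ] (length y ≤ m × Accepts M (kb ++ y))
  guess-sound l kb m n (w ∷ ws) = swept (sweep-++⁻ (map known kb ++ vacant m n) w) ws
    where
    marked : ∀ {e ss y b r zs} → length y ≤ m → ss ~ map bit (kb ++ y) → Transition (guess e , marker , b , r) →
      Sweeps rules l r (letters ss ++ b ∷ []) zs done → ∃[ y ] (length y ≤ m × Accepts M (kb ++ y))
    marked {y = y} le h (toStart _ gs) ws = y , le , run-sound l (initialTapes (kb ++ y)) (start-pending gs h) ws
    swept : ∀ {bs r zs} → ∃[ cs₁ ] ∃[ cs₂ ] ∃[ s ] (bs ≡ cs₁ ++ cs₂ ×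
        Sweep rules (guess false) (map known kb ++ vacant m n) cs₁ s × Sweep rules s (marker ∷ []) cs₂ r) →
      Sweeps rules l r bs zs done → ∃[ y ] (length y ≤ m × Accepts M (kb ++ y))
    swept (_ , _ , _ , refl , w₁ , i ∷ []) ws with ss , e , y , refl , refl , le , h ← known⁻ kb m n w₁ = marked le h (rules⁻ i) ws

-- Sweeps obtained from an accepting computation

sweep-++⁺ : ∀ {A : Set} {ρs : List (A × A × A × A)} {q r s as bs cs ds} → Sweep ρs q as bs r → Sweep ρs r cs ds s → Sweep ρs q (as ++ cs) (bs ++ ds) s
sweep-++⁺ [] y = y
sweep-++⁺ (i ∷ x) y = i ∷ sweep-++⁺ x y

symbolAt-beyond : ∀ {g} (xs : List (Symbol g)) {n} → length xs ≤ n → symbolAt xs n ≡ blank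
symbolAt-beyond [] le = refl
symbolAt-beyond (x ∷ xs) (s≤s le) = symbolAt-beyond xs le

module Complete (M : Machine) where
  open Automaton M
  open Sound M

  symbolsAt : ℕ → Tape extras → Sign × Sign
  symbolsAt j t = symbolAt (left-of t) j , symbolAt (right-of t) j

  cellsOf : Vec (Tape extras) k → ℕ → ℕ → Cells
  cellsOf ts j zero = []
  cellsOf ts j (suc n) = Vec.map (symbolsAt j) ts ∷ cellsOf ts (suc j) n

  -- With the tape known, every guess is right: a pop arriving at cell `j` carries entry `j` of the
  -- half tape before the action, a push the one after it.
  entries : ℕ → Sign × Move → Tape extras → Entry × Entry
  entries j (s , left) (tape ls x rs) = pop (symbolAt ls j) (symbolAt ls (suc j)) , push (symbolAt (s ∷ rs) j) (symbolAt rs j)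
  entries j (s , stay) (tape ls x rs) = keep (symbolAt ls j) , keep (symbolAt rs j)
  entries j (s , right) (tape ls x rs) = push (symbolAt (s ∷ ls) j) (symbolAt ls j) , pop (symbolAt rs j) (symbolAt rs (suc j))

  tasksAt : ℕ → Vec (Sign × Move) k → Vec (Tape extras) k → Vec (Task × Task) k
  tasksAt j as ts = Vec.map (on-both task) (Vec.zipWith (entries j) as ts)

  written : Vec (Sign × Move) k → Vec (Tape extras) k → Vec (Tape extras) k
  written = Vec.zipWith write

  map-zip : ∀ {A B C C' D : Set} {n} {f : C → D} {f' : C' → D} {g : A → B → C} {g' : A → B → C'} (as : Vec A n) (bs : Vec B n) →
    (∀ a b → f (g a b) ≡ f' (g' a b)) → Vec.map f (Vec.zipWith g as bs) ≡ Vec.map f' (Vec.zipWith g' as bs)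
  map-zip [] [] e = refl
  map-zip (a ∷ as) (b ∷ bs) e = cong₂ _∷_ (e a b) (map-zip as bs e)

  zip-second : ∀ {A B : Set} {n} (as : Vec A n) (bs : Vec B n) → Vec.zipWith (λ a b → b) as bs ≡ bs
  zip-second [] [] = refl
  zip-second (a ∷ as) (b ∷ bs) = cong (b ∷_) (zip-second as bs)

  zipWith-zipWith : ∀ {A B C D : Set} {n} {f : A → C → D} {g : A → B → C} {h : A → B → D} (as : Vec A n) (bs : Vec B n) →
    (∀ a b → f a (g a b) ≡ h a b) → Vec.zipWith f as (Vec.zipWith g as bs) ≡ Vec.zipWith h as bs
  zipWith-zipWith [] [] e = refl
  zipWith-zipWith (a ∷ as) (b ∷ bs) e = cong₂ _∷_ (e a b) (zipWith-zipWith as bs e)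

  map-zipWith' : ∀ {A B C D : Set} {n} {f : C → D} {g : A → B → C} (as : Vec A n) (bs : Vec B n) →
    Vec.map f (Vec.zipWith g as bs) ≡ Vec.zipWith (λ a b → f (g a b)) as bs
  map-zipWith' [] [] = refl
  map-zipWith' {f = f} {g} (a ∷ as) (b ∷ bs) = cong (f (g a b) ∷_) (map-zipWith' as bs)

  entries-old : ∀ j a t → on-both old (entries j a t) ≡ symbolsAt j t
  entries-old j (s , left) (tape ls x rs) = refl
  entries-old j (s , stay) (tape ls x rs) = refl
  entries-old j (s , right) (tape ls x rs) = refl

  entries-new : ∀ j a t → on-both new (entries j a t) ≡ symbolsAt j (write a t)
  entries-new j (s , left) (tape [] x rs) = refl
  entries-new j (s , left) (tape (l ∷ ls) x rs) = refl
  entries-new j (s , stay) (tape ls x rs) = refl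
  entries-new j (s , right) (tape ls x []) = refl
  entries-new j (s , right) (tape ls x (r ∷ rs)) = refl

  entries-task' : ∀ j a t → on-both task' (entries j a t) ≡ on-both task (entries (suc j) a t)
  entries-task' j (s , left) (tape ls x rs) = refl
  entries-task' j (s , stay) (tape ls x rs) = refl
  entries-task' j (s , right) (tape ls x rs) = refl

  entries-start : ∀ a t → tasks a (head (write a t)) ≡ on-both task (entries 0 a t)
  entries-start (s , left) (tape [] x rs) = refl
  entries-start (s , left) (tape (l ∷ ls) x rs) = refl
  entries-start (s , stay) (tape ls x rs) = refl
  entries-start (s , right) (tape ls x []) = refl
  entries-start (s , right) (tape ls x (r ∷ rs)) = refl

  head-start : ∀ a t → headAfter a (head (write a t)) ≡ head (write a t)
  head-start (s , left) t = refl
  head-start (s , stay) (tape ls x rs) = refl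
  head-start (s , right) t = refl

  started≡ : ∀ q as ts → started q as (Vec.map head (written as ts)) ≡ running q (Vec.map head (written as ts)) (tasksAt 0 as ts)
  started≡ q as ts = cong₂ (running q)
    (cong (Vec.zipWith headAfter as) (map-zipWith' as ts) ∙ zipWith-zipWith as ts head-start ∙ sym (map-zipWith' as ts))
    (cong (Vec.zipWith tasks as) (map-zipWith' as ts) ∙ zipWith-zipWith as ts entries-start ∙ sym (map-zipWith' as ts))

  sweep⁺ : ∀ q hs as ts j n → Sweep rules (running q hs (tasksAt j as ts)) (map cell (cellsOf ts j n)) (map cell (cellsOf (written as ts) j n))
    (running q hs (tasksAt (n + j) as ts))
  sweep⁺ q hs as ts j zero = []
  sweep⁺ q hs as ts j (suc n) =
    subst₂ (λ b r → (running q hs (tasksAt j as ts) , cell (Vec.map (symbolsAt j) ts) , b , r) ∈ rules)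
      (cong cell (map-zip as ts (entries-new j))) (cong (running q hs) (map-zip as ts (entries-task' j)))
      (subst (λ a → (running q hs (tasksAt j as ts) , a , cell (Vec.map (on-both new) es) , running q hs (Vec.map (on-both task') es)) ∈ rules)
        (cong cell (map-zip as ts (entries-old j) ∙ cong (Vec.map (symbolsAt j)) (zip-second as ts)))
        (rules⁺ (sweep q hs es)))
    ∷ subst (λ m → Sweep rules (running q hs (tasksAt (suc j) as ts)) (map cell (cellsOf ts (suc j) n)) (map cell (cellsOf (written as ts) (suc j) n))
        (running q hs (tasksAt m as ts))) (+-suc n j) (sweep⁺ q hs as ts (suc j) n)
    where
    open import Data.List.Membership.Propositional using (_∈_)
    es = Vec.zipWith (entries j) as ts

  Short : ℕ → Tape extras → Set
  Short n t = length (left-of t) ≤ n × length (right-of t) ≤ n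

  short-write : ∀ {n} a t → Short n t → Short (suc n) (write a t)
  short-write (s , left) (tape [] x rs) (p , q) = z≤n , s≤s q
  short-write (s , left) (tape (l ∷ ls) x rs) (p , q) = n≤1+n _ » p » n≤1+n _ , s≤s q
  short-write (s , stay) (tape ls x rs) (p , q) = p » n≤1+n _ , q » n≤1+n _
  short-write (s , right) (tape ls x []) (p , q) = s≤s p , z≤n
  short-write (s , right) (tape ls x (r ∷ rs)) (p , q) = s≤s p , n≤1+n _ » q » n≤1+n _

  short-written : ∀ {n m} (as : Vec (Sign × Move) m) {ts} → VecAll.All (Short n) ts → VecAll.All (Short (suc n)) (Vec.zipWith write as ts)
  short-written [] [] = []
  short-written (a ∷ as) {t ∷ _} (p ∷ ps) = short-write a t p ∷ short-written as ps

  cleanCode : Sign × Move → Fin 3 × Fin 3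
  cleanCode (_ , left) = suc (suc zero) , suc zero
  cleanCode (_ , stay) = zero , zero
  cleanCode (_ , right) = suc zero , suc (suc zero)

  code-task : ∀ {n C} a t → Short n t → suc n ≤ C → on-both task (entries C a t) ≡ on-both cleanTask (cleanCode a)
  code-task (s , left) (tape ls x rs) (p , q) le = cong₂ (λ y z → pop y , push z) (symbolAt-beyond ls (p » n≤1+n _ » le)) (symbolAt-beyond (s ∷ rs) (s≤s q » le))
  code-task (s , stay) (tape ls x rs) (p , q) le = refl
  code-task (s , right) (tape ls x rs) (p , q) le = cong₂ (λ y z → push y , pop z) (symbolAt-beyond (s ∷ ls) (s≤s p » le)) (symbolAt-beyond rs (q » n≤1+n _ » le))

  code-tasks : ∀ {n C m} (as : Vec (Sign × Move) m) {ts} → VecAll.All (Short n) ts → suc n ≤ C →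
    Vec.map (on-both task) (Vec.zipWith (entries C) as ts) ≡ Vec.map (on-both cleanTask) (Vec.map cleanCode as)
  code-tasks [] [] le = refl
  code-tasks (a ∷ as) {t ∷ _} (p ∷ ps) le = cong₂ _∷_ (code-task a t p le) (code-tasks as ps le)

  track : Vec (Tape extras) k → ℕ → List Letter
  track ts C = map cell (cellsOf ts 0 C) ++ marker ∷ []

  erasedLine : ℕ → List Letter
  erasedLine n = replicate n wiped ++ marker ∷ []

  wiping : ∀ cs → Sweep rules done (map cell cs ++ marker ∷ []) (erasedLine (length cs)) done
  wiping [] = rules⁺ rest ∷ []
  wiping (c ∷ cs) = rules⁺ (wipe c) ∷ wiping cs

  idling : ∀ n → Sweep rules done (erasedLine n) (erasedLine n) done
  idling zero = rules⁺ rest ∷ []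
  idling (suc n) = rules⁺ rewipe ∷ idling n

  idlings : ∀ m n → Sweeps rules m done (erasedLine n) (erasedLine n) done
  idlings zero n = []
  idlings (suc m) n = idling n ∷ idlings m n

  length-cellsOf : ∀ ts j n → length (cellsOf ts j n) ≡ n
  length-cellsOf ts j zero = refl
  length-cellsOf ts j (suc n) = cong suc (length-cellsOf ts (suc j) n)

  finish : ∀ m ts C → Sweeps rules (suc m) done (track ts C) (erasedLine C) done
  finish m ts C = subst (λ n → Sweep rules done (track ts C) (erasedLine n) done)
    (length-cellsOf ts 0 C) (wiping (cellsOf ts 0 C)) ∷ idlings m C

  halts⁻ : ∀ {q} ts → stepM M (config q ts) ≡ nothing → δ q (Vec.map head ts) ≡ nothing
  halts⁻ {q} ts e with δ q (Vec.map head ts)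
  ... | nothing = refl

  goes⁻ : ∀ {q c} ts → stepM M (config q ts) ≡ just c → ∃[ q' ] ∃[ as ] (δ q (Vec.map head ts) ≡ just (q' , as) × c ≡ config q' (written as ts))
  goes⁻ {q} ts e with δ q (Vec.map head ts)
  goes⁻ ts refl | just (q' , as) = q' , as , refl , refl

  cellsOf-cong : ∀ {ts us} → (∀ j → Vec.map (symbolsAt j) ts ≡ Vec.map (symbolsAt j) us) → ∀ j n → cellsOf ts j n ≡ cellsOf us j n
  cellsOf-cong e j zero = refl
  cellsOf-cong e j (suc n) = cong₂ _∷_ (e j) (cellsOf-cong e (suc j) n)

  -- `us` are the tapes after the action `as`, as far as cells and heads show, since loading yields
  -- the initial tapes only up to a blank. A run of t steps takes t + 1 sweeps, the last of which
  -- finds it halted, and at least one more is needed to wipe the cells.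
  run-complete : ∀ t m {q as ts us n C d} → Vec.map head (written as ts) ≡ Vec.map head us →
    (∀ j → Vec.map (symbolsAt j) (written as ts) ≡ Vec.map (symbolsAt j) us) →
    VecAll.All (Short n) ts → VecAll.All (Short (suc n)) us → n + t < C → HaltsAfter M t (config q us) d → accept (Config.state d) ≡ true → 2 + t ≤ m →
    Sweeps rules m (started q as (Vec.map head (written as ts))) (track ts C) (erasedLine C) done
  run-complete t (suc zero) eh ec short short' room H acc (s≤s ())
  run-complete t (suc (suc m)) {q} {as} {ts} {us} {n} {C} {d} eh ec short short' room H acc le =
    subst (λ r → Sweeps rules (2 + m) r (track ts C) (erasedLine C) done)
      (sym (started≡ q as ts ∙ cong (λ hs → running q hs (tasksAt 0 as ts)) eh))
      (go t H room le)
    where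
    hs = Vec.map head us
    cleaned : tasksAt (C + 0) as ts ≡ cleanTasks (Vec.map cleanCode as)
    cleaned = cong (λ c → tasksAt c as ts) (+-identityʳ C) ∙ code-tasks as short (s≤s (m≤m+n n t) » room)
    swept : Sweep rules (running q hs (tasksAt 0 as ts)) (map cell (cellsOf ts 0 C)) (map cell (cellsOf us 0 C)) (running q hs (cleanTasks (Vec.map cleanCode as)))
    swept = subst₂ (λ cs u → Sweep rules (running q hs (tasksAt 0 as ts)) (map cell (cellsOf ts 0 C)) (map cell cs) (running q hs u))
      (cellsOf-cong {written as ts} {us} ec 0 C) cleaned (sweep⁺ q hs as ts 0 C)
    go : ∀ t → HaltsAfter M t (config q us) d → n + t < C → 2 + t ≤ 2 + m →
      Sweeps rules (2 + m) (running q hs (tasksAt 0 as ts)) (track ts C) (erasedLine C) done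
    go zero (halted e) room le = sweep-++⁺ swept (rules⁺ (accepted q hs (Vec.map cleanCode as) (halts⁻ us e) acc) ∷ []) ∷ finish m us C
    go (suc t) (next e H) room (s≤s (s≤s le)) with q' , as' , e' , refl ← goes⁻ us e =
      sweep-++⁺ swept (rules⁺ (next q hs (Vec.map cleanCode as) (Vec.map head (written as' us)) e') ∷ []) ∷
      run-complete t (suc m) {as = as'} refl (λ j → refl) short' (short-written as' short') (subst (λ x → suc x ≤ C) (+-suc n t) room) H acc (s≤s le)

  nths : List Sign → ℕ → ℕ → List Sign
  nths xs j zero = []
  nths xs j (suc n) = symbolAt xs j ∷ nths xs (suc j) n

  nths-suc : ∀ x xs j n → nths (x ∷ xs) (suc j) n ≡ nths xs j n
  nths-suc x xs j zero = refl
  nths-suc x xs j (suc n) = cong (symbolAt xs j ∷_) (nths-suc x xs (suc j) n)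

  nths-[] : ∀ i j n → nths [] i n ≡ nths [] j n
  nths-[] i j zero = refl
  nths-[] i j (suc n) = cong (blank ∷_) (nths-[] (suc i) (suc j) n)

  peel : ∀ {r s as} x xs n → Sweep rules r as (letters (nths xs 0 n)) s → Sweep rules r as (letters (nths (x ∷ xs) 1 n)) s
  peel {r} {s} {as} x xs n = subst (λ ss → Sweep rules r as (letters ss) s) (sym (nths-suc x xs 0 n))

  unused⁺ : ∀ n e → ∃[ e' ] Sweep rules (guess e) (replicate n unused) (letters (nths [] 0 n)) (guess e')
  unused⁺ zero e = e , []
  unused⁺ (suc n) e = let e' , w = unused⁺ n true in e' , rules⁺ (vacate e) ∷
    subst (λ ss → Sweep rules (guess true) (replicate n unused) (letters ss) (guess e')) (nths-[] 0 1 n) w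

  ended⁺ : ∀ m n e → ∃[ e' ] Sweep rules (guess e) (vacant m n) (letters (nths [] 0 (m + n))) (guess e')
  ended⁺ zero n e = unused⁺ n e
  ended⁺ (suc m) n e = let e' , w = ended⁺ m n true in e' , rules⁺ (end e) ∷
    subst (λ ss → Sweep rules (guess true) (vacant m n) (letters ss) (guess e')) (nths-[] 0 1 (m + n)) w

  certificate⁺ : ∀ y m n → length y ≤ m →
    ∃[ e ] Sweep rules (guess false) (vacant m n) (letters (nths (map bit y) 0 (m + n))) (guess e)
  certificate⁺ [] m n le = ended⁺ m n false
  certificate⁺ (b ∷ y) (suc m) n (s≤s le) = let e , w = certificate⁺ y m n le in e , rules⁺ (guessBit b) ∷ peel (bit b) (map bit y) (m + n) w

  known⁺ : ∀ kb y m n → length y ≤ m → ∃[ e ] Sweep rules (guess false) (map known kb ++ vacant m n)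
    (letters (nths (map bit (kb ++ y)) 0 (length kb + (m + n)))) (guess e)
  known⁺ [] y m n le = certificate⁺ y m n le
  known⁺ (b ∷ kb) y m n le = let e , w = known⁺ kb y m n le in e , rules⁺ (enter b) ∷ peel (bit b) (map bit (kb ++ y)) (length kb + (m + n)) w

  loaded-cells : ∀ w j n → map inputCell (nths (map bit w) j n) ≡ cellsOf (preTapes w) j n
  loaded-cells w j zero = refl
  loaded-cells w j (suc n) = cong₂ _∷_ (cong ((blank , symbolAt (map bit w) j) ∷_) (sym (Vecₚ.map-replicate (symbolsAt j) (tape [] blank []) workTapes)))
    (loaded-cells w (suc j) n)

  short-replicate : ∀ n {P : Tape extras → Set} {t} → P t → VecAll.All P (Vec.replicate n t)
  short-replicate zero p = []
  short-replicate (suc n) p = p ∷ short-replicate n p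

  same-head : ∀ w → Vec.map head (written loading (preTapes w)) ≡ Vec.map head (initialTapes w)
  same-head [] = cong (λ ts → blank ∷ Vec.map head ts) (Vecₚ.zipWith-replicate write _ _)
  same-head (b ∷ w) = cong (λ ts → bit b ∷ Vec.map head ts) (Vecₚ.zipWith-replicate write _ _)

  same-cells : ∀ w j → Vec.map (symbolsAt j) (written loading (preTapes w)) ≡ Vec.map (symbolsAt j) (initialTapes w)
  same-cells [] j = cong₂ _∷_ (cong (_, blank) (~-blank j)) (cong (Vec.map (symbolsAt j)) (Vecₚ.zipWith-replicate write _ _))
  same-cells (b ∷ w) j = cong₂ _∷_ (cong (_, symbolAt (map bit w) j) (~-blank j)) (cong (Vec.map (symbolsAt j)) (Vecₚ.zipWith-replicate write _ _))

  guess-complete : ∀ l kb y m n {t d} → length y ≤ m → HaltsAfter M t (initial M (kb ++ y)) d → accept (Config.state d) ≡ true →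
    t < n → 2 + t ≤ l →
    Sweeps rules (suc l) (guess false) ((map known kb ++ vacant m n) ++ marker ∷ [])
      (erasedLine (length kb + (m + n))) done
  guess-complete l kb y m n {t} {d} ley H acc room le =
    let e , w = known⁺ kb y m n ley
        gs = Vec.map head (written loading (preTapes (kb ++ y)))
        C = length kb + (m + n)
    in subst (λ cs → Sweep rules (guess false) ((map known kb ++ vacant m n) ++ marker ∷ []) (map cell cs ++ marker ∷ []) (started start loading gs))
        (loaded-cells (kb ++ y) 0 C) (sweep-++⁺ w (rules⁺ (toStart e gs) ∷ [])) ∷
       run-complete t l {as = loading} {ts = preTapes (kb ++ y)} (same-head (kb ++ y)) (same-cells (kb ++ y)) short short' fits H acc le
    where
    w = kb ++ y
    short : VecAll.All (Short (length w)) (preTapes w)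
    short = (z≤n , ≤-reflexive (length-map bit w)) ∷ short-replicate workTapes (z≤n , z≤n)
    short' : VecAll.All (Short (suc (length w))) (initialTapes w)
    short' = from w ∷ short-replicate workTapes (z≤n , z≤n)
      where
      from : ∀ w → Short (suc (length w)) (fromSymbols (map bit w))
      from [] = z≤n , z≤n
      from (b ∷ w) = z≤n , ≤-reflexive (length-map bit w) » n≤1+n _ » n≤1+n _
    fits : length w + t < length kb + (m + n)
    fits = ≤-reflexive (sym (+-suc (length w) t)) » +-mono-≤ (≤-reflexive (length-++ kb) » +-monoʳ-≤ (length kb) ley) room »
      ≤-reflexive (+-assoc (length kb) m n)

-- Computing the region in polynomial time

opOf : Fin 3 → Op
opOf zero = pass
opOf (suc zero) = swap
opOf (suc (suc zero)) = gate

opCode : Op → Fin 3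
opCode pass = zero
opCode swap = suc zero
opCode gate = suc (suc zero)

opOf-opCode : ∀ op → opOf (opCode op) ≡ op
opOf-opCode pass = refl
opOf-opCode swap = refl
opOf-opCode gate = refl

-- The rows of the region: each operation is at its first row, and zero stands for the other rows.
rowMarks : Fin 3 → List (Fin 4)
rowMarks zero = suc zero ∷ []
rowMarks (suc zero) = suc (suc zero) ∷ zero ∷ []
rowMarks (suc (suc zero)) = suc (suc (suc zero)) ∷ zero ∷ zero ∷ []

marks : List (Fin 3) → List (Fin 4)
marks = concatMap rowMarks

length-marks : ∀ os → length (marks os) ≡ height (map opOf os)
length-marks [] = refl
length-marks (zero ∷ os) = cong suc (length-marks os)
length-marks (suc zero ∷ os) = cong (λ n → 2 + n) (length-marks os)
length-marks (suc (suc zero) ∷ os) = cong (λ n → 3 + n) (length-marks os)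

Mark : Set
Mark = ℤ × ℤ × Fin 4

-- Coordinates are produced by counting along lists. Numbering the marks a second time, from the
-- number of wires, gives the columns of the devices without adding two variable numbers.
numbered : ℕ → ℕ → List (Fin 3) → List Mark
numbered r n os = number (+ r) (number (+ (r + n)) (marks os))

byMark : {A : Set} → (Op → ℤ → ℤ → List A) → Mark → List A
byMark f (r , c , zero) = []
byMark f (r , c , suc o) = f (opOf o) r c

perOp : {A : Set} → (Op → ℤ → ℤ → List A) → ℕ → ℕ → List Op → List A
perOp f r n [] = []
perOp f r n (op ∷ ops) = f op (+ r) (+ (r + n)) ++ perOp f (width op + r) n ops

numbered-perOp : ∀ {A : Set} (f : Op → ℤ → ℤ → List A) r n os → concatMap (byMark f) (numbered r n os) ≡ perOp f r n (map opOf os)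
numbered-perOp f r n [] = refl
numbered-perOp f r n (zero ∷ os) = cong (f pass (+ r) (+ (r + n)) ++_) (numbered-perOp f (1 + r) n os)
numbered-perOp f r n (suc zero ∷ os) = cong (f swap (+ r) (+ (r + n)) ++_) (numbered-perOp f (2 + r) n os)
numbered-perOp f r n (suc (suc zero) ∷ os) = cong (f gate (+ r) (+ (r + n)) ++_) (numbered-perOp f (3 + r) n os)

byMarkF : ∀ {Γ A} {f : El Γ → Op → ℤ → ℤ → List (El A)} →
  (∀ op → PF {Γ ⊗ int ⊗ int} {list A} (λ y → f (fst y) op (fst (snd y)) (snd (snd y)))) →
  PF {Γ ⊗ int ⊗ int ⊗ fin 3} {list A} (λ y → byMark (f (fst y)) (snd y))
byMarkF {Γ} {A} {f} p = extF lemma (caseFinF {Γ ⊗ int ⊗ int} {list A} 3 {h} cases ∘F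
  (sndF {int} {fin 3} ∘F sndF {int} {int ⊗ fin 3} ∘F sndF {Γ} {int ⊗ int ⊗ fin 3} ,F
   fstF {Γ} {int ⊗ int ⊗ fin 3} ,F
   fstF {int} {int ⊗ fin 3} ∘F sndF {Γ} {int ⊗ int ⊗ fin 3} ,F
   fstF {int} {fin 3} ∘F sndF {int} {int ⊗ fin 3} ∘F sndF {Γ} {int ⊗ int ⊗ fin 3}))
  where
  h : Fin 4 → El Γ × ℤ × ℤ → List (El A)
  h i (γ , r , c) = byMark (f γ) (r , c , i)
  cases : ∀ i → PF {Γ ⊗ int ⊗ int} {list A} (h i)
  cases zero = nilF
  cases (suc o) = p (opOf o)
  lemma : ∀ y → h (snd (snd (snd y))) (fst y , fst (snd y) , fst (snd (snd y))) ≡ byMark (f (fst y)) (snd y)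
  lemma y = refl

-- The queue itself serves as the number of its wires, in unary.
rowsOf : ℕ → List Bool × ℤ → List Cell
rowsOf zero _ = []
rowsOf (suc k) (us , z) = map (λ (p : ℤ × Bool) → fst p , z) (number z us) ++ rowsOf k (drop1 us , ℤ.suc z)

rowsOfF : ∀ k → PF {list bool ⊗ int} {list point} (rowsOf k)
rowsOfF zero = nilF
rowsOfF (suc k) = appendF {A = point}
  (mapF {A = int ⊗ bool} {B = point} (numberF {bool} ∘F (sndF {list bool} {int} ,F fstF {list bool} {int}))
    (fstF {int} {bool} ∘F sndF {list bool ⊗ int} {int ⊗ bool} ,F sndF {list bool} {int} ∘F fstF {list bool ⊗ int} {int ⊗ bool}))
  (rowsOfF k ∘F (tailF ∘F fstF {list bool} {int} ,F sucF ∘F sndF {list bool} {int}))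

row≡ : ∀ us x y → map (λ (p : ℤ × Bool) → fst p , + y) (number (+ x) us) ≡ row (length us) x y
row≡ [] x y = refl
row≡ (u ∷ us) x y = cong ((+ x , + y) ∷_) (row≡ us (suc x) y)

length-drop1 : ∀ us → length (drop1 us) ≡ pred (length us)
length-drop1 [] = refl
length-drop1 (_ ∷ us) = refl

rows≡ : ∀ k us r → rowsOf k (us , + r) ≡ rows k (length us) r
rows≡ zero us r = refl
rows≡ (suc k) us r = cong₂ _++_ (row≡ us r r) (rows≡ k (drop1 us) (suc r) ∙ cong (λ n → rows k n (suc r)) (length-drop1 us))

deviceCells : Op → List Cell
deviceCells op = map (λ d → + fst d , + snd d) (device op)

blockCells : List Bool → Op → ℤ → ℤ → List Cell
blockCells us op r c = rowsOf (width op) (us , r) ++ translateCells (c , r) (deviceCells op)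

module _ (us : List Bool) where
  private n = length us
  open Block n

  cells≡ : ∀ r ops → perOp (blockCells us) r n ops ≡ cellsFrom r ops
  cells≡ r [] = refl
  cells≡ r (op ∷ ops) = cong₂ _++_ (cong₂ _++_ (rows≡ (width op) us r) (device≡ op)) (cells≡ (width op + r) ops)
    where
    device≡ : ∀ op → translateCells (+ (r + n) , + r) (deviceCells op) ≡ translateℕ (r + n) r (device op)
    device≡ pass = refl
    device≡ swap = refl
    device≡ gate = refl

lineAt : (ℤ → Segment) → Colour → ∀ {A : Set} → ℤ × A → Segment × Colour
lineAt f k p = f (fst p) , k

line≡ : ∀ f k {A : Set} (xs : List A) r → map (lineAt f k) (number (+ r) xs) ≡ line (λ y → f (+ y)) k (length xs) r
line≡ f k [] r = refl
line≡ f k (x ∷ xs) r = cong (_ ∷_) (line≡ f k xs (suc r))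

sucs : ℕ → ℤ → ℤ
sucs zero z = z
sucs (suc k) z = ℤ.suc (sucs k z)

sucs≡ : ∀ k m → sucs k (+ m) ≡ + (k + m)
sucs≡ zero m = refl
sucs≡ (suc k) m = cong ℤ.suc (sucs≡ k m)

sucsF : ∀ k → PF {int} {int} (sucs k)
sucsF zero = idF
sucsF (suc k) = sucF ∘F sucsF k

bottomAt rightAt : Op → ℤ → ℤ → List (Segment × Colour)
bottomAt op r c = map (lineAt (λ z → horizontal , z , r) (ink op)) (number c (replicate (width op) true))
rightAt op r c = map (lineAt (λ z → vertical , sucs (width op) c , z) (ink op)) (number r (replicate (width op) true))

rightH≡ : ∀ n r ops → perOp bottomAt r n ops ≡ Block.rightH n r ops
rightH≡ n r [] = refl
rightH≡ n r (op ∷ ops) = cong₂ _++_ (line≡ _ _ (replicate (width op) true) (r + n) ∙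
  cong (λ w → line (λ z → hseg z r) (ink op) w (r + n)) (length-replicate (width op))) (rightH≡ n (width op + r) ops)

rightV≡ : ∀ n r ops → perOp rightAt r n ops ≡ Block.rightV n r ops
rightV≡ n r [] = refl
rightV≡ n r (op ∷ ops) = cong₂ _++_ (line≡ _ _ (replicate (width op) true) r ∙
  cong₂ (λ x w → line (λ y → vertical , x , + y) (ink op) w r) (sucs≡ (width op) (r + n)) (length-replicate (width op))) (rightV≡ n (width op + r) ops)

wireAt : ℤ → ℤ × Bool → Segment × Colour
wireAt y (z , b) = (horizontal , z , y) , bit# b

wires≡ : ∀ q x y → map (wireAt (+ y)) (number (+ x) q) ≡ wires x y q
wires≡ [] x y = refl
wires≡ (b ∷ q) x y = cong (at horizontal x y (bit# b) ∷_) (wires≡ q (suc x) y)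

length-number : ∀ {A : Set} z (xs : List A) → length (number z xs) ≡ length xs
length-number z [] = refl
length-number z (x ∷ xs) = cong suc (length-number (ℤ.suc z) xs)

module _ {Γ : U} {os : El Γ → List (Fin 3)} {u v : El Γ → Word}
  (osF : PF {Γ} {list (fin 2)} os) (uF : PF {Γ} {list bool} u) (vF : PF {Γ} {list bool} v) where

  marksF : PF {Γ} {list (fin 3)} (λ γ → marks (os γ))
  marksF = concatMapF {A = fin 2} {B = fin 3} {f = λ y → rowMarks (snd y)} osF
    (caseFinF {Γ} {list (fin 3)} 2 {h = λ i _ → rowMarks i} (λ i → constF (rowMarks i)) ∘F (sndF {Γ} {fin 2} ,F fstF {Γ} {fin 2}))

  numberedF : PF {Γ} {list (int ⊗ int ⊗ fin 3)} (λ γ → numbered 0 (length (u γ)) (os γ))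
  numberedF = numberF {int ⊗ fin 3} ∘F (constF {A = int} (+ 0) ,F numberF {fin 3} ∘F (lengthF {bool} ∘F uF ,F marksF))

  perOpF : ∀ {A} {f : El Γ → Op → ℤ → ℤ → List (El A)} →
    (∀ op → PF {Γ ⊗ int ⊗ int} {list A} (λ y → f (fst y) op (fst (snd y)) (snd (snd y)))) →
    PF {Γ} {list A} (λ γ → perOp (f γ) 0 (length (u γ)) (map opOf (os γ)))
  perOpF {A} {f} p = extF (λ γ → numbered-perOp (f γ) 0 (length (u γ)) (os γ))
    (concatMapF {A = int ⊗ int ⊗ fin 3} {B = A} {f = λ y → byMark (f (fst y)) (snd y)} numberedF (byMarkF {A = A} {f = f} p))

  rowF : PF {Γ ⊗ int ⊗ int} {int} (λ y → fst (snd y))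
  rowF = fstF {int} {int} ∘F sndF {Γ} {int ⊗ int}

  colF : PF {Γ ⊗ int ⊗ int} {int} (λ y → snd (snd y))
  colF = sndF {int} {int} ∘F sndF {Γ} {int ⊗ int}

  at-number : PF {(Γ ⊗ int ⊗ int) ⊗ int ⊗ bool} {int} (λ y → fst (snd y))
  at-number = fstF {int} {bool} ∘F sndF {Γ ⊗ int ⊗ int} {int ⊗ bool}

  cellsF : PF {Γ} {list point} (λ γ → Block.cellsFrom (length (u γ)) 0 (map opOf (os γ)))
  cellsF = extF (λ γ → cells≡ (u γ) 0 (map opOf (os γ))) (perOpF {A = point} {f = λ γ → blockCells (u γ)} (λ op →
    appendF {A = point} (rowsOfF (width op) ∘F (uF ∘F fstF {Γ} {int ⊗ int} ,F rowF))
      (translateCellsF (deviceCells op) ∘F (colF ,F rowF))))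

  boundaryF : PF {Γ} {list (seg ⊗ nat)} (λ γ → Block.boundaryOf (length (u γ)) (map opOf (os γ)) (u γ) (v γ))
  boundaryF =
    appendF {A = seg ⊗ nat} (extF (λ γ → line≡ (λ z → vertical , z , z) 2 (number (+ (length (u γ))) (marks (os γ))) 0 ∙ cong (λ h → leftV h 0) (high γ))
      (mapF {A = int ⊗ int ⊗ fin 3} {B = seg ⊗ nat} numberedF ((constF {A = axis} vertical ,F z ,F z) ,F constF {A = nat} 2)))
    (appendF {A = seg ⊗ nat} (extF (λ γ → line≡ (λ z → horizontal , z , ℤ.suc z) 2 (number (+ (length (u γ))) (marks (os γ))) 0 ∙ cong (λ h → leftH h 0) (high γ))
      (mapF {A = int ⊗ int ⊗ fin 3} {B = seg ⊗ nat} numberedF ((constF {A = axis} horizontal ,F z ,F sucF ∘F z) ,F constF {A = nat} 2)))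
    (appendF {A = seg ⊗ nat} (extF (λ γ → rightH≡ (length (u γ)) 0 (map opOf (os γ))) (perOpF {A = seg ⊗ nat} (λ op →
      mapF {A = int ⊗ bool} {B = seg ⊗ nat} (numberF {bool} ∘F (colF ,F constF {A = list bool} (replicate (width op) true)))
        ((constF {A = axis} horizontal ,F at-number ,F rowF ∘F fstF {Γ ⊗ int ⊗ int} {int ⊗ bool}) ,F constF {A = nat} (ink op)))))
    (appendF {A = seg ⊗ nat} (extF (λ γ → rightV≡ (length (u γ)) 0 (map opOf (os γ))) (perOpF {A = seg ⊗ nat} (λ op →
      mapF {A = int ⊗ bool} {B = seg ⊗ nat} (numberF {bool} ∘F (rowF ,F constF {A = list bool} (replicate (width op) true)))
        ((constF {A = axis} vertical ,F sucsF (width op) ∘F colF ∘F fstF {Γ ⊗ int ⊗ int} {int ⊗ bool} ,F at-number) ,F constF {A = nat} (ink op)))))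
    (appendF {A = seg ⊗ nat} (extF (λ γ → wires≡ (u γ) 0 0) (wiresF (constF {A = int} (+ 0)) uF))
      (extF (λ γ → wires≡ (v γ) (length (marks (os γ))) (length (marks (os γ))) ∙ cong (λ h → wires h h (v γ)) (length-marks (os γ)))
        (wiresF (lengthF {fin 3} ∘F marksF) vF))))))
    where
    high : ∀ γ → length (number (+ (length (u γ))) (marks (os γ))) ≡ height (map opOf (os γ))
    high γ = length-number _ (marks (os γ)) ∙ length-marks (os γ)
    z : PF {Γ ⊗ int ⊗ int ⊗ fin 3} {int} (λ y → fst (snd y))
    z = fstF {int} {int ⊗ fin 3} ∘F sndF {Γ} {int ⊗ int ⊗ fin 3}
    wiresF : ∀ {y : El Γ → ℤ} {q : El Γ → Word} → PF {Γ} {int} y → PF {Γ} {list bool} q →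
      PF {Γ} {list (seg ⊗ nat)} (λ γ → map (wireAt (y γ)) (number (y γ) (q γ)))
    wiresF {y} yF qF = mapF {A = int ⊗ bool} {B = seg ⊗ nat} {f = λ e → wireAt (y (fst e)) (snd e)} (numberF {bool} ∘F (yF ,F qF))
      ((constF {A = axis} horizontal ,F fstF {int} {bool} ∘F sndF {Γ} {int ⊗ bool} ,F yF ∘F fstF {Γ} {int ⊗ bool}) ,F
       extF (λ e → colour (snd (snd e))) (ifF (sndF {int} {bool} ∘F sndF {Γ} {int ⊗ bool}) (constF {A = nat} 1) (constF {A = nat} 0)))
      where
      colour : ∀ b → (if b then 1 else 0) ≡ bit# b
      colour false = refl
      colour true = refl

dropBits : ℕ → List Bool → List Bool
dropBits zero us = us
dropBits (suc k) us = dropBits k (drop1 us)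

length-dropBits : ∀ k us → length (dropBits k us) ≡ length us ∸ k
length-dropBits zero us = refl
length-dropBits (suc k) [] = (length-dropBits k []) ∙ 0∸n≡0 k
length-dropBits (suc k) (_ ∷ us) = length-dropBits k us

dropBitsF : ∀ k → WordF (dropBits k)
dropBitsF zero = idF
dropBitsF (suc k) = dropBitsF k ∘F tailF

-- With the number of wires in unary, the truncated subtraction in `local` amounts to dropping bits.
localCode : Instr → List Bool → List (Fin 3)
localCode (op , o) us = replicate o zero ++ opCode op ∷ map (λ _ → zero) (dropBits (o + width op) us)

localCodeF : ∀ i → PF {list bool} {list (fin 2)} (localCode i)
localCodeF (op , o) = appendF {A = fin 2} (constF {A = list (fin 2)} (replicate o zero))
  (constF {A = fin 2} (opCode op) ∷F mapF {A = bool} {B = fin 2} {f = λ _ → zero} (dropBitsF (o + width op)) (constF {A = fin 2} zero))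

passes : ∀ n → map opOf (replicate n zero) ≡ replicate n pass
passes n = Data.List.Properties.map-replicate opOf n zero

map-const-zero : ∀ (us : List Bool) → map {B = Fin 3} (λ _ → zero) us ≡ replicate (length us) zero
map-const-zero [] = refl
map-const-zero (_ ∷ us) = cong (zero ∷_) (map-const-zero us)

localCode≡ : ∀ i us → map opOf (localCode i us) ≡ local (length us) i
localCode≡ (op , o) us = map-++ opOf (replicate o zero) _ ∙ (cong₂ _++_ (passes o) (cong₂ _∷_ (opOf-opCode op)
  (cong (map opOf) (map-const-zero (dropBits (o + width op) us)) ∙ passes (length (dropBits (o + width op) us)) ∙
    cong (λ n → replicate n pass) (length-dropBits (o + width op) us))))

cellCode : List Instr → ℕ → List Bool → List (Fin 3)
cellCode [] b us = replicate b zero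
cellCode (i ∷ is) b us = localCode i us ++ cellCode is b us

cellCodeF : ∀ is b → PF {list bool} {list (fin 2)} (cellCode is b)
cellCodeF [] b = constF {A = list (fin 2)} (replicate b zero)
cellCodeF (i ∷ is) b = appendF {A = fin 2} (localCodeF i) (cellCodeF is b)

cellCode≡ : ∀ is b us → map opOf (cellCode is b us) ≡ concatMap (local (length us)) is ++ replicate b pass
cellCode≡ [] b us = passes b
cellCode≡ (i ∷ is) b us = map-++ opOf (localCode i us) (cellCode is b us) ∙ cong₂ _++_ (localCode≡ i us) (cellCode≡ is b us) ∙
  sym (++-assoc (local (length us) i) (concatMap (local (length us)) is) (replicate b pass))

-- A loop whose counter `ms` matters by its length only; on unary numbers it is multiplication.
repeat : {A : Set} → List Bool → List A → List A
repeat ms xs = concatMap (λ _ → xs) ms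

repeatF : ∀ {Γ A} {ms : El Γ → List Bool} {xs : El Γ → List (El A)} → PF {Γ} {list bool} ms → PF {Γ} {list A} xs →
  PF {Γ} {list A} (λ γ → repeat (ms γ) (xs γ))
repeatF {Γ} {A} {xs = xs} p q = concatMapF {A = bool} {B = A} {f = λ y → xs (fst y)} p (q ∘F fstF {Γ} {bool})

map-repeat : ∀ {A B : Set} (f : A → B) ms xs → map f (repeat ms xs) ≡ concat (replicate (length ms) (map f xs))
map-repeat f [] xs = refl
map-repeat f (_ ∷ ms) xs = map-++ f xs (repeat ms xs) ∙ cong (map f xs ++_) (map-repeat f ms xs)

programCode : List Instr → ℕ → (us cs ms : List Bool) → List (Fin 3)
programCode is b us cs ms = repeat ms (repeat cs (cellCode is b us))

programCode≡ : ∀ is b us cs ms → map opOf (programCode is b us cs ms) ≡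
  concat (replicate (length ms) (concat (replicate (length cs) (concatMap (local (length us)) is ++ replicate b pass))))
programCode≡ is b us cs ms = map-repeat opOf ms _ ∙ (cong (λ p → concat (replicate (length ms) p))
  (map-repeat opOf cs _ ∙ cong (λ p → concat (replicate (length cs) p)) (cellCode≡ is b us)))

programCodeF : ∀ {Γ us cs ms} is b → PF {Γ} {list bool} us → PF {Γ} {list bool} cs → PF {Γ} {list bool} ms →
  PF {Γ} {list (fin 2)} (λ γ → programCode is b (us γ) (cs γ) (ms γ))
programCodeF is b p q r = repeatF {A = fin 2} r (repeatF {A = fin 2} q (cellCodeF is b ∘F p))

-- Horner's rule in unary, so that its value can serve as a loop counter.
evalUnary : Polynomial → List Bool → List Bool
evalUnary [] xs = []
evalUnary (a ∷ p) xs = replicate a true ++ repeat xs (evalUnary p xs)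

evalUnaryF : ∀ p → WordF (evalUnary p)
evalUnaryF [] = nilF
evalUnaryF (a ∷ p) = (constF {A = list bool} (replicate a true)) ++ʷ (repeatF {A = bool} idF (evalUnaryF p))

length-repeat : ∀ {A : Set} ms (xs : List A) → length (repeat ms xs) ≡ length ms * length xs
length-repeat [] xs = refl
length-repeat (_ ∷ ms) xs = length-++ xs ∙ cong (λ n → length xs + n) (length-repeat ms xs)

length-evalUnary : ∀ p xs → length (evalUnary p xs) ≡ eval p (length xs)
length-evalUnary [] xs = refl
length-evalUnary (a ∷ p) xs = length-++ (replicate a true) ∙ (cong₂ _+_ (length-replicate a)
  (length-repeat xs (evalUnary p xs) ∙ cong (length xs *_) (length-evalUnary p xs)))

eval-mono : ∀ p {m n} → m ≤ n → eval p m ≤ eval p n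
eval-mono [] le = z≤n
eval-mono (a ∷ p) le = +-monoʳ-≤ a (*-mono-≤ le (eval-mono p le))

height-++ : ∀ ops ops' → height (ops ++ ops') ≡ height ops + height ops'
height-++ [] ops' = refl
height-++ (op ∷ ops) ops' = cong (λ n → width op + n) (height-++ ops ops') ∙ sym (+-assoc (width op) (height ops) (height ops'))

height-replicate : ∀ k ops → 1 ≤ k → 1 ≤ height ops → 1 ≤ height (concat (replicate k ops))
height-replicate (suc k) ops _ h = subst (1 ≤_) (sym (height-++ ops (concat (replicate k ops)))) (h » m≤m+n (height ops) _)

height-passes : ∀ k → height (replicate k pass) ≡ k
height-passes zero = refl
height-passes (suc k) = cong suc (height-passes k)

-- The reduction

module FromPF {f : Word → Word} (F : WordF f) where
  abstract
    function : Word → Word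
    function = wordFun (pt F)

    function-computable : PolynomialTimeComputable function
    function-computable = wordFun-computable (pt F)

    function≡ : ∀ x → function x ≡ f x
    function≡ x = sym (dec-bits (raw F (wordTree x))) ∙ sound F (wordTree x) ∙
      cong f (dec-bits (wordTree x) ∙ dec-wordTree x)

module _ (n : ℕ) (ops : List Op) (u v : Word) (3≤n : 3 ≤ n) (lu : length u ≡ n) (lv : length v ≡ n) where
  open Block n

  run⇒tilingProblem : 1 ≤ height ops → Run ops u v → TilingProblem tileset (encodeCellsBoundary (cellsFrom 0 ops) (boundaryOf ops u v))
  run⇒tilingProblem ne r = Boundary.region n 3≤n ops u v lu lv ne , refl , run⇒tiles 3≤n lu lv ne r

  tilingProblem⇒run : TilingProblem tileset (encodeCellsBoundary (cellsFrom 0 ops) (boundaryOf ops u v)) → Run ops u v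
  tilingProblem⇒run (D , e , ps , t) = let ec , eb = encodeCellsBoundary-injective e in
    Tiled.tiles⇒run t n 3≤n {ops} {u} {v} ec eb lu lv

module Reduction (V : Machine) (p q : Polynomial) where
  open Automaton V
  open Sound V using (guess-sound)
  open Complete V using (guess-complete)
  open Finite finite-Letter using () renaming (rank to place; card to places)
  open Renamed finite-Letter rules using () renaming (rules to rulesᶠ; sweeps⁺ to renamed⁺; sweeps⁻ to renamed⁻)
  open Queue places using (block; empty; block-length; length-cellBits; 5≤block; 1≤pair; sweepProgram; cellBits; instructions; sweepsProgram; cellProgram; sweeps⁺; sweeps-exact⁻)

  module _ (x : Word) where

    -- `prefix` is the part of `pair x y` that does not depend on y. The other two words only count:
    -- `certificates` the bits allowed for y, `steps` the time allowed for the verifier on such a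
    -- pair.
    prefix certificates steps : Word
    prefix = concatMap (λ b → true ∷ b ∷ []) x ++ false ∷ []
    certificates = evalUnary q x
    steps = evalUnary p (prefix ++ certificates)

    given wipedOut : List Letter
    given = (map known prefix ++ replicate (length certificates) unknown ++ replicate (suc (length steps)) unused) ++ marker ∷ []
    wipedOut = replicate (length prefix + (length certificates + suc (length steps))) wiped ++ marker ∷ []

    cellCount sweepCount : List Bool
    cellCount = (prefix ++ certificates ++ true ∷ steps) ++ true ∷ []
    -- Besides one sweep per step there is one to guess, one to load the input, and one to wipe.
    sweepCount = true ∷ true ∷ true ∷ steps

    bottom top : Word
    bottom = block (place (guess false)) ++ cellBits (map place given)
    top = block (place done) ++ cellBits (map place wipedOut)

    opCodes : List _
    opCodes = programCode (instructions rulesᶠ) (length (empty ++ empty)) bottom cellCount sweepCount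

    operations : List Op
    operations = sweepsProgram rulesᶠ (length bottom) (length (map place given)) (suc (2 + length steps))

    n = length bottom
    open Block n

    abstract
     word : Word
     word = encodeCellsBoundary (cellsFrom 0 (map opOf opCodes)) (boundaryOf (map opOf opCodes) bottom top)

    length-given : length (map place given) ≡ length prefix + (length certificates + suc (length steps)) + 1
    length-given = length-map place given ∙ length-++ (map known prefix ++ _) ∙ (cong (_+ 1)
      (length-++ (map known prefix) ∙ cong₂ _+_ (length-map known prefix)
        (length-++ (replicate (length certificates) unknown) ∙ cong₂ _+_ (length-replicate (length certificates)) (length-replicate (suc (length steps))))))

    length-wipedOut : length (map place wipedOut) ≡ length prefix + (length certificates + suc (length steps)) + 1
    length-wipedOut = length-map place wipedOut ∙ length-++ (replicate (length prefix + (length certificates + suc (length steps))) wiped) ∙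
      cong (_+ 1) (length-replicate (length prefix + (length certificates + suc (length steps))))

    length-cellCount : length cellCount ≡ length (map place given)
    length-cellCount = (length-++ (prefix ++ certificates ++ true ∷ steps) ∙ cong (_+ 1) (length-++ prefix ∙
      cong (λ k → length prefix + k) (length-++ certificates))) ∙ sym length-given

    length-top : length top ≡ n
    length-top = length-++ (block (place done)) ∙ cong₂ _+_ (block-length (place done) (place (guess false)))
      (length-cellBits (map place wipedOut) (map place given) (length-wipedOut ∙ sym length-given)) ∙ sym (length-++ (block (place (guess false))))

    operations≡ : map opOf opCodes ≡ operations
    operations≡ = programCode≡ (instructions rulesᶠ) (length (empty ++ empty)) bottom cellCount sweepCount ∙
      cong (λ k → sweepsProgram rulesᶠ n k (suc (2 + length steps))) length-cellCount

    3≤n : 3 ≤ n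
    3≤n = (s≤s (s≤s (s≤s z≤n)) » 5≤block (place (guess false))) »
      m≤m+n (length (block (place (guess false)))) _ » ≤-reflexive (sym (length-++ (block (place (guess false)))))

    nonempty-cell : 1 ≤ height (cellProgram rulesᶠ n)
    nonempty-cell = subst (1 ≤_) (sym (height-++ (concatMap (local n) (instructions rulesᶠ)) (replicate (length (empty ++ empty)) pass)))
      (subst (1 ≤_) (sym (height-passes (length (empty ++ empty)))) 1≤pair » m≤n+m _ (height (concatMap (local n) (instructions rulesᶠ))))

    nonempty-operations : 1 ≤ height operations
    nonempty-operations = height-replicate (suc (2 + length steps)) (sweepProgram rulesᶠ n (length (map place given))) (s≤s z≤n)
      (height-replicate (length (map place given)) (cellProgram rulesᶠ n) (subst (1 ≤_) (sym length-given) (m≤n+m 1 _)) nonempty-cell)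

    Witness : Set
    Witness = ∃[ y ] (length y ≤ length certificates × Accepts V (prefix ++ y))

    run⇒certificate : Run operations bottom top → Witness
    run⇒certificate r = guess-sound (2 + length steps) prefix (length certificates) (suc (length steps))
      (renamed⁻ (sweeps-exact⁻ (map place given) (map place wipedOut) (length-wipedOut ∙ sym length-given) refl r))

    certificate⇒run : ∀ {y t d} → length y ≤ length certificates → HaltsAfter V t (initial V (prefix ++ y)) d → accept (Config.state d) ≡ true →
      t ≤ length steps → Run operations bottom top
    certificate⇒run {y} le h a t≤ = sweeps⁺ refl (renamed⁺ (guess-complete (2 + length steps) prefix y (length certificates) (suc (length steps)) le h a (s≤s t≤) (s≤s (s≤s t≤))))

    abstract
     run⇒problem : Run operations bottom top → TilingProblem tileset word
     run⇒problem r = run⇒tilingProblem n (map opOf opCodes) bottom top 3≤n refl length-top (subst (λ ops → 1 ≤ height ops) (sym operations≡) nonempty-operations)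
       (subst (λ ops → Run ops bottom top) (sym operations≡) r)

     problem⇒run : TilingProblem tileset word → Run operations bottom top
     problem⇒run P = subst (λ ops → Run ops bottom top) operations≡ (tilingProblem⇒run n (map opOf opCodes) bottom top 3≤n refl length-top P)

  cellWord : Letter → Word
  cellWord l = empty ++ block (place l)

  lettersBits : List Letter → Word
  lettersBits = concatMap cellWord

  cellBits≡ : ∀ ls → lettersBits ls ≡ cellBits (map place ls)
  cellBits≡ ls = sym (concatMap-map (λ a → empty ++ block a) place ls)

  lettersBits-replicate : ∀ us l → lettersBits (replicate (length us) l) ≡ repeat us (cellWord l)
  lettersBits-replicate [] l = refl
  lettersBits-replicate (_ ∷ us) l = cong (cellWord l ++_) (lettersBits-replicate us l)

  knownBits : Bool → Word
  knownBits b = if b then cellWord (known true) else cellWord (known false)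

  knownBits≡ : ∀ b → knownBits b ≡ cellWord (known b)
  knownBits≡ false = refl
  knownBits≡ true = refl

  lettersBits-known : ∀ w → lettersBits (map known w) ≡ concatMap knownBits w
  lettersBits-known [] = refl
  lettersBits-known (b ∷ w) = cong₂ _++_ (sym (knownBits≡ b)) (lettersBits-known w)

  given≡ : ∀ x → (concatMap knownBits (prefix x) ++ repeat (certificates x) (cellWord unknown) ++ repeat (true ∷ steps x) (cellWord unused)) ++ cellWord marker
    ≡ cellBits (map place (given x))
  given≡ x = sym split ∙ cellBits≡ (given x)
    where
    ks = map known (prefix x)
    us = replicate (length (certificates x)) unknown
    vs = replicate (suc (length (steps x))) unused
    split : lettersBits ((ks ++ us ++ vs) ++ marker ∷ []) ≡ _
    split = concatMap-++ cellWord (ks ++ us ++ vs) (marker ∷ []) ∙ (cong₂ _++_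
      (concatMap-++ cellWord ks (us ++ vs) ∙ cong₂ _++_ (lettersBits-known (prefix x))
        (concatMap-++ cellWord us vs ∙ cong₂ _++_ (lettersBits-replicate (certificates x) unknown) (lettersBits-replicate (true ∷ steps x) unused)))
      (++-identityʳ (cellWord marker)))

  wipedOut≡ : ∀ x → repeat (prefix x ++ certificates x ++ true ∷ steps x) (cellWord wiped) ++ cellWord marker ≡ cellBits (map place (wipedOut x))
  wipedOut≡ x = sym split ∙ cellBits≡ (wipedOut x)
    where
    len : length (prefix x ++ certificates x ++ true ∷ steps x) ≡ length (prefix x) + (length (certificates x) + suc (length (steps x)))
    len = length-++ (prefix x) ∙ cong (λ k → length (prefix x) + k) (length-++ (certificates x))
    split : lettersBits (wipedOut x) ≡ repeat (prefix x ++ certificates x ++ true ∷ steps x) (cellWord wiped) ++ cellWord marker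
    split = concatMap-++ cellWord (replicate (length (prefix x) + (length (certificates x) + suc (length (steps x)))) wiped) (marker ∷ []) ∙ (cong₂ _++_
      (cong (λ k → lettersBits (replicate k wiped)) (sym len) ∙ lettersBits-replicate (prefix x ++ certificates x ++ true ∷ steps x) wiped)
      (++-identityʳ (cellWord marker)))

  prefixF : WordF prefix
  prefixF = (concatMapF {A = bool} {B = bool} {f = λ y → true ∷ snd y ∷ []} idF
    (constF {A = bool} true ∷F sndF {list bool} {bool} ∷F nilF)) ++ʷ (constF {A = list bool} (false ∷ []))

  certificatesF : WordF certificates
  certificatesF = evalUnaryF q

  stepsF : WordF steps
  stepsF = evalUnaryF p ∘F appendF {A = bool} prefixF certificatesF

  trueF : ∀ {g : Word → Word} → WordF g → WordF (λ x → true ∷ g x)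
  trueF g = constF {A = bool} true ∷F g

  cellCountF : WordF cellCount
  cellCountF = (prefixF ++ʷ (certificatesF ++ʷ (trueF stepsF))) ++ʷ (constF {A = list bool} (true ∷ []))

  sweepCountF : WordF sweepCount
  sweepCountF = trueF (trueF (trueF stepsF))

  bitsF : ∀ l → WordF (λ _ → cellWord l)
  bitsF l = constF {A = list bool} (cellWord l)

  bottomF : WordF bottom
  bottomF = appendF {A = bool} (constF {A = list bool} (block (place (guess false)))) (extF given≡ (((concatMapF {A = bool} {B = bool} {f = λ y → knownBits (snd y)} prefixF
        (ifF (sndF {list bool} {bool}) (bitsF (known true) ∘F fstF {list bool} {bool}) (bitsF (known false) ∘F fstF {list bool} {bool}))) ++ʷ ((repeatF {A = bool} certificatesF (bitsF unknown)) ++ʷ (repeatF {A = bool} (trueF stepsF) (bitsF unused)))) ++ʷ (bitsF marker)))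

  topF : WordF top
  topF = (constF {A = list bool} (block (place done))) ++ʷ (extF wipedOut≡ ((repeatF {A = bool} (prefixF ++ʷ (certificatesF ++ʷ (trueF stepsF))) (bitsF wiped)) ++ʷ (bitsF marker)))

  opCodesF : PF {list bool} {list (fin 2)} opCodes
  opCodesF = programCodeF (instructions rulesᶠ) (length (empty ++ empty)) bottomF cellCountF sweepCountF

  abstract
    wordF : WordF word
    wordF = encodeCellsBoundaryF (cellsF opCodesF bottomF topF) (boundaryF opCodesF bottomF topF)

  open FromPF wordF public renaming (function to reduction; function-computable to reduction-computable; function≡ to reduction≡)

  pair≡ : ∀ x y → pair x y ≡ prefix x ++ y
  pair≡ x y = sym (++-assoc (concatMap (λ b → true ∷ b ∷ []) x) (false ∷ []) y)

  module _ (runs : RunsInTime V p) where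

    -- By determinism the accepting computation is the one that `runs` provides, and the time bound
    -- is monotone in the length of the certificate.
    accepted-in-time : ∀ x y → length y ≤ length (certificates x) → Accepts V (prefix x ++ y) →
      ∃[ t ] ∃[ d ] (HaltsAfter V t (initial V (prefix x ++ y)) d × accept (Config.state d) ≡ true × t ≤ length (steps x))
    accepted-in-time x y le (t , d , h , a) =
      let t' , d' , h' , le' = runs (prefix x ++ y) in
      t' , d' , h' , cong (λ c → accept (Config.state c)) (HaltsAfter-deterministic V h' h) ∙ a ,
      le' » eval-mono p (≤-reflexive (length-++ (prefix x)) » +-monoʳ-≤ (length (prefix x)) le »
        ≤-reflexive (sym (length-++ (prefix x)))) » ≤-reflexive (sym (length-evalUnary p (prefix x ++ certificates x)))

    certified⇒problem : ∀ x → (∃[ y ] (length y ≤ length (certificates x) × Accepts V (prefix x ++ y))) → TilingProblem tileset (word x)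
    certified⇒problem x (y , le , acc) = let t , d , h , a , t≤ = accepted-in-time x y le acc in run⇒problem x (certificate⇒run x le h a t≤)

    problem⇒certified : ∀ x → TilingProblem tileset (word x) → ∃[ y ] (length y ≤ length (certificates x) × Accepts V (prefix x ++ y))
    problem⇒certified x P = run⇒certificate x (problem⇒run x P)

    certificates-bound : ∀ x → length (certificates x) ≡ eval q (length x)
    certificates-bound x = length-evalUnary q x

    reduction⁺ : ∀ x → (∃[ y ] (length y ≤ eval q (length x) × Accepts V (pair x y))) → TilingProblem tileset (word x)
    reduction⁺ x (y , le , acc) = certified⇒problem x
      (y , subst (length y ≤_) (sym (certificates-bound x)) le , subst (Accepts V) (pair≡ x y) acc)

    reduction⁻ : ∀ x → TilingProblem tileset (word x) → ∃[ y ] (length y ≤ eval q (length x) × Accepts V (pair x y))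
    reduction⁻ x P = let y , le , acc = problem⇒certified x P in
      y , subst (length y ≤_) (certificates-bound x) le , subst (Accepts V) (sym (pair≡ x y)) acc

    reduction-correct : ∀ x → (∃[ y ] (length y ≤ eval q (length x) × Accepts V (pair x y))) ⇔ TilingProblem tileset (reduction x)
    reduction-correct x = mk⇔ (λ c → subst (TilingProblem tileset) (sym (reduction≡ x)) (reduction⁺ x c))
      (λ P → reduction⁻ x (subst (TilingProblem tileset) (reduction≡ x) P))

TilingProblem-NPHard : NPHard (TilingProblem tileset)
TilingProblem-NPHard L (V , p , q , runs , correct) = reduction , reduction-computable , λ x → mk⇔
  (λ l → Equivalence.to (reduction-correct runs x) (Equivalence.to (correct x) l))
  (λ P → Equivalence.from (correct x) (Equivalence.from (reduction-correct runs x) P))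
  where open Reduction V p q

mainTheorem3 : Σ[ T ∈ TileSet 14 ] NPComplete (TilingProblem T)
mainTheorem3 = tileset , TilingProblem∈NP tileset tile-origin , TilingProblem-NPHard
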